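{- Let $v>1$ be an integer such that every component $q$ of $v$ satisfies $q\equiv1\pmod{14}$ and $q\in[71,9941]\cup\,]Q(7,6),\infty)$. Then there exists an S$(2,\{3,4,5,6\},4v)$ which is harmonious under $\mathbb Z_2\times\mathbb Z_2\times\mathbb F_v$.
   Context: For positive integers $e,n$ let $U=\sum_{h=1}^n\binom nh(e-1)^h(h-1)$ and $Q(e,n)=\frac14\bigl(U+\sqrt{U^2+4ne^{n-1}}\bigr)^2$. The components of an integer $v$ are the maximal prime power divisors of $v$; $\mathbb F_v$ denotes the ring which is the direct product of the finite fields whose orders are the components of $v$ (its additive group is used). A linear space S$(2,K,v)$: $v$ points, blocks with sizes in $K$ (every element of $K$ occurring), every pair of points in exactly one block; a resolution partitions the blocks into parallel classes each partitioning the points. A linear space is harmonious under an additive group $\Gamma$ if it has point set $\Gamma$ and a resolution such that the group of translations of $\Gamma$ is an automorphism group of the resolved linear space acting sharply transitively on points and transitively on parallel classes. -}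

module Defs where

open import Data.Nat using (ℕ; zero; suc; _+_; _*_; _∸_; _^_; _≤_; _<_)
open import Data.Nat.DivMod using (_mod_)
open import Data.Nat.Divisibility using (_∣_)
open import Data.Nat.Primality using (Prime)
open import Data.Nat.Combinatorics using (_C_)
open import Data.Fin using (Fin; toℕ)
open import Data.Unit using (⊤; tt)
open import Data.Product using (_×_; _,_; ∃; ∃-syntax; ∃!; proj₁)
open import Data.List using (List; []; _∷_; _++_; map; length; upTo; replicate)
open import Data.Nat.ListAction using (sum; product)
open import Data.List.Membership.Propositional using (_∈_)
open import Data.List.Relation.Unary.All using (All)
open import Data.List.Relation.Unary.Unique.Propositional using (Unique)
open import Relation.Binary.PropositionalEquality using (_≡_; _≢_)
open import Relation.Nullary using (¬_)
open import Function.Bundles using (_⇔_)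

IsComponent : ℕ → ℕ → Set
IsComponent q v =
  ∃[ p ] ∃[ k ] (Prime p × 1 ≤ k × q ≡ p ^ k × q ∣ v × ¬ (p * q ∣ v))

IsPrimePowerFactorization : ℕ → List (ℕ × ℕ) → Set
IsPrimePowerFactorization v fs =
  All (λ pk → Prime (proj₁ pk) × 1 ≤ Data.Product.proj₂ pk) fs
  × Unique (map proj₁ fs)
  × product (map (λ pk → proj₁ pk ^ Data.Product.proj₂ pk) fs) ≡ v

-- The bound Q(e,n).
-- U(e,n) = Σ_{h=1}^n C(n,h) (e-1)^h (h-1)   (h = suc i, i < n)

U : ℕ → ℕ → ℕ
U e n = sum (map (λ i → (n C suc i) * ((e ∸ 1) ^ suc i) * i) (upTo n))

-- Q(e,n) = ¼ (U + √(U² + 4 n e^{n-1}))².  Since no reals are available,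
-- "Q(e,n) < q" is expressed by the equivalent integer condition
--   q > U √q + n e^{n-1},  i.e.  N < q  and  U² q < (q - N)²,  N = n e^{n-1}.
QBelow : ℕ → ℕ → ℕ → Set
QBelow e n q =
  (n * e ^ (n ∸ 1)) < q × (U e n * U e n) * q < (q ∸ n * e ^ (n ∸ 1)) * (q ∸ n * e ^ (n ∸ 1))

Elt : List ℕ → Set
Elt [] = ⊤
Elt (m ∷ ms) = Fin m × Elt ms

addFin : ∀ {m} → Fin m → Fin m → Fin m
addFin {suc m} a b = (toℕ a + toℕ b) mod (suc m)

_⊕_ : ∀ {ms} → Elt ms → Elt ms → Elt ms
_⊕_ {[]} _ _ = tt
_⊕_ {m ∷ ms} (a , x) (b , y) = addFin a b , (x ⊕ y)

-- Additive group of F_{p^k} is (Z_p)^k; additive group of F_v is the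
-- product over the components p^k of v.
FvModuli : List (ℕ × ℕ) → List ℕ
FvModuli [] = []
FvModuli ((p , k) ∷ fs) = replicate k p ++ FvModuli fs

record ResolvedLinearSpace (P : Set) (K : List ℕ) : Set where
  field
    nBlocks     : ℕ
    block       : Fin nBlocks → List P
    block-uniq  : ∀ j → Unique (block j)
    block-size  : ∀ j → length (block j) ∈ K
    size-occurs : ∀ k → k ∈ K → ∃[ j ] length (block j) ≡ k
    pair-unique : ∀ x y → x ≢ y → ∃! _≡_ (λ j → x ∈ block j × y ∈ block j)
    nClasses    : ℕ
    class       : Fin nBlocks → Fin nClasses
    parallel    : ∀ c x → ∃! _≡_ (λ j → class j ≡ c × x ∈ block j)

-- Harmonious: translations act as automorphisms of the resolved space
-- (blocks to blocks, parallel classes to parallel classes), transitively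
-- on parallel classes (they are sharply transitive on points automatically).
record Harmonious {ms : List ℕ} {K : List ℕ}
                  (L : ResolvedLinearSpace (Elt ms) K) : Set where
  open ResolvedLinearSpace L
  field
    shift            : Elt ms → Fin nBlocks → Fin nBlocks
    shift-block      : ∀ g j y → (y ∈ block (shift g j) ⇔ y ∈ map (g ⊕_) (block j))
    shift-class      : ∀ g j j' → class j ≡ class j' → class (shift g j) ≡ class (shift g j')
    class-transitive : ∀ c c' → ∃[ g ] ∃[ j ] (class j ≡ c × class (shift g j) ≡ c')

K3456 : List ℕ
K3456 = 3 ∷ 4 ∷ 5 ∷ 6 ∷ []

{-# OPTIONS --safe #-}
-- A harmonious space over ℤ₂ × ℤ₂ × G is generated by translating base blocks of sizes 3, 5, 6 (together with the subgroup
-- ℤ₂ × ℤ₂) in which every difference outside that subgroup occurs once. Such families compose along direct products as soon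
-- as the second factor has six multipliers that are units together with their differences, so one may take v = q = p^k.
--
-- Over a field of order q ≡ 1 (mod 14) it suffices to choose seven elements in distinct cosets of the seventh powers such
-- that the differences of each type also lie in distinct cosets; multiplication by the seventh powers up to sign gives the
-- remaining blocks. For q > 67008420535 a greedy choice works: colouring pairs of field elements by the coset of their
-- difference is quasi-random (an exact second moment computation), so the required coloured K₇ occurs. This is weaker than
-- Weil's bound; the fields of order p^d < 258889, d being the order of p modulo 14, are settled by explicit certificates.
-- The other p^k are reached as (p^d)^t: if p^d < 258889 the family on 𝔽_{p^d} is used t times, and otherwise families over
-- the extensions of degree 2 and 3, which are large because 258889² > 67008420535. Irreducible polynomials X² − X − β and
-- X³ − X − β exist because x ↦ x² − x and x ↦ x³ − x are not injective. For p = 29 and 43, where q = p itself is excluded,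
-- the families over the fields of order p² and p³ are used.
module Submission where

open import Defs
open import Data.Nat using (ℕ; _≤_; _<_)
open import Data.Nat.DivMod using (_%_)
open import Data.Product using (Σ; _×_)
open import Data.Sum using (_⊎_)
open import Data.List using (List; _∷_)
open import Relation.Binary.PropositionalEquality using (_≡_)
open import Data.Bool using (Bool; true; false; _∧_)
open import Data.Empty using (⊥; ⊥-elim)
open import Data.Fin as Fin using (Fin; zero; suc; toℕ)
import Data.Fin.Properties as Finₚ
open import Data.List using ([]; _++_; map; length)
open import Data.List.Relation.Unary.All as All using (All; []; _∷_)
open import Data.Nat as ℕ using (zero; suc; NonZero)
import Data.Nat.Properties as ℕₚ
open import Data.Product using (∃; _,_; proj₁; proj₂)
open import Data.Sum using (inj₁; inj₂)
open import Data.Unit using (tt)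
open import Relation.Nullary
open import Relation.Binary.PropositionalEquality hiding ([_])

-- The sizes come from counting. The base blocks have 3 + 5 + 6 = 14 elements and 3 + 10 + 15 = 28
-- pairs, seven pairs for each of the four types in ℤ₂ × ℤ₂. Hence (q - 1)/14 multiples of one
-- triple of blocks can use every nonzero value once and, with both orders of each pair, every
-- nonzero difference of every type once. This is where seventh powers, the sign and q ≡ 1 (mod 14)
-- come from. The fourteen elements are ±x₀, ..., ±x₆, so seven coset conditions settle the values
-- and seven for each type settle the differences. The obstacle is the range of q. The hypothesis
-- bounds the component p^k, but the construction starts from 𝔽 of order p^d, which may be smaller
-- than 71 or fall between the two ranges. A greedy choice by second moments must therefore succeed
-- early enough: its bound 67008420535 lies below Q(7,6) > 487404², and the orders below its square
-- root remain within reach of a computation. To keep the bound low, the colours on three edges at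
-- each of two vertices of K₇ may be permuted, so that six disjoint candidate sets can be united
-- before the last three choices.

-- Finite fields: ring solver, inverses, roots of polynomials

module Fields where
  open import Data.Vec using (Vec; []; _∷_)
  open import Data.Maybe using (nothing)
  open import Relation.Binary.Definitions using (DecidableEquality)
  open import Algebra.Structures using (IsCommutativeRing)
  open import Algebra.Bundles using (CommutativeRing)
  open import Function.Bundles using (_↔_)
  open import Level using (0ℓ)
  import Algebra.Solver.Ring.AlmostCommutativeRing as ACR
  import Algebra.Solver.Ring as RingSolver
  import Algebra.Properties.Semiring.Mult as SemiringMult
  open import Data.Maybe using (Maybe; just)
  open import Algebra.Bundles using (RawRing)
  import Algebra.Properties.Ring as RingProps
  import Algebra.Properties.AbelianGroup as AbelianGroupProps

  -- Integer coefficients for the ring solver, as normalised formal differences.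
  Diff : Set
  Diff = ℕ × ℕ

  normalise : ℕ → ℕ → Diff
  normalise a b = a ℕ.∸ b , b ℕ.∸ a

  diffRawRing : RawRing 0ℓ 0ℓ
  diffRawRing = record
    { Carrier = Diff
    ; _≈_ = _≡_
    ; _+_ = λ { (a , b) (c , d) → normalise (a ℕ.+ c) (b ℕ.+ d) }
    ; _*_ = λ { (a , b) (c , d) → normalise (a ℕ.* c ℕ.+ b ℕ.* d) (a ℕ.* d ℕ.+ b ℕ.* c) }
    ; -_ = λ { (a , b) → b , a }
    ; 0# = 0 , 0
    ; 1# = 1 , 0
    }

  record Raw : Set₁ where
    infixl 6 _+_
    infixl 7 _*_
    infix 8 -_
    infix 4 _≟_
    field
      Carrier : Set
      _+_ _*_ : Carrier → Carrier → Carrier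
      -_ : Carrier → Carrier
      0# 1# : Carrier
      _≟_ : DecidableEquality Carrier

    infixl 6 _-_
    _-_ : Carrier → Carrier → Carrier
    x - y = x + - y

  record Field : Set₁ where
    field raw : Raw
    open Raw raw public
    field
      isCommutativeRing : IsCommutativeRing _≡_ _+_ _*_ -_ 0# 1#
      0≢1 : 0# ≢ 1#
      inverse : ∀ x → x ≢ 0# → ∃ λ y → x * y ≡ 1#
      size : ℕ
      enum : Carrier ↔ Fin size

  module FieldProps (F : Field) where
    open Field F public

    ring : CommutativeRing 0ℓ 0ℓ
    ring = record { isCommutativeRing = isCommutativeRing }

    open CommutativeRing ring public using
      ( +-assoc; +-comm; +-identityˡ; +-identityʳ; *-assoc; *-comm; *-identityˡ; *-identityʳ
      ; distribˡ; distribʳ; zeroˡ; zeroʳ; -‿inverseˡ; -‿inverseʳ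
      ; *-commutativeMonoid; +-commutativeMonoid; *-monoid; semiring; +-abelianGroup; +-group; commutativeSemiring)
    private module GroupProps = AbelianGroupProps +-abelianGroup

    open RingProps (CommutativeRing.ring ring) public
      using (-‿distribˡ-*; -‿distribʳ-*; -0#≈0#)
      renaming (-‿involutive to neg-involutive; -‿injective to neg-injective
               ; +-cancelˡ to +-cancelˡ; +-cancelʳ to +-cancelʳ)

    private
      module M = SemiringMult semiring

      ⟦_⟧ : Diff → Carrier
      ⟦ a , b ⟧ = a M.× 1# - b M.× 1#

      swap-middle : ∀ p q r s → p + q + (r + s) ≡ p + r + (q + s)
      swap-middle p q r s = begin
        p + q + (r + s)   ≡⟨ +-assoc p q _ ⟩
        p + (q + (r + s)) ≡⟨ cong (p +_) (+-assoc q r s) ⟨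
        p + (q + r + s)   ≡⟨ cong (λ t → p + (t + s)) (+-comm q r) ⟩
        p + (r + q + s)   ≡⟨ cong (p +_) (+-assoc r q s) ⟩
        p + (r + (q + s)) ≡⟨ +-assoc p r _ ⟨
        p + r + (q + s)   ∎
        where open ≡-Reasoning

      -‿+ : ∀ p q → - (p + q) ≡ - p + - q
      -‿+ p q = sym (GroupProps.⁻¹-∙-comm p q)

      shift-diff : ∀ p q t → (p + t) - (q + t) ≡ p - q
      shift-diff p q t = begin
        p + t - (q + t)       ≡⟨ cong (p + t +_) (-‿+ q t) ⟩
        p + t + (- q + - t)   ≡⟨ swap-middle p t (- q) (- t) ⟩
        p - q + (t - t)       ≡⟨ cong (p - q +_) (-‿inverseʳ t) ⟩
        p - q + 0#            ≡⟨ +-identityʳ _ ⟩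
        p - q                 ∎
        where open ≡-Reasoning

      -- Normalising removes min(a, b) from both entries of a formal difference; `shift-diff` puts
      -- it back.
      ⟦normalise⟧ : ∀ a b → ⟦ normalise a b ⟧ ≡ a M.× 1# - b M.× 1#
      ⟦normalise⟧ a b with ℕₚ.≤-total a b
      ... | inj₁ a≤b = begin
        (a ℕ.∸ b) M.× 1# - (b ℕ.∸ a) M.× 1#
          ≡⟨ cong (λ t → t M.× 1# - (b ℕ.∸ a) M.× 1#) (ℕₚ.m≤n⇒m∸n≡0 a≤b) ⟩
        0# - (b ℕ.∸ a) M.× 1#
          ≡⟨ shift-diff 0# ((b ℕ.∸ a) M.× 1#) (a M.× 1#) ⟨
        0# + a M.× 1# - ((b ℕ.∸ a) M.× 1# + a M.× 1#)
          ≡⟨ cong₂ _-_ (+-identityˡ _) (sym (M.×-homo-+ 1# (b ℕ.∸ a) a)) ⟩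
        a M.× 1# - (b ℕ.∸ a ℕ.+ a) M.× 1#
          ≡⟨ cong (λ t → a M.× 1# - t M.× 1#) (ℕₚ.m∸n+n≡m a≤b) ⟩
        a M.× 1# - b M.× 1# ∎
        where open ≡-Reasoning
      ... | inj₂ b≤a = begin
        (a ℕ.∸ b) M.× 1# - (b ℕ.∸ a) M.× 1#
          ≡⟨ cong (λ t → (a ℕ.∸ b) M.× 1# - t M.× 1#) (ℕₚ.m≤n⇒m∸n≡0 b≤a) ⟩
        (a ℕ.∸ b) M.× 1# - 0#
          ≡⟨ shift-diff ((a ℕ.∸ b) M.× 1#) 0# (b M.× 1#) ⟨
        (a ℕ.∸ b) M.× 1# + b M.× 1# - (0# + b M.× 1#)
          ≡⟨ cong₂ _-_ (sym (M.×-homo-+ 1# (a ℕ.∸ b) b)) (+-identityˡ _) ⟩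
        (a ℕ.∸ b ℕ.+ b) M.× 1# - b M.× 1#
          ≡⟨ cong (λ t → t M.× 1# - b M.× 1#) (ℕₚ.m∸n+n≡m b≤a) ⟩
        a M.× 1# - b M.× 1# ∎
        where open ≡-Reasoning

      +-homo : ∀ x y → ⟦ RawRing._+_ diffRawRing x y ⟧ ≡ ⟦ x ⟧ + ⟦ y ⟧
      +-homo (a , b) (c , d) = begin
        ⟦ normalise (a ℕ.+ c) (b ℕ.+ d) ⟧
          ≡⟨ ⟦normalise⟧ (a ℕ.+ c) (b ℕ.+ d) ⟩
        (a ℕ.+ c) M.× 1# - (b ℕ.+ d) M.× 1#
          ≡⟨ cong₂ _-_ (M.×-homo-+ 1# a c) (M.×-homo-+ 1# b d) ⟩
        (a M.× 1# + c M.× 1#) - (b M.× 1# + d M.× 1#)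
          ≡⟨ cong (a M.× 1# + c M.× 1# +_) (-‿+ _ _) ⟩
        (a M.× 1# + c M.× 1#) + (- (b M.× 1#) + - (d M.× 1#))
          ≡⟨ swap-middle _ _ _ _ ⟩
        ⟦ a , b ⟧ + ⟦ c , d ⟧ ∎
        where open ≡-Reasoning

      *-expand : ∀ p q r s → (p - q) * (r - s) ≡ (p * r + q * s) - (p * s + q * r)
      *-expand p q r s = begin
        (p - q) * (r - s)                             ≡⟨ distribʳ (r - s) p (- q) ⟩
        p * (r - s) + - q * (r - s)                   ≡⟨ cong₂ _+_ (distribˡ p r (- s)) (distribˡ (- q) r (- s)) ⟩
        p * r + p * - s + (- q * r + - q * - s)       ≡⟨ cong (p * r + p * - s +_) (+-comm _ _) ⟩
        p * r + p * - s + (- q * - s + - q * r)       ≡⟨ swap-middle _ _ _ _ ⟩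
        p * r + - q * - s + (p * - s + - q * r)       ≡⟨ cong₂ (λ t u → p * r + t + u) neg*neg
                                                           (cong₂ _+_ (sym (-‿distribʳ-* p s)) (sym (-‿distribˡ-* q r))) ⟩
        p * r + q * s + (- (p * s) + - (q * r))       ≡⟨ cong (p * r + q * s +_) (-‿+ _ _) ⟨
        p * r + q * s - (p * s + q * r)               ∎
        where
        open ≡-Reasoning
        neg*neg : - q * - s ≡ q * s
        neg*neg = trans (sym (-‿distribˡ-* q (- s)))
                    (trans (cong -_ (sym (-‿distribʳ-* q s))) (neg-involutive (q * s)))

      *-homo : ∀ x y → ⟦ RawRing._*_ diffRawRing x y ⟧ ≡ ⟦ x ⟧ * ⟦ y ⟧
      *-homo (a , b) (c , d) = begin
        ⟦ normalise (a ℕ.* c ℕ.+ b ℕ.* d) (a ℕ.* d ℕ.+ b ℕ.* c) ⟧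
          ≡⟨ ⟦normalise⟧ (a ℕ.* c ℕ.+ b ℕ.* d) (a ℕ.* d ℕ.+ b ℕ.* c) ⟩
        (a ℕ.* c ℕ.+ b ℕ.* d) M.× 1# - (a ℕ.* d ℕ.+ b ℕ.* c) M.× 1#
          ≡⟨ cong₂ _-_ (sums a c b d) (sums a d b c) ⟩
        (a M.× 1# * c M.× 1# + b M.× 1# * d M.× 1#) - (a M.× 1# * d M.× 1# + b M.× 1# * c M.× 1#)
          ≡⟨ *-expand _ _ _ _ ⟨
        ⟦ a , b ⟧ * ⟦ c , d ⟧ ∎
        where
        open ≡-Reasoning
        sums : ∀ k l m n → (k ℕ.* l ℕ.+ m ℕ.* n) M.× 1# ≡ k M.× 1# * l M.× 1# + m M.× 1# * n M.× 1#
        sums k l m n = trans (M.×-homo-+ 1# (k ℕ.* l) (m ℕ.* n)) (cong₂ _+_ (M.×1-homo-* k l) (M.×1-homo-* m n))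

      -‿homo : ∀ x → ⟦ RawRing.-_ diffRawRing x ⟧ ≡ - ⟦ x ⟧
      -‿homo (a , b) = begin
        b M.× 1# - a M.× 1#         ≡⟨ +-comm _ _ ⟩
        - (a M.× 1#) + b M.× 1#     ≡⟨ cong (- (a M.× 1#) +_) (neg-involutive _) ⟨
        - (a M.× 1#) + - - (b M.× 1#) ≡⟨ -‿+ _ _ ⟨
        - (a M.× 1# - b M.× 1#)     ∎
        where open ≡-Reasoning

      0-homo : ⟦ 0 , 0 ⟧ ≡ 0#
      0-homo = -‿inverseʳ 0#

      1-homo : ⟦ 1 , 0 ⟧ ≡ 1#
      1-homo = trans (cong₂ _+_ (+-identityʳ 1#) -0#≈0#) (+-identityʳ 1#)

      almostRing : ACR.AlmostCommutativeRing 0ℓ 0ℓ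
      almostRing = ACR.fromCommutativeRing ring

      morphism : diffRawRing ACR.-Raw-AlmostCommutative⟶ almostRing
      morphism = record
        { ⟦_⟧ = ⟦_⟧ ; +-homo = +-homo ; *-homo = *-homo ; -‿homo = -‿homo ; 0-homo = 0-homo ; 1-homo = 1-homo }

      -- Equality of formal differences is sufficient but not necessary: in positive characteristic
      -- different integers may have the same image, and then the answer is `nothing`.
      coeff≟ : ∀ x y → Maybe (⟦ x ⟧ ≡ ⟦ y ⟧)
      coeff≟ (a , b) (c , d) with a ℕₚ.≟ c | b ℕₚ.≟ d
      ... | yes p | yes q = just (cong₂ (λ s t → ⟦ s , t ⟧) p q)
      ... | _ | _ = nothing

    module Solver = RingSolver diffRawRing almostRing morphism coeff≟

    -- The inverse of 0 is 0, which makes inversion a bijection of the field.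
    _⁻¹ : Carrier → Carrier
    x ⁻¹ with x ≟ 0#
    ... | yes _ = 0#
    ... | no x≢0 = proj₁ (inverse x x≢0)

    infix 9 _⁻¹

    0⁻¹ : 0# ⁻¹ ≡ 0#
    0⁻¹ with 0# ≟ 0#
    ... | yes _ = refl
    ... | no ¬p = ⊥-elim (¬p refl)

    *-inverseʳ : ∀ {x} → x ≢ 0# → x * x ⁻¹ ≡ 1#
    *-inverseʳ {x} x≢0 with x ≟ 0#
    ... | yes p = ⊥-elim (x≢0 p)
    ... | no p = proj₂ (inverse x p)

    *-inverseˡ : ∀ {x} → x ≢ 0# → x ⁻¹ * x ≡ 1#
    *-inverseˡ {x} x≢0 = trans (*-comm _ x) (*-inverseʳ x≢0)

    *-cancelˡ : ∀ x {y z} → x ≢ 0# → x * y ≡ x * z → y ≡ z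
    *-cancelˡ x {y} {z} x≢0 eq = begin
      y                 ≡⟨ *-identityˡ y ⟨
      1# * y            ≡⟨ cong (_* y) (*-inverseˡ x≢0) ⟨
      x ⁻¹ * x * y      ≡⟨ *-assoc _ x y ⟩
      x ⁻¹ * (x * y)    ≡⟨ cong (x ⁻¹ *_) eq ⟩
      x ⁻¹ * (x * z)    ≡⟨ *-assoc _ x z ⟨
      x ⁻¹ * x * z      ≡⟨ cong (_* z) (*-inverseˡ x≢0) ⟩
      1# * z            ≡⟨ *-identityˡ z ⟩
      z                 ∎
      where open ≡-Reasoning

    *-cancelʳ : ∀ x {y z} → x ≢ 0# → y * x ≡ z * x → y ≡ z
    *-cancelʳ x {y} {z} x≢0 eq = *-cancelˡ x x≢0 (trans (*-comm x y) (trans eq (*-comm z x)))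

    *-≢0 : ∀ {x y} → x ≢ 0# → y ≢ 0# → x * y ≢ 0#
    *-≢0 {x} {y} x≢0 y≢0 eq = y≢0 (*-cancelˡ x x≢0 (trans eq (sym (zeroʳ x))))

    *≡0 : ∀ {x y} → x * y ≡ 0# → x ≡ 0# ⊎ y ≡ 0#
    *≡0 {x} {y} eq with x ≟ 0#
    ... | yes p = inj₁ p
    ... | no p = inj₂ (*-cancelˡ x p (trans eq (sym (zeroʳ x))))

    ⁻¹-≢0 : ∀ {x} → x ≢ 0# → x ⁻¹ ≢ 0#
    ⁻¹-≢0 {x} x≢0 eq = 0≢1 (trans (sym (zeroʳ x)) (trans (cong (x *_) (sym eq)) (*-inverseʳ x≢0)))

    ⁻¹-involutive : ∀ x → x ⁻¹ ⁻¹ ≡ x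
    ⁻¹-involutive x = go (x ≟ 0#)
      where
      go : Dec (x ≡ 0#) → x ⁻¹ ⁻¹ ≡ x
      go (yes refl) = trans (cong _⁻¹ 0⁻¹) 0⁻¹
      go (no p) = *-cancelˡ (x ⁻¹) (⁻¹-≢0 p) (trans (*-inverseʳ (⁻¹-≢0 p)) (sym (*-inverseˡ p)))

    x-y≡0⇒x≡y : ∀ {x y} → x - y ≡ 0# → x ≡ y
    x-y≡0⇒x≡y {x} {y} eq = begin
      x             ≡⟨ +-identityʳ x ⟨
      x + 0#        ≡⟨ cong (x +_) (-‿inverseˡ y) ⟨
      x + (- y + y) ≡⟨ +-assoc x (- y) y ⟨
      x - y + y     ≡⟨ cong (_+ y) eq ⟩
      0# + y        ≡⟨ +-identityˡ y ⟩
      y             ∎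
      where open ≡-Reasoning

    x-y≢0 : ∀ {x y} → x ≢ y → x - y ≢ 0#
    x-y≢0 x≢y eq = x≢y (x-y≡0⇒x≡y eq)

    -x≢0 : ∀ {x} → x ≢ 0# → - x ≢ 0#
    -x≢0 {x} x≢0 eq = x≢0 (trans (sym (neg-involutive x)) (trans (cong -_ eq) -0#≈0#))

    infixr 8 _^_
    _^_ : Carrier → ℕ → Carrier
    x ^ zero = 1#
    x ^ suc n = x * x ^ n

    ^-+ : ∀ x m n → x ^ (m ℕ.+ n) ≡ x ^ m * x ^ n
    ^-+ x zero n = sym (*-identityˡ _)
    ^-+ x (suc m) n = trans (cong (x *_) (^-+ x m n)) (sym (*-assoc x _ _))

    ^-*-dist : ∀ x y n → (x * y) ^ n ≡ x ^ n * y ^ n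
    ^-*-dist x y zero = sym (*-identityˡ _)
    ^-*-dist x y (suc n) = trans (cong (x * y *_) (^-*-dist x y n))
      (solve 4 (λ x y p q → x :* y :* (p :* q) := x :* p :* (y :* q)) refl x y (x ^ n) (y ^ n))
      where open Solver

    1^ : ∀ n → 1# ^ n ≡ 1#
    1^ zero = refl
    1^ (suc n) = trans (*-identityˡ _) (1^ n)

    ^-*-assoc : ∀ x m n → (x ^ m) ^ n ≡ x ^ (m ℕ.* n)
    ^-*-assoc x zero n = 1^ n
    ^-*-assoc x (suc m) n = begin
      (x * x ^ m) ^ n       ≡⟨ ^-*-dist x (x ^ m) n ⟩
      x ^ n * (x ^ m) ^ n   ≡⟨ cong (x ^ n *_) (^-*-assoc x m n) ⟩
      x ^ n * x ^ (m ℕ.* n) ≡⟨ ^-+ x n (m ℕ.* n) ⟨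
      x ^ (n ℕ.+ m ℕ.* n)   ∎
      where open ≡-Reasoning

    ^-≢0 : ∀ {x} n → x ≢ 0# → x ^ n ≢ 0#
    ^-≢0 zero x≢0 eq = 0≢1 (sym eq)
    ^-≢0 (suc n) x≢0 = *-≢0 x≢0 (^-≢0 n x≢0)

    -- Coefficients run from the constant term upwards and the leading 1 is implicit, so the length
    -- of the vector is the degree.
    monic : ∀ {d} → Vec Carrier d → Carrier → Carrier
    monic [] x = 1#
    monic (c ∷ cs) x = c + x * monic cs x

    -- Horner's scheme: if f = c + X g, the quotient of f - f(a) by X - a is g(a) + X h, where h is
    -- the corresponding quotient for g.
    deflate : ∀ {d} → Vec Carrier (suc d) → Carrier → Vec Carrier d
    deflate (c ∷ []) a = []
    deflate (c ∷ cs@(_ ∷ _)) a = monic cs a ∷ deflate cs a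

    deflate-spec : ∀ {d} (cs : Vec Carrier (suc d)) a x →
      monic cs x - monic cs a ≡ (x - a) * monic (deflate cs a) x
    deflate-spec (c ∷ []) a x = begin
      c + x * 1# - (c + a * 1#)
        ≡⟨ solve 4 (λ c x a o → c :+ x :* o :- (c :+ a :* o) := (x :- a) :* o) refl c x a 1# ⟩
      (x - a) * 1# ∎
      where
      open Solver
      open ≡-Reasoning
    deflate-spec (c ∷ cs@(_ ∷ _)) a x = begin
      c + x * monic cs x - (c + a * monic cs a)
        ≡⟨ solve 5 (λ c x a e f → c :+ x :* e :- (c :+ a :* f) := x :* (e :- f) :+ (x :- a) :* f)
             refl c x a (monic cs x) (monic cs a) ⟩
      x * (monic cs x - monic cs a) + (x - a) * monic cs a
        ≡⟨ cong (λ t → x * t + (x - a) * monic cs a) (deflate-spec cs a x) ⟩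
      x * ((x - a) * monic (deflate cs a) x) + (x - a) * monic cs a
        ≡⟨ solve 4 (λ x a e f → x :* ((x :- a) :* e) :+ (x :- a) :* f := (x :- a) :* (f :+ x :* e))
             refl x a (monic (deflate cs a) x) (monic cs a) ⟩
      (x - a) * (monic cs a + x * monic (deflate cs a) x) ∎
      where
      open Solver
      open ≡-Reasoning

    -- Dividing by X - r₀ lowers the degree, and since there are no zero divisors the remaining
    -- roots are roots of the quotient.
    too-many-roots : ∀ {d} (cs : Vec Carrier d) (r : Fin (suc d) → Carrier) →
      (∀ {i j} → r i ≡ r j → i ≡ j) → ¬ (∀ i → monic cs (r i) ≡ 0#)
    too-many-roots [] r inj root = 0≢1 (sym (root zero))
    too-many-roots cs@(_ ∷ _) r inj root =
      too-many-roots (deflate cs (r zero)) (λ i → r (suc i)) (λ eq → suc-inj (inj eq)) root′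
      where
      suc-inj : ∀ {n} {i j : Fin n} → suc i ≡ suc j → i ≡ j
      suc-inj refl = refl
      root′ : ∀ i → monic (deflate cs (r zero)) (r (suc i)) ≡ 0#
      root′ i with *≡0 {r (suc i) - r zero} (trans (sym (deflate-spec cs (r zero) (r (suc i))))
                     (trans (cong₂ _-_ (root (suc i)) (root zero)) (-‿inverseʳ 0#)))
      ... | inj₂ p = p
      ... | inj₁ p with inj (x-y≡0⇒x≡y p)
      ...   | ()

    unityPoly : ∀ n → Vec Carrier (suc n)
    unityPoly n = - 1# ∷ Data.Vec.replicate n 0#

    monic-unityPoly : ∀ n x → monic (unityPoly n) x ≡ x ^ suc n - 1#
    monic-unityPoly n x = trans (+-comm (- 1#) _) (cong (λ t → x * t - 1#) (zeros n))
      where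
      zeros : ∀ m → monic (Data.Vec.replicate m 0#) x ≡ x ^ m
      zeros zero = refl
      zeros (suc m) = trans (+-identityˡ _) (cong (x *_) (zeros m))

    -- This stands in for the cyclicity of the multiplicative group. With exponent 7 it limits the
    -- number of cosets of the seventh powers, with exponent (q - 1)/7 it yields an element that is
    -- not a seventh power.
    too-many-roots-of-unity : ∀ n (r : Fin (suc (suc n)) → Carrier) →
      (∀ {i j} → r i ≡ r j → i ≡ j) → ¬ (∀ i → r i ^ suc n ≡ 1#)
    too-many-roots-of-unity n r inj root = too-many-roots (unityPoly n) r inj
      (λ i → trans (monic-unityPoly n (r i)) (trans (cong (_- 1#) (root i)) (-‿inverseʳ 1#)))

-- Quadratic and cubic extensions of a field

module Extensions where
  open Fields
  open import Data.Fin.Properties using (*↔×)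
  open import Data.Product.Properties using (≡-dec)
  open import Algebra.Structures using (IsCommutativeRing)
  import Function.Properties.Inverse as Inv
  open import Data.Product.Function.NonDependent.Propositional using (_×-↔_)

  record RingLaws (R : Raw) : Set where
    open Raw R
    field
      +-assoc : ∀ x y z → x + y + z ≡ x + (y + z)
      +-comm : ∀ x y → x + y ≡ y + x
      +-identityˡ : ∀ x → 0# + x ≡ x
      -‿inverseˡ : ∀ x → - x + x ≡ 0#
      *-assoc : ∀ x y z → x * y * z ≡ x * (y * z)
      *-comm : ∀ x y → x * y ≡ y * x
      *-identityˡ : ∀ x → 1# * x ≡ x
      distribˡ : ∀ x y z → x * (y + z) ≡ x * y + x * z

  module _ {R : Raw} (L : RingLaws R) where
    open Raw R
    open RingLaws L

    fromLaws : IsCommutativeRing _≡_ _+_ _*_ -_ 0# 1#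
    fromLaws = record
      { isRing = record
        { +-isAbelianGroup = record
          { isGroup = record
            { isMonoid = record
              { isSemigroup = record
                { isMagma = record { isEquivalence = isEquivalence ; ∙-cong = cong₂ _+_ }
                ; assoc = +-assoc }
              ; identity = +-identityˡ , (λ x → trans (+-comm x 0#) (+-identityˡ x)) }
            ; inverse = -‿inverseˡ , (λ x → trans (+-comm x (- x)) (-‿inverseˡ x))
            ; ⁻¹-cong = cong (λ x → - x) }
          ; comm = +-comm }
        ; *-cong = cong₂ _*_
        ; *-assoc = *-assoc
        ; *-identity = *-identityˡ , (λ x → trans (*-comm x 1#) (*-identityˡ x))
        ; distrib = distribˡ , λ x y z → trans (*-comm (y + z) x)
            (trans (distribˡ x y z) (cong₂ _+_ (*-comm x y) (*-comm x z)))
        }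
      ; *-comm = *-comm
      }

  -- K[X]/(X² − X − β)
  quadraticRaw : (R : Raw) → Raw.Carrier R → Raw
  quadraticRaw R β = record
    { Carrier = Carrier × Carrier
    ; _+_ = λ { (a , b) (c , d) → a + c , b + d }
    ; _*_ = λ { (a , b) (c , d) → a * c + β * (b * d) , a * d + b * c + b * d }
    ; -_ = λ { (a , b) → - a , - b }
    ; 0# = 0# , 0#
    ; 1# = 1# , 0#
    ; _≟_ = ≡-dec _≟_ _≟_
    }
    where open Raw R

  -- K[X]/(X³ − X − β)
  cubicRaw : (R : Raw) → Raw.Carrier R → Raw
  cubicRaw R β = record
    { Carrier = Carrier × Carrier × Carrier
    ; _+_ = λ { (a , b , c) (d , e , f) → a + d , b + e , c + f }
    ; _*_ = λ { (a , b , c) (d , e , f) →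
          a * d + β * (b * f + c * e)
        , a * e + b * d + (b * f + c * e) + β * (c * f)
        , a * f + b * e + c * d + c * f }
    ; -_ = λ { (a , b , c) → - a , - b , - c }
    ; 0# = 0# , 0# , 0#
    ; 1# = 1# , 0# , 0#
    ; _≟_ = ≡-dec _≟_ (≡-dec _≟_ _≟_)
    }
    where open Raw R

  module Quadratic (F : Field) (β : Field.Carrier F)
    (rootless : ∀ x → Raw._*_ (Field.raw F) x x ≢ Raw._+_ (Field.raw F) x β) where
    open FieldProps F

    private
      Q : Raw
      Q = quadraticRaw raw β
      module Q = Raw Q

      laws : RingLaws Q
      laws = record
        { +-assoc = λ { (a , b) (c , d) (e , f) → cong₂ _,_ (+-assoc a c e) (+-assoc b d f) }
        ; +-comm = λ { (a , b) (c , d) → cong₂ _,_ (+-comm a c) (+-comm b d) }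
        ; +-identityˡ = λ { (a , b) → cong₂ _,_ (+-identityˡ a) (+-identityˡ b) }
        ; -‿inverseˡ = λ { (a , b) → cong₂ _,_ (-‿inverseˡ a) (-‿inverseˡ b) }
        ; *-assoc = λ { (a , b) (c , d) (e , f) → cong₂ _,_
            (solve 7 (λ a b c d e f β →
               (a :* c :+ β :* (b :* d)) :* e :+ β :* ((a :* d :+ b :* c :+ b :* d) :* f) :=
               a :* (c :* e :+ β :* (d :* f)) :+ β :* (b :* (c :* f :+ d :* e :+ d :* f)))
               refl a b c d e f β)
            (solve 7 (λ a b c d e f β →
               (a :* c :+ β :* (b :* d)) :* f :+ (a :* d :+ b :* c :+ b :* d) :* e
                 :+ (a :* d :+ b :* c :+ b :* d) :* f :=
               a :* (c :* f :+ d :* e :+ d :* f) :+ b :* (c :* e :+ β :* (d :* f))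
                 :+ b :* (c :* f :+ d :* e :+ d :* f))
               refl a b c d e f β) }
        ; *-comm = λ { (a , b) (c , d) → cong₂ _,_
            (solve 5 (λ a b c d β → a :* c :+ β :* (b :* d) := c :* a :+ β :* (d :* b)) refl a b c d β)
            (solve 4 (λ a b c d → a :* d :+ b :* c :+ b :* d := c :* b :+ d :* a :+ d :* b) refl a b c d) }
        ; *-identityˡ = λ { (c , d) → cong₂ _,_
            (trans (cong₂ _+_ (*-identityˡ c) (trans (cong (β *_) (zeroˡ d)) (zeroʳ β))) (+-identityʳ c))
            (trans (cong₂ _+_ (trans (cong₂ _+_ (*-identityˡ d) (zeroˡ c)) (+-identityʳ d)) (zeroˡ d)) (+-identityʳ d)) }
        ; distribˡ = λ { (a , b) (c , d) (e , f) → cong₂ _,_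
            (solve 7 (λ a b c d e f β → a :* (c :+ e) :+ β :* (b :* (d :+ f)) :=
               a :* c :+ β :* (b :* d) :+ (a :* e :+ β :* (b :* f))) refl a b c d e f β)
            (solve 6 (λ a b c d e f → a :* (d :+ f) :+ b :* (c :+ e) :+ b :* (d :+ f) :=
               a :* d :+ b :* c :+ b :* d :+ (a :* f :+ b :* e :+ b :* f)) refl a b c d e f) }
        }
        where open Solver

      -- The roots of X² - X - β add up to 1, so a + bX has the conjugate a + b - bX; this is their
      -- product. The inverse is the conjugate divided by it.
      norm : Carrier → Carrier → Carrier
      norm a b = a * a + a * b - β * (b * b)

      -- For b ≠ 0 the norm is b² (x² − x − β) with x = −a/b.
      norm≢0 : ∀ a b → (a , b) ≢ (0# , 0#) → norm a b ≢ 0#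
      norm≢0 a b ab≢0 eq with b ≟ 0#
      ... | yes refl with *≡0 {a} {a} (begin
               a * a                           ≡⟨ solve 3 (λ a z β → a :* a := a :* a :+ (a :* z :- β :* (z :* z)) :+ (β :* (z :* z) :- a :* z)) refl a 0# β ⟩
               a * a + (a * 0# - β * (0# * 0#)) + (β * (0# * 0#) - a * 0#)
                 ≡⟨ cong₂ _+_ (sym (+-assoc _ _ _)) vanish ⟩
               norm a 0# + 0#                  ≡⟨ trans (+-identityʳ _) eq ⟩
               0#                              ∎)
           where
           open ≡-Reasoning
           open Solver
           vanish : β * (0# * 0#) - a * 0# ≡ 0#
           vanish = trans (cong₂ _-_ (trans (cong (β *_) (zeroˡ 0#)) (zeroʳ β)) (zeroʳ a)) (-‿inverseʳ 0#)
      ...   | inj₁ refl = ab≢0 refl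
      ...   | inj₂ refl = ab≢0 refl
      norm≢0 a b ab≢0 eq | no b≢0 = rootless x (x-y≡0⇒x≡y (*-cancelˡ (b * b) (*-≢0 b≢0 b≢0) (begin
        b * b * (x * x - (x + β))
          ≡⟨ solve 3 (λ b x β → b :* b :* (x :* x :- (x :+ β)) := (b :* x) :* (b :* x) :- b :* (b :* x) :- β :* (b :* b)) refl b x β ⟩
        (b * x) * (b * x) - b * (b * x) - β * (b * b)
          ≡⟨ cong (λ t → t * t - b * t - β * (b * b)) bx ⟩
        (- a) * (- a) - b * (- a) - β * (b * b)
          ≡⟨ solve 3 (λ a b β → (:- a) :* (:- a) :- b :* (:- a) :- β :* (b :* b) := a :* a :+ a :* b :- β :* (b :* b)) refl a b β ⟩
        norm a b ≡⟨ eq ⟩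
        0#       ≡⟨ zeroʳ (b * b) ⟨
        b * b * 0# ∎)))
        where
        open ≡-Reasoning
        open Solver
        x = - a * b ⁻¹
        bx : b * x ≡ - a
        bx = trans (solve 3 (λ a b i → b :* ((:- a) :* i) := (:- a) :* (b :* i)) refl a b (b ⁻¹))
               (trans (cong (- a *_) (*-inverseʳ b≢0)) (*-identityʳ (- a)))

      inv : ∀ u → u ≢ Q.0# → ∃ λ w → u Q.* w ≡ Q.1#
      inv (a , b) u≢0 = ((a + b) * n , - b * n) , cong₂ _,_
        (begin
          a * ((a + b) * n) + β * (b * (- b * n))
            ≡⟨ solve 4 (λ a b n β → a :* ((a :+ b) :* n) :+ β :* (b :* ((:- b) :* n)) := (a :* a :+ a :* b :- β :* (b :* b)) :* n) refl a b n β ⟩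
          norm a b * n ≡⟨ *-inverseʳ (norm≢0 a b u≢0) ⟩
          1# ∎)
        (begin
          a * (- b * n) + b * ((a + b) * n) + b * (- b * n)
            ≡⟨ solve 3 (λ a b n → a :* ((:- b) :* n) :+ b :* ((a :+ b) :* n) :+ b :* ((:- b) :* n) := (a :* b :- a :* b)) refl a b n ⟩
          a * b - a * b ≡⟨ -‿inverseʳ _ ⟩
          0# ∎)
        where
        open ≡-Reasoning
        open Solver
        n = norm a b ⁻¹

    quadraticField : Field
    quadraticField = record
      { raw = Q
      ; isCommutativeRing = fromLaws laws
      ; 0≢1 = λ eq → 0≢1 (cong proj₁ eq)
      ; inverse = inv
      ; size = size ℕ.* size
      ; enum = Inv.↔-trans (enum ×-↔ enum) (Inv.↔-sym *↔×)
      }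

  module Cubic (F : Field) (β : Field.Carrier F)
    (rootless : ∀ x → Raw._*_ (Field.raw F) x (Raw._*_ (Field.raw F) x x) ≢ Raw._+_ (Field.raw F) x β) where
    open FieldProps F

    private
      Q : Raw
      Q = cubicRaw raw β
      module Q = Raw Q

      cong₃ : ∀ {a b c d e f : Carrier} → a ≡ d → b ≡ e → c ≡ f → (a , b , c) ≡ (d , e , f)
      cong₃ refl refl refl = refl

      laws : RingLaws Q
      laws = record
        { +-assoc = λ { (a , b , c) (d , e , f) (g , h , i) → cong₃ (+-assoc a d g) (+-assoc b e h) (+-assoc c f i) }
        ; +-comm = λ { (a , b , c) (d , e , f) → cong₃ (+-comm a d) (+-comm b e) (+-comm c f) }
        ; +-identityˡ = λ { (a , b , c) → cong₃ (+-identityˡ a) (+-identityˡ b) (+-identityˡ c) }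
        ; -‿inverseˡ = λ { (a , b , c) → cong₃ (-‿inverseˡ a) (-‿inverseˡ b) (-‿inverseˡ c) }
        ; *-assoc = λ { (a , b , c) (d , e , f) (g , h , i) → cong₃
            (solve 10 (λ a b c d e f g h i β →
               let p = a :* d :+ β :* (b :* f :+ c :* e)
                   q = a :* e :+ b :* d :+ (b :* f :+ c :* e) :+ β :* (c :* f)
                   r = a :* f :+ b :* e :+ c :* d :+ c :* f
                   s = d :* g :+ β :* (e :* i :+ f :* h)
                   t = d :* h :+ e :* g :+ (e :* i :+ f :* h) :+ β :* (f :* i)
                   u = d :* i :+ e :* h :+ f :* g :+ f :* i
               in p :* g :+ β :* (q :* i :+ r :* h) := a :* s :+ β :* (b :* u :+ c :* t))
               refl a b c d e f g h i β)
            (solve 10 (λ a b c d e f g h i β →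
               let p = a :* d :+ β :* (b :* f :+ c :* e)
                   q = a :* e :+ b :* d :+ (b :* f :+ c :* e) :+ β :* (c :* f)
                   r = a :* f :+ b :* e :+ c :* d :+ c :* f
                   s = d :* g :+ β :* (e :* i :+ f :* h)
                   t = d :* h :+ e :* g :+ (e :* i :+ f :* h) :+ β :* (f :* i)
                   u = d :* i :+ e :* h :+ f :* g :+ f :* i
               in p :* h :+ q :* g :+ (q :* i :+ r :* h) :+ β :* (r :* i)
                  := a :* t :+ b :* s :+ (b :* u :+ c :* t) :+ β :* (c :* u))
               refl a b c d e f g h i β)
            (solve 10 (λ a b c d e f g h i β →
               let p = a :* d :+ β :* (b :* f :+ c :* e)
                   q = a :* e :+ b :* d :+ (b :* f :+ c :* e) :+ β :* (c :* f)
                   r = a :* f :+ b :* e :+ c :* d :+ c :* f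
                   s = d :* g :+ β :* (e :* i :+ f :* h)
                   t = d :* h :+ e :* g :+ (e :* i :+ f :* h) :+ β :* (f :* i)
                   u = d :* i :+ e :* h :+ f :* g :+ f :* i
               in p :* i :+ q :* h :+ r :* g :+ r :* i := a :* u :+ b :* t :+ c :* s :+ c :* u)
               refl a b c d e f g h i β) }
        ; *-comm = λ { (a , b , c) (d , e , f) → cong₃
            (solve 7 (λ a b c d e f β → a :* d :+ β :* (b :* f :+ c :* e) := d :* a :+ β :* (e :* c :+ f :* b)) refl a b c d e f β)
            (solve 7 (λ a b c d e f β → a :* e :+ b :* d :+ (b :* f :+ c :* e) :+ β :* (c :* f)
               := d :* b :+ e :* a :+ (e :* c :+ f :* b) :+ β :* (f :* c)) refl a b c d e f β)
            (solve 6 (λ a b c d e f → a :* f :+ b :* e :+ c :* d :+ c :* f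
               := d :* c :+ e :* b :+ f :* a :+ f :* c) refl a b c d e f) }
        ; *-identityˡ = λ { (d , e , f) → cong₃
            (trans (cong₂ _+_ (*-identityˡ d) (trans (cong (β *_) (0+0 f e)) (zeroʳ β))) (+-identityʳ d))
            (trans (cong₂ _+_ (trans (cong₂ _+_ (trans (cong₂ _+_ (*-identityˡ e) (zeroˡ d)) (+-identityʳ e)) (0+0 f e)) (+-identityʳ e))
                      (trans (cong (β *_) (zeroˡ f)) (zeroʳ β))) (+-identityʳ e))
            (trans (cong₂ _+_ (trans (cong₂ _+_ (trans (cong₂ _+_ (*-identityˡ f) (zeroˡ e)) (+-identityʳ f)) (zeroˡ d)) (+-identityʳ f))
                      (zeroˡ f)) (+-identityʳ f)) }
        ; distribˡ = λ { (a , b , c) (d , e , f) (g , h , i) → cong₃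
            (solve 10 (λ a b c d e f g h i β → a :* (d :+ g) :+ β :* (b :* (f :+ i) :+ c :* (e :+ h)) :=
               a :* d :+ β :* (b :* f :+ c :* e) :+ (a :* g :+ β :* (b :* i :+ c :* h))) refl a b c d e f g h i β)
            (solve 10 (λ a b c d e f g h i β →
               a :* (e :+ h) :+ b :* (d :+ g) :+ (b :* (f :+ i) :+ c :* (e :+ h)) :+ β :* (c :* (f :+ i)) :=
               a :* e :+ b :* d :+ (b :* f :+ c :* e) :+ β :* (c :* f)
                 :+ (a :* h :+ b :* g :+ (b :* i :+ c :* h) :+ β :* (c :* i))) refl a b c d e f g h i β)
            (solve 9 (λ a b c d e f g h i →
               a :* (f :+ i) :+ b :* (e :+ h) :+ c :* (d :+ g) :+ c :* (f :+ i) :=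
               a :* f :+ b :* e :+ c :* d :+ c :* f :+ (a :* i :+ b :* h :+ c :* g :+ c :* i)) refl a b c d e f g h i) }
        }
        where
        open Solver
        0+0 : ∀ x y → 0# * x + 0# * y ≡ 0#
        0+0 x y = trans (cong₂ _+_ (zeroˡ x) (zeroˡ y)) (+-identityʳ 0#)

      module QL = IsCommutativeRing (fromLaws laws)

      Unit : Q.Carrier → Set
      Unit u = ∃ λ w → u Q.* w ≡ Q.1#

      -- Instead of a determinant formula, inversion proceeds by degree: each nonzero element is
      -- multiplied into one of lower degree that is known to be a unit. Linear elements divide a
      -- scalar, quadratic ones a linear element.
      unit-* : ∀ {u w} → Unit (u Q.* w) → Unit u
      unit-* {u} {w} (v , eq) = w Q.* v , trans (sym (QL.*-assoc u w v)) eq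

      scalar : Carrier → Q.Carrier
      scalar x = x , 0# , 0#

      scalar-* : ∀ x a b c → (a , b , c) Q.* scalar x ≡ (a * x , b * x , c * x)
      scalar-* x a b c = cong₃
        (trans (cong (a * x +_) (trans (cong (β *_) 0+0) (zeroʳ β))) (+-identityʳ _))
        (trans (cong₂ _+_ (trans (cong₂ _+_ (trans (cong (_+ b * x) (zeroʳ a)) (+-identityˡ _)) 0+0) (+-identityʳ _))
                  (trans (cong (β *_) (zeroʳ c)) (zeroʳ β))) (+-identityʳ _))
        (trans (cong₂ _+_ (trans (cong (_+ c * x) (trans (cong₂ _+_ (zeroʳ a) (zeroʳ b)) (+-identityʳ 0#))) (+-identityˡ _)) (zeroʳ c)) (+-identityʳ _))
        where
        0+0 : b * 0# + c * 0# ≡ 0#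
        0+0 = trans (cong₂ _+_ (zeroʳ b) (zeroʳ c)) (+-identityʳ 0#)

      unit-scalar : ∀ {x} → x ≢ 0# → Unit (scalar x)
      unit-scalar {x} x≢0 = scalar (x ⁻¹) , trans (scalar-* (x ⁻¹) x 0# 0#)
        (cong₃ (*-inverseʳ x≢0) (zeroˡ _) (zeroˡ _))

      -- (X + r)(X² − rX + r² − 1) = X³ − X − β + (β − r + r³)
      unit-X+r : ∀ r → Unit (r , 1# , 0#)
      unit-X+r r = unit-* {w = r * r - 1# , - r , 1#} (subst Unit (sym prod) (unit-scalar val≢0))
        where
        open Solver
        val = β + r * (r * r - 1#)
        val≢0 : val ≢ 0#
        val≢0 eq = rootless (- r) (x-y≡0⇒x≡y (begin
          - r * (- r * - r) - (- r + β)
            ≡⟨ solve 2 (λ r β → (:- r) :* ((:- r) :* (:- r)) :- ((:- r) :+ β) := :- (β :+ (r :* (r :* r) :- r))) refl r β ⟩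
          - (β + (r * (r * r) - r))   ≡⟨ cong (λ t → - (β + (r * (r * r) - t))) (*-identityʳ r) ⟨
          - (β + (r * (r * r) - r * 1#))
            ≡⟨ solve 3 (λ r β o → :- (β :+ (r :* (r :* r) :- r :* o)) := :- (β :+ r :* (r :* r :- o))) refl r β 1# ⟩
          - val ≡⟨ cong -_ eq ⟩
          - 0#  ≡⟨ -0#≈0# ⟩
          0#    ∎))
          where open ≡-Reasoning
        prod : (r , 1# , 0#) Q.* (r * r - 1# , - r , 1#) ≡ scalar val
        prod = cong₃
          (begin
            r * (r * r - 1#) + β * (1# * 1# + 0# * - r)
              ≡⟨ cong (λ t → r * (r * r - 1#) + β * t) (trans (cong₂ _+_ (*-identityˡ 1#) (zeroˡ (- r))) (+-identityʳ 1#)) ⟩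
            r * (r * r - 1#) + β * 1#  ≡⟨ cong (r * (r * r - 1#) +_) (*-identityʳ β) ⟩
            r * (r * r - 1#) + β       ≡⟨ +-comm _ _ ⟩
            val ∎)
          (begin
            r * - r + 1# * (r * r - 1#) + (1# * 1# + 0# * - r) + β * (0# * 1#)
              ≡⟨ cong₂ _+_ (cong₂ _+_ (cong (r * - r +_) (*-identityˡ _))
                   (trans (cong₂ _+_ (*-identityˡ 1#) (zeroˡ (- r))) (+-identityʳ 1#))) (trans (cong (β *_) (zeroˡ 1#)) (zeroʳ β)) ⟩
            r * - r + (r * r - 1#) + 1# + 0#  ≡⟨ +-identityʳ _ ⟩
            r * - r + (r * r - 1#) + 1#
              ≡⟨ solve 2 (λ r o → r :* (:- r) :+ (r :* r :- o) :+ o := r :- r) refl r 1# ⟩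
            r - r ≡⟨ -‿inverseʳ r ⟩
            0# ∎)
          (begin
            r * 1# + 1# * - r + 0# * (r * r - 1#) + 0# * 1#
              ≡⟨ cong₂ _+_ (cong₂ _+_ (cong₂ _+_ (*-identityʳ r) (*-identityˡ (- r))) (zeroˡ _)) (zeroˡ 1#) ⟩
            r - r + 0# + 0# ≡⟨ trans (+-identityʳ _) (+-identityʳ _) ⟩
            r - r           ≡⟨ -‿inverseʳ r ⟩
            0# ∎)
          where open ≡-Reasoning

      -- Scalars are units, so it suffices to treat elements with leading coefficient 1.
      descale : ∀ {a b c} x → x ≢ 0# → Unit (x ⁻¹ * a , x ⁻¹ * b , x ⁻¹ * c) → Unit (a , b , c)
      descale {a} {b} {c} x x≢0 un = unit-* {w = scalar (x ⁻¹)}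
        (subst Unit (sym (trans (scalar-* (x ⁻¹) a b c) (cong₃ (*-comm a _) (*-comm b _) (*-comm c _)))) un)

      unit-linear : ∀ a b → (a , b , 0#) ≢ Q.0# → Unit (a , b , 0#)
      unit-linear a b u≢0 with b ≟ 0#
      ... | yes refl = unit-scalar λ { refl → u≢0 refl }
      ... | no b≢0 = descale b b≢0 (subst Unit (sym (cong₃ refl (*-inverseˡ b≢0) (zeroʳ (b ⁻¹)))) (unit-X+r (b ⁻¹ * a)))

      -- Dividing X³ − X − β by s = X² + rX + t gives (X − r) s plus a linear remainder, nonzero as there is no root r.
      unit-monic : ∀ t r → Unit (t , r , 1#)
      unit-monic t r = unit-* {w = - r , 1# , 0#} (subst Unit (sym prod) (unit-linear _ _ rem≢0))
        where
        open Solver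
        open ≡-Reasoning
        l₀ = β - r * t
        l₁ = t - r * r + 1#
        rem≢0 : (l₀ , l₁ , 0#) ≢ Q.0#
        rem≢0 eq = rootless r (x-y≡0⇒x≡y (begin
          r * (r * r) - (r + β)
            ≡⟨ solve 3 (λ r t β → r :* (r :* r) :- (r :+ β) := :- (β :- r :* t) :- (r :* (t :- r :* r) :+ r)) refl r t β ⟩
          - l₀ - (r * (t - r * r) + r) ≡⟨ cong (λ z → - l₀ - (r * (t - r * r) + z)) (*-identityʳ r) ⟨
          - l₀ - (r * (t - r * r) + r * 1#) ≡⟨ cong (λ z → - l₀ - z) (distribˡ r _ 1#) ⟨
          - l₀ - r * l₁ ≡⟨ cong₂ (λ p q → - p - r * q) (cong proj₁ eq) (cong (λ u → proj₁ (proj₂ u)) eq) ⟩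
          - 0# - r * 0# ≡⟨ cong₂ _-_ -0#≈0# (zeroʳ r) ⟩
          0# - 0# ≡⟨ -‿inverseʳ 0# ⟩
          0# ∎))
        prod : (t , r , 1#) Q.* (- r , 1# , 0#) ≡ (l₀ , l₁ , 0#)
        prod = cong₃
          (begin
            t * - r + β * (r * 0# + 1# * 1#)
              ≡⟨ cong (λ z → t * - r + β * z) (trans (cong₂ _+_ (zeroʳ r) (*-identityˡ 1#)) (+-identityˡ 1#)) ⟩
            t * - r + β * 1#  ≡⟨ cong (t * - r +_) (*-identityʳ β) ⟩
            t * - r + β ≡⟨ solve 3 (λ t r β → t :* (:- r) :+ β := β :- r :* t) refl t r β ⟩
            l₀ ∎)
          (begin
            t * 1# + r * - r + (r * 0# + 1# * 1#) + β * (1# * 0#)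
              ≡⟨ cong₂ _+_ (cong₂ _+_ (cong (_+ r * - r) (*-identityʳ t))
                   (trans (cong₂ _+_ (zeroʳ r) (*-identityˡ 1#)) (+-identityˡ 1#))) (trans (cong (β *_) (zeroʳ 1#)) (zeroʳ β)) ⟩
            t + r * - r + 1# + 0# ≡⟨ +-identityʳ _ ⟩
            t + r * - r + 1# ≡⟨ cong (λ z → t + z + 1#) (-‿distribʳ-* r r) ⟨
            l₁ ∎)
          (begin
            t * 0# + r * 1# + 1# * - r + 1# * 0#
              ≡⟨ cong₂ _+_ (cong₂ _+_ (cong₂ _+_ (zeroʳ t) (*-identityʳ r)) (*-identityˡ (- r))) (zeroʳ 1#) ⟩
            0# + r - r + 0# ≡⟨ trans (+-identityʳ _) (cong (_- r) (+-identityˡ r)) ⟩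
            r - r ≡⟨ -‿inverseʳ r ⟩
            0# ∎)

      inv : ∀ u → u ≢ Q.0# → Unit u
      inv (a , b , c) u≢0 with c ≟ 0#
      ... | yes refl = unit-linear a b u≢0
      ... | no c≢0 = descale c c≢0 (subst Unit (sym (cong₃ refl refl (*-inverseˡ c≢0))) (unit-monic (c ⁻¹ * a) (c ⁻¹ * b)))

    cubicField : Field
    cubicField = record
      { raw = Q
      ; isCommutativeRing = fromLaws laws
      ; 0≢1 = λ eq → 0≢1 (cong proj₁ eq)
      ; inverse = inv
      ; size = size ℕ.* (size ℕ.* size)
      ; enum = Inv.↔-trans (enum ×-↔ Inv.↔-trans (enum ×-↔ enum) (Inv.↔-sym *↔×)) (Inv.↔-sym *↔×)
      }

-- Sums and products over a finite field, Fermat's theorem, omitted values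

module Sums where
  open Fields
  open Extensions
  open import Data.Fin using (punchIn; punchOut)
  open import Data.Fin.Properties using (injective⇒≤; punchOut-injective)
  open import Algebra.Bundles using (CommutativeMonoid)
  open import Function.Bundles using (_↔_; Inverse; mk↔ₛ′)
  import Function.Properties.Inverse as Inv
  import Algebra.Properties.CommutativeMonoid.Sum as Sum
  open import Level using (0ℓ)

  -- A right inverse g of f is injective. If f i = f j with i ≠ j, then g misses one of the two
  -- points and would squeeze n + 1 points into n.
  surjective-endo-injective : ∀ {n} (f : Fin n → Fin n) → (∀ y → ∃ λ x → f x ≡ y) →
    ∀ {i j} → f i ≡ f j → i ≡ j
  surjective-endo-injective {zero} f sur {()}
  surjective-endo-injective {suc n} f sur {i} {j} eq with i Finₚ.≟ j
  ... | yes p = p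
  ... | no i≢j = ⊥-elim (missed missing)
    where
    g : Fin (suc n) → Fin (suc n)
    g y = proj₁ (sur y)
    g-injective : ∀ {x y} → g x ≡ g y → x ≡ y
    g-injective {x} {y} e = trans (sym (proj₂ (sur x))) (trans (cong f e) (proj₂ (sur y)))
    missing : ∃ λ m → ∀ y → m ≢ g y
    missing with g (f i) Finₚ.≟ i
    ... | yes gfi≡i = j , λ y e → i≢j (trans (sym gfi≡i) (trans (cong g (trans eq
                        (trans (cong f e) (proj₂ (sur y))))) (sym e)))
    ... | no gfi≢i = i , λ y e → gfi≢i (trans (cong g (trans (cong f e) (proj₂ (sur y)))) (sym e))
    missed : ¬ (∃ λ m → ∀ y → m ≢ g y)
    missed (m , m≢g) = ℕₚ.1+n≰n (injective⇒≤ {f = λ y → punchOut (m≢g y)}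
      (λ {x} {y} e → g-injective (punchOut-injective (m≢g x) (m≢g y) e)))

  module FieldCounting (F : Field) where
    open FieldProps F

    index : Carrier → Fin size
    index = Inverse.to enum

    element : Fin size → Carrier
    element = Inverse.from enum

    element-index : ∀ x → element (index x) ≡ x
    element-index = Inverse.strictlyInverseʳ enum

    index-element : ∀ i → index (element i) ≡ i
    index-element = Inverse.strictlyInverseˡ enum

    index-injective : ∀ {x y} → index x ≡ index y → x ≡ y
    index-injective {x} {y} eq = trans (sym (element-index x)) (trans (cong element eq) (element-index y))

    all? : {P : Carrier → Set} → (∀ x → Dec (P x)) → Dec (∀ x → P x)
    all? {P} P? with Finₚ.all? (λ i → P? (element i))
    ... | yes p = yes λ x → subst P (element-index x) (p (index x))
    ... | no ¬p = no λ p → ¬p λ i → p (element i)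

    any? : {P : Carrier → Set} → (∀ x → Dec (P x)) → Dec (∃ P)
    any? {P} P? with Finₚ.any? (λ i → P? (element i))
    ... | yes (i , p) = yes (element i , p)
    ... | no ¬p = no λ (x , p) → ¬p (index x , subst P (sym (element-index x)) p)

    -- A map that identifies two points of a finite set is not onto, and the missing value is found
    -- by search. Applied to x² - x and x³ - x at 0 and 1.
    non-value : (f : Carrier → Carrier) → ∀ x y → x ≢ y → f x ≡ f y → ∃ λ z → ∀ w → f w ≢ z
    non-value f x y x≢y fx≡fy with any? (λ z → all? (λ w → ¬? (f w ≟ z)))
    ... | yes p = p
    ... | no ¬p = ⊥-elim (x≢y (index-injective (surjective-endo-injective f′ sur
                    (cong index (trans (cong f (element-index x)) (trans fx≡fy (sym (cong f (element-index y)))))))))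
      where
      f′ : Fin size → Fin size
      f′ i = index (f (element i))
      sur : ∀ j → ∃ λ i → f′ i ≡ j
      sur j with any? (λ w → f w ≟ element j)
      ... | yes (w , e) = index w , trans (cong index (trans (cong f (element-index w)) e)) (index-element j)
      ... | no ¬q = ⊥-elim (¬p (element j , λ w e → ¬q (w , e)))

    permutation : (π π⁻¹ : Carrier → Carrier) → (∀ x → π (π⁻¹ x) ≡ x) → (∀ x → π⁻¹ (π x) ≡ x) → Fin size ↔ Fin size
    permutation π π⁻¹ πl πr = Inv.↔-trans (Inv.↔-sym enum) (Inv.↔-trans (mk↔ₛ′ π π⁻¹ πl πr) enum)

    -- Stated for any commutative monoid, because both products (for Fermat) and sums in ℕ (for
    -- counting) over the whole field occur.
    module Total (M : CommutativeMonoid 0ℓ 0ℓ) where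
      open CommutativeMonoid M using (_≈_; _∙_; ε; setoid) renaming (Carrier to A)
      open Sum M using (sum; sum-permute; sum-cong-≋; ∑-distrib-+; sum-remove) public
      private module M = CommutativeMonoid M

      total : (Carrier → A) → A
      total f = sum (λ i → f (element i))

      total-cong : ∀ {f g} → (∀ x → f x ≈ g x) → total f ≈ total g
      total-cong eq = sum-cong-≋ (λ i → eq (element i))

      total-reindex : ∀ (f : Carrier → A) (π π⁻¹ : Carrier → Carrier) → (∀ x → π (π⁻¹ x) ≡ x) → (∀ x → π⁻¹ (π x) ≡ x) →
        total (λ x → f (π x)) ≈ total f
      total-reindex f π π⁻¹ πl πr = M.trans
        (sum-cong-≋ (λ i → M.reflexive (cong f (sym (element-index (π (element i)))))))
        (M.sym (sum-permute (λ i → f (element i)) (permutation π π⁻¹ πl πr)))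

      total-∙ : ∀ f g → total (λ x → f x ∙ g x) ≈ total f ∙ total g
      total-∙ f g = ∑-distrib-+ (λ i → f (element i)) (λ i → g (element i))

    private
      module ∏ = Total *-commutativeMonoid

      -- Replacing 0 by 1 lets the product over the units be taken over the whole field; `constOn g`
      -- does the same for a constant factor g.
      unit : Carrier → Carrier
      unit x with x ≟ 0#
      ... | yes _ = 1#
      ... | no _ = x

      unit≢0 : ∀ x → unit x ≢ 0#
      unit≢0 x with x ≟ 0#
      ... | yes _ = λ e → 0≢1 (sym e)
      ... | no p = p

      constOn : Carrier → Carrier → Carrier
      constOn g x with x ≟ 0#
      ... | yes _ = 1#
      ... | no _ = g

      constOn-0 : ∀ g → constOn g 0# ≡ 1#
      constOn-0 g with 0# ≟ 0#
      ... | yes _ = refl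
      ... | no ¬p = ⊥-elim (¬p refl)

      constOn-≢0 : ∀ g {x} → x ≢ 0# → constOn g x ≡ g
      constOn-≢0 g {x} x≢0 with x ≟ 0#
      ... | yes p = ⊥-elim (x≢0 p)
      ... | no _ = refl

      unit-scale : ∀ {g} → g ≢ 0# → ∀ x → unit (g * x) ≡ constOn g x * unit x
      unit-scale {g} g≢0 x with x ≟ 0# | g * x ≟ 0#
      ... | yes _ | yes _ = sym (*-identityˡ 1#)
      ... | yes refl | no p = ⊥-elim (p (zeroʳ g))
      ... | no p | yes q = ⊥-elim (*-≢0 g≢0 p q)
      ... | no _ | no _ = refl

      product≢0 : ∀ {n} (t : Fin n → Carrier) → (∀ i → t i ≢ 0#) → ∏.sum t ≢ 0#
      product≢0 {zero} t nz e = 0≢1 (sym e)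
      product≢0 {suc n} t nz = *-≢0 (nz zero) (product≢0 (λ i → t (suc i)) (λ i → nz (suc i)))

      product-const : ∀ {n} g (t : Fin n → Carrier) → (∀ i → t i ≡ g) → ∏.sum t ≡ g ^ n
      product-const {zero} g t eq = refl
      product-const {suc n} g t eq = cong₂ _*_ (eq zero) (product-const g (λ i → t (suc i)) (λ i → eq (suc i)))

    constOn-product : ∀ g n (enum′ : Fin n → Carrier) (z : Fin n) → (∀ i → enum′ i ≡ 0# → i ≡ z) → enum′ z ≡ 0# →
      ∏.sum (λ i → constOn g (enum′ i)) ≡ g ^ ℕ.pred n
    constOn-product g (suc n) e z only z≡0 = begin
      ∏.sum (λ i → constOn g (e i))
        ≡⟨ ∏.sum-remove {i = z} (λ i → constOn g (e i)) ⟩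
      constOn g (e z) * ∏.sum (λ i → constOn g (e (punchIn z i)))
        ≡⟨ cong₂ _*_ (trans (cong (constOn g) z≡0) (constOn-0 g))
             (product-const g _ (λ i → constOn-≢0 g (λ e≡0 → Finₚ.punchInᵢ≢i z i (only _ e≡0)))) ⟩
      1# * g ^ n ≡⟨ *-identityˡ _ ⟩
      g ^ n ∎
      where open ≡-Reasoning

    -- Multiplication by g permutes the units, so their product P satisfies P = g^(q - 1) P, and P ≠
    -- 0 may be cancelled.
    fermat : ∀ {g} → g ≢ 0# → g ^ ℕ.pred size ≡ 1#
    fermat {g} g≢0 = *-cancelʳ (∏.total unit) (product≢0 _ (λ i → unit≢0 (element i))) (begin
      g ^ ℕ.pred size * ∏.total unit
        ≡⟨ cong (_* ∏.total unit) (constOn-product g size element (index 0#)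
             (λ i e → trans (sym (index-element i)) (cong index e)) (element-index 0#)) ⟨
      ∏.total (constOn g) * ∏.total unit    ≡⟨ ∏.total-∙ (constOn g) unit ⟨
      ∏.total (λ x → constOn g x * unit x)  ≡⟨ ∏.total-cong (unit-scale g≢0) ⟨
      ∏.total (λ x → unit (g * x))
        ≡⟨ ∏.total-reindex unit (g *_) (g ⁻¹ *_)
             (λ x → trans (sym (*-assoc g _ x)) (trans (cong (_* x) (*-inverseʳ g≢0)) (*-identityˡ x)))
             (λ x → trans (sym (*-assoc _ g x)) (trans (cong (_* x) (*-inverseˡ g≢0)) (*-identityˡ x))) ⟩
      ∏.total unit                          ≡⟨ *-identityˡ _ ⟨
      1# * ∏.total unit ∎)
      where open ≡-Reasoning

    quadratic-nonvalue : ∃ λ β → ∀ x → x * x ≢ x + β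
    quadratic-nonvalue with non-value (λ x → x * x - x) 0# 1# 0≢1
      (trans (trans (cong (_- 0#) (zeroˡ 0#)) (-‿inverseʳ 0#)) (sym (trans (cong (_- 1#) (*-identityˡ 1#)) (-‿inverseʳ 1#))))
    ... | β , no-value = β , λ x e → no-value x (trans (cong (_- x) e)
            (trans (cong (_- x) (+-comm x β)) (trans (+-assoc β x (- x)) (trans (cong (β +_) (-‿inverseʳ x)) (+-identityʳ β)))))

    cubic-nonvalue : ∃ λ β → ∀ x → x * (x * x) ≢ x + β
    cubic-nonvalue with non-value (λ x → x * (x * x) - x) 0# 1# 0≢1
      (trans (trans (cong (_- 0#) (zeroˡ _)) (-‿inverseʳ 0#))
        (sym (trans (cong (_- 1#) (trans (*-identityˡ _) (*-identityˡ 1#))) (-‿inverseʳ 1#))))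
    ... | β , no-value = β , λ x e → no-value x (trans (cong (_- x) e)
            (trans (cong (_- x) (+-comm x β)) (trans (+-assoc β x (- x)) (trans (cong (β +_) (-‿inverseʳ x)) (+-identityʳ β)))))

-- Families of base blocks and their direct products

module Families where
  open import Data.Nat.DivMod
  open import Data.Fin using (inject≤)
  open import Data.List.Membership.Propositional using (_∈_)
  open import Data.List.Relation.Unary.Any using (here; there)
  open import Relation.Nullary.Decidable using (toWitness)
  open import Relation.Binary.Definitions using (DecidableEquality)
  open import Algebra.Structures using (IsAbelianGroup)
  open import Algebra.Bundles using (AbelianGroup)
  open import Function.Bundles using (_↔_; Inverse; mk↔ₛ′)
  import Function.Properties.Inverse as Inv
  open import Data.Product.Function.NonDependent.Propositional using (_×-↔_)
  open import Data.Sum.Function.Propositional using (_⊎-↔_)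
  open import Level using (0ℓ)
  import Algebra.Properties.AbelianGroup as AbelianGroupProps

  record FiniteAbelianGroup : Set₁ where
    infixl 7 _∙_
    field
      Carrier : Set
      _∙_ : Carrier → Carrier → Carrier
      ε : Carrier
      _⁻¹ : Carrier → Carrier
      isAbelianGroup : IsAbelianGroup _≡_ _∙_ ε _⁻¹
      order : ℕ
      enum : Carrier ↔ Fin order

    open IsAbelianGroup isAbelianGroup public using (assoc; comm; identityˡ; identityʳ; inverseˡ; inverseʳ)

    abelianGroup : AbelianGroup 0ℓ 0ℓ
    abelianGroup = record { isAbelianGroup = isAbelianGroup }

    open AbelianGroupProps abelianGroup public using (∙-cancelˡ; ∙-cancelʳ; ⁻¹-∙-comm; ⁻¹-involutive)

    infixl 7 _-_
    _-_ : Carrier → Carrier → Carrier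
    x - y = x ∙ y ⁻¹

    _≟_ : DecidableEquality Carrier
    x ≟ y with Inverse.to enum x Finₚ.≟ Inverse.to enum y
    ... | yes p = yes (trans (sym (Inverse.strictlyInverseʳ enum x))
                        (trans (cong (Inverse.from enum) p) (Inverse.strictlyInverseʳ enum y)))
    ... | no ¬p = no λ { refl → ¬p refl }

    x-y∙y≡x : ∀ x y → x - y ∙ y ≡ x
    x-y∙y≡x x y = trans (assoc x _ y) (trans (cong (x ∙_) (inverseˡ y)) (identityʳ x))

    x∙y-y≡x : ∀ x y → (x ∙ y) - y ≡ x
    x∙y-y≡x x y = trans (assoc x y _) (trans (cong (x ∙_) (inverseʳ y)) (identityʳ x))

    x∙[y-x]≡y : ∀ x y → x ∙ (y - x) ≡ y
    x∙[y-x]≡y x y = trans (comm x _) (x-y∙y≡x y x)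

    x-y≡ε⇒x≡y : ∀ {x y} → x - y ≡ ε → x ≡ y
    x-y≡ε⇒x≡y {x} {y} eq = trans (sym (x-y∙y≡x x y)) (trans (cong (_∙ y) eq) (identityˡ y))

    translate-diff : ∀ x y t → (x ∙ t) - (y ∙ t) ≡ x - y
    translate-diff x y t = begin
      (x ∙ t) ∙ (y ∙ t) ⁻¹     ≡⟨ cong (x ∙ t ∙_) (trans (sym (⁻¹-∙-comm y t)) (comm _ _)) ⟩
      x ∙ t ∙ (t ⁻¹ ∙ y ⁻¹)    ≡⟨ assoc (x ∙ t) _ _ ⟨
      x ∙ t ∙ t ⁻¹ ∙ y ⁻¹      ≡⟨ cong (_∙ y ⁻¹) (x∙y-y≡x x t) ⟩
      x - y ∎
      where open ≡-Reasoning

  infixr 5 _×ᴳ_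
  _×ᴳ_ : FiniteAbelianGroup → FiniteAbelianGroup → FiniteAbelianGroup
  G ×ᴳ H = record
    { Carrier = G.Carrier × H.Carrier
    ; _∙_ = λ x y → (proj₁ x G.∙ proj₁ y) , (proj₂ x H.∙ proj₂ y)
    ; ε = G.ε , H.ε
    ; _⁻¹ = λ x → (proj₁ x G.⁻¹) , (proj₂ x H.⁻¹)
    ; isAbelianGroup = record
      { isGroup = record
        { isMonoid = record
          { isSemigroup = record
            { isMagma = record { isEquivalence = isEquivalence ; ∙-cong = cong₂ (λ x y → (proj₁ x G.∙ proj₁ y) , (proj₂ x H.∙ proj₂ y)) }
            ; assoc = λ x y z → cong₂ _,_ (G.assoc _ _ _) (H.assoc _ _ _) }
          ; identity = (λ x → cong₂ _,_ (G.identityˡ _) (H.identityˡ _)) , (λ x → cong₂ _,_ (G.identityʳ _) (H.identityʳ _)) }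
        ; inverse = (λ x → cong₂ _,_ (G.inverseˡ _) (H.inverseˡ _)) , (λ x → cong₂ _,_ (G.inverseʳ _) (H.inverseʳ _))
        ; ⁻¹-cong = cong (λ x → (proj₁ x G.⁻¹) , (proj₂ x H.⁻¹)) }
      ; comm = λ x y → cong₂ _,_ (G.comm _ _) (H.comm _ _) }
    ; order = G.order ℕ.* H.order
    ; enum = Inv.↔-trans (G.enum ×-↔ H.enum) (Inv.↔-sym Finₚ.*↔×)
    }
    where
    module G = FiniteAbelianGroup G
    module H = FiniteAbelianGroup H

  record _≅_ (G H : FiniteAbelianGroup) : Set where
    private
      module G = FiniteAbelianGroup G
      module H = FiniteAbelianGroup H
    field
      to : G.Carrier → H.Carrier
      from : H.Carrier → G.Carrier
      to-from : ∀ y → to (from y) ≡ y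
      from-to : ∀ x → from (to x) ≡ x
      homo : ∀ x y → to (x G.∙ y) ≡ to x H.∙ to y

    to-ε : to G.ε ≡ H.ε
    to-ε = H.∙-cancelʳ (to G.ε) _ _ (trans (sym (homo _ _)) (trans (cong to (G.identityˡ G.ε)) (sym (H.identityˡ _))))

    to-⁻¹ : ∀ x → to (x G.⁻¹) ≡ to x H.⁻¹
    to-⁻¹ x = H.∙-cancelʳ (to x) _ _ (trans (sym (homo _ _)) (trans (cong to (G.inverseˡ x)) (trans to-ε (sym (H.inverseˡ _)))))

    to-diff : ∀ x y → to (x G.- y) ≡ to x H.- to y
    to-diff x y = trans (homo x _) (cong (to x H.∙_) (to-⁻¹ y))

    to-injective : ∀ {x y} → to x ≡ to y → x ≡ y
    to-injective {x} {y} eq = trans (sym (from-to x)) (trans (cong from eq) (from-to y))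

    from-≢ε : ∀ {y} → y ≢ H.ε → from y ≢ G.ε
    from-≢ε y≢ε eq = y≢ε (trans (sym (to-from _)) (trans (cong to eq) to-ε))

  ≅-trans : ∀ {G H K} → G ≅ H → H ≅ K → G ≅ K
  ≅-trans f g = record
    { to = λ x → g.to (f.to x)
    ; from = λ x → f.from (g.from x)
    ; to-from = λ y → trans (cong g.to (f.to-from _)) (g.to-from y)
    ; from-to = λ x → trans (cong f.from (g.from-to _)) (f.from-to x)
    ; homo = λ x y → trans (cong g.to (f.homo x y)) (g.homo _ _)
    }
    where
    module f = _≅_ f
    module g = _≅_ g

  ≅-× : ∀ {G G′ H H′} → G ≅ G′ → H ≅ H′ → (G ×ᴳ H) ≅ (G′ ×ᴳ H′)
  ≅-× f g = record
    { to = λ (x , y) → f.to x , g.to y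
    ; from = λ (x , y) → f.from x , g.from y
    ; to-from = λ (x , y) → cong₂ _,_ (f.to-from x) (g.to-from y)
    ; from-to = λ (x , y) → cong₂ _,_ (f.from-to x) (g.from-to y)
    ; homo = λ _ _ → cong₂ _,_ (f.homo _ _) (g.homo _ _)
    }
    where
    module f = _≅_ f
    module g = _≅_ g

  T : Set
  T = Fin 2 × Fin 2

  infixl 6 _⊞_
  _⊞_ : T → T → T
  (a , b) ⊞ (c , d) = addFin a c , addFin b d

  private
    addFin₂-assoc : ∀ (x y z : Fin 2) → addFin (addFin x y) z ≡ addFin x (addFin y z)
    addFin₂-assoc = toWitness {a? = Finₚ.all? λ x → Finₚ.all? λ y → Finₚ.all? λ z →
      addFin (addFin x y) z Finₚ.≟ addFin x (addFin y z)} tt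
    addFin₂-comm : ∀ (x y : Fin 2) → addFin x y ≡ addFin y x
    addFin₂-comm = toWitness {a? = Finₚ.all? λ x → Finₚ.all? λ y → addFin x y Finₚ.≟ addFin y x} tt
    addFin₂-idˡ : ∀ (x : Fin 2) → addFin zero x ≡ x
    addFin₂-idˡ = toWitness {a? = Finₚ.all? λ x → addFin zero x Finₚ.≟ x} tt
    addFin₂-self : ∀ (x : Fin 2) → addFin x x ≡ zero
    addFin₂-self = toWitness {a? = Finₚ.all? λ x → addFin x x Finₚ.≟ zero} tt

  ⊞-assoc : ∀ x y z → x ⊞ y ⊞ z ≡ x ⊞ (y ⊞ z)
  ⊞-assoc (a , b) (c , d) (e , f) = cong₂ _,_ (addFin₂-assoc a c e) (addFin₂-assoc b d f)

  ⊞-comm : ∀ x y → x ⊞ y ≡ y ⊞ x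
  ⊞-comm (a , b) (c , d) = cong₂ _,_ (addFin₂-comm a c) (addFin₂-comm b d)

  ⊞-cancel : ∀ x y → x ⊞ (x ⊞ y) ≡ y
  ⊞-cancel x@(a , b) y@(c , d) = trans (sym (⊞-assoc x x y))
    (trans (cong (_⊞ y) (cong₂ _,_ (addFin₂-self a) (addFin₂-self b))) (cong₂ _,_ (addFin₂-idˡ c) (addFin₂-idˡ d)))

  ⊞-solve : ∀ x y {z} → x ⊞ y ≡ z → y ≡ x ⊞ z
  ⊞-solve x y eq = trans (sym (⊞-cancel x y)) (cong (x ⊞_) eq)

  sizes : List ℕ
  sizes = 3 ∷ 5 ∷ 6 ∷ []

  -- Base blocks in T × G with T = ℤ₂ × ℤ₂: together with T × {ε} they generate a harmonious space, the translates
  -- by T × {ε} of the base blocks and of T × {ε} forming one parallel class.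
  record Family (G : FiniteAbelianGroup) : Set₁ where
    open FiniteAbelianGroup G
    field
      Index : Set
      count : ℕ
      indexEnum : Index ↔ Fin count
      width : Index → ℕ
      type : ∀ j → Fin (width j) → T
      value : ∀ j → Fin (width j) → Carrier
      width∈ : ∀ j → width j ∈ sizes
      width-occurs : ∀ s → s ∈ sizes → ∃ λ j → width j ≡ s

    Position : Set
    Position = Σ Index λ j → Fin (width j)

    OrderedPair : Set
    OrderedPair = Σ Index λ j → Fin (width j) × Fin (width j)

    valueAt : Position → Carrier
    valueAt (j , a) = value j a

    typeSum : OrderedPair → T
    typeSum (j , a , b) = type j a ⊞ type j b

    valueDiff : OrderedPair → Carrier
    valueDiff (j , a , b) = value j a - value j b

    Distinct : OrderedPair → Set
    Distinct (j , a , b) = a ≢ b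

    field
      -- The next three conditions give the parallel class: up to T the values run once through G
      -- without ε, and T × {ε} supplies the rest. The last two give a unique block through two
      -- points: ordered pairs of positions run once through T × (G without ε).
      value≢ε : ∀ p → valueAt p ≢ ε
      value-cover : ∀ g → g ≢ ε → ∃ λ p → valueAt p ≡ g
      value-injective : ∀ p p′ → valueAt p ≡ valueAt p′ → p ≡ p′
      diff-cover : ∀ h g → g ≢ ε → ∃ λ p → typeSum p ≡ h × valueDiff p ≡ g
      diff-injective : ∀ p p′ → Distinct p → Distinct p′ →
        typeSum p ≡ typeSum p′ → valueDiff p ≡ valueDiff p′ → p ≡ p′

  -- Six maps x ↦ cᵢ x with cᵢ and cᵢ − cⱼ units.
  record SixMaps (G : FiniteAbelianGroup) : Set where
    open FiniteAbelianGroup G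
    field
      act : Fin 6 → Carrier → Carrier
      act-onto : ∀ i g → ∃ λ x → act i x ≡ g
      act-injective : ∀ i {x y} → act i x ≡ act i y → x ≡ y
      actDiff-onto : ∀ {i j} → i ≢ j → ∀ g → ∃ λ x → act i x - act j x ≡ g
      actDiff-injective : ∀ {i j} → i ≢ j → ∀ {x y} → act i x - act j x ≡ act i y - act j y → x ≡ y

  six-× : ∀ {G H} → SixMaps G → SixMaps H → SixMaps (G ×ᴳ H)
  six-× A B = record
    { act = λ i (x , y) → A.act i x , B.act i y
    ; act-onto = λ i (g , h) → (proj₁ (A.act-onto i g) , proj₁ (B.act-onto i h)) ,
        cong₂ _,_ (proj₂ (A.act-onto i g)) (proj₂ (B.act-onto i h))
    ; act-injective = λ i eq → cong₂ _,_ (A.act-injective i (cong proj₁ eq)) (B.act-injective i (cong proj₂ eq))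
    ; actDiff-onto = λ i≢j (g , h) → (proj₁ (A.actDiff-onto i≢j g) , proj₁ (B.actDiff-onto i≢j h)) ,
        cong₂ _,_ (proj₂ (A.actDiff-onto i≢j g)) (proj₂ (B.actDiff-onto i≢j h))
    ; actDiff-injective = λ i≢j eq →
        cong₂ _,_ (A.actDiff-injective i≢j (cong proj₁ eq)) (B.actDiff-injective i≢j (cong proj₂ eq))
    }
    where
    module A = SixMaps A
    module B = SixMaps B

  six-≅ : ∀ {G H} → G ≅ H → SixMaps G → SixMaps H
  six-≅ {G} {H} f A = record
    { act = λ i y → to (A.act i (from y))
    ; act-onto = λ i g → to (proj₁ (A.act-onto i (from g))) ,
        trans (cong (λ t → to (A.act i t)) (from-to _)) (trans (cong to (proj₂ (A.act-onto i (from g)))) (to-from g))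
    ; act-injective = λ i eq → from-injective (A.act-injective i (to-injective eq))
    ; actDiff-onto = λ {i} {j} i≢j g → to (proj₁ (A.actDiff-onto i≢j (from g))) ,
        trans (sym (to-diff _ _)) (trans (cong₂ (λ s t → to (A.act i s G.- A.act j t)) (from-to _) (from-to _))
          (trans (cong to (proj₂ (A.actDiff-onto i≢j (from g)))) (to-from g)))
    ; actDiff-injective = λ i≢j eq → from-injective (A.actDiff-injective i≢j
        (to-injective (trans (to-diff _ _) (trans eq (sym (to-diff _ _))))))
    }
    where
    open _≅_ f
    module A = SixMaps A
    module G = FiniteAbelianGroup G
    from-injective : ∀ {x y} → from x ≡ from y → x ≡ y
    from-injective {x} {y} eq = trans (sym (to-from x)) (trans (cong to eq) (to-from y))

  family-≅ : ∀ {G H} → G ≅ H → Family G → Family H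
  family-≅ {G} {H} f 𝓕 = record
    { Index = Index
    ; count = count
    ; indexEnum = indexEnum
    ; width = width
    ; type = type
    ; value = λ j a → to (value j a)
    ; width∈ = width∈
    ; width-occurs = width-occurs
    ; value≢ε = λ p eq → value≢ε p (to-injective (trans eq (sym to-ε)))
    ; value-cover = λ g g≢ε → proj₁ (value-cover (from g) (from-≢ε g≢ε)) ,
        trans (cong to (proj₂ (value-cover (from g) (from-≢ε g≢ε)))) (to-from g)
    ; value-injective = λ p p′ eq → value-injective p p′ (to-injective eq)
    ; diff-cover = λ h g g≢ε → let p , th , vd = diff-cover h (from g) (from-≢ε g≢ε) in
        p , th , trans (sym (to-diff _ _)) (trans (cong to vd) (to-from g))
    ; diff-injective = λ p p′ d d′ t v → diff-injective p p′ d d′ t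
        (to-injective (trans (to-diff _ _) (trans v (sym (to-diff _ _)))))
    }
    where
    open _≅_ f
    open Family 𝓕

  -- A block of 𝓕 and an element x of H give the block with entries (vₐ , cₐ x), a being the
  -- position. Its differences are (vₐ - v_b , (cₐ - c_b) x), and x ↦ (cₐ - c_b) x is bijective, so
  -- every pair with first coordinate other than ε arises exactly once. Pairs with first coordinate
  -- ε come from the blocks of 𝓖 inside {ε} × H. Six multipliers suffice because no block has more
  -- than six positions.
  module FamilyProduct {G H : FiniteAbelianGroup} (𝓕 : Family G) (𝓖 : Family H) (S : SixMaps H) where
    private
      module G = FiniteAbelianGroup G
      module H = FiniteAbelianGroup H
      module 𝓕 = Family 𝓕
      module 𝓖 = Family 𝓖
    open SixMaps S

    private
      size≤6 : ∀ {k} → k ∈ sizes → k ℕ.≤ 6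
      size≤6 (here refl) = ℕₚ.m≤m+n 3 3
      size≤6 (there (here refl)) = ℕₚ.m≤m+n 5 1
      size≤6 (there (there (here refl))) = ℕₚ.≤-refl

      Index : Set
      Index = (𝓕.Index × H.Carrier) ⊎ 𝓖.Index

      width : Index → ℕ
      width (inj₁ (j , _)) = 𝓕.width j
      width (inj₂ j) = 𝓖.width j

      type : ∀ j → Fin (width j) → T
      type (inj₁ (j , _)) = 𝓕.type j
      type (inj₂ j) = 𝓖.type j

      six : ∀ j → Fin (𝓕.width j) → Fin 6
      six j a = inject≤ a (size≤6 (𝓕.width∈ j))

      six-≢ : ∀ j {a b} → a ≢ b → six j a ≢ six j b
      six-≢ j a≢b eq = a≢b (Finₚ.inject≤-injective (size≤6 (𝓕.width∈ j)) _ _ _ eq)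

      value : ∀ j → Fin (width j) → G.Carrier × H.Carrier
      value (inj₁ (j , x)) a = 𝓕.value j a , act (six j a) x
      value (inj₂ j) a = G.ε , 𝓖.value j a

      Position : Set
      Position = Σ Index λ j → Fin (width j)

      OrderedPair : Set
      OrderedPair = Σ Index λ j → Fin (width j) × Fin (width j)

      valueAt : Position → G.Carrier × H.Carrier
      valueAt (j , a) = value j a

      typeSum : OrderedPair → T
      typeSum (j , a , b) = type j a ⊞ type j b

      valueDiff : OrderedPair → G.Carrier × H.Carrier
      valueDiff (j , a , b) = FiniteAbelianGroup._-_ (G ×ᴳ H) (value j a) (value j b)

      Distinct : OrderedPair → Set
      Distinct (j , a , b) = a ≢ b

      value≢ε : ∀ p → valueAt p ≢ (G.ε , H.ε)
      value≢ε (inj₁ (j , x) , a) eq = 𝓕.value≢ε (j , a) (cong proj₁ eq)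
      value≢ε (inj₂ j , a) eq = 𝓖.value≢ε (j , a) (cong proj₂ eq)

      value-cover : ∀ g → g ≢ (G.ε , H.ε) → ∃ λ p → valueAt p ≡ g
      value-cover (g , h) gh≢ε with g G.≟ G.ε
      ... | yes refl with 𝓖.value-cover h (λ { refl → gh≢ε refl })
      ...   | (j , a) , refl = (inj₂ j , a) , refl
      value-cover (g , h) gh≢ε | no g≢ε with 𝓕.value-cover g g≢ε
      ... | (j , a) , refl with act-onto (six j a) h
      ...   | x , refl = (inj₁ (j , x) , a) , refl

      value-injective : ∀ p p′ → valueAt p ≡ valueAt p′ → p ≡ p′
      value-injective (inj₁ (j , x) , a) (inj₁ (j′ , x′) , a′) eq
        with 𝓕.value-injective (j , a) (j′ , a′) (cong proj₁ eq)
      ... | refl with act-injective (six j a) (cong proj₂ eq)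
      ...   | refl = refl
      value-injective (inj₁ (j , x) , a) (inj₂ j′ , a′) eq = ⊥-elim (𝓕.value≢ε (j , a) (cong proj₁ eq))
      value-injective (inj₂ j , a) (inj₁ (j′ , x′) , a′) eq = ⊥-elim (𝓕.value≢ε (j′ , a′) (sym (cong proj₁ eq)))
      value-injective (inj₂ j , a) (inj₂ j′ , a′) eq with 𝓖.value-injective (j , a) (j′ , a′) (cong proj₂ eq)
      ... | refl = refl

      diff≡ε⇒same : ∀ j {a b} → 𝓕.value j a G.- 𝓕.value j b ≡ G.ε → a ≡ b
      diff≡ε⇒same j {a} {b} eq with 𝓕.value-injective (j , a) (j , b) (G.x-y≡ε⇒x≡y eq)
      ... | refl = refl

      distinct-of-≢ε : ∀ p → 𝓕.valueDiff p ≢ G.ε → 𝓕.Distinct p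
      distinct-of-≢ε (j , a , .a) d≢ε refl = d≢ε (G.inverseʳ _)

      diff-cover : ∀ h g → g ≢ (G.ε , H.ε) → ∃ λ p → typeSum p ≡ h × valueDiff p ≡ g
      diff-cover h (u , w) g≢ε with u G.≟ G.ε
      ... | yes refl with 𝓖.diff-cover h w (λ { refl → g≢ε refl })
      ...   | (j , a , b) , th , vd = (inj₂ j , a , b) , th , cong₂ _,_ (G.inverseʳ G.ε) vd
      diff-cover h (u , w) g≢ε | no u≢ε with 𝓕.diff-cover h u u≢ε
      ... | (j , a , b) , th , vd
        with actDiff-onto (six-≢ j (distinct-of-≢ε (j , a , b) (λ e → u≢ε (trans (sym vd) e)))) w
      ...   | x , ad = (inj₁ (j , x) , a , b) , th , cong₂ _,_ vd ad

      diff-injective : ∀ p p′ → Distinct p → Distinct p′ → typeSum p ≡ typeSum p′ → valueDiff p ≡ valueDiff p′ → p ≡ p′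
      diff-injective (inj₁ (j , x) , a , b) (inj₁ (j′ , x′) , a′ , b′) d d′ t v
        with 𝓕.diff-injective (j , a , b) (j′ , a′ , b′) d d′ t (cong proj₁ v)
      ... | refl with actDiff-injective (six-≢ j d) (cong proj₂ v)
      ...   | refl = refl
      diff-injective (inj₁ (j , x) , a , b) (inj₂ j′ , a′ , b′) d d′ t v =
        ⊥-elim (d (diff≡ε⇒same j (trans (cong proj₁ v) (G.inverseʳ G.ε))))
      diff-injective (inj₂ j , a , b) (inj₁ (j′ , x′) , a′ , b′) d d′ t v =
        ⊥-elim (d′ (diff≡ε⇒same j′ (trans (sym (cong proj₁ v)) (G.inverseʳ G.ε))))
      diff-injective (inj₂ j , a , b) (inj₂ j′ , a′ , b′) d d′ t v
        with 𝓖.diff-injective (j , a , b) (j′ , a′ , b′) d d′ t (cong proj₂ v)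
      ... | refl = refl

    family-× : Family (G ×ᴳ H)
    family-× = record
      { Index = Index
      ; count = 𝓕.count ℕ.* H.order ℕ.+ 𝓖.count
      ; indexEnum = Inv.↔-trans (Inv.↔-trans (𝓕.indexEnum ×-↔ H.enum) (Inv.↔-sym Finₚ.*↔×) ⊎-↔ 𝓖.indexEnum) (Inv.↔-sym Finₚ.+↔⊎)
      ; width = width
      ; type = type
      ; value = value
      ; width∈ = λ { (inj₁ (j , _)) → 𝓕.width∈ j ; (inj₂ j) → 𝓖.width∈ j }
      ; width-occurs = λ s s∈ → inj₂ (proj₁ (𝓖.width-occurs s s∈)) , proj₂ (𝓖.width-occurs s s∈)
      ; value≢ε = value≢ε
      ; value-cover = value-cover
      ; value-injective = value-injective
      ; diff-cover = diff-cover
      ; diff-injective = diff-injective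
      }

  private
    [m%n+o]%n : ∀ m o n .{{_ : NonZero n}} → (m % n ℕ.+ o) % n ≡ (m ℕ.+ o) % n
    [m%n+o]%n m o n = trans (%-distribˡ-+ (m % n) o n)
      (trans (cong (λ t → (t ℕ.+ o % n) % n) (m%n%n≡m%n m n)) (sym (%-distribˡ-+ m o n)))

    toℕ-mod : ∀ m n .{{_ : NonZero n}} → toℕ (m mod n) ≡ m % n
    toℕ-mod m n = Finₚ.toℕ-fromℕ< (m%n<n m n)

    toℕ-addFin : ∀ {n} (a b : Fin (suc n)) → toℕ (addFin a b) ≡ (toℕ a ℕ.+ toℕ b) % suc n
    toℕ-addFin a b = toℕ-mod (toℕ a ℕ.+ toℕ b) _

  cyclic : ∀ n .{{_ : NonZero n}} → FiniteAbelianGroup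
  cyclic n@(suc n-1) = record
    { Carrier = Fin n
    ; _∙_ = addFin
    ; ε = zero
    ; _⁻¹ = neg
    ; isAbelianGroup = record
      { isGroup = record
        { isMonoid = record
          { isSemigroup = record
            { isMagma = record { isEquivalence = isEquivalence ; ∙-cong = cong₂ addFin }
            ; assoc = λ a b c → Finₚ.toℕ-injective (begin
                toℕ (addFin (addFin a b) c)               ≡⟨ toℕ-addFin (addFin a b) c ⟩
                (toℕ (addFin a b) ℕ.+ toℕ c) % n          ≡⟨ cong (λ t → (t ℕ.+ toℕ c) % n) (toℕ-addFin a b) ⟩
                ((toℕ a ℕ.+ toℕ b) % n ℕ.+ toℕ c) % n     ≡⟨ [m%n+o]%n (toℕ a ℕ.+ toℕ b) (toℕ c) n ⟩
                (toℕ a ℕ.+ toℕ b ℕ.+ toℕ c) % n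
                  ≡⟨ cong (_% n) (trans (ℕₚ.+-assoc (toℕ a) _ _) (ℕₚ.+-comm (toℕ a) _)) ⟩
                (toℕ b ℕ.+ toℕ c ℕ.+ toℕ a) % n           ≡⟨ [m%n+o]%n (toℕ b ℕ.+ toℕ c) (toℕ a) n ⟨
                ((toℕ b ℕ.+ toℕ c) % n ℕ.+ toℕ a) % n     ≡⟨ cong (λ t → (t ℕ.+ toℕ a) % n) (toℕ-addFin b c) ⟨
                (toℕ (addFin b c) ℕ.+ toℕ a) % n          ≡⟨ cong (_% n) (ℕₚ.+-comm _ (toℕ a)) ⟩
                (toℕ a ℕ.+ toℕ (addFin b c)) % n          ≡⟨ toℕ-addFin a (addFin b c) ⟨
                toℕ (addFin a (addFin b c))               ∎) }
          ; identity = idˡ , λ a → trans (add-comm a zero) (idˡ a) }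
        ; inverse = invˡ , λ a → trans (add-comm a (neg a)) (invˡ a)
        ; ⁻¹-cong = cong neg }
      ; comm = add-comm }
    ; order = n
    ; enum = Inv.↔-refl
    }
    where
    open ≡-Reasoning
    neg : Fin n → Fin n
    neg a = (n ℕ.∸ toℕ a) mod n
    add-comm : ∀ (a b : Fin n) → addFin a b ≡ addFin b a
    add-comm a b = cong (_mod n) (ℕₚ.+-comm (toℕ a) (toℕ b))
    idˡ : ∀ a → addFin zero a ≡ a
    idˡ a = Finₚ.toℕ-injective (trans (toℕ-addFin zero a) (m<n⇒m%n≡m (Finₚ.toℕ<n a)))
    invˡ : ∀ a → addFin (neg a) a ≡ zero
    invˡ a = Finₚ.toℕ-injective (begin
      toℕ (addFin (neg a) a)              ≡⟨ toℕ-addFin (neg a) a ⟩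
      (toℕ (neg a) ℕ.+ toℕ a) % n         ≡⟨ cong (λ t → (t ℕ.+ toℕ a) % n) (toℕ-mod (n ℕ.∸ toℕ a) n) ⟩
      ((n ℕ.∸ toℕ a) % n ℕ.+ toℕ a) % n   ≡⟨ [m%n+o]%n (n ℕ.∸ toℕ a) (toℕ a) n ⟩
      (n ℕ.∸ toℕ a ℕ.+ toℕ a) % n         ≡⟨ cong (_% n) (ℕₚ.m∸n+n≡m (ℕₚ.<⇒≤ (Finₚ.toℕ<n a))) ⟩
      n % n                               ≡⟨ n%n≡0 n ⟩
      0 ∎)

  record EltStructure (ms : List ℕ) : Set where
    field
      ε : Elt ms
      neg : Elt ms → Elt ms
      ⊕-isAbelianGroup : IsAbelianGroup _≡_ (_⊕_ {ms}) ε neg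
      order : ℕ
      enum : Elt ms ↔ Fin order

  structureGroup : ∀ {ms} → EltStructure ms → FiniteAbelianGroup
  structureGroup {ms} E = record
    { Carrier = Elt ms ; _∙_ = _⊕_ ; ε = E.ε ; _⁻¹ = E.neg ; isAbelianGroup = E.⊕-isAbelianGroup ; order = E.order ; enum = E.enum }
    where module E = EltStructure E

  eltStructure : ∀ ms → All NonZero ms → EltStructure ms
  eltStructure [] [] = record
    { ε = tt
    ; neg = λ _ → tt
    ; ⊕-isAbelianGroup = record
      { isGroup = record
        { isMonoid = record
          { isSemigroup = record { isMagma = record { isEquivalence = isEquivalence ; ∙-cong = λ _ _ → refl } ; assoc = λ _ _ _ → refl }
          ; identity = (λ _ → refl) , (λ _ → refl) }
        ; inverse = (λ _ → refl) , (λ _ → refl) ; ⁻¹-cong = λ _ → refl }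
      ; comm = λ _ _ → refl }
    ; order = 1
    ; enum = mk↔ₛ′ (λ _ → zero) (λ _ → tt) (λ { zero → refl }) (λ _ → refl)
    }
  eltStructure (suc n ∷ ms) (_ ∷ nzs) = record
    { ε = P.ε
    ; neg = P._⁻¹
    ; ⊕-isAbelianGroup = P.isAbelianGroup
    ; order = P.order
    ; enum = P.enum
    }
    where
    module P = FiniteAbelianGroup (cyclic (suc n) ×ᴳ structureGroup (eltStructure ms nzs))

  eltGroup : ∀ ms → All NonZero ms → FiniteAbelianGroup
  eltGroup ms nz = structureGroup (eltStructure ms nz)

  split : ∀ ms {ns} → Elt (ms ++ ns) → Elt ms × Elt ns
  split [] x = tt , x
  split (m ∷ ms) (a , x) = (a , proj₁ (split ms x)) , proj₂ (split ms x)

  join : ∀ ms {ns} → Elt ms × Elt ns → Elt (ms ++ ns)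
  join [] (_ , y) = y
  join (m ∷ ms) ((a , x) , y) = a , join ms (x , y)

  join-split : ∀ ms {ns} (x : Elt (ms ++ ns)) → join ms (split ms x) ≡ x
  join-split [] x = refl
  join-split (m ∷ ms) (a , x) = cong (a ,_) (join-split ms x)

  split-join : ∀ ms {ns} (x : Elt ms) (y : Elt ns) → split ms (join ms (x , y)) ≡ (x , y)
  split-join [] x y = refl
  split-join (m ∷ ms) (a , x) y = cong (λ (u , v) → (a , u) , v) (split-join ms x y)

  join-⊕ : ∀ ms {ns} (x x′ : Elt ms) (y y′ : Elt ns) → join ms (x ⊕ x′ , y ⊕ y′) ≡ join ms (x , y) ⊕ join ms (x′ , y′)
  join-⊕ [] x x′ y y′ = refl
  join-⊕ (m ∷ ms) (a , x) (a′ , x′) y y′ = cong (addFin a a′ ,_) (join-⊕ ms x x′ y y′)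

  elt-++ : ∀ ms {ns} nzm nzn nz → (eltGroup ms nzm ×ᴳ eltGroup ns nzn) ≅ eltGroup (ms ++ ns) nz
  elt-++ ms nzm nzn nz = record
    { to = join ms
    ; from = split ms
    ; to-from = join-split ms
    ; from-to = λ (x , y) → split-join ms x y
    ; homo = λ (x , y) (x′ , y′) → join-⊕ ms x x′ y y′
    }

-- From a family to a harmonious linear space

module Spaces where
  open Families
  open import Data.List using (tabulate)
  open import Data.List.Membership.Propositional using (_∈_)
  open import Data.List.Membership.Propositional.Properties using (∈-tabulate⁺; ∈-tabulate⁻; ∈-map⁻; ∈-map⁺)
  open import Data.List.Properties using (length-tabulate)
  open import Data.List.Relation.Unary.Any using (here; there)
  open import Data.List.Relation.Unary.Unique.Propositional.Properties using (tabulate⁺)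
  open import Function.Bundles using (_↔_; Inverse; mk⇔)
  import Function.Properties.Inverse as Inv
  open import Data.Product.Function.NonDependent.Propositional using (_×-↔_)
  open import Data.Sum.Function.Propositional using (_⊎-↔_)

  module Resolution (ms : List ℕ) (nz : All NonZero ms) (𝓕 : Family (eltGroup ms nz)) where
    open FiniteAbelianGroup (eltGroup ms nz)
    open Family 𝓕

    private
      Point : Set
      Point = Elt (2 ∷ 2 ∷ ms)

      pt : T → Elt ms → Point
      pt (a , b) x = a , b , x

      tp : Point → T
      tp (a , b , _) = a , b

      base : Point → Elt ms
      base (_ , _ , x) = x

      -- `inj₁ g` is the coset T × {g}, and `inj₂ (j , t , g)` is the translate of base block j by
      -- (t , g).
      Block : Set
      Block = Elt ms ⊎ (Index × T × Elt ms)

      total : ℕ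
      total = order ℕ.+ count ℕ.* (2 ℕ.* 2 ℕ.* order)

      blocks : Block ↔ Fin total
      blocks = Inv.↔-trans (enum ⊎-↔ Inv.↔-trans (indexEnum ×-↔ Inv.↔-trans (Inv.↔-sym Finₚ.*↔× ×-↔ enum) (Inv.↔-sym Finₚ.*↔×))
                 (Inv.↔-sym Finₚ.*↔×)) (Inv.↔-sym Finₚ.+↔⊎)

      width′ : Block → ℕ
      width′ (inj₁ _) = 4
      width′ (inj₂ (j , _)) = width j

      corner : Fin 4 → T
      corner i = Fin.remQuot {2} 2 i

      point : ∀ B → Fin (width′ B) → Point
      point (inj₁ g) i = pt (corner i) g
      point (inj₂ (j , t , g)) a = pt (type j a ⊞ t) (value j a ∙ g)

      points : Block → List Point
      points B = tabulate (point B)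

      On : Block → Point → Set
      On B y = ∃ λ i → y ≡ point B i

      corner-injective : ∀ {i i′} → corner i ≡ corner i′ → i ≡ i′
      corner-injective {i} {i′} eq = trans (sym (Inverse.strictlyInverseʳ (Finₚ.*↔× {2} {2}) i))
        (trans (cong (λ (a , b) → Fin.combine a b) eq) (Inverse.strictlyInverseʳ (Finₚ.*↔× {2} {2}) i′))

      corner-onto : ∀ t → ∃ λ i → corner i ≡ t
      corner-onto (a , b) = Fin.combine a b , Finₚ.remQuot-combine a b

      same-value : ∀ {j a b} → value j a ≡ value j b → a ≡ b
      same-value {j} {a} {b} eq with value-injective (j , a) (j , b) eq
      ... | refl = refl

      point-injective : ∀ B {i i′} → point B i ≡ point B i′ → i ≡ i′
      point-injective (inj₁ g) eq = corner-injective (cong tp eq)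
      point-injective (inj₂ (j , t , g)) eq = same-value (∙-cancelʳ g _ _ (cong base eq))

      center-On : ∀ {g} y → base y ≡ g → On (inj₁ g) y
      center-On y refl = proj₁ (corner-onto (tp y)) , cong (λ t → pt t (base y)) (sym (proj₂ (corner-onto (tp y))))

      module _ (x y : Point) (x≢y : x ≢ y) where
        through : ∃ λ B → On B x × On B y
        through with base x ≟ base y
        ... | yes eq = inj₁ (base y) , center-On x eq , center-On y refl
        ... | no neq with diff-cover (tp x ⊞ tp y) (base x - base y) (λ e → neq (x-y≡ε⇒x≡y e))
        -- The translation is the one that carries position b to y; position a then falls on x
        -- because type and difference of the two positions agree with those of x and y.
        ...   | (j , a , b) , ts , vd = inj₂ (j , type j b ⊞ tp y , base y - value j b) ,
                (a , sym (cong₂ pt type-a value-a)) , (b , sym (cong₂ pt (⊞-cancel (type j b) (tp y)) (x∙[y-x]≡y _ _)))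
          where
          open ≡-Reasoning
          type-a : type j a ⊞ (type j b ⊞ tp y) ≡ tp x
          type-a = begin
            type j a ⊞ (type j b ⊞ tp y) ≡⟨ ⊞-assoc (type j a) (type j b) (tp y) ⟨
            type j a ⊞ type j b ⊞ tp y   ≡⟨ cong (_⊞ tp y) ts ⟩
            tp x ⊞ tp y ⊞ tp y           ≡⟨ ⊞-comm (tp x ⊞ tp y) (tp y) ⟩
            tp y ⊞ (tp x ⊞ tp y)         ≡⟨ cong (tp y ⊞_) (⊞-comm (tp x) (tp y)) ⟩
            tp y ⊞ (tp y ⊞ tp x)         ≡⟨ ⊞-cancel (tp y) (tp x) ⟩
            tp x ∎
          value-a : value j a ∙ (base y - value j b) ≡ base x
          value-a = begin
            value j a ∙ (base y - value j b)     ≡⟨ cong (value j a ∙_) (comm _ _) ⟩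
            value j a ∙ (value j b ⁻¹ ∙ base y)  ≡⟨ assoc _ _ _ ⟨
            value j a - value j b ∙ base y       ≡⟨ cong (_∙ base y) vd ⟩
            base x - base y ∙ base y             ≡⟨ x-y∙y≡x _ _ ⟩
            base x ∎

        private
          tp-pair : ∀ u v t → (u ⊞ t) ⊞ (v ⊞ t) ≡ u ⊞ v
          tp-pair u v t = trans (⊞-assoc u t _) (cong (u ⊞_) (trans (cong (t ⊞_) (⊞-comm v t)) (⊞-cancel t v)))

          base-differ : ∀ {g} → On (inj₁ g) x → On (inj₁ g) y → base x ≡ base y
          base-differ (_ , p) (_ , q) = trans (cong base p) (sym (cong base q))

          inj₂-differ : ∀ {B} → On (inj₂ B) x → On (inj₂ B) y → base x ≢ base y
          inj₂-differ {j , t , g} (a , p) (b , q) eq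
            with same-value {j} {a} {b} (∙-cancelʳ g _ _ (trans (sym (cong base p)) (trans eq (cong base q))))
          ... | refl = x≢y (trans p (sym q))

        -- The type and difference of x and y determine the base block and both positions; the point
        -- x then determines the translation. A coset of T is recognised by equal base coordinates.
        through-unique : ∀ B B′ → On B x → On B y → On B′ x → On B′ y → B ≡ B′
        through-unique (inj₁ g) (inj₁ g′) (_ , p) _ (_ , p′) _ = cong inj₁ (trans (sym (cong base p)) (cong base p′))
        through-unique (inj₁ g) (inj₂ B′) p q p′ q′ = ⊥-elim (inj₂-differ p′ q′ (base-differ p q))
        through-unique (inj₂ B) (inj₁ g′) p q p′ q′ = ⊥-elim (inj₂-differ p q (base-differ p′ q′))
        through-unique (inj₂ B@(j , t , g)) (inj₂ B′@(j′ , t′ , g′)) P@(a , p) Q@(b , q) P′@(a′ , p′) Q′@(b′ , q′)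
          with diff-injective (j , a , b) (j′ , a′ , b′) (distinct {B} P Q) (distinct {B′} P′ Q′)
                 (trans (sym (types {B} P Q)) (types {B′} P′ Q′)) (trans (sym (values {B} P Q)) (values {B′} P′ Q′))
          where
          distinct : ∀ {B} (P : On (inj₂ B) x) (Q : On (inj₂ B) y) → proj₁ P ≢ proj₁ Q
          distinct {B} P@(a , p) (.a , q) refl = x≢y (trans p (sym q))
          types : ∀ {B} (P : On (inj₂ B) x) (Q : On (inj₂ B) y) → tp x ⊞ tp y ≡ typeSum (proj₁ B , proj₁ P , proj₁ Q)
          types {j , t , g} (a , p) (b , q) = trans (cong₂ (λ u v → tp u ⊞ tp v) p q) (tp-pair (type j a) (type j b) t)
          values : ∀ {B} (P : On (inj₂ B) x) (Q : On (inj₂ B) y) → base x - base y ≡ valueDiff (proj₁ B , proj₁ P , proj₁ Q)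
          values {j , t , g} (a , p) (b , q) = trans (cong₂ (λ u v → base u - base v) p q) (translate-diff (value j a) (value j b) g)
        ... | refl = cong₂ (λ t g → inj₂ (j , t , g))
                       (trans (⊞-solve (type j a) t (sym (cong tp p))) (sym (⊞-solve (type j a) t′ (sym (cong tp p′)))))
                       (∙-cancelˡ (value j a) _ _ (trans (sym (cong base p)) (cong base p′)))

      -- Translation by T stays within a parallel class, so the classes are indexed by the remaining
      -- coordinate of the translation.
      classOf : Block → Elt ms
      classOf (inj₁ g) = g
      classOf (inj₂ (_ , _ , g)) = g

      module _ (c : Elt ms) (x : Point) where
        parallel-to : ∃ λ B → classOf B ≡ c × On B x
        parallel-to with base x ≟ c
        ... | yes eq = inj₁ c , refl , center-On x eq
        ... | no neq with value-cover (base x - c) (λ e → neq (x-y≡ε⇒x≡y e))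
        ...   | (j , a) , v = inj₂ (j , type j a ⊞ tp x , c) , refl ,
                a , sym (cong₂ pt (⊞-cancel (type j a) (tp x)) (trans (cong (_∙ c) v) (x-y∙y≡x _ _)))

        private
          -- value j a ∙ c ≡ c would force value j a ≡ ε.
          off-center : ∀ {j t} → On (inj₂ (j , t , c)) x → base x ≢ c
          off-center {j} (a , p) eq = value≢ε (j , a) (∙-cancelʳ c _ _ (trans (sym (cong base p)) (trans eq (sym (identityˡ c)))))

        parallel-unique : ∀ B B′ → classOf B ≡ c → On B x → classOf B′ ≡ c → On B′ x → B ≡ B′
        parallel-unique (inj₁ g) (inj₁ .g) refl _ refl _ = refl
        parallel-unique (inj₁ g) (inj₂ (j′ , t′ , .g)) refl (_ , p) refl p′ = ⊥-elim (off-center p′ (cong base p))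
        parallel-unique (inj₂ (j , t , g)) (inj₁ .g) refl p refl (_ , p′) = ⊥-elim (off-center p (cong base p′))
        parallel-unique (inj₂ (j , t , g)) (inj₂ (j′ , t′ , .g)) refl (a , p) refl (a′ , p′)
          with value-injective (j , a) (j′ , a′) (∙-cancelʳ g _ _ (trans (sym (cong base p)) (cong base p′)))
        ... | refl = cong (λ t → inj₂ (j , t , g)) (trans (⊞-solve (type j a) t (sym (cong tp p))) (sym (⊞-solve (type j a) t′ (sym (cong tp p′)))))

      toIx : Block → Fin total
      toIx = Inverse.to blocks

      fromIx : Fin total → Block
      fromIx = Inverse.from blocks

      from-to : ∀ B → fromIx (toIx B) ≡ B
      from-to = Inverse.strictlyInverseʳ blocks

      fromIx-injective : ∀ {i j} → fromIx i ≡ fromIx j → i ≡ j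
      fromIx-injective {i} {j} eq = trans (sym (Inverse.strictlyInverseˡ blocks i))
        (trans (cong toIx eq) (Inverse.strictlyInverseˡ blocks j))

      classIx : Elt ms → Fin order
      classIx = Inverse.to enum

      classIx-injective : ∀ {g h} → classIx g ≡ classIx h → g ≡ h
      classIx-injective {g} {h} eq = trans (sym (Inverse.strictlyInverseʳ enum g))
        (trans (cong (Inverse.from enum) eq) (Inverse.strictlyInverseʳ enum h))

      ∈⁺ : ∀ B {y} → On B y → y ∈ points B
      ∈⁺ B (i , refl) = ∈-tabulate⁺ i

      ∈⁻ : ∀ B {y} → y ∈ points B → On B y
      ∈⁻ B = ∈-tabulate⁻

      width∈K : ∀ B → width′ B ∈ K3456
      width∈K (inj₁ _) = there (here refl)
      width∈K (inj₂ (j , _)) with width∈ j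
      ... | here eq = here eq
      ... | there (here eq) = there (there (here eq))
      ... | there (there (here eq)) = there (there (there (here eq)))

      width-found : ∀ k → k ∈ K3456 → ∃ λ B → width′ B ≡ k
      width-found k (here eq) = with-width (here eq)
        where
        with-width : k ∈ sizes → ∃ λ B → width′ B ≡ k
        with-width k∈ = inj₂ (proj₁ (width-occurs k k∈) , (zero , zero) , ε) , proj₂ (width-occurs k k∈)
      width-found k (there (here refl)) = inj₁ ε , refl
      width-found k (there (there k∈)) = inj₂ (proj₁ (width-occurs k (there k∈)) , (zero , zero) , ε) , proj₂ (width-occurs k (there k∈))

      translate : Point → Block → Block
      translate y (inj₁ g) = inj₁ (base y ∙ g)
      translate y (inj₂ (j , t , g)) = inj₂ (j , tp y ⊞ t , base y ∙ g)

      -- On translates of base blocks the position is preserved; on a coset of T the translation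
      -- permutes the four positions.
      point-translate : ∀ y B i → ∃ λ i′ → point (translate y B) i′ ≡ y ⊕ point B i
      point-translate y (inj₁ g) i = proj₁ (corner-onto (tp y ⊞ corner i)) ,
        cong (λ t → pt t (base y ∙ g)) (proj₂ (corner-onto (tp y ⊞ corner i)))
      point-translate y (inj₂ (j , t , g)) a = a , cong₂ pt
        (trans (sym (⊞-assoc (type j a) (tp y) t)) (trans (cong (_⊞ t) (⊞-comm (type j a) (tp y))) (⊞-assoc (tp y) (type j a) t)))
        (trans (sym (assoc _ _ _)) (trans (cong (_∙ g) (comm _ _)) (assoc _ _ _)))

      point-translate⁻ : ∀ y B i → ∃ λ i′ → point (translate y B) i ≡ y ⊕ point B i′
      point-translate⁻ y (inj₁ g) i = proj₁ (corner-onto (tp y ⊞ corner i)) ,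
        cong (λ t → pt t (base y ∙ g)) (trans (sym (⊞-cancel (tp y) (corner i)))
          (cong (tp y ⊞_) (sym (proj₂ (corner-onto (tp y ⊞ corner i))))))
      point-translate⁻ y B@(inj₂ _) a = a , proj₂ (point-translate y B a)

      class-translate : ∀ y B → classOf (translate y B) ≡ base y ∙ classOf B
      class-translate y (inj₁ g) = refl
      class-translate y (inj₂ (j , t , g)) = refl

    space : ResolvedLinearSpace Point K3456
    space = record
      { nBlocks = total
      ; block = λ i → points (fromIx i)
      ; block-uniq = λ i → tabulate⁺ (point-injective (fromIx i))
      ; block-size = λ i → subst (_∈ K3456) (sym (length-tabulate (point (fromIx i)))) (width∈K (fromIx i))
      ; size-occurs = λ k k∈ → let B , eq = width-found k k∈ in
          toIx B , trans (length-tabulate (point (fromIx (toIx B)))) (trans (cong width′ (from-to B)) eq)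
      ; pair-unique = λ x y x≢y → let B , p , q = through x y x≢y in
          toIx B
          , (subst (λ C → x ∈ points C) (sym (from-to B)) (∈⁺ B p) , subst (λ C → y ∈ points C) (sym (from-to B)) (∈⁺ B q))
          , λ {i} (p′ , q′) → fromIx-injective (trans (from-to B)
              (through-unique x y x≢y B (fromIx i) p q (∈⁻ (fromIx i) p′) (∈⁻ (fromIx i) q′)))
      ; nClasses = order
      ; class = λ i → classIx (classOf (fromIx i))
      ; parallel = λ c x → let B , cl , p = parallel-to (Inverse.from enum c) x in
          toIx B
          , (trans (cong classIx (trans (cong classOf (from-to B)) cl)) (Inverse.strictlyInverseˡ enum c)
            , subst (λ C → x ∈ points C) (sym (from-to B)) (∈⁺ B p))
          , λ {i} (cl′ , p′) → fromIx-injective (trans (from-to B)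
              (parallel-unique (Inverse.from enum c) x B (fromIx i) cl p
                (trans (sym (Inverse.strictlyInverseʳ enum _)) (cong (Inverse.from enum) cl′)) (∈⁻ (fromIx i) p′)))
      }

    harmonious : Harmonious {2 ∷ 2 ∷ ms} space
    harmonious = record
      { shift = λ y i → toIx (translate y (fromIx i))
      ; shift-block = λ g i y → mk⇔ (forth g i y) (back g i y)
      ; shift-class = λ g i j eq → cong classIx (begin
          classOf (fromIx (toIx (translate g (fromIx i))))  ≡⟨ class-shift g i ⟩
          base g ∙ classOf (fromIx i)                       ≡⟨ cong (base g ∙_) (classIx-injective eq) ⟩
          base g ∙ classOf (fromIx j)                       ≡⟨ class-shift g j ⟨
          classOf (fromIx (toIx (translate g (fromIx j))))  ∎)
      ; class-transitive = λ c c′ →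
          let u = Inverse.from enum c ; u′ = Inverse.from enum c′ in
          pt (zero , zero) (u′ - u) , toIx (inj₁ u)
          , trans (cong (λ B → classIx (classOf B)) (from-to (inj₁ u))) (Inverse.strictlyInverseˡ enum c)
          , trans (cong classIx (trans (class-shift (pt (zero , zero) (u′ - u)) (toIx (inj₁ u)))
              (trans (cong (λ B → (u′ - u) ∙ classOf B) (from-to (inj₁ u))) (x-y∙y≡x u′ u)))) (Inverse.strictlyInverseˡ enum c′)
      }
      where
      open ≡-Reasoning
      class-shift : ∀ g i → classOf (fromIx (toIx (translate g (fromIx i)))) ≡ base g ∙ classOf (fromIx i)
      class-shift g i = trans (cong classOf (from-to (translate g (fromIx i)))) (class-translate g (fromIx i))
      forth : ∀ g i y → y ∈ points (fromIx (toIx (translate g (fromIx i)))) → y ∈ map (g ⊕_) (points (fromIx i))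
      forth g i y y∈ with ∈⁻ (translate g (fromIx i)) (subst (λ C → y ∈ points C) (from-to (translate g (fromIx i))) y∈)
      ... | k , refl with point-translate⁻ g (fromIx i) k
      ...   | k′ , eq = subst (_∈ map (g ⊕_) (points (fromIx i))) (sym eq) (∈-map⁺ (g ⊕_) (∈⁺ (fromIx i) (k′ , refl)))
      back : ∀ g i y → y ∈ map (g ⊕_) (points (fromIx i)) → y ∈ points (fromIx (toIx (translate g (fromIx i))))
      back g i y y∈ with ∈-map⁻ (g ⊕_) y∈
      ... | z , z∈ , refl with ∈⁻ (fromIx i) z∈
      ...   | k , refl with point-translate g (fromIx i) k
      ...     | k′ , eq = subst (λ C → g ⊕ point (fromIx i) k ∈ points C) (sym (from-to (translate g (fromIx i))))
                            (∈⁺ (translate g (fromIx i)) (k′ , sym eq))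

-- Layouts of three blocks and the families they generate through seventh powers

module Layouts where
  open Fields
  open Sums
  open Families using (FiniteAbelianGroup; Family; T; _⊞_; ⊞-comm; sizes)
  import Data.Bool.Properties as Boolₚ
  import Data.Product.Properties as Prodₚ
  open import Data.List using (lookup; allFin; cartesianProduct; filter)
  open import Data.List.Membership.Propositional using (_∈_)
  open import Data.List.Membership.Propositional.Properties using (∈-lookup; ∈-filter⁺; ∈-filter⁻; ∈-cartesianProduct⁺; ∈-allFin; ∈-map⁺; ∈-++⁺ˡ; ∈-++⁺ʳ)
  open import Data.List.Properties using (length-map)
  import Data.List.Relation.Unary.All.Properties as Allₚ
  open import Data.List.Relation.Unary.Any as Any using (Any; here; there)
  import Data.List.Relation.Unary.Any.Properties as Anyₚ
  open import Data.List.Relation.Unary.AllPairs using (_∷_)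
  open import Data.List.Relation.Unary.Unique.Propositional using (Unique)
  open import Data.List.Relation.Unary.Unique.Propositional.Properties using (filter⁺; allFin⁺)
  open import Relation.Binary.Definitions using (DecidableEquality; tri<; tri≈; tri>)
  import Function.Properties.Inverse as Inv

  lookup-injective : ∀ {A : Set} {xs : List A} → Unique xs → ∀ i j → lookup xs i ≡ lookup xs j → i ≡ j
  lookup-injective (_ ∷ _) zero zero eq = refl
  lookup-injective (px ∷ _) zero (suc j) eq = ⊥-elim (All.lookup px (∈-lookup j) eq)
  lookup-injective (px ∷ _) (suc i) zero eq = ⊥-elim (All.lookup px (∈-lookup i) (sym eq))
  lookup-injective (_ ∷ u) (suc i) (suc j) eq = cong suc (lookup-injective u i j eq)

  unique-map-injective : ∀ {A B : Set} (f : A → B) {xs : List A} → Unique (map f xs) →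
    ∀ {x y} → x ∈ xs → y ∈ xs → f x ≡ f y → x ≡ y
  unique-map-injective f (p ∷ u) (here refl) (here refl) eq = refl
  unique-map-injective f (p ∷ u) (here refl) (there y∈) eq = ⊥-elim (All.lookup p (∈-map⁺ f y∈) eq)
  unique-map-injective f (p ∷ u) (there x∈) (here refl) eq = ⊥-elim (All.lookup p (∈-map⁺ f x∈) (sym eq))
  unique-map-injective f (p ∷ u) (there x∈) (there y∈) eq = unique-map-injective f u x∈ y∈ eq

  width : Fin 3 → ℕ
  width zero = 3
  width (suc zero) = 5
  width (suc (suc zero)) = 6

  Slot : Set
  Slot = Σ (Fin 3) λ X → Fin (width X)

  SlotPair : Set
  SlotPair = Σ (Fin 3) λ X → Fin (width X) × Fin (width X)

  slots : List Slot
  slots = map (zero ,_) (allFin 3) ++ map (suc zero ,_) (allFin 5) ++ map (suc (suc zero) ,_) (allFin 6)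

  slotPairs : List SlotPair
  slotPairs = map (zero ,_) (square 3) ++ map (suc zero ,_) (square 5) ++ map (suc (suc zero) ,_) (square 6)
    where
    square : ∀ n → List (Fin n × Fin n)
    square n = cartesianProduct (allFin n) (allFin n)

  slots-complete : ∀ p → p ∈ slots
  slots-complete (zero , a) = ∈-++⁺ˡ (∈-map⁺ (zero ,_) (∈-allFin a))
  slots-complete (suc zero , a) = ∈-++⁺ʳ (map (zero ,_) (allFin 3)) (∈-++⁺ˡ (∈-map⁺ (suc zero ,_) (∈-allFin a)))
  slots-complete (suc (suc zero) , a) = ∈-++⁺ʳ (map (zero ,_) (allFin 3)) (∈-++⁺ʳ (map (suc zero ,_) (allFin 5))
    (∈-map⁺ (suc (suc zero) ,_) (∈-allFin a)))

  slotPairs-complete : ∀ p → p ∈ slotPairs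
  slotPairs-complete (zero , a , b) = ∈-++⁺ˡ (∈-map⁺ (zero ,_) (∈-cartesianProduct⁺ (∈-allFin a) (∈-allFin b)))
  slotPairs-complete (suc zero , a , b) = ∈-++⁺ʳ (map (zero ,_) (cartesianProduct (allFin 3) (allFin 3)))
    (∈-++⁺ˡ (∈-map⁺ (suc zero ,_) (∈-cartesianProduct⁺ (∈-allFin a) (∈-allFin b))))
  slotPairs-complete (suc (suc zero) , a , b) = ∈-++⁺ʳ (map (zero ,_) (cartesianProduct (allFin 3) (allFin 3)))
    (∈-++⁺ʳ (map (suc zero ,_) (cartesianProduct (allFin 5) (allFin 5)))
      (∈-map⁺ (suc (suc zero) ,_) (∈-cartesianProduct⁺ (∈-allFin a) (∈-allFin b))))

  _≟ᵀ_ : DecidableEquality T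
  _≟ᵀ_ = Prodₚ.≡-dec Finₚ._≟_ Finₚ._≟_

  -- The element in a slot is ± one of seven field elements x₀,…,x₆; the label tells which.
  record Layout : Set where
    field
      type : Slot → T
      label : Slot → Fin 7 × Bool

    pairType : SlotPair → T
    pairType (X , a , b) = type (X , a) ⊞ type (X , b)

    pairsOf : T → List SlotPair
    pairsOf h = filter (λ p → proj₁ (proj₂ p) Finₚ.<? proj₂ (proj₂ p) ×-dec (pairType p ≟ᵀ h)) slotPairs

    -- Seven unordered pairs of each type are as many as there are cosets of the seventh powers,
    -- which is what `Tile` asks for.
    Balanced : Set
    Balanced = ∀ (a b : Fin 2) → length (pairsOf (a , b)) ≡ 7

    -- Fourteen slots meet the fourteen labels bijectively, so every ±xᵢ is an entry of exactly one
    -- slot.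
    Labelled : Set
    Labelled = Unique (map label slots) × ∀ i → Any (λ p → label p ≡ (i , true)) slots × Any (λ p → label p ≡ (i , false)) slots

    balanced? : Dec Balanced
    balanced? = Finₚ.all? λ a → Finₚ.all? λ b → length (pairsOf (a , b)) ℕₚ.≟ 7

    _≟ˡ_ : DecidableEquality (Fin 7 × Bool)
    _≟ˡ_ = Prodₚ.≡-dec Finₚ._≟_ Boolₚ._≟_

    labelled? : Dec Labelled
    labelled? = unique? (map label slots) ×-dec Finₚ.all? λ i →
      Any.any? (λ p → label p ≟ˡ (i , true)) slots ×-dec Any.any? (λ p → label p ≟ˡ (i , false)) slots
      where open import Data.List.Relation.Unary.Unique.DecPropositional _≟ˡ_ using (unique?)

  additiveGroup : Field → FiniteAbelianGroup
  additiveGroup F = record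
    { Carrier = Carrier ; _∙_ = _+_ ; ε = 0# ; _⁻¹ = -_
    ; isAbelianGroup = +-isAbelianGroup
    ; order = size ; enum = enum }
    where
    open Field F
    open import Algebra.Structures
    open IsCommutativeRing isCommutativeRing using (+-isAbelianGroup)

  signed : (R : Raw) → Bool → Raw.Carrier R → Raw.Carrier R
  signed R true x = x
  signed R false x = Raw.-_ R x

  module Entries (R : Raw) (L : Layout) (xs : Fin 7 → Raw.Carrier R) where
    open Raw R
    open Layout L

    entry : Slot → Carrier
    entry p = signed R (proj₂ (label p)) (xs (proj₁ (label p)))

    difference : SlotPair → Carrier
    difference (X , a , b) = entry (X , a) - entry (X , b)

  module SeventhPowers (F : Field) (n′ : ℕ)
    (size≡ : Field.size F ≡ suc (7 ℕ.* (suc n′ ℕ.+ suc n′))) (2≢0 : Raw._+_ (Field.raw F) (Field.1# F) (Field.1# F) ≢ Field.0# F) where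
    open FieldProps F
    open FieldCounting F

    n : ℕ
    n = suc n′ ℕ.+ suc n′

    -- With 7n = q - 1 this power maps units to seventh roots of unity and serves as the name of the
    -- coset modulo seventh powers.
    φ : Carrier → Carrier
    φ x = x ^ n

    φ-* : ∀ x y → φ (x * y) ≡ φ x * φ y
    φ-* x y = ^-*-dist x y n

    φ-≢0 : ∀ {x} → x ≢ 0# → φ x ≢ 0#
    φ-≢0 = ^-≢0 n

    φ^7 : ∀ {x} → x ≢ 0# → φ x ^ 7 ≡ 1#
    φ^7 {x} x≢0 = begin
      (x ^ n) ^ 7        ≡⟨ ^-*-assoc x n 7 ⟩
      x ^ (n ℕ.* 7)      ≡⟨ cong (x ^_) (trans (ℕₚ.*-comm n 7) (sym (cong ℕ.pred size≡))) ⟩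
      x ^ ℕ.pred size    ≡⟨ fermat x≢0 ⟩
      1# ∎
      where open ≡-Reasoning

    -- The exponent n is even because q ≡ 1 (mod 14), hence -1 lies in the kernel of φ.
    φ-neg : ∀ x → φ (- x) ≡ φ x
    φ-neg x = begin
      (- x) ^ (suc n′ ℕ.+ suc n′)      ≡⟨ ^-+ (- x) (suc n′) (suc n′) ⟩
      (- x) ^ suc n′ * (- x) ^ suc n′  ≡⟨ ^-*-dist (- x) (- x) (suc n′) ⟨
      (- x * - x) ^ suc n′             ≡⟨ cong (_^ suc n′) (solve 1 (λ x → (:- x) :* (:- x) := x :* x) refl x) ⟩
      (x * x) ^ suc n′                 ≡⟨ ^-*-dist x x (suc n′) ⟩
      x ^ suc n′ * x ^ suc n′          ≡⟨ ^-+ x (suc n′) (suc n′) ⟨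
      x ^ (suc n′ ℕ.+ suc n′) ∎
      where
      open ≡-Reasoning
      open Solver

    φ-signed : ∀ s x → φ (signed raw s x) ≡ φ x
    φ-signed true x = refl
    φ-signed false x = φ-neg x

    x≢-x : ∀ {x} → x ≢ 0# → x ≢ - x
    x≢-x {x} x≢0 eq = *-≢0 2≢0 x≢0 (begin
      (1# + 1#) * x   ≡⟨ trans (distribʳ x 1# 1#) (cong₂ _+_ (*-identityˡ x) (*-identityˡ x)) ⟩
      x + x           ≡⟨ cong (x +_) eq ⟩
      x - x           ≡⟨ -‿inverseʳ x ⟩
      0# ∎)
      where open ≡-Reasoning

    -- One of each pair ±c with φ c = 1.
    Multiplier : Carrier → Set
    Multiplier c = φ c ≡ 1# × index c Fin.< index (- c)

    multiplier? : ∀ c → Dec (Multiplier c)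
    multiplier? c = (φ c ≟ 1#) ×-dec (index c Finₚ.<? index (- c))

    multipliers : List (Fin size)
    multipliers = filter (λ i → multiplier? (element i)) (allFin size)

    M : Set
    M = Fin (length multipliers)

    mult : M → Carrier
    mult m = element (lookup multipliers m)

    mult-multiplier : ∀ m → Multiplier (mult m)
    mult-multiplier m = proj₂ (∈-filter⁻ (λ i → multiplier? (element i)) {xs = allFin size} (∈-lookup {xs = multipliers} m))

    element-injective : ∀ {i j} → element i ≡ element j → i ≡ j
    element-injective {i} {j} eq = trans (sym (index-element i)) (trans (cong index eq) (index-element j))

    mult-injective : ∀ {m m′} → mult m ≡ mult m′ → m ≡ m′
    mult-injective {m} {m′} eq = lookup-injective (filter⁺ (λ i → multiplier? (element i)) (allFin⁺ size)) m m′ (element-injective eq)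

    mult-cover : ∀ {c} → Multiplier c → ∃ λ m → mult m ≡ c
    mult-cover {c} Mc = Any.index c∈ , trans (cong element (sym (Anyₚ.lookup-index c∈))) (element-index c)
      where
      c∈ : index c ∈ multipliers
      c∈ = ∈-filter⁺ (λ i → multiplier? (element i)) (∈-allFin (index c)) (subst Multiplier (sym (element-index c)) Mc)

    mult≢0 : ∀ m → mult m ≢ 0#
    mult≢0 m eq = 0≢1 (trans (sym (zeroˡ _)) (trans (cong (λ t → t ^ n) (sym eq)) (proj₁ (mult-multiplier m))))

    signed-* : ∀ s x y → x * signed raw s y ≡ signed raw s (x * y)
    signed-* true x y = refl
    signed-* false x y = sym (-‿distribʳ-* x y)

    signed-multiplier : ∀ {c} → c ≢ 0# → φ c ≡ 1# → ∃ λ s → ∃ λ m → c ≡ signed raw s (mult m)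
    signed-multiplier {c} c≢0 φc with Finₚ.<-cmp (index c) (index (- c))
    ... | tri< lt _ _ = true , proj₁ (mult-cover (φc , lt)) , sym (proj₂ (mult-cover (φc , lt)))
    ... | tri≈ _ eq _ = ⊥-elim (x≢-x c≢0 (index-injective eq))
    ... | tri> _ _ gt = false , proj₁ (mult-cover neg) , trans (sym (neg-involutive c)) (cong -_ (sym (proj₂ (mult-cover neg))))
      where
      neg : Multiplier (- c)
      neg = trans (φ-neg c) φc , subst (index (- c) Fin.<_) (cong index (sym (neg-involutive c))) gt

    signed-unique : ∀ s s′ m m′ → signed raw s (mult m) ≡ signed raw s′ (mult m′) → s ≡ s′ × m ≡ m′
    signed-unique true true m m′ eq = refl , mult-injective eq
    signed-unique false false m m′ eq = refl , mult-injective (neg-injective eq)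
    signed-unique true false m m′ eq = ⊥-elim (ℕₚ.<-asym (proj₂ (mult-multiplier m))
      (subst₂ Fin._<_ (cong index (trans (sym (neg-involutive _)) (cong -_ (sym eq)))) (cong index (sym eq)) (proj₂ (mult-multiplier m′))))
    signed-unique false true m m′ eq = ⊥-elim (ℕₚ.<-asym (proj₂ (mult-multiplier m′))
      (subst₂ Fin._<_ (cong index (trans (sym (neg-involutive _)) (cong -_ eq))) (cong index eq) (proj₂ (mult-multiplier m))))

    -- Seven elements with distinct values of φ meet all cosets, since another value would be an
    -- eighth root of X⁷ - 1. If φ g = φ y, then g/y lies in the kernel of φ and is plus or minus a
    -- multiplier. Hence the elements ±m y tile the nonzero elements of the field.
    module Tile {A : Set} (ps : List A) (y : A → Carrier) (seven : length ps ≡ 7)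
      (y≢0 : All (λ a → y a ≢ 0#) ps) (distinct : Unique (map (λ a → φ (y a)) ps)) where

      φ-cover : ∀ {g} → g ≢ 0# → Any (λ a → φ (y a) ≡ φ g) ps
      φ-cover {g} g≢0 with Any.any? (λ a → φ (y a) ≟ φ g) ps
      ... | yes p = p
      ... | no ¬p = ⊥-elim (too-many-roots-of-unity 6 (λ i → lookup roots (at i)) at-injective
                      (λ i → All.lookup roots-root (∈-lookup {xs = roots} (at i))))
        where
        roots : List Carrier
        roots = φ g ∷ map (λ a → φ (y a)) ps
        eight : length roots ≡ 8
        eight = cong suc (trans (length-map _ ps) seven)
        at : Fin 8 → Fin (length roots)
        at = Fin.cast (sym eight)
        roots-unique : Unique roots
        roots-unique = Allₚ.map⁺ (All.map (λ ne e → ne (sym e)) (Allₚ.¬Any⇒All¬ ps ¬p)) ∷ distinct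
        at-injective : ∀ {i j} → lookup roots (at i) ≡ lookup roots (at j) → i ≡ j
        at-injective {i} {j} eq = Finₚ.toℕ-injective (trans (sym (Finₚ.toℕ-cast (sym eight) i))
          (trans (cong Fin.toℕ (lookup-injective roots-unique (at i) (at j) eq)) (Finₚ.toℕ-cast (sym eight) j)))
        roots-root : All (λ r → r ^ 7 ≡ 1#) roots
        roots-root = φ^7 {g} g≢0 ∷ Allₚ.map⁺ {f = λ a → φ (y a)} (All.map (λ {a} → φ^7 {y a}) y≢0)

      cover : ∀ {g} → g ≢ 0# → ∃ λ a → a ∈ ps × ∃ λ s → ∃ λ m → mult m * signed raw s (y a) ≡ g
      cover {g} g≢0 with φ-cover g≢0
      ... | p∈ = a , a∈ , s , m , (begin
          mult m * signed raw s (y a)  ≡⟨ signed-* s _ _ ⟩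
          signed raw s (mult m * y a)  ≡⟨ cong (signed raw s) (*-comm _ _) ⟩
          signed raw s (y a * mult m)  ≡⟨ signed-* s _ _ ⟨
          y a * signed raw s (mult m)  ≡⟨ cong (y a *_) c≡ ⟨
          y a * c                      ≡⟨ *-comm _ _ ⟩
          g * y a ⁻¹ * y a             ≡⟨ *-assoc _ _ _ ⟩
          g * (y a ⁻¹ * y a)           ≡⟨ cong (g *_) (*-inverseˡ ya≢0) ⟩
          g * 1#                       ≡⟨ *-identityʳ g ⟩
          g ∎)
        where
        open ≡-Reasoning
        a = Any.lookup p∈
        a∈ : a ∈ ps
        a∈ = ∈-lookup (Any.index p∈)
        ya≢0 = All.lookup y≢0 a∈
        c = g * y a ⁻¹
        φc : φ c ≡ 1#
        φc = begin
          φ c                      ≡⟨ φ-* g (y a ⁻¹) ⟩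
          φ g * φ (y a ⁻¹)         ≡⟨ cong (_* φ (y a ⁻¹)) (Anyₚ.lookup-index p∈) ⟨
          φ (y a) * φ (y a ⁻¹)     ≡⟨ φ-* (y a) (y a ⁻¹) ⟨
          φ (y a * y a ⁻¹)         ≡⟨ cong φ (*-inverseʳ ya≢0) ⟩
          φ 1#                     ≡⟨ 1^ n ⟩
          1# ∎
        found = signed-multiplier (*-≢0 g≢0 (⁻¹-≢0 ya≢0)) φc
        s = proj₁ found
        m = proj₁ (proj₂ found)
        c≡ = proj₂ (proj₂ found)

      φ-mult : ∀ m s a → φ (mult m * signed raw s (y a)) ≡ φ (y a)
      φ-mult m s a = trans (φ-* (mult m) _) (trans (cong₂ _*_ (proj₁ (mult-multiplier m)) (φ-signed s (y a))) (*-identityˡ _))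

      unique : ∀ {a a′} → a ∈ ps → a′ ∈ ps → ∀ s s′ m m′ →
        mult m * signed raw s (y a) ≡ mult m′ * signed raw s′ (y a′) → a ≡ a′ × s ≡ s′ × m ≡ m′
      unique {a} {a′} a∈ a′∈ s s′ m m′ eq = same , signed-unique s s′ m m′
        (*-cancelˡ (y a) {signed raw s (mult m)} {signed raw s′ (mult m′)} (All.lookup y≢0 a∈) (begin
          y a * signed raw s (mult m)    ≡⟨ exchange (y a) s m ⟩
          mult m * signed raw s (y a)    ≡⟨ eq ⟩
          mult m′ * signed raw s′ (y a′) ≡⟨ exchange (y a′) s′ m′ ⟨
          y a′ * signed raw s′ (mult m′) ≡⟨ cong (λ a → y a * signed raw s′ (mult m′)) same ⟨
          y a * signed raw s′ (mult m′)  ∎))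
        where
        open ≡-Reasoning
        same : a ≡ a′
        same = unique-map-injective (λ a → φ (y a)) distinct a∈ a′∈
          (trans (sym (φ-mult m s a)) (trans (cong φ eq) (φ-mult m′ s′ a′)))
        exchange : ∀ x s m → x * signed raw s (mult m) ≡ mult m * signed raw s x
        exchange x s m = trans (signed-* s x (mult m)) (trans (cong (signed raw s) (*-comm x (mult m))) (sym (signed-* s (mult m) x)))

    -- `Tile` is used once for the seven xᵢ, which gives the values, and once for each type h with
    -- its seven differences. The sign is realised by the label of the slot in the first case and by
    -- the order of the pair in the second.
    module FromLayout (L : Layout) (balanced : Layout.Balanced L) (labelled : Layout.Labelled L) (xs : Fin 7 → Carrier)
      (xs≢0 : All (λ i → xs i ≢ 0#) (allFin 7)) (xs-distinct : Unique (map (λ i → φ (xs i)) (allFin 7)))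
      (diff≢0 : ∀ h → All (λ p → Entries.difference raw L xs p ≢ 0#) (Layout.pairsOf L h))
      (diff-distinct : ∀ h → Unique (map (λ p → φ (Entries.difference raw L xs p)) (Layout.pairsOf L h))) where
      open Layout L
      open Entries raw L xs

      private
        module V = Tile (allFin 7) xs refl xs≢0 xs-distinct
        module D (h : T) = Tile (pairsOf h) difference (balanced (proj₁ h) (proj₂ h)) (diff≢0 h) (diff-distinct h)

        G = additiveGroup F
        module G = FiniteAbelianGroup G

        Index : Set
        Index = Fin 3 × M

        value : ∀ (j : Index) → Fin (width (proj₁ j)) → Carrier
        value (X , m) a = mult m * entry (X , a)

        Position : Set
        Position = Σ Index λ j → Fin (width (proj₁ j))

        OrderedPair : Set
        OrderedPair = Σ Index λ j → Fin (width (proj₁ j)) × Fin (width (proj₁ j))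

        valueAt : Position → Carrier
        valueAt (j , a) = value j a

        value-injective : ∀ p p′ → valueAt p ≡ valueAt p′ → p ≡ p′
        value-injective ((X , m) , a) ((X′ , m′) , a′) eq = cong₂ (λ p m → (proj₁ p , m) , proj₂ p) same-slot (proj₂ (proj₂ found))
          where
          found = V.unique (∈-allFin (proj₁ (label (X , a)))) (∈-allFin (proj₁ (label (X′ , a′))))
            (proj₂ (label (X , a))) (proj₂ (label (X′ , a′))) m m′ eq
          same-slot : (X , a) ≡ (X′ , a′)
          same-slot = unique-map-injective label (proj₁ labelled) (slots-complete (X , a)) (slots-complete (X′ , a′))
            (cong₂ _,_ (proj₁ found) (proj₁ (proj₂ found)))

        labelled-slot : ∀ {ps} ℓ → Any (λ p → label p ≡ ℓ) ps → ∃ λ p → label p ≡ ℓ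
        labelled-slot ℓ p∈ = Any.lookup p∈ , Anyₚ.lookup-index p∈

        slot-of : ∀ i s → ∃ λ p → label p ≡ (i , s)
        slot-of i true = labelled-slot {slots} (i , true) (proj₁ (proj₂ labelled i))
        slot-of i false = labelled-slot {slots} (i , false) (proj₂ (proj₂ labelled i))

        cover-at : ∀ {g} i s m → mult m * signed raw s (xs i) ≡ g → (∃ λ p → label p ≡ (i , s)) → ∃ λ p → valueAt p ≡ g
        cover-at i s m eq ((X , a) , lab) = ((X , m) , a) , trans (cong (λ ℓ → mult m * signed raw (proj₂ ℓ) (xs (proj₁ ℓ))) lab) eq

        value-cover : ∀ g → g ≢ 0# → ∃ λ p → valueAt p ≡ g
        value-cover g g≢0 = let i , _ , s , m , eq = V.cover g≢0 in cover-at i s m eq (slot-of i s)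

        signed≢0 : ∀ s {x} → x ≢ 0# → signed raw s x ≢ 0#
        signed≢0 true x≢0 = x≢0
        signed≢0 false x≢0 = -x≢0 x≢0

        value≢0 : ∀ p → valueAt p ≢ 0#
        value≢0 ((X , m) , a) = *-≢0 (mult≢0 m) (signed≢0 (proj₂ (label (X , a))) (All.lookup {P = λ i → xs i ≢ 0#} {xs = allFin 7} xs≢0 (∈-allFin (proj₁ (label (X , a))))))

        -- Interchanging the two positions negates the difference and keeps the type, T having
        -- exponent 2.
        flip : Bool → SlotPair → SlotPair
        flip true p = p
        flip false (X , a , b) = X , b , a

        flip-type : ∀ s p → pairType (flip s p) ≡ pairType p
        flip-type true p = refl
        flip-type false (X , a , b) = ⊞-comm (type (X , b)) (type (X , a))

        flip-difference : ∀ s p → difference (flip s p) ≡ signed raw s (difference p)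
        flip-difference true p = refl
        flip-difference false (X , a , b) = solve 2 (λ x y → y :- x := :- (x :- y)) refl (entry (X , a)) (entry (X , b))
          where open Solver

        in-pairsOf : ∀ X a b → a Fin.< b → (X , a , b) ∈ pairsOf (pairType (X , a , b))
        in-pairsOf X a b a<b = ∈-filter⁺
          (λ p → proj₁ (proj₂ p) Finₚ.<? proj₂ (proj₂ p) ×-dec (pairType p ≟ᵀ pairType (X , a , b))) {xs = slotPairs}
          (slotPairs-complete (X , a , b)) (a<b , refl)

        canonical : ∀ X a b → a ≢ b → ∃ λ p → ∃ λ s → (p ∈ pairsOf (pairType (X , a , b))) × flip s p ≡ (X , a , b)
        canonical X a b a≢b with Finₚ.<-cmp a b
        ... | tri< a<b _ _ = (X , a , b) , true , in-pairsOf X a b a<b , refl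
        ... | tri≈ _ a≡b _ = ⊥-elim (a≢b a≡b)
        ... | tri> _ _ b<a = (X , b , a) , false ,
                subst (λ h → (X , b , a) ∈ pairsOf h) (⊞-comm (type (X , b)) (type (X , a))) (in-pairsOf X b a b<a) , refl

        attach : M → SlotPair → OrderedPair
        attach m (X , a , b) = (X , m) , a , b

        detach : OrderedPair → SlotPair
        detach ((X , m) , a , b) = X , a , b

        valueDiff : OrderedPair → Carrier
        valueDiff (j , a , b) = value j a - value j b

        valueDiff-attach : ∀ m p → valueDiff (attach m p) ≡ mult m * difference p
        valueDiff-attach m (X , a , b) = solve 3 (λ m x y → m :* x :- m :* y := m :* (x :- y)) refl (mult m) (entry (X , a)) (entry (X , b))
          where open Solver

        of-type : ∀ h p → p ∈ pairsOf h → pairType p ≡ h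
        of-type h p p∈ = proj₂ (proj₂ (∈-filter⁻ (λ p → proj₁ (proj₂ p) Finₚ.<? proj₂ (proj₂ p) ×-dec (pairType p ≟ᵀ h)) {xs = slotPairs} p∈))

        attach-type : ∀ m p → pairType (detach (attach m p)) ≡ pairType p
        attach-type m (X , a , b) = refl

        diff-cover : ∀ h g → g ≢ 0# → ∃ λ p → pairType (detach p) ≡ h × valueDiff p ≡ g
        diff-cover h g g≢0 = let p , p∈ , s , m , eq = D.cover h g≢0 in attach m (flip s p) ,
          trans (attach-type m (flip s p)) (trans (flip-type s p) (of-type h p p∈)) ,
          trans (valueDiff-attach m (flip s p)) (trans (cong (mult m *_) (flip-difference s p)) eq)

        diff-injective : ∀ p p′ → proj₁ (proj₂ p) ≢ proj₂ (proj₂ p) → proj₁ (proj₂ p′) ≢ proj₂ (proj₂ p′) →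
          pairType (detach p) ≡ pairType (detach p′) → valueDiff p ≡ valueDiff p′ → p ≡ p′
        diff-injective ((X , m) , a , b) ((X′ , m′) , a′ , b′) d d′ t v = begin
          attach m (X , a , b)     ≡⟨ cong (attach m) e ⟨
          attach m (flip s p)      ≡⟨ cong₂ (λ m p → attach m (flip s p)) (proj₂ (proj₂ found)) (proj₁ found) ⟩
          attach m′ (flip s p′)    ≡⟨ cong (λ s → attach m′ (flip s p′)) (proj₁ (proj₂ found)) ⟩
          attach m′ (flip s′ p′)   ≡⟨ cong (attach m′) e′ ⟩
          attach m′ (X′ , a′ , b′) ∎
          where
          open ≡-Reasoning
          c = canonical X a b d
          c′ = canonical X′ a′ b′ d′
          p = proj₁ c
          p′ = proj₁ c′
          s = proj₁ (proj₂ c)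
          s′ = proj₁ (proj₂ c′)
          e : flip s p ≡ (X , a , b)
          e = proj₂ (proj₂ (proj₂ c))
          e′ : flip s′ p′ ≡ (X′ , a′ , b′)
          e′ = proj₂ (proj₂ (proj₂ c′))
          rewritten : ∀ m s p q → flip s p ≡ q → valueDiff (attach m q) ≡ mult m * signed raw s (difference p)
          rewritten m s p q refl = trans (valueDiff-attach m (flip s p)) (cong (mult m *_) (flip-difference s p))
          found = D.unique (pairType (X , a , b)) (proj₁ (proj₂ (proj₂ c)))
            (subst (λ h → p′ ∈ pairsOf h) (sym t) (proj₁ (proj₂ (proj₂ c′)))) s s′ m m′
            (trans (sym (rewritten m s p (X , a , b) e)) (trans v (rewritten m′ s′ p′ (X′ , a′ , b′) e′)))

        width∈ : ∀ X → width X ∈ sizes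
        width∈ zero = here refl
        width∈ (suc zero) = there (here refl)
        width∈ (suc (suc zero)) = there (there (here refl))

      module _ (m₀ : M) where
        private
          width-occurs : ∀ s → s ∈ sizes → ∃ λ (j : Index) → width (proj₁ j) ≡ s
          width-occurs s (here refl) = (zero , m₀) , refl
          width-occurs s (there (here refl)) = (suc zero , m₀) , refl
          width-occurs s (there (there (here refl))) = (suc (suc zero) , m₀) , refl

        family′ : Family G
        family′ = record
          { Index = Index
          ; count = 3 ℕ.* length multipliers
          ; indexEnum = Inv.↔-sym Finₚ.*↔×
          ; width = λ j → width (proj₁ j)
          ; type = λ j a → type (proj₁ j , a)
          ; value = value
          ; width∈ = λ j → width∈ (proj₁ j)
          ; width-occurs = width-occurs
          ; value≢ε = value≢0
          ; value-cover = value-cover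
          ; value-injective = value-injective
          ; diff-cover = diff-cover
          ; diff-injective = diff-injective
          }

      family : Family G
      -- Blocks of all sizes exist as soon as there is one multiplier; one is found by covering the
      -- element 1.
      family = family′ (proj₁ (proj₂ (proj₂ (proj₂ (V.cover (λ e → 0≢1 (sym e)))))))

-- Prime fields with fast arithmetic

module PrimeFields where
  open Fields
  open Extensions
  open Layouts
  open import Data.Bool using (not; if_then_else_)
  open import Data.Nat.DivMod
  open import Data.Nat.Primality using (Prime; prime⇒nonTrivial)
  open import Data.Nat.Coprimality using (prime⇒coprime; coprime-Bézout)
  open import Data.Nat.GCD using (module Bézout)
  open import Data.Fin using (fromℕ<)
  open import Function.Bundles using (mk↔ₛ′)

  -- A natural number with an irrelevant bound instead of `Fin`: built-in arithmetic then evaluates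
  -- the certificates, and equality of residues is equality of the numbers.
  record Mod (m : ℕ) : Set where
    constructor mod
    field
      value : ℕ
      .bounded : value ℕ.< suc m

  open Mod

  mod-≡ : ∀ {m} {x y : Mod m} → value x ≡ value y → x ≡ y
  mod-≡ refl = refl

  residue : ∀ m → ℕ → Mod m
  residue m a = mod (a % suc m) (m%n<n a (suc m))

  modRaw : ℕ → Raw
  modRaw m = record
    { Carrier = Mod m
    ; _+_ = λ x y → residue m (value x ℕ.+ value y)
    ; _*_ = λ x y → residue m (value x ℕ.* value y)
    ; -_ = λ x → residue m (suc m ℕ.∸ value x)
    ; 0# = mod 0 (ℕ.s≤s ℕ.z≤n)
    ; 1# = residue m 1
    ; _≟_ = λ x y → map′ mod-≡ (cong value) (value x ℕₚ.≟ value y)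
    }
    where open import Relation.Nullary.Decidable using (map′)

  module Residues (m : ℕ) where
    open Raw (modRaw m)

    value< : ∀ x → value x ℕ.< suc m
    value< (mod v b) = recompute (v ℕₚ.<? suc m) b

    residue-value : ∀ x → residue m (value x) ≡ x
    residue-value x = mod-≡ (m<n⇒m%n≡m (value< x))

    residue-+ˡ : ∀ a b → residue m (a % suc m ℕ.+ b) ≡ residue m (a ℕ.+ b)
    residue-+ˡ a b = mod-≡ (begin
      (a % suc m ℕ.+ b) % suc m                    ≡⟨ %-distribˡ-+ (a % suc m) b (suc m) ⟩
      (a % suc m % suc m ℕ.+ b % suc m) % suc m    ≡⟨ cong (λ t → (t ℕ.+ b % suc m) % suc m) (m%n%n≡m%n a (suc m)) ⟩
      (a % suc m ℕ.+ b % suc m) % suc m            ≡⟨ %-distribˡ-+ a b (suc m) ⟨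
      (a ℕ.+ b) % suc m ∎)
      where open ≡-Reasoning

    residue-*ˡ : ∀ a b → residue m (a % suc m ℕ.* b) ≡ residue m (a ℕ.* b)
    residue-*ˡ a b = mod-≡ (begin
      (a % suc m ℕ.* b) % suc m                    ≡⟨ %-distribˡ-* (a % suc m) b (suc m) ⟩
      (a % suc m % suc m ℕ.* (b % suc m)) % suc m  ≡⟨ cong (λ t → (t ℕ.* (b % suc m)) % suc m) (m%n%n≡m%n a (suc m)) ⟩
      (a % suc m ℕ.* (b % suc m)) % suc m          ≡⟨ %-distribˡ-* a b (suc m) ⟨
      (a ℕ.* b) % suc m ∎)
      where open ≡-Reasoning

    residue-+ʳ : ∀ a b → residue m (a ℕ.+ b % suc m) ≡ residue m (a ℕ.+ b)
    residue-+ʳ a b = trans (cong (residue m) (ℕₚ.+-comm a _)) (trans (residue-+ˡ b a) (cong (residue m) (ℕₚ.+-comm b a)))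

    residue-*ʳ : ∀ a b → residue m (a ℕ.* (b % suc m)) ≡ residue m (a ℕ.* b)
    residue-*ʳ a b = trans (cong (residue m) (ℕₚ.*-comm a _)) (trans (residue-*ˡ b a) (cong (residue m) (ℕₚ.*-comm b a)))

    residue-+ : ∀ a b → residue m a + residue m b ≡ residue m (a ℕ.+ b)
    residue-+ a b = trans (residue-+ˡ a _) (residue-+ʳ a b)

    modLaws : RingLaws (modRaw m)
    modLaws = record
      { +-assoc = λ x y z → trans (residue-+ˡ (value x ℕ.+ value y) (value z))
          (trans (cong (residue m) (ℕₚ.+-assoc (value x) _ _)) (sym (residue-+ʳ (value x) _)))
      ; +-comm = λ x y → cong (residue m) (ℕₚ.+-comm (value x) (value y))
      ; +-identityˡ = residue-value
      ; -‿inverseˡ = λ x → trans (residue-+ˡ (suc m ℕ.∸ value x) (value x)) (mod-≡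
          (trans (cong (_% suc m) (ℕₚ.m∸n+n≡m (ℕₚ.<⇒≤ (value< x)))) (n%n≡0 (suc m))))
      ; *-assoc = λ x y z → trans (residue-*ˡ (value x ℕ.* value y) (value z))
          (trans (cong (residue m) (ℕₚ.*-assoc (value x) _ _)) (sym (residue-*ʳ (value x) _)))
      ; *-comm = λ x y → cong (residue m) (ℕₚ.*-comm (value x) (value y))
      ; *-identityˡ = λ x → trans (residue-*ˡ 1 (value x)) (trans (cong (residue m) (ℕₚ.*-identityˡ (value x))) (residue-value x))
      ; distribˡ = λ x y z → trans (residue-*ʳ (value x) _) (trans (cong (residue m) (ℕₚ.*-distribˡ-+ (value x) (value y) (value z)))
          (sym (residue-+ (value x ℕ.* value y) (value x ℕ.* value z))))
      }

  module PrimeField (m : ℕ) (p-prime : Prime (suc m)) where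
    open Raw (modRaw m)
    open Residues m
    open RingLaws modLaws

    private
      1<p : 1 ℕ.< suc m
      1<p = ℕ.nonTrivial⇒n>1 (suc m) {{prime⇒nonTrivial p-prime}}

      zero-residue : ∀ k → residue m (k ℕ.* suc m) ≡ 0#
      zero-residue k = mod-≡ (m*n%n≡0 k (suc m))

      inverse : ∀ x → x ≢ 0# → ∃ λ y → x * y ≡ 1#
      inverse x@(mod zero _) x≢0 = ⊥-elim (x≢0 refl)
      inverse x@(mod v@(suc v′) b) x≢0 with coprime-Bézout (prime⇒coprime p-prime (recompute (v ℕₚ.<? suc m) b))
      ... | Bézout.+- s t eq = - residue m t , trans (*-comm x (- residue m t)) (begin
          - residue m t * x                                  ≡⟨ +-identityˡ′ (- residue m t * x) ⟨
          - residue m t * x + 0#                             ≡⟨ cong (- residue m t * x +_) (zero-residue s) ⟨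
          - residue m t * x + residue m (s ℕ.* suc m)        ≡⟨ cong (λ u → - residue m t * x + residue m u) eq ⟨
          - residue m t * x + residue m (1 ℕ.+ t ℕ.* v)      ≡⟨ cong (- residue m t * x +_) (trans (+-comm (residue m (t ℕ.* v)) 1#) (residue-+ 1 (t ℕ.* v))) ⟨
          - residue m t * x + (residue m (t ℕ.* v) + 1#)     ≡⟨ +-assoc (- residue m t * x) (residue m (t ℕ.* v)) 1# ⟨
          - residue m t * x + residue m (t ℕ.* v) + 1#       ≡⟨ cong (λ u → - residue m t * x + u + 1#) (residue-*ˡ t v) ⟨
          - residue m t * x + residue m t * x + 1#           ≡⟨ cong (_+ 1#) (distribʳ x (- residue m t) (residue m t)) ⟨
          (- residue m t + residue m t) * x + 1#             ≡⟨ cong (λ u → u * x + 1#) (-‿inverseˡ (residue m t)) ⟩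
          0# * x + 1#                                        ≡⟨ +-identityˡ 1# ⟩
          1# ∎)
        where
        open ≡-Reasoning
        +-identityˡ′ : ∀ y → y + 0# ≡ y
        +-identityˡ′ y = trans (+-comm y 0#) (+-identityˡ y)
        distribʳ : ∀ x y z → (y + z) * x ≡ y * x + z * x
        distribʳ x y z = trans (*-comm (y + z) x) (trans (distribˡ x y z) (cong₂ _+_ (*-comm x y) (*-comm x z)))
      ... | Bézout.-+ s t eq = residue m t , (begin
          x * residue m t                     ≡⟨ *-comm x (residue m t) ⟩
          residue m t * x                     ≡⟨ residue-*ˡ t v ⟩
          residue m (t ℕ.* v)                 ≡⟨ cong (residue m) eq ⟨
          residue m (1 ℕ.+ s ℕ.* suc m)       ≡⟨ residue-+ 1 (s ℕ.* suc m) ⟨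
          1# + residue m (s ℕ.* suc m)        ≡⟨ cong (1# +_) (zero-residue s) ⟩
          1# + 0#                             ≡⟨ trans (+-comm 1# 0#) (+-identityˡ 1#) ⟩
          1# ∎)
        where open ≡-Reasoning

    primeField : Field
    primeField = record
      { raw = modRaw m
      ; isCommutativeRing = fromLaws modLaws
      ; 0≢1 = λ eq → ℕₚ.0≢1+n (trans (cong value eq) (m<n⇒m%n≡m 1<p))
      ; inverse = inverse
      ; size = suc m
      ; enum = mk↔ₛ′ (λ x → fromℕ< (value< x)) (λ i → mod (toℕ i) (Finₚ.toℕ<n i))
          (λ i → Finₚ.fromℕ<-toℕ i _) (λ x → mod-≡ (Finₚ.toℕ-fromℕ< _))
      }

  -- Square and multiply; the first argument bounds the number of rounds.
  fastPower : (R : Raw) → ℕ → Raw.Carrier R → ℕ → Raw.Carrier R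
  fastPower R zero x n = Raw.1# R
  fastPower R (suc k) x zero = Raw.1# R
  fastPower R (suc k) x n@(suc _) =
    if n % 2 ℕ.≡ᵇ 1 then Raw._*_ R x (fastPower R k (Raw._*_ R x x) (n / 2)) else fastPower R k (Raw._*_ R x x) (n / 2)

  freshᵇ : (R : Raw) → Raw.Carrier R → List (Raw.Carrier R) → Bool
  freshᵇ R x [] = true
  freshᵇ R x (y ∷ ys) = not (does (Raw._≟_ R x y)) ∧ freshᵇ R x ys

  distinctᵇ : (R : Raw) → List (Raw.Carrier R) → Bool
  distinctᵇ R [] = true
  distinctᵇ R (x ∷ xs) = not (does (Raw._≟_ R x (Raw.0# R))) ∧ (freshᵇ R x xs ∧ distinctᵇ R xs)

-- Boolean tests for certificates

module Tests where
  open Fields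
  open Extensions
  open Families using (T)
  open Layouts
  open PrimeFields
  open import Data.Bool using (if_then_else_)
  open import Data.Nat.DivMod
  open import Data.Fin.Patterns
  open import Data.List using (lookup; allFin)
  open import Data.Vec as Vec using (Vec; []; _∷_)

  types : List T
  types = (0F , 0F) ∷ (0F , 1F) ∷ (1F , 0F) ∷ (1F , 1F) ∷ []

  -- Opaque, so that the type checker compares tests without evaluating them.
  opaque
    allᵇ : {A : Set} → (A → Bool) → List A → Bool
    allᵇ p [] = true
    allᵇ p (x ∷ xs) = p x ∧ allᵇ p xs

  -- The lists of pairs are an argument, so that one computation of `pairsOf` can serve all tests
  -- with the same layout. The exponent also serves as the number of rounds allowed to `fastPower`.
  check : (R : Raw) → ℕ → (L : Layout) → List (List SlotPair) → (Fin 7 → Raw.Carrier R) → Bool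
  check R n L pairs xs = distinctᵇ R (map (λ i → φ (xs i)) (allFin 7))
    ∧ allᵇ (λ ps → distinctᵇ R (map (λ p → φ (Entries.difference R L xs p)) ps)) pairs
    where
    φ : Raw.Carrier R → Raw.Carrier R
    φ x = fastPower R n x n

  fromVectors : Vec (T × Fin 7 × Bool) 3 → Vec (T × Fin 7 × Bool) 5 → Vec (T × Fin 7 × Bool) 6 → Layout
  fromVectors A B C = record { type = λ p → proj₁ (at p) ; label = λ p → proj₂ (at p) }
    where
    at : Slot → T × Fin 7 × Bool
    at (0F , i) = Vec.lookup A i
    at (1F , i) = Vec.lookup B i
    at (2F , i) = Vec.lookup C i

  -- A = {±x₇, −x₆}, B = {±x₄, ±x₅, x₆}, C = {±x₁, ±x₂, ±x₃}.
  symmetric : Layout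
  symmetric = fromVectors
    (((0F , 0F) , 6F , true) ∷ ((1F , 0F) , 6F , false) ∷ ((0F , 0F) , 5F , false) ∷ [])
    (((0F , 0F) , 3F , true) ∷ ((1F , 0F) , 3F , false) ∷ ((1F , 1F) , 4F , true) ∷ ((1F , 1F) , 4F , false) ∷ ((1F , 1F) , 5F , true) ∷ [])
    (((0F , 0F) , 0F , true) ∷ ((1F , 1F) , 0F , false) ∷ ((0F , 0F) , 1F , true) ∷ ((1F , 0F) , 1F , false) ∷ ((0F , 1F) , 2F , true) ∷ ((0F , 0F) , 2F , false) ∷ [])

  digits : ℕ → ℕ → List ℕ
  digits zero c = []
  digits (suc k) c = c % 256 ∷ digits k (c / 256)

  nth : List ℕ → ℕ → ℕ
  nth [] _ = 0
  nth (d ∷ ds) zero = d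
  nth (d ∷ ds) (suc k) = nth ds k

  data Certificate : Set where
    short : ℕ → Certificate
    full : Layout → List ℕ → Certificate

  -- Byte b stands for b − 128 modulo p.
  shortElements : ∀ m → ℕ → Fin 7 → Mod m
  shortElements m c = elements (digits 7 c)
    where
    elements : List ℕ → Fin 7 → Mod m
    -- Twice the modulus keeps the subtraction from being truncated, since p itself may be less than
    -- 128 while p ≥ 71 on all these certificates.
    elements ds i = residue m (nth ds (toℕ i) ℕ.+ (2 ℕ.* suc m ℕ.∸ 128))

  listElements : ∀ m → List ℕ → Fin 7 → Mod m
  listElements m xs i = residue m (nth xs (toℕ i))

  checkPrime : List (List SlotPair) → ℕ → Certificate → Bool
  checkPrime pairs m (short c) = check (modRaw m) (m / 7) symmetric pairs (shortElements m c)
  checkPrime _ m (full L xs) = (does (Layout.balanced? L) ∧ does (Layout.labelled? L))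
    ∧ check (modRaw m) (m / 7) L (map (Layout.pairsOf L) types) (listElements m xs)

  -- Trial division that stops at the first d with d² > p. For a list of numbers above 1 the answer
  -- `true` thus exhibits a proper divisor; the answer `false` promises nothing.
  composite : List ℕ → ℕ → Bool
  composite [] p = false
  composite (zero ∷ ds) p = composite ds p
  composite (d@(suc _) ∷ ds) p = if d ℕ.* d ℕ.≤ᵇ p then (if p % d ℕ.≡ᵇ 0 then true else composite ds p) else false

  -- Runs through k numbers in steps of 14. A number with a divisor found by `composite` takes no
  -- certificate; every other number consumes the next one, whether or not it has been proved prime.
  scan : {C : Set} → (ℕ → C → Bool) → List ℕ → ℕ → ℕ → List C → Bool
  scan test primes zero m cs = true
  scan test primes (suc k) m cs = if composite primes (suc m) then scan test primes k (14 ℕ.+ m) cs else next cs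
    where
    next : List _ → Bool
    next [] = false
    next (c ∷ cs) = test m c ∧ scan test primes k (14 ℕ.+ m) cs

-- Exact second moment of the colouring by cosets of seventh powers

module QuasiRandomness where
  open Fields
  open Sums
  open Layouts using (module SeventhPowers)
  open import Data.Bool using (if_then_else_)
  open import Data.Nat using (∣_-_∣)
  open import Data.Nat.Solver using (module +-*-Solver)
  open import Data.Fin using (punchIn; inject≤)
  open import Relation.Nullary.Decidable using (dec-true; dec-false)
  open import Relation.Binary.Definitions using (tri<; tri≈; tri>)

  [_] : Bool → ℕ
  [ b ] = if b then 1 else 0

  [∧] : ∀ a b → [ a ∧ b ] ≡ [ a ] ℕ.* [ b ]
  [∧] true b = sym (ℕₚ.+-identityʳ _)
  [∧] false b = refl

  []-idem : ∀ b → [ b ] ℕ.* [ b ] ≡ [ b ]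
  []-idem true = refl
  []-idem false = refl

  -- The variances below are computed in ℕ, so the cross term of the square stands on the left.
  ∣a-b∣²+2ab : ∀ a b → ∣ a - b ∣ ℕ.* ∣ a - b ∣ ℕ.+ 2 ℕ.* (a ℕ.* b) ≡ a ℕ.* a ℕ.+ b ℕ.* b
  ∣a-b∣²+2ab zero b = trans (ℕₚ.+-identityʳ _) refl
  ∣a-b∣²+2ab (suc a) zero = cong ((suc a ℕ.* suc a) ℕ.+_) (cong (2 ℕ.*_) (ℕₚ.*-zeroʳ (suc a)))
  ∣a-b∣²+2ab (suc a) (suc b) = begin
    d ℕ.* d ℕ.+ 2 ℕ.* (suc a ℕ.* suc b)
      ≡⟨ solve 3 (λ d a b → d :* d :+ con 2 :* ((con 1 :+ a) :* (con 1 :+ b)) := (d :* d :+ con 2 :* (a :* b)) :+ (con 2 :+ con 2 :* a :+ con 2 :* b)) refl d a b ⟩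
    d ℕ.* d ℕ.+ 2 ℕ.* (a ℕ.* b) ℕ.+ (2 ℕ.+ 2 ℕ.* a ℕ.+ 2 ℕ.* b)
      ≡⟨ cong (ℕ._+ (2 ℕ.+ 2 ℕ.* a ℕ.+ 2 ℕ.* b)) (∣a-b∣²+2ab a b) ⟩
    a ℕ.* a ℕ.+ b ℕ.* b ℕ.+ (2 ℕ.+ 2 ℕ.* a ℕ.+ 2 ℕ.* b)
      ≡⟨ solve 2 (λ a b → a :* a :+ b :* b :+ (con 2 :+ con 2 :* a :+ con 2 :* b) := (con 1 :+ a) :* (con 1 :+ a) :+ (con 1 :+ b) :* (con 1 :+ b)) refl a b ⟩
    suc a ℕ.* suc a ℕ.+ suc b ℕ.* suc b ∎
    where
    open ≡-Reasoning
    open +-*-Solver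
    d = ∣ a - b ∣

  module Discrepancy (F : Field) (n′ : ℕ)
    (size≡ : Field.size F ≡ suc (7 ℕ.* (suc n′ ℕ.+ suc n′))) (2≢0 : Raw._+_ (Field.raw F) (Field.1# F) (Field.1# F) ≢ Field.0# F) where
    open FieldProps F
    open FieldCounting F
    open SeventhPowers F n′ size≡ 2≢0 public using (n; φ; φ-*; φ-≢0; φ^7; φ-neg)

    private
      module ∑ = Total ℕₚ.+-0-commutativeMonoid

    open ∑ using (sum) public

    opaque
      ∑ : (Carrier → ℕ) → ℕ
      ∑ = ∑.total

    module Finite where
      sum-mono : ∀ {k} (f g : Fin k → ℕ) → (∀ i → f i ≤ g i) → sum f ≤ sum g
      sum-mono {zero} f g le = ℕ.z≤n
      sum-mono {suc k} f g le = ℕₚ.+-mono-≤ (le zero) (sum-mono (λ i → f (suc i)) (λ i → g (suc i)) (λ i → le (suc i)))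

      sum-*ˡ : ∀ {k} c (f : Fin k → ℕ) → sum (λ i → c ℕ.* f i) ≡ c ℕ.* sum f
      sum-*ˡ {zero} c f = sym (ℕₚ.*-zeroʳ c)
      sum-*ˡ {suc k} c f = trans (cong (c ℕ.* f zero ℕ.+_) (sum-*ˡ c (λ i → f (suc i)))) (sym (ℕₚ.*-distribˡ-+ c _ _))

      sum-const : ∀ k c → sum {k} (λ _ → c) ≡ k ℕ.* c
      sum-const zero c = refl
      sum-const (suc k) c = cong (c ℕ.+_) (sum-const k c)

      sum-zero : ∀ {k} (f : Fin k → ℕ) → (∀ i → f i ≡ 0) → sum f ≡ 0
      sum-zero {k} f eq = trans (∑.sum-cong-≋ {k} {f} {λ _ → 0} eq) (trans (sum-const k 0) (ℕₚ.*-zeroʳ k))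

      sum-single : ∀ {k} (i : Fin k) (f : Fin k → ℕ) → (∀ j → j ≢ i → f j ≡ 0) → sum f ≡ f i
      sum-single {suc k} i f zeros = trans (∑.sum-remove {i = i} f)
        (trans (cong (f i ℕ.+_) (sum-zero _ (λ j → zeros (punchIn i j) (Finₚ.punchInᵢ≢i i j)))) (ℕₚ.+-identityʳ _))

      sum-swap : ∀ {k l} (f : Fin k → Fin l → ℕ) → sum (λ i → sum (f i)) ≡ sum (λ j → sum (λ i → f i j))
      sum-swap f = ∑-comm f
        where open import Algebra.Properties.CommutativeMonoid.Sum ℕₚ.+-0-commutativeMonoid using (∑-comm)

      sum-product : ∀ {k} (f : Fin k → ℕ) → sum f ℕ.* sum f ≡ sum (λ i → sum (λ j → f i ℕ.* f j))
      sum-product f = trans (sym (trans (∑.sum-cong-≋ (λ i → trans (sum-*ˡ (f i) f) (ℕₚ.*-comm (f i) (sum f)))) (sum-*ˡ (sum f) f))) refl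

    open Finite

    opaque
      unfolding ∑

      ∑-mono : ∀ f g → (∀ x → f x ≤ g x) → ∑ f ≤ ∑ g
      ∑-mono f g le = sum-mono _ _ (λ i → le (element i))

      ∑-*ˡ : ∀ c f → ∑ (λ x → c ℕ.* f x) ≡ c ℕ.* ∑ f
      ∑-*ˡ c f = sum-*ˡ c (λ i → f (element i))

      ∑-cong : ∀ {f g} → (∀ x → f x ≡ g x) → ∑ f ≡ ∑ g
      ∑-cong = ∑.total-cong

      ∑-+ : ∀ f g → ∑ (λ x → f x ℕ.+ g x) ≡ ∑ f ℕ.+ ∑ g
      ∑-+ = ∑.total-∙

      ∑-swap : ∀ (f : Carrier → Carrier → ℕ) → ∑ (λ x → ∑ (f x)) ≡ ∑ (λ y → ∑ (λ x → f x y))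
      ∑-swap f = sum-swap (λ i j → f (element i) (element j))

      ∑-colours : ∀ {k} (f : Fin k → Carrier → ℕ) → sum (λ i → ∑ (f i)) ≡ ∑ (λ x → sum (λ i → f i x))
      ∑-colours f = sum-swap (λ i j → f i (element j))

      ∑-const : ∀ c → ∑ (λ _ → c) ≡ size ℕ.* c
      ∑-const c = sum-const size c

      ∑-single : ∀ x f → (∀ y → y ≢ x → f y ≡ 0) → ∑ f ≡ f x
      ∑-single x f zeros = trans
        (sum-single (index x) (λ i → f (element i)) (λ j j≢ → zeros (element j) (λ e → j≢ (trans (sym (index-element j)) (cong index e)))))
        (cong f (element-index x))

      ∑-reindex : ∀ (f : Carrier → ℕ) (π π⁻¹ : Carrier → Carrier) → (∀ x → π (π⁻¹ x) ≡ x) → (∀ x → π⁻¹ (π x) ≡ x) →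
        ∑ (λ x → f (π x)) ≡ ∑ f
      ∑-reindex = ∑.total-reindex

      ∑-product : ∀ f → ∑ f ℕ.* ∑ f ≡ ∑ (λ x → ∑ (λ y → f x ℕ.* f y))
      ∑-product f = sum-product (λ k → f (element k))

    private
      nonzero : Fin (7 ℕ.* n) → Carrier
      nonzero i = element (Fin.cast (sym size≡) (punchIn (Fin.cast size≡ (index 0#)) i))

      nonzero≢0 : ∀ i → nonzero i ≢ 0#
      nonzero≢0 i eq = Finₚ.punchInᵢ≢i (Fin.cast size≡ (index 0#)) i (begin
        punchIn (Fin.cast size≡ (index 0#)) i
          ≡⟨ Finₚ.cast-involutive size≡ (sym size≡) _ ⟨
        Fin.cast size≡ (Fin.cast (sym size≡) (punchIn (Fin.cast size≡ (index 0#)) i))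
          ≡⟨ cong (Fin.cast size≡) (trans (sym (index-element _)) (cong index eq)) ⟩
        Fin.cast size≡ (index 0#) ∎)
        where open ≡-Reasoning

      nonzero-injective : ∀ {i j} → nonzero i ≡ nonzero j → i ≡ j
      nonzero-injective {i} {j} eq = Finₚ.punchIn-injective (Fin.cast size≡ (index 0#)) i j (begin
        p i                                          ≡⟨ Finₚ.cast-involutive size≡ (sym size≡) _ ⟨
        Fin.cast size≡ (Fin.cast (sym size≡) (p i))  ≡⟨ cong (Fin.cast size≡) (element-injective eq) ⟩
        Fin.cast size≡ (Fin.cast (sym size≡) (p j))  ≡⟨ Finₚ.cast-involutive size≡ (sym size≡) _ ⟩
        p j ∎)
        where
        open ≡-Reasoning
        open SeventhPowers F n′ size≡ 2≢0 using (element-injective)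
        p = punchIn (Fin.cast size≡ (index 0#))

    opaque
      -- X^n − 1 has fewer roots than there are units.
      generator : ∃ λ g → g ≢ 0# × φ g ≢ 1#
      generator with any? (λ g → ¬? (g ≟ 0#) ×-dec ¬? (φ g ≟ 1#))
      ... | yes p = p
      ... | no ¬p = ⊥-elim (too-many-roots-of-unity (n′ ℕ.+ suc n′) (λ i → nonzero (inject≤ i enough))
                      (λ {i} {j} eq → Finₚ.inject≤-injective enough enough i j (nonzero-injective eq)) root)
        where
        enough : suc n ≤ 7 ℕ.* n
        enough = ℕₚ.≤-trans (ℕₚ.+-mono-≤ {1} {6 ℕ.* n} {n} {n} (ℕ.s≤s ℕ.z≤n) ℕₚ.≤-refl) (ℕₚ.≤-reflexive (ℕₚ.+-comm (6 ℕ.* n) n))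
        root : ∀ i → φ (nonzero (inject≤ i enough)) ≡ 1#
        root i with φ (nonzero (inject≤ i enough)) ≟ 1#
        ... | yes e = e
        ... | no ne = ⊥-elim (¬p (nonzero (inject≤ i enough) , nonzero≢0 _ , ne))

    -- A seventh root of unity other than 1, hence primitive; its powers `r 0`, ..., `r 6` are the
    -- colours.
    ζ : Carrier
    ζ = φ (proj₁ generator)

    ζ^7 : ζ ^ 7 ≡ 1#
    ζ^7 = φ^7 (proj₁ (proj₂ generator))

    r : Fin 7 → Carrier
    r i = ζ ^ toℕ i

    private
      -- The number k′ inverts k modulo 7, so ζ^k = 1 would force ζ = 1.
      no-small-order : ∀ k k′ l → k ℕ.* k′ ≡ suc (7 ℕ.* l) → ζ ^ k ≢ 1#
      no-small-order k k′ l eq ζ^k = proj₂ (proj₂ generator) (begin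
        ζ                     ≡⟨ *-identityʳ ζ ⟨
        ζ * 1#                ≡⟨ cong (ζ *_) (trans (sym (1^ l)) (cong (_^ l) (sym ζ^7))) ⟩
        ζ * (ζ ^ 7) ^ l       ≡⟨ cong (ζ *_) (^-*-assoc ζ 7 l) ⟩
        ζ ^ suc (7 ℕ.* l)     ≡⟨ cong (ζ ^_) eq ⟨
        ζ ^ (k ℕ.* k′)        ≡⟨ ^-*-assoc ζ k k′ ⟨
        (ζ ^ k) ^ k′          ≡⟨ cong (_^ k′) ζ^k ⟩
        1# ^ k′               ≡⟨ 1^ k′ ⟩
        1# ∎)
        where open ≡-Reasoning

      ζ^k≢1 : ∀ k → k < 6 → ζ ^ suc k ≢ 1#
      ζ^k≢1 0 _ = no-small-order 1 1 0 refl
      ζ^k≢1 1 _ = no-small-order 2 4 1 refl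
      ζ^k≢1 2 _ = no-small-order 3 5 2 refl
      ζ^k≢1 3 _ = no-small-order 4 2 1 refl
      ζ^k≢1 4 _ = no-small-order 5 3 2 refl
      ζ^k≢1 5 _ = no-small-order 6 6 5 refl
      ζ^k≢1 (suc (suc (suc (suc (suc (suc _)))))) (ℕ.s≤s (ℕ.s≤s (ℕ.s≤s (ℕ.s≤s (ℕ.s≤s (ℕ.s≤s ()))))))

      ζ≢0 : ζ ≢ 0#
      ζ≢0 = φ-≢0 (proj₁ (proj₂ generator))

      r-distinct : ∀ {i j} → i Fin.< j → r i ≢ r j
      r-distinct {i} {j} i<j eq with ℕₚ.m≤n⇒∃[o]m+o≡n i<j
      ... | k , sum≡ = ζ^k≢1 k k<6 (*-cancelˡ (ζ ^ toℕ i) (^-≢0 (toℕ i) ζ≢0) (begin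
          ζ ^ toℕ i * ζ ^ suc k    ≡⟨ ^-+ ζ (toℕ i) (suc k) ⟨
          ζ ^ (toℕ i ℕ.+ suc k)    ≡⟨ cong (ζ ^_) (trans (ℕₚ.+-suc (toℕ i) k) sum≡) ⟩
          ζ ^ toℕ j                ≡⟨ eq ⟨
          ζ ^ toℕ i                ≡⟨ *-identityʳ _ ⟨
          ζ ^ toℕ i * 1# ∎))
        where
        open ≡-Reasoning
        k<6 : k < 6
        k<6 = ℕₚ.≤-pred (ℕₚ.≤-trans (ℕ.s≤s (ℕₚ.≤-trans (ℕₚ.m≤n+m (suc k) (toℕ i)) (ℕₚ.≤-reflexive (trans (ℕₚ.+-suc (toℕ i) k) sum≡)))) (Finₚ.toℕ<n j))

    r-injective : ∀ {i j} → r i ≡ r j → i ≡ j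
    r-injective {i} {j} eq with Finₚ.<-cmp i j
    ... | tri< i<j _ _ = ⊥-elim (r-distinct i<j eq)
    ... | tri≈ _ i≡j _ = i≡j
    ... | tri> _ _ j<i = ⊥-elim (r-distinct j<i (sym eq))

    r≢0 : ∀ i → r i ≢ 0#
    r≢0 i = ^-≢0 (toℕ i) ζ≢0

    -- Both φ x and the seven `r i` are roots of X⁷ - 1, which has no eighth root.
    colour : ∀ {x} → x ≢ 0# → ∃ λ i → φ x ≡ r i
    colour {x} x≢0 with Finₚ.any? (λ i → φ x ≟ r i)
    ... | yes p = p
    ... | no ¬p = ⊥-elim (too-many-roots-of-unity 6 roots roots-injective root)
      where
      roots : Fin 8 → Carrier
      roots zero = φ x
      roots (suc i) = r i
      roots-injective : ∀ {i j} → roots i ≡ roots j → i ≡ j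
      roots-injective {zero} {zero} eq = refl
      roots-injective {zero} {suc j} eq = ⊥-elim (¬p (j , eq))
      roots-injective {suc i} {zero} eq = ⊥-elim (¬p (i , sym eq))
      roots-injective {suc i} {suc j} eq = cong suc (r-injective eq)
      root : ∀ i → roots i ^ 7 ≡ 1#
      root zero = φ^7 x≢0
      root (suc i) = begin
        (ζ ^ toℕ i) ^ 7   ≡⟨ ^-*-assoc ζ (toℕ i) 7 ⟩
        ζ ^ (toℕ i ℕ.* 7) ≡⟨ cong (ζ ^_) (ℕₚ.*-comm (toℕ i) 7) ⟩
        ζ ^ (7 ℕ.* toℕ i) ≡⟨ ^-*-assoc ζ 7 (toℕ i) ⟨
        (ζ ^ 7) ^ toℕ i   ≡⟨ cong (_^ toℕ i) ζ^7 ⟩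
        1# ^ toℕ i        ≡⟨ 1^ (toℕ i) ⟩
        1# ∎
        where open ≡-Reasoning

    opaque
      coloured : Fin 7 → Carrier → Bool
      coloured i d = does (φ d ≟ r i)

      coloured-sound : ∀ i d → coloured i d ≡ true → φ d ≡ r i
      coloured-sound i d eq with φ d ≟ r i
      ... | yes p = p

      coloured-true : ∀ i d → φ d ≡ r i → coloured i d ≡ true
      coloured-true i d eq = dec-true (φ d ≟ r i) eq

      coloured-false : ∀ i d → φ d ≢ r i → coloured i d ≡ false
      coloured-false i d ne = dec-false (φ d ≟ r i) ne

    E : Fin 7 → Carrier → ℕ
    E i d = [ coloured i d ]

    φ0 : φ 0# ≡ 0#
    φ0 = zeroˡ _

    private
      E-0 : ∀ i → E i 0# ≡ 0
      E-0 i = cong [_] (coloured-false i 0# (λ e → r≢0 i (trans (sym e) φ0)))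

      E-here : ∀ {i d} → φ d ≡ r i → E i d ≡ 1
      E-here eq = cong [_] (coloured-true _ _ eq)

      E-other : ∀ {i j d} → φ d ≡ r i → j ≢ i → E j d ≡ 0
      E-other {i} {j} {d} eq j≢i = cong [_] (coloured-false j d (λ e → j≢i (r-injective (trans (sym e) eq))))

      -- Multiplication by the i-th power of the generator carries colour 0 onto colour i. So the
      -- seven colour classes are equal parts of the 7n units, of size n each.
      ∑E-shift : ∀ i → ∑ (E i) ≡ ∑ (E zero)
      ∑E-shift i = begin
        ∑ (E i)                     ≡⟨ ∑-reindex (E i) (c *_) (c ⁻¹ *_) forth back ⟨
        ∑ (λ x → E i (c * x))       ≡⟨ ∑-cong same ⟩
        ∑ (E zero)                  ∎
        where
        open ≡-Reasoning
        g = proj₁ generator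
        c = g ^ toℕ i
        c≢0 : c ≢ 0#
        c≢0 = ^-≢0 (toℕ i) (proj₁ (proj₂ generator))
        forth : ∀ x → c * (c ⁻¹ * x) ≡ x
        forth x = trans (sym (*-assoc c _ x)) (trans (cong (_* x) (*-inverseʳ c≢0)) (*-identityˡ x))
        back : ∀ x → c ⁻¹ * (c * x) ≡ x
        back x = trans (sym (*-assoc _ c x)) (trans (cong (_* x) (*-inverseˡ c≢0)) (*-identityˡ x))
        φc : φ c ≡ r i
        φc = begin
          (g ^ toℕ i) ^ n     ≡⟨ ^-*-assoc g (toℕ i) n ⟩
          g ^ (toℕ i ℕ.* n)   ≡⟨ cong (g ^_) (ℕₚ.*-comm (toℕ i) n) ⟩
          g ^ (n ℕ.* toℕ i)   ≡⟨ ^-*-assoc g n (toℕ i) ⟨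
          (g ^ n) ^ toℕ i ∎
        same : ∀ x → E i (c * x) ≡ E zero x
        same x = decide (φ x ≟ r zero)
          where
          decide : Dec (φ x ≡ r zero) → E i (c * x) ≡ E zero x
          decide (yes p) = trans (E-here (trans (φ-* c x) (trans (cong₂ _*_ φc p) (*-identityʳ (r i))))) (sym (E-here p))
          decide (no ¬p) = cong [_] (trans (coloured-false i (c * x) (λ e → ¬p (*-cancelˡ (r i) (r≢0 i)
            (trans (sym (trans (φ-* c x) (cong (_* φ x) φc))) (trans e (sym (*-identityʳ (r i)))))))) (sym (coloured-false zero x ¬p)))

      unit : Carrier → ℕ
      unit x = [ does (¬? (x ≟ 0#)) ]

      sum-E : ∀ x → sum (λ i → E i x) ≡ unit x
      sum-E x with x ≟ 0#
      ... | yes refl = sum-zero (λ i → E i 0#) E-0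
      ... | no x≢0 = let i , eq = colour x≢0 in trans (sum-single i (λ j → E j x) (λ j → E-other eq)) (E-here eq)

      ∑-unit : ∑ unit ≡ 7 ℕ.* n
      ∑-unit = ℕₚ.suc-injective (begin
        1 ℕ.+ ∑ unit          ≡⟨ cong (ℕ._+ ∑ unit) (trans (∑-single 0# z (λ y y≢ → cong [_] (dec-false (y ≟ 0#) y≢))) (cong [_] (dec-true (0# ≟ 0#) refl))) ⟨
        ∑ z ℕ.+ ∑ unit        ≡⟨ ∑-+ z unit ⟨
        ∑ (λ x → z x ℕ.+ unit x) ≡⟨ ∑-cong one ⟩
        ∑ (λ _ → 1)           ≡⟨ ∑-const 1 ⟩
        size ℕ.* 1            ≡⟨ ℕₚ.*-identityʳ size ⟩
        size                  ≡⟨ size≡ ⟩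
        suc (7 ℕ.* n) ∎)
        where
        open ≡-Reasoning
        z : Carrier → ℕ
        z x = [ does (x ≟ 0#) ]
        one : ∀ x → z x ℕ.+ unit x ≡ 1
        one x with does (x ≟ 0#)
        ... | true = refl
        ... | false = refl

    ∑E : ∀ i → ∑ (E i) ≡ n
    ∑E i = trans (∑E-shift i) (ℕₚ.*-cancelˡ-≡ (∑ (E zero)) n 7 (begin
      7 ℕ.* ∑ (E zero)            ≡⟨ sum-const 7 (∑ (E zero)) ⟨
      sum {7} (λ i → ∑ (E zero))  ≡⟨ ∑.sum-cong-≋ {7} (λ i → ∑E-shift i) ⟨
      sum (λ i → ∑ (E i))         ≡⟨ ∑-colours E ⟩
      ∑ (λ x → sum (λ i → E i x)) ≡⟨ ∑-cong sum-E ⟩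
      ∑ unit                      ≡⟨ ∑-unit ⟩
      7 ℕ.* n ∎))
      where open ≡-Reasoning

    ∑-translate : ∀ f y → ∑ (λ z → f (z - y)) ≡ ∑ f
    ∑-translate f y = ∑-reindex f (_- y) (_+ y)
      (λ x → trans (+-assoc x y (- y)) (trans (cong (x +_) (-‿inverseʳ y)) (+-identityʳ x)))
      (λ x → trans (+-assoc x (- y) y) (trans (cong (x +_) (-‿inverseˡ y)) (+-identityʳ x)))

    ∑-negate : ∀ f → ∑ (λ z → f (- z)) ≡ ∑ f
    ∑-negate f = ∑-reindex f (λ x → - x) (λ x → - x) neg-involutive neg-involutive

    private
      -- Counts the z for which z - x and z - y have the same colour. That this takes only one value
      -- for all x ≠ y is what makes the second moment exact.
      correlation : Carrier → Carrier → ℕ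
      correlation x y = sum (λ i → ∑ (λ z → E i (z - x) ℕ.* E i (z - y)))

      n-1 : ℕ
      n-1 = n′ ℕ.+ suc n′

      correlation-self : ∀ x → correlation x x ≡ 7 ℕ.* n
      correlation-self x = begin
        sum (λ i → ∑ (λ z → E i (z - x) ℕ.* E i (z - x)))
          ≡⟨ ∑.sum-cong-≋ (λ i → trans (∑-cong (λ z → []-idem (coloured i (z - x)))) (trans (∑-translate (E i) x) (∑E i))) ⟩
        sum {7} (λ i → n) ≡⟨ sum-const 7 n ⟩
        7 ℕ.* n ∎
        where open ≡-Reasoning

      -- For z ≠ x, y the elements z − x and z − y have one colour iff the ratio (z − x)/(z − y) ≠ 1 has colour 0.
      correlation-other : ∀ x y → x ≢ y → correlation x y ≡ n-1
      correlation-other x y x≢y = begin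
        sum (λ i → ∑ (λ z → E i (z - x) ℕ.* E i (z - y)))
          ≡⟨ ∑-colours (λ i z → E i (z - x) ℕ.* E i (z - y)) ⟩
        ∑ (λ z → sum (λ i → E i (z - x) ℕ.* E i (z - y)))
          ≡⟨ ∑-cong (λ z → cong (λ t → sum (λ i → E i t ℕ.* E i (z - y))) (shift z)) ⟩
        ∑ (λ z → sum (λ i → E i (z - y + d) ℕ.* E i (z - y)))
          ≡⟨ ∑-translate (λ u → sum (λ i → E i (u + d) ℕ.* E i u)) y ⟩
        ∑ (λ u → sum (λ i → E i (u + d) ℕ.* E i u))
          ≡⟨ ∑-cong agree ⟩
        ∑ (λ u → f (1# + d * u ⁻¹))
          ≡⟨ ∑-reindex f ratio ratio⁻¹ ratio-l ratio-r ⟩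
        -- Colour class 0 has n elements, and f omits exactly one of them, the element 1.
        ∑ f ≡⟨ ℕₚ.suc-injective (trans (cong (ℕ._+ ∑ f) (sym e1)) (trans (sym (∑-+ e f)) (trans (∑-cong split) (∑E zero)))) ⟩
        n-1 ∎
        where
        open ≡-Reasoning
        d = y - x
        d≢0 : d ≢ 0#
        d≢0 = x-y≢0 (λ e → x≢y (sym e))
        shift : ∀ z → z - x ≡ z - y + d
        shift z = solve 3 (λ x y z → z :- x := z :- y :+ (y :- x)) refl x y z where open Solver
        e f : Carrier → ℕ
        e w = [ does (w ≟ 1#) ]
        f w = [ does (¬? (w ≟ 1#)) ] ℕ.* E zero w
        e1 : ∑ e ≡ 1
        e1 = trans (∑-single 1# e (λ y y≢ → cong [_] (dec-false (y ≟ 1#) y≢))) (cong [_] (dec-true (1# ≟ 1#) refl))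
        split : ∀ w → e w ℕ.+ f w ≡ E zero w
        split w with w ≟ 1#
        ... | yes refl = sym (E-here (1^ n))
        ... | no _ = ℕₚ.+-identityʳ _
        -- Since the inverse of 0 is 0, this is a permutation of the entire field; it sends u = 0 to
        -- 1, where f vanishes as it must.
        ratio ratio⁻¹ : Carrier → Carrier
        ratio u = 1# + d * u ⁻¹
        ratio⁻¹ w = (d ⁻¹ * (w - 1#)) ⁻¹
        ratio-l : ∀ w → ratio (ratio⁻¹ w) ≡ w
        ratio-l w = begin
          1# + d * (d ⁻¹ * (w - 1#)) ⁻¹ ⁻¹  ≡⟨ cong (λ t → 1# + d * t) (⁻¹-involutive _) ⟩
          1# + d * (d ⁻¹ * (w - 1#))        ≡⟨ cong (1# +_) (trans (sym (*-assoc d _ _)) (trans (cong (_* (w - 1#)) (*-inverseʳ d≢0)) (*-identityˡ _))) ⟩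
          1# + (w - 1#)                     ≡⟨ solve 2 (λ o w → o :+ (w :- o) := w) refl 1# w ⟩
          w ∎
          where open Solver
        ratio-r : ∀ u → ratio⁻¹ (ratio u) ≡ u
        ratio-r u = trans (cong _⁻¹ (begin
          d ⁻¹ * (1# + d * u ⁻¹ - 1#)  ≡⟨ cong (d ⁻¹ *_) (solve 2 (λ o w → o :+ w :- o := w) refl 1# (d * u ⁻¹)) ⟩
          d ⁻¹ * (d * u ⁻¹)            ≡⟨ trans (sym (*-assoc _ d _)) (trans (cong (_* u ⁻¹) (*-inverseˡ d≢0)) (*-identityˡ _)) ⟩
          u ⁻¹ ∎)) (⁻¹-involutive u)
          where open Solver
        agree : ∀ u → sum (λ i → E i (u + d) ℕ.* E i u) ≡ f (1# + d * u ⁻¹)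
        agree u = go (u ≟ 0#)
          where
          go : Dec (u ≡ 0#) → sum (λ i → E i (u + d) ℕ.* E i u) ≡ f (1# + d * u ⁻¹)
          go (yes refl) = trans (sum-zero (λ i → E i (0# + d) ℕ.* E i 0#) (λ i → trans (cong (E i (0# + d) ℕ.*_) (E-0 i)) (ℕₚ.*-zeroʳ (E i (0# + d)))))
            (sym (trans (cong f ratio0) (cong (λ b → [ b ] ℕ.* E zero 1#) (dec-false (¬? (1# ≟ 1#)) (λ ne → ne refl)))))
            where
            ratio0 : 1# + d * 0# ⁻¹ ≡ 1#
            ratio0 = trans (cong (λ t → 1# + d * t) 0⁻¹) (trans (cong (1# +_) (zeroʳ d)) (+-identityʳ 1#))
          go (no u≢0) = trans (sum-single i (λ j → E j (u + d) ℕ.* E j u) (λ j j≢i → trans (cong (E j (u + d) ℕ.*_) (E-other φu j≢i)) (ℕₚ.*-zeroʳ (E j (u + d)))))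
            (trans (cong (E i (u + d) ℕ.*_) (E-here φu)) (trans (ℕₚ.*-identityʳ _) (trans same
              (sym (trans (cong (λ b → [ b ] ℕ.* E zero w) (dec-true (¬? (w ≟ 1#)) w≢1)) (ℕₚ.+-identityʳ _))))))
            where
            i = proj₁ (colour u≢0)
            φu = proj₂ (colour u≢0)
            w = 1# + d * u ⁻¹
            w*u : w * u ≡ u + d
            w*u = begin
              (1# + d * u ⁻¹) * u     ≡⟨ distribʳ u 1# _ ⟩
              1# * u + d * u ⁻¹ * u   ≡⟨ cong₂ _+_ (*-identityˡ u) (trans (*-assoc d _ u) (trans (cong (d *_) (*-inverseˡ u≢0)) (*-identityʳ d))) ⟩
              u + d ∎
            φw : φ (u + d) ≡ φ w * r i
            φw = trans (cong φ (sym w*u)) (trans (φ-* w u) (cong (φ w *_) φu))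
            same-colour : Dec (φ w ≡ r zero) → E i (u + d) ≡ E zero w
            same-colour (yes p) = trans (E-here (trans φw (trans (cong (_* r i) p) (*-identityˡ (r i))))) (sym (E-here p))
            same-colour (no ¬p) = cong [_] (trans
              (coloured-false i (u + d) (λ e → ¬p (*-cancelʳ (r i) (r≢0 i) (trans (sym φw) (trans e (sym (*-identityˡ (r i))))))))
              (sym (coloured-false zero w ¬p)))
            same : E i (u + d) ≡ E zero w
            same = same-colour (φ w ≟ r zero)
            w≢1 : w ≢ 1#
            w≢1 eq = *-≢0 d≢0 (⁻¹-≢0 u≢0) (begin
              d * u ⁻¹              ≡⟨ solve 2 (λ o t → t := o :+ t :- o) refl 1# (d * u ⁻¹) ⟩
              1# + d * u ⁻¹ - 1#    ≡⟨ cong (_- 1#) eq ⟩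
              1# - 1#               ≡⟨ -‿inverseʳ 1# ⟩
              0# ∎)
              where open Solver

      correlation≡ : ∀ x y → correlation x y ≡ n-1 ℕ.+ [ does (y ≟ x) ] ℕ.* suc (6 ℕ.* n)
      correlation≡ x y with y ≟ x
      ... | yes refl = trans (correlation-self x) (solve 1 (λ m → con 7 :* (con 1 :+ m) := m :+ (con 1 :* (con 1 :+ con 6 :* (con 1 :+ m)))) refl n-1)
        where open +-*-Solver
      ... | no y≢x = trans (correlation-other x y (λ e → y≢x (sym e))) (sym (ℕₚ.+-identityʳ _))

    Subset : Set
    Subset = Carrier → Bool

    ∣_∣ₛ : Subset → ℕ
    ∣ ω ∣ₛ = ∑ (λ x → [ ω x ])

    neighbours : Fin 7 → Subset → Carrier → ℕ
    neighbours i ω z = ∑ (λ x → [ ω x ] ℕ.* E i (z - x))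

    -- About a seventh of ω is expected among the neighbours of z in one colour; the factor 7 keeps
    -- this squared distance integral.
    deviation : Fin 7 → Subset → ℕ
    deviation i ω = ∑ (λ z → ∣ 7 ℕ.* neighbours i ω z - ∣ ω ∣ₛ ∣ ℕ.* ∣ 7 ℕ.* neighbours i ω z - ∣ ω ∣ₛ ∣)

    private
      module _ (ω : Subset) where
        s = ∣ ω ∣ₛ
        N = λ i → neighbours i ω

        ∑N : ∀ i → ∑ (N i) ≡ s ℕ.* n
        ∑N i = begin
          ∑ (λ z → ∑ (λ x → [ ω x ] ℕ.* E i (z - x)))  ≡⟨ ∑-swap (λ z x → [ ω x ] ℕ.* E i (z - x)) ⟩
          ∑ (λ x → ∑ (λ z → [ ω x ] ℕ.* E i (z - x)))  ≡⟨ ∑-cong (λ x → trans (∑-*ˡ [ ω x ] (λ z → E i (z - x))) (cong ([ ω x ] ℕ.*_) (trans (∑-translate (E i) x) (∑E i)))) ⟩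
          ∑ (λ x → [ ω x ] ℕ.* n)                      ≡⟨ ∑-cong (λ x → ℕₚ.*-comm [ ω x ] n) ⟩
          ∑ (λ x → n ℕ.* [ ω x ])                      ≡⟨ ∑-*ˡ n (λ x → [ ω x ]) ⟩
          n ℕ.* s                                      ≡⟨ ℕₚ.*-comm n s ⟩
          s ℕ.* n ∎
          where open ≡-Reasoning

        square-expand : ∀ i z → N i z ℕ.* N i z ≡ ∑ (λ x → ∑ (λ y → [ ω x ] ℕ.* [ ω y ] ℕ.* (E i (z - x) ℕ.* E i (z - y))))
        square-expand i z = trans (∑-product (λ x → [ ω x ] ℕ.* E i (z - x)))
          (∑-cong (λ x → ∑-cong (λ y → solve 4 (λ a b c d → a :* b :* (c :* d) := a :* c :* (b :* d)) refl [ ω x ] (E i (z - x)) [ ω y ] (E i (z - y)))))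
          where open +-*-Solver

        -- Squaring N counts pairs x, y in ω joined to z by the same colour. Summing over z and the
        -- colours first leaves `correlation`, which is constant apart from the diagonal.
        ∑N² : sum (λ i → ∑ (λ z → N i z ℕ.* N i z)) ≡ n-1 ℕ.* (s ℕ.* s) ℕ.+ suc (6 ℕ.* n) ℕ.* s
        ∑N² = begin
          sum (λ i → ∑ (λ z → N i z ℕ.* N i z))
            ≡⟨ ∑.sum-cong-≋ (λ i → trans (∑-cong (square-expand i)) (trans
                 (∑-swap (λ z x → ∑ (λ y → [ ω x ] ℕ.* [ ω y ] ℕ.* (E i (z - x) ℕ.* E i (z - y)))))
                 (∑-cong (λ x → trans (∑-swap (λ z y → [ ω x ] ℕ.* [ ω y ] ℕ.* (E i (z - x) ℕ.* E i (z - y))))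
                   (∑-cong (λ y → ∑-*ˡ ([ ω x ] ℕ.* [ ω y ]) (λ z → E i (z - x) ℕ.* E i (z - y)))))))) ⟩
          sum (λ i → ∑ (λ x → ∑ (λ y → [ ω x ] ℕ.* [ ω y ] ℕ.* ∑ (λ z → E i (z - x) ℕ.* E i (z - y)))))
            ≡⟨ ∑-colours (λ i x → ∑ (λ y → [ ω x ] ℕ.* [ ω y ] ℕ.* ∑ (λ z → E i (z - x) ℕ.* E i (z - y)))) ⟩
          ∑ (λ x → sum (λ i → ∑ (λ y → [ ω x ] ℕ.* [ ω y ] ℕ.* ∑ (λ z → E i (z - x) ℕ.* E i (z - y)))))
            ≡⟨ ∑-cong (λ x → trans (∑-colours (λ i y → [ ω x ] ℕ.* [ ω y ] ℕ.* ∑ (λ z → E i (z - x) ℕ.* E i (z - y)))) (∑-cong (λ y → sum-*ˡ ([ ω x ] ℕ.* [ ω y ]) (λ i → ∑ (λ z → E i (z - x) ℕ.* E i (z - y)))))) ⟩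
          ∑ (λ x → ∑ (λ y → [ ω x ] ℕ.* [ ω y ] ℕ.* correlation x y))
            ≡⟨ ∑-cong (λ x → trans (∑-cong (λ y → expand x y)) (trans (∑-+ (first x) (second x)) (cong₂ ℕ._+_ (row₁ x) (row₂ x)))) ⟩
          ∑ (λ x → n-1 ℕ.* s ℕ.* [ ω x ] ℕ.+ suc (6 ℕ.* n) ℕ.* [ ω x ])
            ≡⟨ trans (∑-+ (λ x → n-1 ℕ.* s ℕ.* [ ω x ]) (λ x → K ℕ.* [ ω x ])) (cong₂ ℕ._+_ (∑-*ˡ (n-1 ℕ.* s) (λ x → [ ω x ])) (∑-*ˡ K (λ x → [ ω x ]))) ⟩
          n-1 ℕ.* s ℕ.* s ℕ.+ suc (6 ℕ.* n) ℕ.* s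
            ≡⟨ cong (ℕ._+ suc (6 ℕ.* n) ℕ.* s) (ℕₚ.*-assoc n-1 s s) ⟩
          n-1 ℕ.* (s ℕ.* s) ℕ.+ suc (6 ℕ.* n) ℕ.* s ∎
          where
          open ≡-Reasoning
          open +-*-Solver
          K = suc (6 ℕ.* n)
          first second : Carrier → Carrier → ℕ
          first x y = n-1 ℕ.* [ ω x ] ℕ.* [ ω y ]
          second x y = [ ω x ] ℕ.* K ℕ.* ([ does (y ≟ x) ] ℕ.* [ ω y ])
          expand : ∀ x y → [ ω x ] ℕ.* [ ω y ] ℕ.* correlation x y ≡ first x y ℕ.+ second x y
          expand x y = trans (cong ([ ω x ] ℕ.* [ ω y ] ℕ.*_) (correlation≡ x y))
            (solve 5 (λ a b m d k → a :* b :* (m :+ d :* k) := m :* a :* b :+ a :* k :* (d :* b)) refl [ ω x ] [ ω y ] n-1 [ does (y ≟ x) ] K)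
          row₁ : ∀ x → ∑ (first x) ≡ n-1 ℕ.* s ℕ.* [ ω x ]
          row₁ x = trans (∑-*ˡ (n-1 ℕ.* [ ω x ]) (λ y → [ ω y ])) (solve 3 (λ m a t → m :* a :* t := m :* t :* a) refl n-1 [ ω x ] s)
          row₂ : ∀ x → ∑ (second x) ≡ K ℕ.* [ ω x ]
          row₂ x = begin
            ∑ (λ y → [ ω x ] ℕ.* K ℕ.* ([ does (y ≟ x) ] ℕ.* [ ω y ]))
              ≡⟨ ∑-*ˡ ([ ω x ] ℕ.* K) (λ y → [ does (y ≟ x) ] ℕ.* [ ω y ]) ⟩
            [ ω x ] ℕ.* K ℕ.* ∑ (λ y → [ does (y ≟ x) ] ℕ.* [ ω y ])
              ≡⟨ cong ([ ω x ] ℕ.* K ℕ.*_) (trans (∑-single x (λ y → [ does (y ≟ x) ] ℕ.* [ ω y ]) (λ y y≢ → cong (λ b → [ b ] ℕ.* [ ω y ]) (dec-false (y ≟ x) y≢)))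
                   (trans (cong (λ b → [ b ] ℕ.* [ ω x ]) (dec-true (x ≟ x) refl)) (ℕₚ.+-identityʳ _))) ⟩
            [ ω x ] ℕ.* K ℕ.* [ ω x ]
              ≡⟨ solve 2 (λ a k → a :* k :* a := k :* (a :* a)) refl [ ω x ] K ⟩
            K ℕ.* ([ ω x ] ℕ.* [ ω x ]) ≡⟨ cong (K ℕ.*_) ([]-idem (ω x)) ⟩
            K ℕ.* [ ω x ] ∎

        -- Expand (7N - s)² and insert the first and second moments; the terms of order n s² cancel,
        -- leaving an error linear in s.
        total-deviation : sum (λ i → deviation i ω) ℕ.+ 42 ℕ.* (s ℕ.* s) ≡ 49 ℕ.* (suc (6 ℕ.* n) ℕ.* s)
        -- The mixed term 98 n s² is added on both sides to avoid subtraction.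
        total-deviation = ℕₚ.+-cancelʳ-≡ (98 ℕ.* (n ℕ.* (s ℕ.* s)) ) _ _ (begin
          D ℕ.+ 42 ℕ.* (s ℕ.* s) ℕ.+ 98 ℕ.* (n ℕ.* (s ℕ.* s))
            ≡⟨ solve 3 (λ D s n → D :+ con 42 :* (s :* s) :+ con 98 :* (n :* (s :* s)) := D :+ con 7 :* (con 14 :* s :* (s :* n)) :+ con 42 :* (s :* s)) refl D s n ⟩
          D ℕ.+ 7 ℕ.* (14 ℕ.* s ℕ.* (s ℕ.* n)) ℕ.+ 42 ℕ.* (s ℕ.* s)
            ≡⟨ cong (ℕ._+ 42 ℕ.* (s ℕ.* s)) balance ⟩
          49 ℕ.* (n-1 ℕ.* (s ℕ.* s) ℕ.+ suc (6 ℕ.* n) ℕ.* s) ℕ.+ 7 ℕ.* (suc (7 ℕ.* n) ℕ.* (s ℕ.* s)) ℕ.+ 42 ℕ.* (s ℕ.* s)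
            ≡⟨ solve 2 (λ m s → con 49 :* (m :* (s :* s) :+ (con 1 :+ con 6 :* (con 1 :+ m)) :* s) :+ con 7 :* ((con 1 :+ con 7 :* (con 1 :+ m)) :* (s :* s)) :+ con 42 :* (s :* s)
                 := con 49 :* ((con 1 :+ con 6 :* (con 1 :+ m)) :* s) :+ con 98 :* ((con 1 :+ m) :* (s :* s))) refl n-1 s ⟩
          49 ℕ.* (suc (6 ℕ.* n) ℕ.* s) ℕ.+ 98 ℕ.* (n ℕ.* (s ℕ.* s)) ∎)
          where
          open ≡-Reasoning
          open +-*-Solver
          D = sum (λ i → deviation i ω)
          pointwise : ∀ i → deviation i ω ℕ.+ 14 ℕ.* s ℕ.* (s ℕ.* n) ≡ 49 ℕ.* ∑ (λ z → N i z ℕ.* N i z) ℕ.+ suc (7 ℕ.* n) ℕ.* (s ℕ.* s)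
          pointwise i = begin
            deviation i ω ℕ.+ 14 ℕ.* s ℕ.* (s ℕ.* n)
              ≡⟨ cong (λ t → deviation i ω ℕ.+ 14 ℕ.* s ℕ.* t) (∑N i) ⟨
            deviation i ω ℕ.+ 14 ℕ.* s ℕ.* ∑ (N i)
              ≡⟨ cong (deviation i ω ℕ.+_) (∑-*ˡ (14 ℕ.* s) (N i)) ⟨
            deviation i ω ℕ.+ ∑ (λ z → 14 ℕ.* s ℕ.* N i z)
              ≡⟨ ∑-+ dev (λ z → 14 ℕ.* s ℕ.* N i z) ⟨
            ∑ (λ z → dev z ℕ.+ 14 ℕ.* s ℕ.* N i z)
              ≡⟨ ∑-cong (λ z → trans (cong (∣ 7 ℕ.* N i z - s ∣ ℕ.* ∣ 7 ℕ.* N i z - s ∣ ℕ.+_)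
                   (solve 2 (λ s t → con 14 :* s :* t := con 2 :* (con 7 :* t :* s)) refl s (N i z)))
                   (trans (∣a-b∣²+2ab (7 ℕ.* N i z) s) (cong (ℕ._+ s ℕ.* s) (solve 1 (λ t → con 7 :* t :* (con 7 :* t) := con 49 :* (t :* t)) refl (N i z))))) ⟩
            ∑ (λ z → 49 ℕ.* (N i z ℕ.* N i z) ℕ.+ s ℕ.* s)
              ≡⟨ trans (∑-+ _ _) (cong₂ ℕ._+_ (∑-*ˡ 49 _) (trans (∑-const (s ℕ.* s)) (cong (ℕ._* (s ℕ.* s)) size≡))) ⟩
            49 ℕ.* ∑ (λ z → N i z ℕ.* N i z) ℕ.+ suc (7 ℕ.* n) ℕ.* (s ℕ.* s) ∎
            where
            dev : Carrier → ℕ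
            dev z = ∣ 7 ℕ.* N i z - s ∣ ℕ.* ∣ 7 ℕ.* N i z - s ∣
          balance : D ℕ.+ 7 ℕ.* (14 ℕ.* s ℕ.* (s ℕ.* n)) ≡
            49 ℕ.* (n-1 ℕ.* (s ℕ.* s) ℕ.+ suc (6 ℕ.* n) ℕ.* s) ℕ.+ 7 ℕ.* (suc (7 ℕ.* n) ℕ.* (s ℕ.* s))
          balance = begin
            D ℕ.+ 7 ℕ.* (14 ℕ.* s ℕ.* (s ℕ.* n))
              ≡⟨ cong (D ℕ.+_) (sum-const 7 (14 ℕ.* s ℕ.* (s ℕ.* n))) ⟨
            D ℕ.+ sum {7} (λ i → 14 ℕ.* s ℕ.* (s ℕ.* n))
              ≡⟨ ∑.∑-distrib-+ {7} (λ i → deviation i ω) (λ i → 14 ℕ.* s ℕ.* (s ℕ.* n)) ⟨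
            sum {7} (λ i → deviation i ω ℕ.+ 14 ℕ.* s ℕ.* (s ℕ.* n))
              ≡⟨ ∑.sum-cong-≋ pointwise ⟩
            sum {7} (λ i → 49 ℕ.* ∑ (λ z → N i z ℕ.* N i z) ℕ.+ suc (7 ℕ.* n) ℕ.* (s ℕ.* s))
              ≡⟨ ∑.∑-distrib-+ {7} (λ i → 49 ℕ.* ∑ (λ z → N i z ℕ.* N i z)) (λ i → suc (7 ℕ.* n) ℕ.* (s ℕ.* s)) ⟩
            sum {7} (λ i → 49 ℕ.* ∑ (λ z → N i z ℕ.* N i z)) ℕ.+ sum {7} (λ i → suc (7 ℕ.* n) ℕ.* (s ℕ.* s))
              ≡⟨ cong₂ ℕ._+_ (trans (sum-*ˡ 49 (λ i → ∑ (λ z → N i z ℕ.* N i z))) (cong (49 ℕ.*_) ∑N²)) (sum-const 7 (suc (7 ℕ.* n) ℕ.* (s ℕ.* s))) ⟩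
            49 ℕ.* (n-1 ℕ.* (s ℕ.* s) ℕ.+ suc (6 ℕ.* n) ℕ.* s) ℕ.+ 7 ℕ.* (suc (7 ℕ.* n) ℕ.* (s ℕ.* s)) ∎

        term≤sum : ∀ {k} (f : Fin k → ℕ) i → f i ≤ sum f
        term≤sum f zero = ℕₚ.m≤m+n _ _
        term≤sum f (suc i) = ℕₚ.≤-trans (term≤sum (λ j → f (suc j)) i) (ℕₚ.m≤n+m _ (f zero))

    -- One colour is bounded by the sum over all seven, and 49(6n + 1) = 42q + 7 ≤ 43q.
    deviation≤ : ∀ i ω → deviation i ω ≤ 43 ℕ.* (size ℕ.* ∣ ω ∣ₛ)
    deviation≤ i ω = begin
      deviation i ω                                ≤⟨ term≤sum ω (λ i → deviation i ω) i ⟩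
      sum (λ i → deviation i ω)                    ≤⟨ ℕₚ.m≤m+n _ _ ⟩
      sum (λ i → deviation i ω) ℕ.+ 42 ℕ.* (s ω ℕ.* s ω) ≡⟨ total-deviation ω ⟩
      49 ℕ.* (suc (6 ℕ.* n) ℕ.* s ω)               ≤⟨ ℕₚ.m≤m+n _ (n-1 ℕ.* 7 ℕ.* s ω ℕ.+ s ω) ⟩
      49 ℕ.* (suc (6 ℕ.* n) ℕ.* s ω) ℕ.+ (n-1 ℕ.* 7 ℕ.* s ω ℕ.+ s ω)
        ≡⟨ solve 2 (λ m s → con 49 :* ((con 1 :+ con 6 :* (con 1 :+ m)) :* s) :+ (m :* con 7 :* s :+ s) := con 43 :* ((con 1 :+ con 7 :* (con 1 :+ m)) :* s)) refl n-1 (s ω) ⟩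
      43 ℕ.* (suc (7 ℕ.* n) ℕ.* s ω)               ≡⟨ cong (λ t → 43 ℕ.* (t ℕ.* s ω)) size≡ ⟨
      43 ℕ.* (size ℕ.* s ω) ∎
      where
      open ℕₚ.≤-Reasoning
      open +-*-Solver

-- Greedy selection of points by Chebyshev's inequality

module Selections where
  open Fields
  open Sums
  open Layouts
  open QuasiRandomness
  import Data.Bool.Properties as Boolₚ
  open import Data.Nat using (∣_-_∣)
  open import Data.Nat.Solver using (module +-*-Solver)
  open import Data.Fin.Patterns
  open import Data.List.Relation.Unary.AllPairs using ([]; _∷_)
  open import Data.Vec using ([]; _∷_)
  open import Relation.Nullary.Decidable using (map′)

  module Selection (F : Field) (n′ : ℕ)
    (size≡ : Field.size F ≡ suc (7 ℕ.* (suc n′ ℕ.+ suc n′))) (2≢0 : Raw._+_ (Field.raw F) (Field.1# F) (Field.1# F) ≢ Field.0# F) where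
    open FieldProps F
    open FieldCounting F using (any?)
    open Discrepancy F n′ size≡ 2≢0 public
    open Finite

    -- 1000/a is a lower bound for the density of ω.
    record Big (a : ℕ) (ω : Subset) : Set where
      constructor dense
      field bound : size ℕ.* 1000 ≤ a ℕ.* ∣ ω ∣ₛ

    open Big

    big? : ∀ a ω → Dec (Big a ω)
    big? a ω = map′ dense bound (size ℕ.* 1000 ℕₚ.≤? a ℕ.* ∣ ω ∣ₛ)

    restrict : Fin 7 → Bool → Subset → Carrier → Subset
    restrict κ σ ω z x = ω x ∧ coloured κ (z - signed raw σ x)

    size>0 : 0 < size
    size>0 = subst (0 <_) (sym size≡) (ℕ.s≤s ℕ.z≤n)

    inhabited : ∀ {a ω} → Big a ω → ∃ λ x → ω x ≡ true
    inhabited {a} {ω} big with any? (λ x → ω x Boolₚ.≟ true)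
    ... | yes p = p
    ... | no ¬p = ⊥-elim (ℕₚ.<⇒≱ (ℕₚ.*-monoˡ-< 1000 size>0) (ℕₚ.≤-trans (bound big) (ℕₚ.≤-reflexive (trans (cong (a ℕ.*_) empty) (ℕₚ.*-zeroʳ a)))))
      where
      empty : ∣ ω ∣ₛ ≡ 0
      empty = trans (∑-cong (λ x → cong [_] (Boolₚ.¬-not (λ e → ¬p (x , e))))) (trans (∑-const 0) (ℕₚ.*-zeroʳ size))

    module _ (κ : Fin 7) (ω : Subset) where
      private
        ω⁻ : Subset
        ω⁻ x = ω (- x)

        ∣ω⁻∣ : ∣ ω⁻ ∣ₛ ≡ ∣ ω ∣ₛ
        ∣ω⁻∣ = ∑-negate (λ x → [ ω x ])

        restrict-true : ∀ z → ∣ restrict κ true ω z ∣ₛ ≡ neighbours κ ω z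
        restrict-true z = ∑-cong (λ x → [∧] (ω x) _)

        -- The substitution x ↦ -x turns the condition on z + x into one on z - x, with -ω in place
        -- of ω.
        restrict-false : ∀ z → ∣ restrict κ false ω z ∣ₛ ≡ neighbours κ ω⁻ z
        restrict-false z = trans (sym (∑-negate (λ x → [ restrict κ false ω z x ])))
          (∑-cong (λ x → trans ([∧] (ω (- x)) _) (cong (λ t → [ ω (- x) ] ℕ.* E κ (z - t)) (neg-involutive x))))

      spread : Bool → ℕ
      spread σ = ∑ (λ z → ∣ 7 ℕ.* ∣ restrict κ σ ω z ∣ₛ - ∣ ω ∣ₛ ∣ ℕ.* ∣ 7 ℕ.* ∣ restrict κ σ ω z ∣ₛ - ∣ ω ∣ₛ ∣)

      spread≤ : ∀ σ → spread σ ≤ 43 ℕ.* (size ℕ.* ∣ ω ∣ₛ)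
      spread≤ true = subst (_≤ 43 ℕ.* (size ℕ.* ∣ ω ∣ₛ))
        (∑-cong (λ z → cong (λ t → ∣ 7 ℕ.* t - ∣ ω ∣ₛ ∣ ℕ.* ∣ 7 ℕ.* t - ∣ ω ∣ₛ ∣) (sym (restrict-true z)))) (deviation≤ κ ω)
      spread≤ false = subst₂ _≤_
        (∑-cong (λ z → cong₂ (λ t s → ∣ 7 ℕ.* t - s ∣ ℕ.* ∣ 7 ℕ.* t - s ∣) (sym (restrict-false z)) ∣ω⁻∣))
        (cong (λ s → 43 ℕ.* (size ℕ.* s)) ∣ω⁻∣) (deviation≤ κ ω⁻)

      bad : ℕ → Bool → Carrier → ℕ
      bad a σ z = [ does (¬? (big? a (restrict κ σ ω z))) ]

      -- Chebyshev: restricting to a colour rarely loses a factor more than 7 + c/a.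
      bad-count : ∀ σ a c β → 43 ℕ.* (a ℕ.* ((7 ℕ.* a ℕ.+ c) ℕ.* (7 ℕ.* a ℕ.+ c))) < suc β ℕ.* (1000 ℕ.* (c ℕ.* c)) →
        Big a ω → ∑ (bad (7 ℕ.* a ℕ.+ c) σ) ≤ β
      bad-count σ a c β numeric big = ℕₚ.≤-pred (ℕₚ.*-cancelʳ-< (1000 ℕ.* (c ℕ.* c)) b (suc β) (ℕₚ.≤-<-trans few-bad numeric))
        where
        open ℕₚ.≤-Reasoning
        open +-*-Solver
        a′ = 7 ℕ.* a ℕ.+ c
        b = ∑ (bad a′ σ)
        s = ∣ ω ∣ₛ
        N : Carrier → ℕ
        N z = ∣ restrict κ σ ω z ∣ₛ
        D : Carrier → ℕ
        D z = ∣ 7 ℕ.* N z - s ∣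
        s>0 : 0 < s
        s>0 = ℕₚ.n≢0⇒n>0 λ eq → ℕₚ.<⇒≱ (ℕₚ.*-monoˡ-< 1000 size>0)
          (ℕₚ.≤-trans (bound big) (ℕₚ.≤-reflexive (trans (cong (a ℕ.*_) eq) (ℕₚ.*-zeroʳ a))))
        -- If a′N < 1000q ≤ a s, then 7N falls short of s by at least (c/a′) s.
        far : ∀ z → ¬ Big a′ (restrict κ σ ω z) → c ℕ.* s ≤ a′ ℕ.* D z
        far z ¬big = ℕₚ.+-cancelˡ-≤ (a′ ℕ.* (7 ℕ.* N z)) _ _ (begin
          a′ ℕ.* (7 ℕ.* N z) ℕ.+ c ℕ.* s  ≡⟨ cong (ℕ._+ c ℕ.* s) (solve 2 (λ a n → a :* (con 7 :* n) := con 7 :* (a :* n)) refl a′ (N z)) ⟩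
          7 ℕ.* (a′ ℕ.* N z) ℕ.+ c ℕ.* s  ≤⟨ ℕₚ.+-monoˡ-≤ (c ℕ.* s) (ℕₚ.*-monoʳ-≤ 7 (ℕₚ.≤-trans (ℕₚ.<⇒≤ (ℕₚ.≰⇒> (λ le → ¬big (dense le)))) (bound big))) ⟩
          7 ℕ.* (a ℕ.* s) ℕ.+ c ℕ.* s     ≡⟨ solve 3 (λ a c s → con 7 :* (a :* s) :+ c :* s := (con 7 :* a :+ c) :* s) refl a c s ⟩
          a′ ℕ.* s                        ≤⟨ ℕₚ.*-monoʳ-≤ a′ (ℕₚ.m≤n+∣n-m∣ s (7 ℕ.* N z)) ⟩
          a′ ℕ.* (7 ℕ.* N z ℕ.+ D z)      ≡⟨ ℕₚ.*-distribˡ-+ a′ (7 ℕ.* N z) (D z) ⟩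
          a′ ℕ.* (7 ℕ.* N z) ℕ.+ a′ ℕ.* D z ∎)
        pointwise : ∀ z → (c ℕ.* s) ℕ.* (c ℕ.* s) ℕ.* bad a′ σ z ≤ a′ ℕ.* a′ ℕ.* (D z ℕ.* D z)
        pointwise z = decide (big? a′ (restrict κ σ ω z))
          where
          decide : (d : Dec (Big a′ (restrict κ σ ω z))) → (c ℕ.* s) ℕ.* (c ℕ.* s) ℕ.* [ does (¬? d) ] ≤ a′ ℕ.* a′ ℕ.* (D z ℕ.* D z)
          decide (yes _) = ℕₚ.≤-trans (ℕₚ.≤-reflexive (ℕₚ.*-zeroʳ ((c ℕ.* s) ℕ.* (c ℕ.* s)))) ℕ.z≤n
          decide (no ¬big) = begin
            (c ℕ.* s) ℕ.* (c ℕ.* s) ℕ.* 1       ≡⟨ ℕₚ.*-identityʳ _ ⟩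
            (c ℕ.* s) ℕ.* (c ℕ.* s)             ≤⟨ ℕₚ.*-mono-≤ (far z ¬big) (far z ¬big) ⟩
            (a′ ℕ.* D z) ℕ.* (a′ ℕ.* D z)       ≡⟨ solve 2 (λ a d → a :* d :* (a :* d) := a :* a :* (d :* d)) refl a′ (D z) ⟩
            a′ ℕ.* a′ ℕ.* (D z ℕ.* D z)         ∎
        summed : (c ℕ.* s) ℕ.* (c ℕ.* s) ℕ.* b ≤ a′ ℕ.* a′ ℕ.* (43 ℕ.* (size ℕ.* s))
        summed = begin
          (c ℕ.* s) ℕ.* (c ℕ.* s) ℕ.* b                    ≡⟨ ∑-*ˡ ((c ℕ.* s) ℕ.* (c ℕ.* s)) (bad a′ σ) ⟨
          ∑ (λ z → (c ℕ.* s) ℕ.* (c ℕ.* s) ℕ.* bad a′ σ z) ≤⟨ ∑-mono _ _ pointwise ⟩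
          ∑ (λ z → a′ ℕ.* a′ ℕ.* (D z ℕ.* D z))            ≡⟨ ∑-*ˡ (a′ ℕ.* a′) (λ z → D z ℕ.* D z) ⟩
          a′ ℕ.* a′ ℕ.* spread σ                           ≤⟨ ℕₚ.*-monoʳ-≤ (a′ ℕ.* a′) (spread≤ σ) ⟩
          a′ ℕ.* a′ ℕ.* (43 ℕ.* (size ℕ.* s))              ∎
        reduced : c ℕ.* c ℕ.* s ℕ.* b ≤ a′ ℕ.* a′ ℕ.* (43 ℕ.* size)
        reduced = ℕₚ.*-cancelʳ-≤ _ _ s {{ℕ.>-nonZero s>0}} (begin
          c ℕ.* c ℕ.* s ℕ.* b ℕ.* s            ≡⟨ solve 3 (λ c s b → c :* c :* s :* b :* s := (c :* s) :* (c :* s) :* b) refl c s b ⟩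
          (c ℕ.* s) ℕ.* (c ℕ.* s) ℕ.* b        ≤⟨ summed ⟩
          a′ ℕ.* a′ ℕ.* (43 ℕ.* (size ℕ.* s))  ≡⟨ solve 3 (λ a q s → a :* a :* (con 43 :* (q :* s)) := a :* a :* (con 43 :* q) :* s) refl a′ size s ⟩
          a′ ℕ.* a′ ℕ.* (43 ℕ.* size) ℕ.* s    ∎)
        -- The Chebyshev bound is 43 a′² q/(c² s), and q/s ≤ a/1000 turns it into a number that does
        -- not depend on the field.
        few-bad : b ℕ.* (1000 ℕ.* (c ℕ.* c)) ≤ 43 ℕ.* (a ℕ.* (a′ ℕ.* a′))
        few-bad = ℕₚ.*-cancelʳ-≤ _ _ size {{ℕ.>-nonZero size>0}} (begin
          b ℕ.* (1000 ℕ.* (c ℕ.* c)) ℕ.* size  ≡⟨ solve 4 (λ b c q k → b :* (k :* (c :* c)) :* q := c :* c :* b :* (q :* k)) refl b c size 1000 ⟩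
          c ℕ.* c ℕ.* b ℕ.* (size ℕ.* 1000)    ≤⟨ ℕₚ.*-monoʳ-≤ (c ℕ.* c ℕ.* b) (bound big) ⟩
          c ℕ.* c ℕ.* b ℕ.* (a ℕ.* s)          ≡⟨ solve 4 (λ a b c s → c :* c :* b :* (a :* s) := a :* (c :* c :* s :* b)) refl a b c s ⟩
          a ℕ.* (c ℕ.* c ℕ.* s ℕ.* b)          ≤⟨ ℕₚ.*-monoʳ-≤ a reduced ⟩
          a ℕ.* (a′ ℕ.* a′ ℕ.* (43 ℕ.* size))  ≡⟨ solve 4 (λ a b q k → a :* (b :* b :* (k :* q)) := k :* (a :* (b :* b)) :* q) refl a a′ size 43 ⟩
          43 ℕ.* (a ℕ.* (a′ ℕ.* a′)) ℕ.* size  ∎)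

    -- A subset together with the colour and sign by which the next point restricts it.
    Tracked : Set
    Tracked = Subset × Fin 7 × Bool

    next : Tracked → Carrier → Subset
    next (ω , κ , σ) z = restrict κ σ ω z

    -- Selecting a point turns densities ≥ 1/a into ≥ 1/(7a + c) (in thousandths); β bounds the exceptional points of each subset.
    module _ (a c β : ℕ) (numeric : 43 ℕ.* (a ℕ.* ((7 ℕ.* a ℕ.+ c) ℕ.* (7 ℕ.* a ℕ.+ c))) < suc β ℕ.* (1000 ℕ.* (c ℕ.* c))) where
      private
        a′ = 7 ℕ.* a ℕ.+ c

        badness : List Tracked → Carrier → ℕ
        badness [] z = 0
        badness ((ω , κ , σ) ∷ ts) z = bad κ ω a′ σ z ℕ.+ badness ts z

        badness-count : ∀ ts → All (λ t → Big a (proj₁ t)) ts → ∑ (badness ts) ≤ length ts ℕ.* β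
        badness-count [] [] = ℕₚ.≤-reflexive (trans (∑-const 0) (ℕₚ.*-zeroʳ size))
        badness-count ((ω , κ , σ) ∷ ts) (big ∷ bigs) = ℕₚ.≤-trans (ℕₚ.≤-reflexive (∑-+ (bad κ ω a′ σ) (badness ts)))
          (ℕₚ.+-mono-≤ (bad-count κ ω σ a c β numeric big) (badness-count ts bigs))

        harmless : ∀ ts z → badness ts z ≡ 0 → All (λ t → Big a′ (next t z)) ts
        harmless [] z eq = []
        harmless ((ω , κ , σ) ∷ ts) z eq = decide (big? a′ (restrict κ σ ω z)) (ℕₚ.m+n≡0⇒m≡0 _ eq) ∷
          harmless ts z (ℕₚ.m+n≡0⇒n≡0 (bad κ ω a′ σ z) eq)
          where
          decide : (d : Dec (Big a′ (restrict κ σ ω z))) → [ does (¬? d) ] ≡ 0 → Big a′ (restrict κ σ ω z)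
          decide (yes big) _ = big

      -- Union bound: ω₀ has at least 1000q/a₀ points, which exceeds the total number of points that
      -- are exceptional for some tracked subset.
      select : ∀ {a₀} ω₀ ts → Big a₀ ω₀ → All (λ t → Big a (proj₁ t)) ts → a₀ ℕ.* (length ts ℕ.* β) < size ℕ.* 1000 →
        ∃ λ z → ω₀ z ≡ true × All (λ t → Big a′ (next t z)) ts
      select {a₀} ω₀ ts big bigs few = decide (any? (λ z → (ω₀ z Boolₚ.≟ true) ×-dec (badness ts z ℕₚ.≟ 0)))
        where
        cover : ∀ b k → (b ≡ true → k ≡ 0 → ⊥) → [ b ] ≤ k
        cover false k _ = ℕ.z≤n
        cover true zero ¬p = ⊥-elim (¬p refl refl)
        cover true (suc _) _ = ℕ.s≤s ℕ.z≤n
        Result = ∃ λ z → ω₀ z ≡ true × All (λ t → Big a′ (next t z)) ts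
        decide : Dec (∃ λ z → ω₀ z ≡ true × badness ts z ≡ 0) → Result
        decide (yes (z , z∈ , ok)) = z , z∈ , harmless ts z ok
        decide (no ¬p) = ⊥-elim (ℕₚ.<⇒≱ few few′)
          where
          covered : ∣ ω₀ ∣ₛ ≤ ∑ (badness ts)
          covered = ∑-mono (λ z → [ ω₀ z ]) (badness ts) (λ z → cover (ω₀ z) (badness ts z) (λ e e′ → ¬p (z , e , e′)))
          few′ : size ℕ.* 1000 ≤ a₀ ℕ.* (length ts ℕ.* β)
          few′ = ℕₚ.≤-trans (bound big) (ℕₚ.*-monoʳ-≤ a₀ (ℕₚ.≤-trans covered (badness-count ts bigs)))

-- The coloured K₇ in large fields

module LargeFields where
  open Fields
  open Sums
  open Families using (Family)
  open Layouts
  open QuasiRandomness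
  open Selections
  open Tests using (fromVectors)
  open import Data.Bool using (not; if_then_else_)
  import Data.Bool.Properties as Boolₚ
  open import Data.Fin.Patterns
  open import Data.List using (allFin)
  open import Data.List.Properties using (map-cong-local; map-∘)
  open import Data.List.Membership.Propositional using (_∈_)
  open import Data.List.Membership.Propositional.Properties using (∈-filter⁻; ∈-allFin; ∈-map⁺)
  open import Data.List.Relation.Unary.Any as Any using (Any; here; there)
  import Data.List.Relation.Unary.All.Properties as Allₚ
  open import Data.List.Relation.Unary.AllPairs using (AllPairs; []; _∷_)
  open import Data.List.Relation.Unary.Unique.Propositional using (Unique)
  import Data.List.Relation.Unary.Unique.Propositional.Properties as Uniqueₚ
  open import Data.Vec as Vec using (Vec; []; _∷_)
  open import Relation.Nullary.Decidable using (toWitness)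

  -- Vertices 0,…,5 are the elements c₁,…,c₆ of the block of size 6, vertex 6 is a.
  generic : Layout
  generic = fromVectors
    (((0F , 0F) , 4F , false) ∷ ((0F , 0F) , 5F , false) ∷ ((0F , 0F) , 6F , true) ∷ [])
    (((0F , 0F) , 0F , false) ∷ ((0F , 1F) , 1F , false) ∷ ((1F , 0F) , 2F , false) ∷ ((1F , 0F) , 3F , false) ∷ ((1F , 1F) , 6F , false) ∷ [])
    (((0F , 0F) , 0F , true) ∷ ((0F , 0F) , 1F , true) ∷ ((0F , 0F) , 2F , true) ∷ ((0F , 1F) , 3F , true) ∷ ((1F , 0F) , 4F , true) ∷ ((1F , 1F) , 5F , true) ∷ [])

  generic-balanced : Layout.Balanced generic
  generic-balanced = toWitness {a? = Layout.balanced? generic} tt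

  generic-labelled : Layout.Labelled generic
  generic-labelled = toWitness {a? = Layout.labelled? generic} tt

  private
    edges : Vec (Vec (Fin 7) 7) 7
    edges = (0F ∷ 3F ∷ 1F ∷ 5F ∷ 6F ∷ 5F ∷ 3F ∷ [])
          ∷ (3F ∷ 0F ∷ 6F ∷ 1F ∷ 4F ∷ 0F ∷ 3F ∷ [])
          ∷ (1F ∷ 6F ∷ 0F ∷ 4F ∷ 2F ∷ 4F ∷ 6F ∷ [])
          ∷ (5F ∷ 1F ∷ 4F ∷ 0F ∷ 2F ∷ 0F ∷ 2F ∷ [])
          ∷ (6F ∷ 4F ∷ 2F ∷ 2F ∷ 0F ∷ 0F ∷ 2F ∷ [])
          ∷ (5F ∷ 0F ∷ 4F ∷ 0F ∷ 0F ∷ 0F ∷ 5F ∷ [])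
          ∷ (3F ∷ 3F ∷ 6F ∷ 2F ∷ 2F ∷ 5F ∷ 0F ∷ [])
          ∷ []

    -- The colours from c₅ (and c₆) to c₁, c₂, c₃ belong to one type of difference, so they may be permuted freely.
    permuted₄ permuted₅ : Vec (Vec (Fin 7) 3) 6
    permuted₄ = (6F ∷ 4F ∷ 2F ∷ []) ∷ (6F ∷ 2F ∷ 4F ∷ []) ∷ (4F ∷ 6F ∷ 2F ∷ []) ∷ (4F ∷ 2F ∷ 6F ∷ []) ∷ (2F ∷ 6F ∷ 4F ∷ []) ∷ (2F ∷ 4F ∷ 6F ∷ []) ∷ []
    permuted₅ = (5F ∷ 0F ∷ 4F ∷ []) ∷ (5F ∷ 4F ∷ 0F ∷ []) ∷ (0F ∷ 5F ∷ 4F ∷ []) ∷ (0F ∷ 4F ∷ 5F ∷ []) ∷ (4F ∷ 5F ∷ 0F ∷ []) ∷ (4F ∷ 0F ∷ 5F ∷ []) ∷ []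

  κ : Fin 6 → Fin 7 → Fin 7 → Fin 7
  κ π i 4F with i
  ... | 0F = Vec.lookup (Vec.lookup permuted₄ π) 0F
  ... | 1F = Vec.lookup (Vec.lookup permuted₄ π) 1F
  ... | 2F = Vec.lookup (Vec.lookup permuted₄ π) 2F
  ... | _ = Vec.lookup (Vec.lookup edges i) 4F
  κ π i 5F with i
  ... | 0F = Vec.lookup (Vec.lookup permuted₅ π) 0F
  ... | 1F = Vec.lookup (Vec.lookup permuted₅ π) 1F
  ... | 2F = Vec.lookup (Vec.lookup permuted₅ π) 2F
  ... | _ = Vec.lookup (Vec.lookup edges i) 5F
  κ π i j = Vec.lookup (Vec.lookup edges i) j

  -- Which of xᵢ − xⱼ (true) and xᵢ + xⱼ (false) occurs as a difference.
  ε : Fin 7 → Fin 7 → Bool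
  ε 4F 6F = false
  ε 5F 6F = false
  ε 6F 4F = false
  ε 6F 5F = false
  ε _ _ = true

  module _ (π₄ π₅ : Fin 6) where
    at : Fin 7 → Fin 6
    at 5F = π₅
    at _ = π₄

    -- The permutations are entered in κ only above the diagonal; putting the smaller vertex first
    -- makes the colouring symmetric.
    K : Fin 7 → Fin 7 → Fin 7
    K i j = if toℕ i ℕ.≤ᵇ toℕ j then κ (at j) i j else κ (at i) j i

    colourOf : SlotPair → Fin 7
    colourOf (X , a , b) = K (proj₁ (Layout.label generic (X , a))) (proj₁ (Layout.label generic (X , b)))

  private
    module Dec-Fin7 where
      open import Data.List.Relation.Unary.Unique.DecPropositional {A = Fin 7} Finₚ._≟_ using (unique?) public

    _≐_ : Bool → Bool → Bool
    true ≐ b = b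
    false ≐ b = not b

  -- A finite check over all 36 pairs of permutations. It is what permits the last vertices to be
  -- sought in the unions of the candidate sets.
  colours-unique : ∀ π₄ π₅ (a b : Fin 2) → Unique (map (colourOf π₄ π₅) (Layout.pairsOf generic (a , b)))
  colours-unique = toWitness {a? = Finₚ.all? λ π₄ → Finₚ.all? λ π₅ → Finₚ.all? λ a → Finₚ.all? λ b →
    Dec-Fin7.unique? (map (colourOf π₄ π₅) (Layout.pairsOf generic (a , b)))} tt

  -- Up to sign a slot pair yields xᵢ - s xⱼ with s the product of the two signs. The 28 pairs use
  -- some of the 21 edges of K₇ twice; as s depends only on the edge, a single colour condition per
  -- edge serves all of them.
  Compatible : SlotPair → Set
  Compatible (X , a , b) = a ≡ b ⊎ (proj₁ (Layout.label generic (X , a)) ≢ proj₁ (Layout.label generic (X , b)) ×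
    (proj₂ (Layout.label generic (X , a)) ≐ proj₂ (Layout.label generic (X , b)))
      ≡ ε (proj₁ (Layout.label generic (X , a))) (proj₁ (Layout.label generic (X , b))))

  compatible : All Compatible slotPairs
  compatible = toWitness {a? = All.all? (λ (X , a , b) → (a Finₚ.≟ b) ⊎-dec
    (¬? (proj₁ (Layout.label generic (X , a)) Finₚ.≟ proj₁ (Layout.label generic (X , b))) ×-dec
    ((proj₂ (Layout.label generic (X , a)) ≐ proj₂ (Layout.label generic (X , b)))
      Boolₚ.≟ ε (proj₁ (Layout.label generic (X , a))) (proj₁ (Layout.label generic (X , b)))))) slotPairs} tt

  K-symmetric : ∀ π₄ π₅ i j → K π₄ π₅ i j ≡ K π₄ π₅ j i
  K-symmetric = toWitness {a? = Finₚ.all? λ π₄ → Finₚ.all? λ π₅ → Finₚ.all? λ i → Finₚ.all? λ j →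
    K π₄ π₅ i j Finₚ.≟ K π₄ π₅ j i} tt

  ε-symmetric : ∀ i j → ε i j ≡ ε j i
  ε-symmetric = toWitness {a? = Finₚ.all? λ i → Finₚ.all? λ j → ε i j Boolₚ.≟ ε j i} tt

  -- The three colours on the edges from vertices 0, 1, 2 are distinct, so they reveal the
  -- permutation; this makes the six candidate sets disjoint.
  permutation-determined : ∀ (j : Fin 2) π π′ →
    (∀ (i : Fin 3) → κ π (i Fin.↑ˡ 4) (4 Fin.↑ʳ (Fin.inject₁ j)) ≡ κ π′ (i Fin.↑ˡ 4) (4 Fin.↑ʳ (Fin.inject₁ j))) → π ≡ π′
  permutation-determined = toWitness {a? = Finₚ.all? λ j → Finₚ.all? λ π → Finₚ.all? λ π′ →
    (Finₚ.all? λ i → κ π (i Fin.↑ˡ 4) (4 Fin.↑ʳ (Fin.inject₁ j)) Finₚ.≟ κ π′ (i Fin.↑ˡ 4) (4 Fin.↑ʳ (Fin.inject₁ j))) →-dec (π Finₚ.≟ π′)} tt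

  related : ∀ {A : Set} {R : A → A → Set} {xs : List A} → AllPairs R xs → ∀ {x y} → x ∈ xs → y ∈ xs → x ≢ y → R x y ⊎ R y x
  related (p ∷ ps) (here refl) (here refl) x≢y = ⊥-elim (x≢y refl)
  related (p ∷ ps) (here refl) (there y∈) x≢y = inj₁ (All.lookup p y∈)
  related (p ∷ ps) (there x∈) (here refl) x≢y = inj₂ (All.lookup p x∈)
  related (p ∷ ps) (there x∈) (there y∈) x≢y = related ps x∈ y∈ x≢y

  module Generic (F : Field) (n′ : ℕ)
    (size≡ : Field.size F ≡ suc (7 ℕ.* (suc n′ ℕ.+ suc n′))) (2≢0 : Raw._+_ (Field.raw F) (Field.1# F) (Field.1# F) ≢ Field.0# F)
    (large : 67008420535 < Field.size F) where
    open FieldProps F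
    open Selection F n′ size≡ 2≢0
    open Finite
    open Big

    module _ (π₄ π₅ : Fin 6) (x : Fin 7 → Carrier) (values : ∀ i → φ (x i) ≡ r i)
      (edge : ∀ i j → i ≢ j → φ (x i - signed raw (ε i j) (x j)) ≡ r (K π₄ π₅ i j)) where
      open Entries raw generic x
      private
        φ≡r⇒≢0 : ∀ y i → φ y ≡ r i → y ≢ 0#
        φ≡r⇒≢0 y i eq y≡0 = r≢0 i (trans (sym eq) (trans (cong φ y≡0) φ0))

        φ-difference : ∀ s s′ u w → φ (signed raw s u - signed raw s′ w) ≡ φ (u - signed raw (s ≐ s′) w)
        φ-difference true true u w = refl
        φ-difference true false u w = refl
        φ-difference false true u w = trans (cong φ (solve 2 (λ u w → (:- u) :- w := :- (u :- (:- w))) refl u w)) (φ-neg _)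
          where open Solver
        φ-difference false false u w = trans (cong φ (solve 2 (λ u w → (:- u) :- (:- w) := :- (u :- w)) refl u w)) (φ-neg _)
          where open Solver

        difference-colour : ∀ p → Compatible p → proj₁ (proj₂ p) ≢ proj₂ (proj₂ p) → φ (difference p) ≡ r (colourOf π₄ π₅ p)
        difference-colour (X , a , b) (inj₁ a≡b) a≢b = ⊥-elim (a≢b a≡b)
        difference-colour (X , a , b) (inj₂ (i≢j , signs)) a≢b =
          trans (φ-difference (proj₂ (label (X , a))) (proj₂ (label (X , b))) (x (proj₁ (label (X , a)))) (x (proj₁ (label (X , b)))))
            (trans (cong (λ s → φ (x (proj₁ (label (X , a))) - signed raw s (x (proj₁ (label (X , b)))))) signs)
              (edge (proj₁ (label (X , a))) (proj₁ (label (X , b))) i≢j))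
          where open Layout generic using (label)

        pair-colour : ∀ h p → p ∈ Layout.pairsOf generic h → φ (difference p) ≡ r (colourOf π₄ π₅ p)
        pair-colour h p p∈ = let in-slots , a<b , _ = ∈-filter⁻ (λ p → proj₁ (proj₂ p) Finₚ.<? proj₂ (proj₂ p) ×-dec (Layout.pairType generic p ≟ᵀ h)) {xs = slotPairs} p∈ in
          difference-colour p (All.lookup compatible in-slots) (λ e → ℕₚ.<⇒≢ a<b (cong toℕ e))

      assembled : Family (additiveGroup F)
      assembled = SeventhPowers.FromLayout.family F n′ size≡ 2≢0 generic generic-balanced generic-labelled x
        (All.tabulate λ {i} _ → φ≡r⇒≢0 (x i) i (values i))
        (Uniqueₚ.map⁺ (λ {i} {j} eq → r-injective (trans (sym (values i)) (trans eq (values j)))) (Uniqueₚ.allFin⁺ 7))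
        (λ h → All.tabulate λ {p} p∈ → φ≡r⇒≢0 (difference p) (colourOf π₄ π₅ p) (pair-colour h p p∈))
        (λ h → subst Unique (trans (sym (map-∘ (Layout.pairsOf generic h))) (sym (map-cong-local (All.tabulate λ {p} p∈ → pair-colour h p p∈))))
          (Uniqueₚ.map⁺ r-injective (colours-unique π₄ π₅ (proj₁ h) (proj₂ h))))

    Chosen : Set
    Chosen = List (Fin 7 × Carrier)

    candidates : Chosen → Fin 7 × Fin 6 → Subset
    candidates [] (j , π) = coloured j
    candidates ((i , v) ∷ pts) (j , π) = restrict (κ π i j) (ε i j) (candidates pts (j , π)) v

    private
      ∧-left : ∀ a b → a ∧ b ≡ true → a ≡ true
      ∧-left true b eq = refl

      ∧-right : ∀ a b → a ∧ b ≡ true → b ≡ true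
      ∧-right true b eq = eq

    candidate-value : ∀ pts j π x → candidates pts (j , π) x ≡ true → φ x ≡ r j
    candidate-value [] j π x eq = coloured-sound j x eq
    candidate-value ((i , v) ∷ pts) j π x eq = candidate-value pts j π x (∧-left _ _ eq)

    candidate-edges : ∀ pts j π x → candidates pts (j , π) x ≡ true →
      All (λ (i , v) → φ (v - signed raw (ε i j) x) ≡ r (κ π i j)) pts
    candidate-edges [] j π x eq = []
    candidate-edges ((i , v) ∷ pts) j π x eq = coloured-sound (κ π i j) _ (∧-right (candidates pts (j , π) x) _ eq) ∷
      candidate-edges pts j π x (∧-left _ _ eq)

    -- One copy of vertex j for each permutation. While vertices 6, 0, 1, 2 are chosen, all six
    -- candidate sets of vertices 4 and 5 have to stay dense.
    ghosts : Fin 7 → List (Fin 7 × Fin 6)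
    ghosts j = map (j ,_) (allFin 6)

    AllBig : ℕ → Chosen → List (Fin 7 × Fin 6) → Set
    AllBig a pts gs = All (λ g → Big a (candidates pts g)) gs

    private
      track : Fin 7 → Chosen → Fin 7 × Fin 6 → Tracked
      track i pts (j , π) = candidates pts (j , π) , κ π i j , ε i j

    advance : ∀ a c β → 43 ℕ.* (a ℕ.* ((7 ℕ.* a ℕ.+ c) ℕ.* (7 ℕ.* a ℕ.+ c))) < suc β ℕ.* (1000 ℕ.* (c ℕ.* c)) →
      ∀ pts i π gs → Big a (candidates pts (i , π)) → AllBig a pts gs → a ℕ.* (length gs ℕ.* β) ≤ 67008420535 ℕ.* 1000 →
      ∃ λ v → candidates pts (i , π) v ≡ true × AllBig (7 ℕ.* a ℕ.+ c) ((i , v) ∷ pts) gs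
    advance a c β numeric pts i π gs big bigs few =
      let v , v∈ , next-big = select a c β numeric {a} (candidates pts (i , π)) (map (track i pts) gs) big (Allₚ.map⁺ bigs)
            (subst (λ l → a ℕ.* (l ℕ.* β) < size ℕ.* 1000) (sym (length-map (track i pts) gs))
              (ℕₚ.≤-<-trans few (ℕₚ.*-monoˡ-< 1000 large)))
      in v , v∈ , Allₚ.map⁻ next-big
      where open import Data.List.Properties using (length-map)

    private
      -- Uniting the six candidate sets multiplies the guaranteed density by six just before the
      -- expensive last choices.
      union : Chosen → Fin 7 → Subset
      union pts j x = does (Finₚ.any? (λ π → candidates pts (j , π) x Boolₚ.≟ true))

      in-union : ∀ pts j x → union pts j x ≡ true → ∃ λ π → candidates pts (j , π) x ≡ true
      in-union pts j x = sound (Finₚ.any? (λ π → candidates pts (j , π) x Boolₚ.≟ true))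
        where
        sound : ∀ {P : Set} (d : Dec P) → does d ≡ true → P
        sound (yes p) _ = p

      -- At most one permutation fits a given candidate, so the six candidate sets are disjoint.
      union-big : ∀ pts j a u → (∀ x π π′ → candidates pts (j , π) x ≡ true → candidates pts (j , π′) x ≡ true → π ≡ π′) →
        AllBig a pts (ghosts j) → a ≤ 6 ℕ.* u → Big u (union pts j)
      union-big pts j a u disjoint bigs a≤6u = dense (ℕₚ.*-cancelˡ-≤ 6 (begin
        6 ℕ.* (size ℕ.* 1000)                          ≡⟨ sum-const 6 (size ℕ.* 1000) ⟨
        sum {6} (λ π → size ℕ.* 1000)                  ≤⟨ sum-mono {6} (λ _ → size ℕ.* 1000) (λ π → a ℕ.* ∣ candidates pts (j , π) ∣ₛ) (λ π → bound (All.lookup {P = λ g → Big a (candidates pts g)} bigs (∈-map⁺ (j ,_) (∈-allFin π)))) ⟩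
        sum (λ π → a ℕ.* ∣ candidates pts (j , π) ∣ₛ)  ≡⟨ sum-*ˡ a (λ π → ∣ candidates pts (j , π) ∣ₛ) ⟩
        a ℕ.* sum (λ π → ∣ candidates pts (j , π) ∣ₛ)  ≡⟨ cong (a ℕ.*_) (∑-colours {6} (λ π x → [ candidates pts (j , π) x ])) ⟩
        a ℕ.* ∑ (λ x → sum (λ π → [ candidates pts (j , π) x ])) ≤⟨ ℕₚ.*-monoʳ-≤ a (∑-mono _ (λ x → [ union pts j x ]) single) ⟩
        a ℕ.* ∣ union pts j ∣ₛ                         ≤⟨ ℕₚ.*-monoˡ-≤ ∣ union pts j ∣ₛ a≤6u ⟩
        6 ℕ.* u ℕ.* ∣ union pts j ∣ₛ                   ≡⟨ ℕₚ.*-assoc 6 u ∣ union pts j ∣ₛ ⟩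
        6 ℕ.* (u ℕ.* ∣ union pts j ∣ₛ) ∎))
        where
        open ℕₚ.≤-Reasoning
        single : ∀ x → sum (λ π → [ candidates pts (j , π) x ]) ≤ [ union pts j x ]
        single x = decide (Finₚ.any? (λ π → candidates pts (j , π) x Boolₚ.≟ true))
          where
          member : Fin 6 → ℕ
          member π = [ candidates pts (j , π) x ]
          decide : (d : Dec (∃ λ π → candidates pts (j , π) x ≡ true)) → sum member ≤ [ does d ]
          decide (yes (π , e)) = ℕₚ.≤-reflexive (trans (sum-single π member
            (λ π′ π′≢π → cong [_] (Boolₚ.¬-not (λ e′ → π′≢π (disjoint x π′ π e′ e))))) (cong [_] e))
          decide (no ¬p) = ℕₚ.≤-reflexive (sum-zero member (λ π → cong [_] (Boolₚ.¬-not (λ e → ¬p (π , e)))))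

      -- A colour class has n = (q - 1)/7 points. The excess of 7001 over 7000 makes up for the
      -- missing element 0 once n ≥ 1000.
      start : ∀ j π → Big 7001 (candidates [] (j , π))
      start j π = dense (begin
        size ℕ.* 1000                       ≡⟨ cong (ℕ._* 1000) size≡ ⟩
        suc (7 ℕ.* n) ℕ.* 1000              ≡⟨ solve 2 (λ n k → (con 1 :+ con 7 :* n) :* k := k :+ con 7 :* k :* n) refl n 1000 ⟩
        1000 ℕ.+ 7 ℕ.* 1000 ℕ.* n           ≤⟨ ℕₚ.+-monoˡ-≤ (7 ℕ.* 1000 ℕ.* n) 1000≤n ⟩
        n ℕ.+ 7 ℕ.* 1000 ℕ.* n              ≡⟨⟩
        7001 ℕ.* n                          ≡⟨ cong (7001 ℕ.*_) (∑E j) ⟨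
        7001 ℕ.* ∣ candidates [] (j , π) ∣ₛ ∎)
        where
        open ℕₚ.≤-Reasoning
        open import Data.Nat.Solver using (module +-*-Solver)
        open +-*-Solver
        1000≤n : 1000 ≤ n
        1000≤n = ℕₚ.*-cancelˡ-≤ 7 (ℕₚ.≤-pred (ℕₚ.≤-trans (ℕₚ.≤-trans (toWitness {a? = 7001 ℕₚ.≤? 67008420535} tt) (ℕₚ.<⇒≤ large)) (ℕₚ.≤-reflexive size≡)))

      -- Reverse of the order of choice 6, 0, 1, 2, 3, 4, 5, so that each vertex precedes those that
      -- constrained it.
      order : List (Fin 7)
      order = 5F ∷ 4F ∷ 3F ∷ 2F ∷ 1F ∷ 0F ∷ 6F ∷ []

      ordered : ∀ i → i ∈ order
      ordered = toWitness {a? = Finₚ.all? λ i → Any.any? (i Finₚ.≟_) order} tt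

      module _ (π₄ π₅ : Fin 6) (x : Fin 7 → Carrier) where
        Edge : Fin 7 → Fin 7 → Set
        Edge j i = φ (x i - signed raw (ε i j) (x j)) ≡ r (K π₄ π₅ i j)

        edge-symmetric : ∀ i j → Edge j i → Edge i j
        edge-symmetric i j e = trans (cong (λ s → φ (x j - signed raw s (x i))) (ε-symmetric j i))
          (trans (flip (ε i j)) (trans e (cong r (K-symmetric π₄ π₅ i j))))
          where
          open Solver
          flip : ∀ s → φ (x j - signed raw s (x i)) ≡ φ (x i - signed raw s (x j))
          flip true = trans (cong φ (solve 2 (λ u w → w :- u := :- (u :- w)) refl (x i) (x j))) (φ-neg _)
          flip false = cong φ (solve 2 (λ u w → w :- (:- u) := u :- (:- w)) refl (x i) (x j))

        finish : (∀ i → φ (x i) ≡ r i) → AllPairs Edge order → Family (additiveGroup F)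
        finish values edges = assembled π₄ π₅ x values edge
          where
          edge : ∀ i j → i ≢ j → φ (x i - signed raw (ε i j) (x j)) ≡ r (K π₄ π₅ i j)
          edge i j i≢j with related edges (ordered i) (ordered j) i≢j
          ... | inj₁ e = edge-symmetric j i e
          ... | inj₂ e = e

      disjoint : ∀ (j : Fin 2) a v₀ v₁ v₂ x π π′ → let v = 4 Fin.↑ʳ Fin.inject₁ j ; pts = (2F , v₂) ∷ (1F , v₁) ∷ (0F , v₀) ∷ a ∷ [] in
        candidates pts (v , π) x ≡ true → candidates pts (v , π′) x ≡ true → π ≡ π′
      disjoint j a v₀ v₁ v₂ x π π′ e e′ = permutation-determined j π π′ same
        where
        v = 4 Fin.↑ʳ Fin.inject₁ j
        pts = (2F , v₂) ∷ (1F , v₁) ∷ (0F , v₀) ∷ a ∷ []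
        same : ∀ (i : Fin 3) → κ π (i Fin.↑ˡ 4) v ≡ κ π′ (i Fin.↑ˡ 4) v
        same i with candidate-edges pts v π x e | candidate-edges pts v π′ x e′
        same 0F | _ ∷ _ ∷ p ∷ _ | _ ∷ _ ∷ p′ ∷ _ = r-injective (trans (sym p) p′)
        same 1F | _ ∷ p ∷ _ | _ ∷ p′ ∷ _ = r-injective (trans (sym p) p′)
        same 2F | p ∷ _ | p′ ∷ _ = r-injective (trans (sym p) p′)

      fours++fives : List (Fin 7 × Fin 6)
      fours++fives = ghosts 4F ++ ghosts 5F

      module Stage (v₆ v₀ v₁ v₂ : Carrier) where
        pts₀ pts₁ pts₂ pts : Chosen
        pts₀ = (6F , v₆) ∷ []
        pts₁ = (0F , v₀) ∷ pts₀
        pts₂ = (1F , v₁) ∷ pts₁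
        pts = (2F , v₂) ∷ pts₂

        module _ (e₆ : candidates [] (6F , 0F) v₆ ≡ true) (e₀ : candidates pts₀ (0F , 0F) v₀ ≡ true)
          (e₁ : candidates pts₁ (1F , 0F) v₁ ≡ true) (e₂ : candidates pts₂ (2F , 0F) v₂ ≡ true) where

          last : ∀ v₃ v₄ v₅ π₄ π₅ → candidates pts (3F , 0F) v₃ ≡ true →
            candidates pts (4F , π₄) v₄ ≡ true → coloured (κ 0F 3F 4F) (v₃ - v₄) ≡ true →
            candidates pts (5F , π₅) v₅ ≡ true → coloured (κ 0F 3F 5F) (v₃ - v₅) ≡ true → coloured (κ 0F 4F 5F) (v₄ - v₅) ≡ true →
            Family (additiveGroup F)
          last v₃ v₄ v₅ π₄ π₅ e₃ e₄ e₃₄ e₅ e₃₅ e₄₅ = finish π₄ π₅ x values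
            ( (coloured-sound (κ 0F 4F 5F) (v₄ - v₅) e₄₅ ∷ coloured-sound (κ 0F 3F 5F) (v₃ - v₅) e₃₅ ∷ four₅ (candidate-edges pts 5F π₅ v₅ e₅))
            ∷ (coloured-sound (κ 0F 3F 4F) (v₃ - v₄) e₃₄ ∷ four₄ (candidate-edges pts 4F π₄ v₄ e₄))
            ∷ four₃ (candidate-edges pts 3F 0F v₃ e₃)
            ∷ three (candidate-edges pts₂ 2F 0F v₂ e₂)
            ∷ two (candidate-edges pts₁ 1F 0F v₁ e₁)
            ∷ one (candidate-edges pts₀ 0F 0F v₀ e₀)
            ∷ [] ∷ [])
            where
            x : Fin 7 → Carrier
            x = Vec.lookup (v₀ ∷ v₁ ∷ v₂ ∷ v₃ ∷ v₄ ∷ v₅ ∷ v₆ ∷ [])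
            values : ∀ i → φ (x i) ≡ r i
            values 0F = candidate-value pts₀ 0F 0F v₀ e₀
            values 1F = candidate-value pts₁ 1F 0F v₁ e₁
            values 2F = candidate-value pts₂ 2F 0F v₂ e₂
            values 3F = candidate-value pts 3F 0F v₃ e₃
            values 4F = candidate-value pts 4F π₄ v₄ e₄
            values 5F = candidate-value pts 5F π₅ v₅ e₅
            values 6F = candidate-value [] 6F 0F v₆ e₆
            Fits : Fin 7 → Fin 6 → Fin 7 × Carrier → Set
            Fits j π (i , v) = φ (v - signed raw (ε i j) (x j)) ≡ r (κ π i j)
            -- From here on each edge is converted separately: `κ` and `K` agree by evaluation at
            -- concrete vertices, where the permutation affects only the edges from 0, 1, 2 to 4 and
            -- 5.
            one : All (Fits 0F 0F) pts₀ → All (Edge π₄ π₅ x 0F) (6F ∷ [])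
            one (p ∷ []) = p ∷ []
            two : All (Fits 1F 0F) pts₁ → All (Edge π₄ π₅ x 1F) (0F ∷ 6F ∷ [])
            two (p ∷ q ∷ []) = p ∷ q ∷ []
            three : All (Fits 2F 0F) pts₂ → All (Edge π₄ π₅ x 2F) (1F ∷ 0F ∷ 6F ∷ [])
            three (p ∷ q ∷ s ∷ []) = p ∷ q ∷ s ∷ []
            four₃ : All (Fits 3F 0F) pts → All (Edge π₄ π₅ x 3F) (2F ∷ 1F ∷ 0F ∷ 6F ∷ [])
            four₃ (p ∷ q ∷ s ∷ t ∷ []) = p ∷ q ∷ s ∷ t ∷ []
            four₄ : All (Fits 4F π₄) pts → All (Edge π₄ π₅ x 4F) (2F ∷ 1F ∷ 0F ∷ 6F ∷ [])
            four₄ (p ∷ q ∷ s ∷ t ∷ []) = p ∷ q ∷ s ∷ t ∷ []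
            four₅ : All (Fits 5F π₅) pts → All (Edge π₄ π₅ x 5F) (2F ∷ 1F ∷ 0F ∷ 6F ∷ [])
            four₅ (p ∷ q ∷ s ∷ t ∷ []) = p ∷ q ∷ s ∷ t ∷ []

          -- The least favourable stage: 39475490 · 1697469 / 1000 is the bound on the size of the field.
          stage₄ : ∀ v₃ → candidates pts (3F , 0F) v₃ ≡ true →
            let union₃ = λ j → restrict (κ 0F 3F j) true (union pts j) v₃ in Big 39475490 (union₃ 4F) → Big 39475490 (union₃ 5F) → Family (additiveGroup F)
          -- Afterwards the candidates for vertex 5 need only be nonempty. So c is taken a million
          -- times a, which brings β down almost to its limit 43a/1000.
          stage₄ v₃ e₃ big₄ big₅ = found₄ (select 39475490 39475490000000 1697469 (toWitness {a? = _ ℕₚ.<? _} tt) {39475490}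
              (union₃ 4F) ((union₃ 5F , κ 0F 4F 5F , true) ∷ []) big₄ (big₅ ∷ [])
              (ℕₚ.≤-<-trans (toWitness {a? = 39475490 ℕ.* (1 ℕ.* 1697469) ℕₚ.≤? 67008420535 ℕ.* 1000} tt) (ℕₚ.*-monoˡ-< 1000 large)))
            where
            union₃ : Fin 7 → Subset
            union₃ j = restrict (κ 0F 3F j) true (union pts j) v₃
            found₅ : ∀ v₄ v₅ → union₃ 4F v₄ ≡ true → union₃ 5F v₅ ∧ coloured (κ 0F 4F 5F) (v₄ - v₅) ≡ true → Family (additiveGroup F)
            found₅ v₄ v₅ e₄ e₅ with in-union pts 4F v₄ (∧-left (union pts 4F v₄) _ e₄) | in-union pts 5F v₅ (∧-left (union pts 5F v₅) _ (∧-left (union₃ 5F v₅) _ e₅))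
            ... | π₄ , m₄ | π₅ , m₅ = last v₃ v₄ v₅ π₄ π₅ e₃ m₄ (∧-right (union pts 4F v₄) _ e₄)
              m₅ (∧-right (union pts 5F v₅) _ (∧-left (union₃ 5F v₅) _ e₅)) (∧-right (union₃ 5F v₅) _ e₅)
            found₄ : (∃ λ v₄ → union₃ 4F v₄ ≡ true × All (λ t → Big 39475766328430 (next t v₄)) ((union₃ 5F , κ 0F 4F 5F , true) ∷ [])) → Family (additiveGroup F)
            found₄ (v₄ , e₄ , big ∷ []) = found₅ v₄ (proj₁ (inhabited big)) e₄ (proj₂ (inhabited big))

          stage₃ : AllBig 22634857 pts ((3F , 0F) ∷ fours++fives) → Family (additiveGroup F)
          -- Here the candidate sets give way to their unions: 3772477 is 22634857/6 rounded up.
          -- Only two subsets remain to be tracked.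
          stage₃ (big₃ ∷ bigs) = found (select 3772477 13068151 1480204 (toWitness {a? = _ ℕₚ.<? _} tt) {22634857}
            (candidates pts (3F , 0F)) tracked big₃
            (union-big pts 4F 22634857 3772477 (disjoint 0F (6F , v₆) v₀ v₁ v₂) (proj₁ (Allₚ.++⁻ (ghosts 4F) bigs)) (toWitness {a? = _ ℕₚ.≤? _} tt)
              ∷ union-big pts 5F 22634857 3772477 (disjoint 1F (6F , v₆) v₀ v₁ v₂) (proj₂ (Allₚ.++⁻ (ghosts 4F) bigs)) (toWitness {a? = _ ℕₚ.≤? _} tt) ∷ [])
            (ℕₚ.≤-<-trans (toWitness {a? = 22634857 ℕ.* (2 ℕ.* 1480204) ℕₚ.≤? 67008420535 ℕ.* 1000} tt) (ℕₚ.*-monoˡ-< 1000 large)))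
            where
            tracked : List Tracked
            tracked = (union pts 4F , κ 0F 3F 4F , true) ∷ (union pts 5F , κ 0F 3F 5F , true) ∷ []
            found : (∃ λ v₃ → candidates pts (3F , 0F) v₃ ≡ true × All (λ t → Big 39475490 (next t v₃)) tracked) → Family (additiveGroup F)
            found (v₃ , e₃ , big₄ ∷ big₅ ∷ []) = stage₄ v₃ e₃ big₄ big₅

    genericFamily : Family (additiveGroup F)
    -- The numbers passed to `advance` are a, c and β, where β comes from 43a(7a + c)²/(1000c²). A
    -- larger c wastes density but lowers β. Early sets are dense and tolerate many exceptions, so
    -- c/a is small at first and grows from stage to stage. The sixteen tracked sets are those of
    -- vertices 0 to 3 and six for each of the vertices 4 and 5.
    genericFamily = found₆ (advance 7001 35 591056217 (toWitness {a? = _ ℕₚ.<? _} tt) [] 6F 0F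
        ((0F , 0F) ∷ (1F , 0F) ∷ (2F , 0F) ∷ (3F , 0F) ∷ fours++fives)
        (start 6F 0F) (All.tabulate λ {g} _ → start (proj₁ g) (proj₂ g)) (toWitness {a? = _ ℕₚ.≤? _} tt))
      where
      Next : ℕ → Chosen → Fin 7 → List (Fin 7 × Fin 6) → Set
      Next a pts i gs = ∃ λ v → candidates pts (i , 0F) v ≡ true × AllBig a ((i , v) ∷ pts) gs
      -- The repeated arguments of `Stage` stand for points not chosen yet; the lists `pts₀`,
      -- `pts₁`, `pts₂` mention only the points already chosen.
      found₂ : ∀ v₆ v₀ v₁ → candidates [] (6F , 0F) v₆ ≡ true → candidates (Stage.pts₀ v₆ v₀ v₁ v₁) (0F , 0F) v₀ ≡ true →
        candidates (Stage.pts₁ v₆ v₀ v₁ v₁) (1F , 0F) v₁ ≡ true →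
        Next 22634857 (Stage.pts₂ v₆ v₀ v₁ v₁) 2F ((3F , 0F) ∷ fours++fives) → Family (additiveGroup F)
      found₂ v₆ v₀ v₁ e₆ e₀ e₁ (v₂ , e₂ , bigs) = Stage.stage₃ v₆ v₀ v₁ v₂ e₆ e₀ e₁ e₂ bigs
      found₁ : ∀ v₆ v₀ → candidates [] (6F , 0F) v₆ ≡ true → candidates (Stage.pts₀ v₆ v₀ v₀ v₀) (0F , 0F) v₀ ≡ true →
        Next 2496297 (Stage.pts₁ v₆ v₀ v₀ v₀) 1F ((2F , 0F) ∷ (3F , 0F) ∷ fours++fives) → Family (additiveGroup F)
      found₁ v₆ v₀ e₆ e₀ (v₁ , e₁ , big ∷ bigs) = found₂ v₆ v₀ v₁ e₆ e₀ e₁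
        (advance 2496297 5160778 2064856 (toWitness {a? = _ ℕₚ.<? _} tt) (Stage.pts₂ v₆ v₀ v₁ v₁) 2F 0F
          ((3F , 0F) ∷ fours++fives) big bigs (toWitness {a? = _ ℕₚ.≤? _} tt))
      found₀ : ∀ v₆ → candidates [] (6F , 0F) v₆ ≡ true →
        Next 344954 (Stage.pts₀ v₆ v₆ v₆ v₆) 0F ((1F , 0F) ∷ (2F , 0F) ∷ (3F , 0F) ∷ fours++fives) → Family (additiveGroup F)
      found₀ v₆ e₆ (v₀ , e₀ , big ∷ bigs) = found₁ v₆ v₀ e₆ e₀
        (advance 344954 81619 13875211 (toWitness {a? = _ ℕₚ.<? _} tt) (Stage.pts₁ v₆ v₀ v₀ v₀) 1F 0F
          ((2F , 0F) ∷ (3F , 0F) ∷ fours++fives) big bigs (toWitness {a? = _ ℕₚ.≤? _} tt))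
      found₆ : Next 49042 [] 6F ((0F , 0F) ∷ (1F , 0F) ∷ (2F , 0F) ∷ (3F , 0F) ∷ fours++fives) → Family (additiveGroup F)
      found₆ (v₆ , e₆ , big ∷ bigs) = found₀ v₆ e₆
        (advance 49042 1660 91063182 (toWitness {a? = _ ℕₚ.<? _} tt) (Stage.pts₀ v₆ v₆ v₆ v₆) 0F 0F
          ((1F , 0F) ∷ (2F , 0F) ∷ (3F , 0F) ∷ fours++fives) big bigs (toWitness {a? = _ ℕₚ.≤? _} tt))

-- Soundness of the tests

module Soundness where
  open Fields
  open Extensions
  open Families using (T; Family)
  open Layouts
  open PrimeFields
  open Tests
  open import Data.Bool using (not; if_then_else_)
  open import Data.Nat.DivMod
  open import Data.Nat.Divisibility using (m%n≡0⇒n∣m)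
  open import Data.Nat.Primality using (Prime; prime⇒irreducible)
  open import Data.Fin.Patterns
  open import Data.List using (allFin)
  open import Data.List.Membership.Propositional using (_∈_)
  open import Data.List.Relation.Unary.Any using (here; there)
  import Data.List.Relation.Unary.All.Properties as Allₚ
  open import Data.List.Relation.Unary.AllPairs using ([]; _∷_)
  open import Data.List.Relation.Unary.Unique.Propositional using (Unique)
  open import Relation.Nullary.Decidable using (toWitness)

  ∧-left : ∀ a {b} → a ∧ b ≡ true → a ≡ true
  ∧-left true eq = refl

  ∧-right : ∀ a {b} → a ∧ b ≡ true → b ≡ true
  ∧-right true eq = eq

  not-does : ∀ {P : Set} (d : Dec P) → not (does d) ≡ true → ¬ P
  not-does (no ¬p) _ = ¬p

  does-true : ∀ {P : Set} (d : Dec P) → does d ≡ true → P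
  does-true (yes p) _ = p

  opaque
    unfolding allᵇ

    allᵇ-sound : ∀ {A : Set} (p : A → Bool) {xs} → allᵇ p xs ≡ true → ∀ {x} → x ∈ xs → p x ≡ true
    allᵇ-sound p {x ∷ xs} eq (here refl) = ∧-left (p x) eq
    allᵇ-sound p {x ∷ xs} eq (there x∈) = allᵇ-sound p (∧-right (p x) eq) x∈

    allᵇ-map : ∀ {A B : Set} (p : B → Bool) (f : A → B) {xs} → allᵇ p (map f xs) ≡ true → ∀ {x} → x ∈ xs → p (f x) ≡ true
    allᵇ-map p f {x ∷ xs} eq (here refl) = ∧-left (p (f x)) eq
    allᵇ-map p f {x ∷ xs} eq (there x∈) = allᵇ-map p f (∧-right (p (f x)) eq) x∈

  fresh-sound : ∀ R x ys → freshᵇ R x ys ≡ true → All (x ≢_) ys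
  fresh-sound R x [] eq = []
  fresh-sound R x (y ∷ ys) eq = not-does (Raw._≟_ R x y) (∧-left _ eq) ∷ fresh-sound R x ys (∧-right (not (does (Raw._≟_ R x y))) eq)

  distinct-sound : ∀ R xs → distinctᵇ R xs ≡ true → All (_≢ Raw.0# R) xs × Unique xs
  distinct-sound R [] eq = [] , []
  distinct-sound R (x ∷ xs) eq =
    let rest = ∧-right (not (does (Raw._≟_ R x (Raw.0# R)))) eq
        nonzeros , unique = distinct-sound R xs (∧-right (freshᵇ R x xs) rest)
    in not-does (Raw._≟_ R x (Raw.0# R)) (∧-left _ eq) ∷ nonzeros , fresh-sound R x xs (∧-left (freshᵇ R x xs) rest) ∷ unique

  types-complete : ∀ h → h ∈ types
  types-complete (0F , 0F) = here refl
  types-complete (0F , 1F) = there (here refl)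
  types-complete (1F , 0F) = there (there (here refl))
  types-complete (1F , 1F) = there (there (there (here refl)))

  module _ (F : Field) where
    open FieldProps F

    fastPower-correct : ∀ k x n → n ≤ k → fastPower raw k x n ≡ x ^ n
    fastPower-correct zero x zero le = refl
    fastPower-correct (suc k) x zero le = refl
    fastPower-correct (suc k) x n@(suc n-1) (ℕ.s≤s le) = begin
      fastPower raw (suc k) x n               ≡⟨ branch (n % 2) refl (m%n<n n 2) ⟩
      x ^ (n % 2) * fastPower raw k (x * x) (n / 2)
        ≡⟨ cong (x ^ (n % 2) *_) (fastPower-correct k (x * x) (n / 2) half≤) ⟩
      x ^ (n % 2) * (x * x) ^ (n / 2)         ≡⟨ cong (λ t → x ^ (n % 2) * (x * t) ^ (n / 2)) (*-identityʳ x) ⟨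
      x ^ (n % 2) * (x ^ 2) ^ (n / 2)         ≡⟨ cong (x ^ (n % 2) *_) (^-*-assoc x 2 (n / 2)) ⟩
      x ^ (n % 2) * x ^ (2 ℕ.* (n / 2))       ≡⟨ ^-+ x (n % 2) (2 ℕ.* (n / 2)) ⟨
      x ^ (n % 2 ℕ.+ 2 ℕ.* (n / 2))           ≡⟨ cong (λ t → x ^ (n % 2 ℕ.+ t)) (ℕₚ.*-comm 2 (n / 2)) ⟩
      x ^ (n % 2 ℕ.+ n / 2 ℕ.* 2)             ≡⟨ cong (x ^_) (m≡m%n+[m/n]*n n 2) ⟨
      x ^ n ∎
      where
      open ≡-Reasoning
      half≤ : n / 2 ≤ k
      half≤ = ℕₚ.≤-trans (ℕₚ.≤-pred (m/n<m n 2 (ℕ.s≤s (ℕ.s≤s ℕ.z≤n)))) le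
      y = fastPower raw k (x * x) (n / 2)
      branch : ∀ b → n % 2 ≡ b → b < 2 → fastPower raw (suc k) x n ≡ x ^ b * y
      branch 0 eq _ = trans (cong (λ t → if t ℕ.≡ᵇ 1 then x * y else y) eq) (sym (*-identityˡ y))
      branch 1 eq _ = trans (cong (λ t → if t ℕ.≡ᵇ 1 then x * y else y) eq) (cong (_* y) (sym (*-identityʳ x)))
      branch (suc (suc _)) eq (ℕ.s≤s (ℕ.s≤s ()))

  module Checked (F : Field) (n′ : ℕ)
    (size≡ : Field.size F ≡ suc (7 ℕ.* (suc n′ ℕ.+ suc n′))) (2≢0 : Raw._+_ (Field.raw F) (Field.1# F) (Field.1# F) ≢ Field.0# F) where
    open FieldProps F
    open SeventhPowers F n′ size≡ 2≢0 using (n; φ; module FromLayout)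

    private
      fast : Carrier → Carrier
      fast x = fastPower raw n x n

      fast≡φ : ∀ x → fast x ≡ φ x
      fast≡φ x = fastPower-correct F n x n ℕₚ.≤-refl

      transfer : ∀ {A : Set} (y : A → Carrier) (as : List A) → distinctᵇ raw (map (λ a → fast (y a)) as) ≡ true →
        All (λ a → y a ≢ 0#) as × Unique (map (λ a → φ (y a)) as)
      transfer y as eq = All.map (λ {a} ne e → ne (trans (fast≡φ (y a)) (trans (cong φ e) (zeroˡ _)))) (Allₚ.map⁻ (proj₁ sound))
        , subst Unique (map-cong (λ a → fast≡φ (y a)) as) (proj₂ sound)
        where
        open import Data.List.Properties using (map-cong)
        sound = distinct-sound raw (map (λ a → fast (y a)) as) eq

    checked-family : ∀ L → Layout.Balanced L → Layout.Labelled L → ∀ xs →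
      check raw n L (map (Layout.pairsOf L) types) xs ≡ true → Family (additiveGroup F)
    checked-family L balanced labelled xs eq = FromLayout.family L balanced labelled xs
      (proj₁ values) (proj₂ values) (λ h → proj₁ (differences h)) (λ h → proj₂ (differences h))
      where
      values = transfer xs (allFin 7) (∧-left (distinctᵇ raw (map (λ i → fast (xs i)) (allFin 7))) eq)
      differences = λ h → transfer (Entries.difference raw L xs) (Layout.pairsOf L h)
        (allᵇ-map (λ ps → distinctᵇ raw (map (λ p → fast (Entries.difference raw L xs p)) ps)) (Layout.pairsOf L)
          (∧-right (distinctᵇ raw (map (λ i → fast (xs i)) (allFin 7))) eq) (types-complete h))

  symmetric-balanced : Layout.Balanced symmetric
  symmetric-balanced = toWitness {a? = Layout.balanced? symmetric} tt

  symmetric-labelled : Layout.Labelled symmetric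
  symmetric-labelled = toWitness {a? = Layout.labelled? symmetric} tt

  composite-sound : ∀ ds p → All (1 <_) ds → composite ds p ≡ true → ¬ Prime p
  composite-sound (zero ∷ ds) p (() ∷ _) eq
  composite-sound (d@(suc _) ∷ ds) p (1<d ∷ big) eq p-prime with d ℕ.* d ℕ.≤ᵇ p in le
  ... | true with p % d ℕ.≡ᵇ 0 in divides
  ...   | false = composite-sound ds p big eq p-prime
  ...   | true with prime⇒irreducible p-prime (m%n≡0⇒n∣m p d (ℕₚ.≡ᵇ⇒≡ (p % d) 0 (subst Data.Bool.T (sym divides) tt)))
  ...     | inj₁ refl = ℕₚ.<-irrefl refl 1<d
  ...     | inj₂ refl = ℕₚ.<⇒≱ (ℕₚ.m<m*n d d 1<d) (ℕₚ.≤ᵇ⇒≤ (d ℕ.* d) d (subst Data.Bool.T (sym le) tt))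

  -- A prime among the scanned numbers is never skipped as composite, hence a certificate was
  -- consumed for it and passed the test.
  scan-sound : ∀ {C : Set} (test : ℕ → C → Bool) primes → All (1 <_) primes → ∀ k m cs → scan test primes k m cs ≡ true →
    ∀ i → i < k → Prime (suc (i ℕ.* 14 ℕ.+ m)) → ∃ λ c → test (i ℕ.* 14 ℕ.+ m) c ≡ true
  scan-sound test primes big (suc k) m cs eq i i<k p-prime with composite primes (suc m) in comp
  scan-sound test primes big (suc k) m cs eq zero i<k p-prime | true = ⊥-elim (composite-sound primes (suc m) big comp p-prime)
  scan-sound test primes big (suc k) m cs eq (suc i) (ℕ.s≤s i<k) p-prime | true =
    subst (λ t → ∃ λ c → test t c ≡ true) (shift i m)
      (scan-sound test primes big k (14 ℕ.+ m) cs eq i i<k (subst (λ t → Prime (suc t)) (sym (shift i m)) p-prime))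
    where
    shift : ∀ i m → i ℕ.* 14 ℕ.+ (14 ℕ.+ m) ≡ suc i ℕ.* 14 ℕ.+ m
    shift i m = trans (sym (ℕₚ.+-assoc (i ℕ.* 14) 14 m)) (cong (ℕ._+ m) (ℕₚ.+-comm (i ℕ.* 14) 14))
  scan-sound test primes big (suc k) m (c ∷ cs) eq zero i<k p-prime | false = c , ∧-left (test m c) eq
  scan-sound test primes big (suc k) m (c ∷ cs) eq (suc i) (ℕ.s≤s i<k) p-prime | false =
    subst (λ t → ∃ λ c → test t c ≡ true) (shift i m)
      (scan-sound test primes big k (14 ℕ.+ m) cs (∧-right (test m c) eq) i i<k (subst (λ t → Prime (suc t)) (sym (shift i m)) p-prime))
    where
    shift : ∀ i m → i ℕ.* 14 ℕ.+ (14 ℕ.+ m) ≡ suc i ℕ.* 14 ℕ.+ m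
    shift i m = trans (sym (ℕₚ.+-assoc (i ℕ.* 14) 14 m)) (cong (ℕ._+ m) (ℕₚ.+-comm (i ℕ.* 14) 14))

-- Fields of prime power order and their direct powers

module PrimePowerFields where
  open Fields
  open Extensions
  open Sums
  open Families
  open Layouts
  open PrimeFields
  open Tests
  open LargeFields using (module Generic)
  open Soundness
  open import Data.Bool using (not)
  open import Data.Nat using (_^_)
  open import Data.Nat.DivMod
  open import Data.Nat.Primality using (Prime)
  open import Data.Fin using (inject≤)
  open import Data.Fin.Patterns
  open import Data.List using (upTo; replicate; cartesianProduct)
  open import Data.List.Membership.Propositional using (_∈_)
  open import Data.List.Membership.Propositional.Properties using (∈-upTo⁺; ∈-map⁺; ∈-cartesianProduct⁺)
  import Data.List.Relation.Unary.All.Properties as Allₚ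

  cofactor : ℕ → ℕ → ℕ
  cofactor p d = ℕ.pred (p ^ d) / 7

  residues : ∀ m → List (Mod m)
  residues m = map (residue m) (upTo (suc m))

  residues-complete : ∀ m x → x ∈ residues m
  residues-complete m x = subst (_∈ residues m) (Residues.residue-value m x) (∈-map⁺ (residue m) (∈-upTo⁺ (Residues.value< m x)))

  quadraticRootlessᵇ cubicRootlessᵇ : (R : Raw) → List (Raw.Carrier R) → Raw.Carrier R → Bool
  quadraticRootlessᵇ R xs β = allᵇ (λ x → not (does (x * x ≟ x + β))) xs where open Raw R
  cubicRootlessᵇ R xs β = allᵇ (λ x → not (does (x * (x * x) ≟ x + β))) xs where open Raw R

  quadraticRootless-sound : ∀ R xs β → (∀ x → x ∈ xs) → quadraticRootlessᵇ R xs β ≡ true → ∀ x → Raw._*_ R x x ≢ Raw._+_ R x β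
  quadraticRootless-sound R xs β complete eq x = not-does (x * x ≟ x + β) (allᵇ-sound (λ x → not (does (x * x ≟ x + β))) eq (complete x))
    where open Raw R

  cubicRootless-sound : ∀ R xs β → (∀ x → x ∈ xs) → cubicRootlessᵇ R xs β ≡ true → ∀ x → Raw._*_ R x (Raw._*_ R x x) ≢ Raw._+_ R x β
  cubicRootless-sound R xs β complete eq x = not-does (x * (x * x) ≟ x + β) (allᵇ-sound (λ x → not (does (x * (x * x) ≟ x + β))) eq (complete x))
    where open Raw R

  coordinates : ∀ m → List ℕ → ℕ → Mod m
  coordinates m xs k = residue m (nth xs k)

  pairAt : ∀ m → List ℕ → ℕ → Mod m × Mod m
  pairAt m xs k = coordinates m xs (2 ℕ.* k) , coordinates m xs (1 ℕ.+ 2 ℕ.* k)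

  pairElements : ∀ m → List ℕ → Fin 7 → Mod m × Mod m
  pairElements m xs i = pairAt m xs (toℕ i)

  tripleElements : ∀ m → List ℕ → Fin 7 → Mod m × Mod m × Mod m
  tripleElements m xs i = coordinates m xs (3 ℕ.* toℕ i) , coordinates m xs (1 ℕ.+ 3 ℕ.* toℕ i) , coordinates m xs (2 ℕ.+ 3 ℕ.* toℕ i)

  tripleOfPairsElements : ∀ m → List ℕ → Fin 7 → (Mod m × Mod m) × (Mod m × Mod m) × (Mod m × Mod m)
  tripleOfPairsElements m xs i = pairAt m xs (3 ℕ.* toℕ i) , pairAt m xs (1 ℕ.+ 3 ℕ.* toℕ i) , pairAt m xs (2 ℕ.+ 3 ℕ.* toℕ i)

  -- In each list the coordinates of β come first.
  quadraticTest cubicTest sexticTest : List (List SlotPair) → ℕ → List ℕ → Bool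
  quadraticTest pairs m [] = false
  quadraticTest pairs m (b ∷ xs) = quadraticRootlessᵇ (modRaw m) (residues m) (residue m b)
    ∧ check (quadraticRaw (modRaw m) (residue m b)) (cofactor (suc m) 2) symmetric pairs (pairElements m xs)
  cubicTest pairs m [] = false
  cubicTest pairs m (b ∷ xs) = cubicRootlessᵇ (modRaw m) (residues m) (residue m b)
    ∧ check (cubicRaw (modRaw m) (residue m b)) (cofactor (suc m) 3) symmetric pairs (tripleElements m xs)
  sexticTest pairs m (b ∷ c₀ ∷ c₁ ∷ xs) = quadraticRootlessᵇ (modRaw m) (residues m) (residue m b)
    ∧ (cubicRootlessᵇ (quadraticRaw (modRaw m) (residue m b)) (cartesianProduct (residues m) (residues m)) (residue m c₀ , residue m c₁)
    ∧ check (cubicRaw (quadraticRaw (modRaw m) (residue m b)) (residue m c₀ , residue m c₁))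
        (cofactor (suc m) 6) symmetric pairs (tripleOfPairsElements m xs))
  sexticTest pairs m _ = false

  -- Take seven distinct elements and subtract the first from the others. The six results are
  -- nonzero, and their mutual differences are differences of the original elements.
  six-field : (F : Field) → 7 ≤ Field.size F → SixMaps (additiveGroup F)
  six-field F 7≤size = record
    { act = λ i x → c i * x
    ; act-onto = λ i g → c i ⁻¹ * g , cancel (c≢0 i) g
    ; act-injective = λ i → *-cancelˡ (c i) (c≢0 i)
    ; actDiff-onto = λ {i} {j} i≢j g → let d = c i - c j in d ⁻¹ * g ,
        trans (expand i j (d ⁻¹ * g)) (cancel (c-distinct i≢j) g)
    ; actDiff-injective = λ {i} {j} i≢j {x} {y} eq → *-cancelˡ (c i - c j) (c-distinct i≢j)
        (trans (sym (expand i j x)) (trans eq (expand i j y)))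
    }
    where
    open FieldProps F
    open FieldCounting F
    open Solver
    at : Fin 7 → Carrier
    at i = element (inject≤ i 7≤size)
    at-injective : ∀ {i j} → at i ≡ at j → i ≡ j
    at-injective {i} {j} eq = Finₚ.inject≤-injective 7≤size 7≤size i j (trans (sym (index-element _)) (trans (cong index eq) (index-element _)))
    c : Fin 6 → Carrier
    c i = at (suc i) - at zero
    c≢0 : ∀ i → c i ≢ 0#
    c≢0 i = x-y≢0 λ eq → Finₚ.0≢1+n (sym (at-injective eq))
    c-distinct : ∀ {i j} → i ≢ j → c i - c j ≢ 0#
    c-distinct {i} {j} i≢j = x-y≢0 λ eq → i≢j (Finₚ.suc-injective (at-injective (begin
      at (suc i)                      ≡⟨ solve 2 (λ u z → u := u :- z :+ z) refl (at (suc i)) (at zero) ⟩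
      at (suc i) - at zero + at zero  ≡⟨ cong (_+ at zero) eq ⟩
      at (suc j) - at zero + at zero  ≡⟨ solve 2 (λ u z → u := u :- z :+ z) refl (at (suc j)) (at zero) ⟨
      at (suc j) ∎)))
      where open ≡-Reasoning
    cancel : ∀ {d} → d ≢ 0# → ∀ g → d * (d ⁻¹ * g) ≡ g
    cancel {d} d≢0 g = trans (sym (*-assoc d _ g)) (trans (cong (_* g) (*-inverseʳ d≢0)) (*-identityˡ g))
    expand : ∀ i j x → c i * x - c j * x ≡ (c i - c j) * x
    expand i j x = solve 3 (λ u v x → u :* x :- v :* x := (u :- v) :* x) refl (c i) (c j) x

  -- The lower bound excludes q = 1, so that (q - 1)/14 is a successor.
  one-mod-14 : ∀ q → q % 14 ≡ 1 → 15 ≤ q → ∃ λ n → q ≡ suc (7 ℕ.* (suc n ℕ.+ suc n))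
  one-mod-14 q q%14 15≤q with q / 14 | m≡m%n+[m/n]*n q 14
  ... | zero | eq = ⊥-elim (ℕₚ.<⇒≱ (ℕ.s≤s (ℕ.s≤s ℕ.z≤n)) (ℕₚ.≤-trans 15≤q (ℕₚ.≤-reflexive (trans eq (trans (ℕₚ.+-identityʳ _) q%14)))))
  ... | suc n | eq = n , trans eq (trans (cong (ℕ._+ suc n ℕ.* 14) q%14)
          (cong suc (solve 1 (λ n → (con 1 :+ n) :* con 14 := con 7 :* ((con 1 :+ n) :+ (con 1 :+ n))) refl n)))
    where
    open import Data.Nat.Solver using (module +-*-Solver)
    open +-*-Solver

  eltGroup-cong : ∀ {ms ns} → ms ≡ ns → ∀ nzm nzn → eltGroup ms nzm ≅ eltGroup ns nzn
  eltGroup-cong refl nzm nzn = record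
    { to = λ x → x ; from = λ x → x ; to-from = λ _ → refl ; from-to = λ _ → refl ; homo = λ _ _ → refl }

  -- The data that survive concatenation of lists of moduli; `six` is carried along because the
  -- product of families asks for it in the second factor.
  record Good (ms : List ℕ) : Set₁ where
    field
      nonzero : All NonZero ms
      family : Family (eltGroup ms nonzero)
      six : SixMaps (eltGroup ms nonzero)

  good-++ : ∀ {ms ns} → Good ms → Good ns → Good (ms ++ ns)
  good-++ {ms} A B = record
    { nonzero = nz
    ; family = family-≅ iso (FamilyProduct.family-× A.family B.family B.six)
    ; six = six-≅ iso (six-× A.six B.six)
    }
    where
    module A = Good A
    module B = Good B
    nz = Allₚ.++⁺ A.nonzero B.nonzero
    iso = elt-++ ms A.nonzero B.nonzero nz

  replicate-+ : ∀ {A : Set} a b (x : A) → replicate (a ℕ.+ b) x ≡ replicate a x ++ replicate b x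
  replicate-+ zero b x = refl
  replicate-+ (suc a) b x = cong (x ∷_) (replicate-+ a b x)

  module Tower (m : ℕ) (prime : Prime (suc m)) (odd : 2 < suc m) where
    p : ℕ
    p = suc m

    nonzeros : ∀ d → All NonZero (replicate d p)
    nonzeros zero = []
    nonzeros (suc d) = _ ∷ nonzeros d

    E : ℕ → FiniteAbelianGroup
    E d = eltGroup (replicate d p) (nonzeros d)

    E-+ : ∀ a b → (E a ×ᴳ E b) ≅ E (a ℕ.+ b)
    E-+ a b = ≅-trans (elt-++ (replicate a p) (nonzeros a) (nonzeros b) (Allₚ.++⁺ (nonzeros a) (nonzeros b)))
      (eltGroup-cong (sym (replicate-+ a b p)) _ _)

    -- The statement sees only the additive group of the field, so any irreducible polynomial may be
    -- used to build it; `iso` identifies this group with the power (ℤ_p)^d of the statement.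
    record Presented (d : ℕ) : Set₁ where
      field
        F : Field
        2≢0 : Raw._+_ (Field.raw F) (Field.1# F) (Field.1# F) ≢ Field.0# F
        iso : additiveGroup F ≅ E d
        size≡ : Field.size F ≡ p ^ d

    open Presented

    base : Presented 1
    base = record
      { F = F₀
      ; 2≢0 = λ eq → 2≢0₀ (cong Mod.value eq)
      ; iso = record
        { to = λ x → to x , tt
        ; from = λ (i , _) → Inverse.from (Field.enum F₀) i
        ; to-from = λ (i , _) → cong (_, tt) (Inverse.strictlyInverseˡ (Field.enum F₀) i)
        ; from-to = Inverse.strictlyInverseʳ (Field.enum F₀)
        ; homo = λ x y → cong (_, tt) (Finₚ.toℕ-injective (begin
            toℕ (to (x + y))                   ≡⟨ toℕ-to (x + y) ⟩
            (Mod.value x ℕ.+ Mod.value y) % p  ≡⟨ cong₂ (λ a b → (a ℕ.+ b) % p) (toℕ-to x) (toℕ-to y) ⟨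
            (toℕ (to x) ℕ.+ toℕ (to y)) % p    ≡⟨ Finₚ.toℕ-fromℕ< (m%n<n (toℕ (to x) ℕ.+ toℕ (to y)) p) ⟨
            toℕ (addFin (to x) (to y))         ∎)) }
      ; size≡ = sym (ℕₚ.*-identityʳ p)
      }
      where
      open import Function.Bundles using (Inverse)
      open ≡-Reasoning
      F₀ = PrimeField.primeField m prime
      open Field F₀ using (_+_)
      to : Mod m → Fin p
      to = Inverse.to (Field.enum F₀)
      toℕ-to : ∀ x → toℕ (to x) ≡ Mod.value x
      toℕ-to x = Finₚ.toℕ-fromℕ< (Residues.value< m x)
      2≢0₀ : (1 % p ℕ.+ 1 % p) % p ≢ 0
      2≢0₀ eq = ℕₚ.1+n≢0 (trans (sym (m<n⇒m%n≡m odd)) (trans (cong (λ t → (t ℕ.+ t) % p) (sym (m<n⇒m%n≡m (ℕₚ.<-trans (ℕₚ.n<1+n 1) odd)))) eq))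

    quadratic : ∀ {d} (P : Presented d) β → (∀ x → Raw._*_ (Field.raw (F P)) x x ≢ Raw._+_ (Field.raw (F P)) x β) → Presented (d ℕ.+ d)
    quadratic {d} P β rootless = record
      { F = Quadratic.quadraticField (F P) β rootless
      ; 2≢0 = λ eq → 2≢0 P (cong proj₁ eq)
      ; iso = ≅-trans {H = additiveGroup (F P) ×ᴳ additiveGroup (F P)}
          (record { to = λ x → x ; from = λ x → x ; to-from = λ _ → refl ; from-to = λ _ → refl ; homo = λ _ _ → refl })
          (≅-trans (≅-× (iso P) (iso P)) (E-+ d d))
      ; size≡ = trans (cong₂ ℕ._*_ (size≡ P) (size≡ P)) (sym (ℕₚ.^-distribˡ-+-* p d d))
      }

    cubic : ∀ {d} (P : Presented d) β → (∀ x → Raw._*_ (Field.raw (F P)) x (Raw._*_ (Field.raw (F P)) x x) ≢ Raw._+_ (Field.raw (F P)) x β) →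
      Presented (d ℕ.+ (d ℕ.+ d))
    cubic {d} P β rootless = record
      { F = Cubic.cubicField (F P) β rootless
      ; 2≢0 = λ eq → 2≢0 P (cong proj₁ eq)
      ; iso = ≅-trans {H = additiveGroup (F P) ×ᴳ (additiveGroup (F P) ×ᴳ additiveGroup (F P))}
          (record { to = λ x → x ; from = λ x → x ; to-from = λ _ → refl ; from-to = λ _ → refl ; homo = λ _ _ → refl })
          (≅-trans (≅-× (iso P) (≅-trans (≅-× (iso P) (iso P)) (E-+ d d))) (E-+ d (d ℕ.+ d)))
      ; size≡ = trans (cong₂ ℕ._*_ (size≡ P) (trans (cong₂ ℕ._*_ (size≡ P) (size≡ P)) (sym (ℕₚ.^-distribˡ-+-* p d d))))
          (sym (ℕₚ.^-distribˡ-+-* p d (d ℕ.+ d)))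
      }

    double : ∀ {d} → Presented d → Presented (d ℕ.+ d)
    double P = quadratic P (proj₁ (FieldCounting.quadratic-nonvalue (F P))) (proj₂ (FieldCounting.quadratic-nonvalue (F P)))

    triple : ∀ {d} → Presented d → Presented (d ℕ.+ (d ℕ.+ d))
    triple P = cubic P (proj₁ (FieldCounting.cubic-nonvalue (F P))) (proj₂ (FieldCounting.cubic-nonvalue (F P)))

    module _ {d} (P : Presented d) (order≡1 : p ^ d % 14 ≡ 1) (15≤order : 15 ≤ p ^ d) where
      private
        n′ : ℕ
        n′ = proj₁ (one-mod-14 (p ^ d) order≡1 15≤order)

        order≡ : p ^ d ≡ suc (7 ℕ.* (suc n′ ℕ.+ suc n′))
        order≡ = proj₂ (one-mod-14 (p ^ d) order≡1 15≤order)

        exponent : cofactor p d ≡ suc n′ ℕ.+ suc n′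
        exponent = trans (cong (λ q → ℕ.pred q / 7) order≡) (trans (cong (_/ 7) (ℕₚ.*-comm 7 (suc n′ ℕ.+ suc n′))) (m*n/n≡m (suc n′ ℕ.+ suc n′) 7))

      good-field : Family (additiveGroup (F P)) → Good (replicate d p)
      good-field 𝓕 = record
        { nonzero = nonzeros d
        ; family = family-≅ (iso P) 𝓕
        ; six = six-≅ (iso P) (six-field (F P) (ℕₚ.≤-trans (ℕₚ.m≤m+n 7 8) (ℕₚ.≤-trans 15≤order (ℕₚ.≤-reflexive (sym (size≡ P))))))
        }

      good-checked : ∀ L → Layout.Balanced L → Layout.Labelled L → ∀ xs →
        check (Field.raw (F P)) (cofactor p d) L (map (Layout.pairsOf L) types) xs ≡ true → Good (replicate d p)
      good-checked L balanced labelled xs eq = good-field (Checked.checked-family (F P) n′ (trans (size≡ P) order≡) (2≢0 P)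
        L balanced labelled xs (subst (λ n → check (Field.raw (F P)) n L (map (Layout.pairsOf L) types) xs ≡ true) exponent eq))

      good-large : 67008420535 < p ^ d → Good (replicate d p)
      good-large large = good-field (Generic.genericFamily (F P) n′ (trans (size≡ P) order≡) (2≢0 P)
        (ℕₚ.<-≤-trans large (ℕₚ.≤-reflexive (sym (size≡ P)))))

    private
      pairs : List (List SlotPair)
      pairs = map (Layout.pairsOf symmetric) types

    good-prime : p ^ 1 % 14 ≡ 1 → 15 ≤ p ^ 1 → ∀ c → checkPrime pairs m c ≡ true → Good (replicate 1 p)
    good-prime order≡1 15≤order (short c) eq = good-checked base order≡1 15≤order symmetric symmetric-balanced symmetric-labelled (shortElements m c)
      (subst (λ n → check (modRaw m) n symmetric pairs (shortElements m c) ≡ true) (cong (_/ 7) (sym (ℕₚ.*-identityʳ m))) eq)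
    good-prime order≡1 15≤order (full L xs) eq = good-checked base order≡1 15≤order L
      (does-true (Layout.balanced? L) (∧-left (does (Layout.balanced? L)) valid)) (does-true (Layout.labelled? L) (∧-right (does (Layout.balanced? L)) valid)) (listElements m xs)
      (subst (λ n → check (modRaw m) n L (map (Layout.pairsOf L) types) (listElements m xs) ≡ true) (cong (_/ 7) (sym (ℕₚ.*-identityʳ m)))
        (∧-right (does (Layout.balanced? L) ∧ does (Layout.labelled? L)) eq))
      where
      valid : does (Layout.balanced? L) ∧ does (Layout.labelled? L) ≡ true
      valid = ∧-left (does (Layout.balanced? L) ∧ does (Layout.labelled? L)) eq

    good-square : p ^ 2 % 14 ≡ 1 → 15 ≤ p ^ 2 → ∀ xs → quadraticTest pairs m xs ≡ true → Good (replicate 2 p)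
    good-square order≡1 15≤order (b ∷ xs) eq = good-checked
      (quadratic base (residue m b) (quadraticRootless-sound (modRaw m) (residues m) (residue m b) (residues-complete m)
        (∧-left (quadraticRootlessᵇ (modRaw m) (residues m) (residue m b)) eq)))
      order≡1 15≤order symmetric symmetric-balanced symmetric-labelled (pairElements m xs)
      (∧-right (quadraticRootlessᵇ (modRaw m) (residues m) (residue m b)) eq)

    good-cube : p ^ 3 % 14 ≡ 1 → 15 ≤ p ^ 3 → ∀ xs → cubicTest pairs m xs ≡ true → Good (replicate 3 p)
    good-cube order≡1 15≤order (b ∷ xs) eq = good-checked
      (cubic base (residue m b) (cubicRootless-sound (modRaw m) (residues m) (residue m b) (residues-complete m)
        (∧-left (cubicRootlessᵇ (modRaw m) (residues m) (residue m b)) eq)))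
      order≡1 15≤order symmetric symmetric-balanced symmetric-labelled (tripleElements m xs)
      (∧-right (cubicRootlessᵇ (modRaw m) (residues m) (residue m b)) eq)

    good-sixth : p ^ 6 % 14 ≡ 1 → 15 ≤ p ^ 6 → ∀ xs → sexticTest pairs m xs ≡ true → Good (replicate 6 p)
    good-sixth order≡1 15≤order (b ∷ c₀ ∷ c₁ ∷ xs) eq = good-checked P order≡1 15≤order
      symmetric symmetric-balanced symmetric-labelled (tripleOfPairsElements m xs) (∧-right (cubicRootlessᵇ Q elements γ) rest)
      where
      Q = quadraticRaw (modRaw m) (residue m b)
      γ = residue m c₀ , residue m c₁
      elements = cartesianProduct (residues m) (residues m)
      rest : cubicRootlessᵇ Q elements γ ∧ check (cubicRaw Q γ) (cofactor p 6) symmetric pairs (tripleOfPairsElements m xs) ≡ true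
      rest = ∧-right (quadraticRootlessᵇ (modRaw m) (residues m) (residue m b)) eq
      P₂ : Presented 2
      P₂ = quadratic base (residue m b) (quadraticRootless-sound (modRaw m) (residues m) (residue m b) (residues-complete m)
          (∧-left (quadraticRootlessᵇ (modRaw m) (residues m) (residue m b)) eq))
      P : Presented 6
      P = cubic P₂ γ (cubicRootless-sound Q elements γ (λ (x , y) → ∈-cartesianProduct⁺ (residues-complete m x) (residues-complete m y))
          (∧-left (cubicRootlessᵇ Q elements γ) rest))

    good-+ : ∀ {a b} → Good (replicate a p) → Good (replicate b p) → Good (replicate (a ℕ.+ b) p)
    good-+ {a} {b} A B = subst Good (sym (replicate-+ a b p)) (good-++ A B)

    good-multiples : ∀ {d} → Good (replicate d p) → ∀ k → Good (replicate (suc k ℕ.* d) p)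
    good-multiples {d} A zero = subst (λ e → Good (replicate e p)) (sym (ℕₚ.+-identityʳ d)) A
    good-multiples {d} A (suc k) = good-+ {d} A (good-multiples A k)

    -- Every integer from 2 on is a sum of twos and threes: twos are split off until 2 or 3 is left.
    good-from-2-3 : ∀ {d} → Good (replicate (d ℕ.+ d) p) → Good (replicate (d ℕ.+ (d ℕ.+ d)) p) → ∀ k → Good (replicate (suc (suc k) ℕ.* d) p)
    good-from-2-3 {d} A₂ A₃ zero = subst (λ e → Good (replicate e p)) (cong (d ℕ.+_) (sym (ℕₚ.+-identityʳ d))) A₂
    good-from-2-3 {d} A₂ A₃ (suc zero) = subst (λ e → Good (replicate e p)) (cong (λ t → d ℕ.+ (d ℕ.+ t)) (sym (ℕₚ.+-identityʳ d))) A₃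
    good-from-2-3 {d} A₂ A₃ (suc (suc k)) = subst (λ e → Good (replicate e p)) (ℕₚ.+-assoc d d (suc (suc k) ℕ.* d))
      (good-+ {d ℕ.+ d} A₂ (good-from-2-3 {d} A₂ A₃ k))

-- Certificates for small orders

module Tables where
  open Layouts
  open Tests
  open Soundness
  open PrimePowerFields
  open import Data.Nat.DivMod
  open import Data.Fin.Patterns
  open import Data.Vec using ([]; _∷_)
  open import Relation.Nullary.Decidable using (toWitness)

  -- Certificates of seven bytes each, for the primes p ≡ 1 (mod 14) with 71 ≤ p < 258889 in increasing order.
  unpack : ℕ → ℕ → List Certificate
  unpack zero c = []
  unpack (suc k) c = short (c % 0x100000000000000) ∷ unpack k (c / 0x100000000000000)

  -- The odd primes other than 7 up to 509. The scanned numbers are prime to 14 and less than 258889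
  -- < 509², so composite numbers among them are recognised and need no certificate.
  smallPrimes : List ℕ
  smallPrimes = 3 ∷ 5 ∷ 11 ∷ 13 ∷ 17 ∷ 19 ∷ 23 ∷ 29 ∷ 31 ∷ 37 ∷ 41 ∷ 43 ∷ 47 ∷ 53 ∷ 59 ∷ 61 ∷ 67 ∷ 71 ∷ 73 ∷ 79 ∷ 83 ∷ 89 ∷ 97 ∷ 101 ∷ 103 ∷ 107 ∷ 109 ∷ 113 ∷ 127 ∷ 131 ∷ 137 ∷ 139 ∷ 149 ∷ 151 ∷ 157 ∷ 163 ∷ 167 ∷ 173 ∷ 179 ∷ 181 ∷ 191 ∷ 193 ∷ 197 ∷ 199 ∷ 211 ∷ 223 ∷ 227 ∷ 229 ∷ 233 ∷ 239 ∷ 241 ∷ 251 ∷ 257 ∷ 263 ∷ 269 ∷ 271 ∷ 277 ∷ 281 ∷ 283 ∷ 293 ∷ 307 ∷ 311 ∷ 313 ∷ 317 ∷ 331 ∷ 337 ∷ 347 ∷ 349 ∷ 353 ∷ 359 ∷ 367 ∷ 373 ∷ 379 ∷ 383 ∷ 389 ∷ 397 ∷ 401 ∷ 409 ∷ 419 ∷ 421 ∷ 431 ∷ 433 ∷ 439 ∷ 443 ∷ 449 ∷ 457 ∷ 461 ∷ 463 ∷ 467 ∷ 479 ∷ 487 ∷ 491 ∷ 499 ∷ 503 ∷ 509 ∷ []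

  primeCertificates : List Certificate
  primeCertificates =
    -- The primes 71 and 127 have layouts of their own; 113, between them, uses the common one.
    (full (fromVectors (((0F , 0F) , 4F , false) ∷ ((1F , 0F) , 5F , false) ∷ ((0F , 0F) , 6F , true) ∷ []) (((0F , 0F) , 0F , false) ∷ ((0F , 0F) , 1F , false) ∷ ((1F , 1F) , 2F , false) ∷ ((0F , 0F) , 3F , false) ∷ ((0F , 1F) , 6F , false) ∷ []) (((0F , 0F) , 0F , true) ∷ ((0F , 1F) , 1F , true) ∷ ((0F , 1F) , 2F , true) ∷ ((1F , 1F) , 3F , true) ∷ ((1F , 0F) , 4F , true) ∷ ((0F , 1F) , 5F , true) ∷ [])) (14 ∷ 21 ∷ 12 ∷ 39 ∷ 68 ∷ 27 ∷ 40 ∷ []) ∷ [])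
    ++ unpack 1 0x65876768708A92
    ++ (full (fromVectors (((0F , 0F) , 6F , true) ∷ ((0F , 1F) , 6F , false) ∷ ((0F , 1F) , 5F , false) ∷ []) (((0F , 0F) , 3F , true) ∷ ((0F , 0F) , 3F , false) ∷ ((1F , 1F) , 4F , true) ∷ ((0F , 0F) , 4F , false) ∷ ((1F , 0F) , 5F , true) ∷ []) (((0F , 0F) , 0F , true) ∷ ((1F , 0F) , 0F , false) ∷ ((1F , 0F) , 1F , true) ∷ ((0F , 1F) , 1F , false) ∷ ((1F , 1F) , 2F , true) ∷ ((1F , 0F) , 2F , false) ∷ [])) (60 ∷ 90 ∷ 47 ∷ 119 ∷ 120 ∷ 10 ∷ 2 ∷ []) ∷ [])
    ++ unpack 24 0x9E9C7F6008CCFC748366616A949E54897B5260833A94887379AC629673907665C0E04D899667788FC28C979267745AACB0708E7E7530A4D889996C68B6C5AA64955F663241E36989726D5E7C909183645D8AE9319A967F689EB486958E7778A07D96958177619C63839382726B0810E0898473663262EC868478656B7B1B83827C76DDB4CE86937C70B6D4BC8F86667F1BEE2F65986C78D0358A6B9D665FE39CE099817E66BF6883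
    ++ unpack 24 0x9D897673A4C6909598697D10ACB47F937D6F2C449E9A8B6772975D9E799C7174A358B7948A6867EEA8F38A856F69A8B0E87D8F5C761CADCB5D82605E1A35E992955F7FF0B09889826A7C698B9393A45E68BF88B792896C793B41B39487676A0870E09E85746B58B2B8758E656A70609C90847F6D864DAA8F81687A8CB8B68384775D8287929D8473625C60AA9F82796A98749799987E76AFD25DA18C6B67D4AA8793996F7250BA82
    ++ unpack 24 0x76917F6A6EC28F8E8F6B76355FC26986666A8E9CB26E897476B6A4867E95697129E3CE88857364A75CD47684787B9894D08D977D66A088C25185706BB4DAA661A56457DD86AD7A996A69C87CE090856C649EA8AD9A84575358A3A682846B77327AF269996D738C669C628173769661826F8D7876C894BC6C95777D30C8E073867D6CAA77B987917C71E46CD86CA4636A7E40C698956D6F3850887E867D6B6C60BC7F837A648C6D8A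
    ++ unpack 24 0x8A8C68716058E47E85707CD0A8AC7A8D7E6AB48CC087886B727F7C9181927072324D9B9983696B9096899586756F71389B70845C6A94898A8DA07D9033E9FE6785697FCB65AD74987D7B5818D87E837064B730C188917B732C869E548A656A4686D08283735F9289BC8597747250AA9676835B529159877C816276C2B4867B81757E7097875B8F54518375A4848677748A788396897968948F9B819B545B08FBC274817B73946AB2
    ++ unpack 24 0x84877B786E56DA7A856A6E658891A1A3737678FCB05F87646AF0DCE484827F76C85CC4738C7669A65EB0658E6C76919684B38A425173439C8784707B648A9765947C728FCEBF678A7C5C9E1AD77192647CC298D48C827B7C789CA25E86617368D0E85F887B6EB221FD69B57C4F9344A27F8E767958A686678A616A20D4A86F8A7566B353D4629F7F796640A0868168731271DA9686786BD8B4EC888C7E689B72968482766D748F8B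
    ++ unpack 24 0x7788736D3EC5E6508B53787F5BAF618B5572A85BAA5B9C657FE0F28F7A986D7F968CA676817E6AC29E8F7695697781968477816F687988945E8F795A435B90898A7A719884A49584786C35A798979E6B577463917A8A716E74B0B97F84626965899390816F6C77A7BC88816B6F9A38928D827F7C60889C65937F7D532FE989957F7E5DD0AD82817871B353A188827D6DE0CE8C828575778D78909E8D7965945A9A6A857A6B5CCCA0
    ++ unpack 24 0x8B81656DA783897F89747D5E6E968A9077758D9A97618C6978C0B6BEB083697F78719E7C986977176CF883865D7658309884947D74B0CC8889826B70479EA19C87707BD004EC75817A768CACB26B846A5E8CC2E67F8870775848BC9A987F6786D1B067866B786F7D9D6D83657FB671C2738A7E70405CB0938678726A5CA29F836444E6659582976F7A12D0A396816465D1A1AA7A91677E3FB2EE778E737D38ACCC7E886B738E17DB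
    ++ unpack 24 0x6081684FA2528474866D716294A36F997B70533598798A787CB248968F867C725044C46B8A7D6C708EA8758179654C9EB679887E7F866B908A946A7D86A8AC95857D686E65A09B905B51A36CAB7B96647F6038BC60867F69045CC8639C6F602084E48A947C6D5E8EA0658D7C77E49888648B71654CD0BC7A896A6F90AEB495976C76623BBCAB8E69438C45A9858C71649B2F869A8371655CCB8C8C8A6B686CDCB076926965B0D7AA
    ++ unpack 24 0x8E855E780C68EC9B947F6447C2868D92757614E0C469856B7A67B7DA7384785F8CA09D6F88676E71978A9187777573889BAC875BB26E7DE9908A7B6C8341D1978E7A74AA9AB46A8479704850F86F87667EE6ECBC68837873B0C0B48D89667D533AB7A08D66681753926F8F69762C41C68182656B3C18C0818D666D8A87868283796CB4ACEC8292677241839B888A7179995DB7B2B5585E519AAB84887B7F8656898A847A78B6AAC5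
    ++ unpack 24 0x748F706F5AA4887B9F5D67E48AFD8D8E745DD0C4F0758D6A7F2C88B8838C7677B8889679817864232095699865787732CB818C7A6D96A4A270885E792834C47AAB5D4FAE2ADC698F73687D7A8E668A737E542CCC9B996A82269289828B616D5817F3B98B59789167AA81876175263B83629267639820846F8A616BA7DABC7181766EB86CE446A43F374439B89487756E676F8E7089716AC656DB72886C7B8C5E91879B7B6E2C53B9
    ++ unpack 24 0x88826E75BCD59979987364CC48D47E816976848587938A707ED0A3F89B95676CB8A89A8D9A7A7D988C9C8E837B7060A4B05E9A505FA588A99B97777374B99589816F64AC3484738C727C5CAAB68B8C65667F6B83519A635F2C26C560906C5C7159EC948D7C749202A482907565994EB78C8E7E6564B1BF8C956F72A798C86383705E8C898D949672749EDFC68B97776BAE96928281737667658C6B827D6EB25EA0868C6F7F8298A2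
    ++ unpack 24 0x66836F7F2CB3CEBE835E67475685688578750D44B27D986D72A044D099907D6BB67786748F6C6764A6B2A2825C7F9C7ABC72836D6E6C81857E887473E056F284827F768C38E48582757C302CE475856D6579729A77937E7504A8E881946B7B6AAA926F89786E62A7B982847F788EA6AE758970749B929362857270C678B2818D786CA192B3A3897C609B7B9E679774756284A467867B64924ABCA0896C5C1490BC898C797B7094A4
    ++ unpack 24 0x6B9A787AC024C882847F65BC719275837E7FB2D0856A8277696C92837D827C777394816F8B627D200CBC81987A75BC0EFE689B7E7264668F60976B7D8D5C8F69927F7084D48885825F5E604C9C81887679DF49B285845F6078E8D4709375742FBFEC72876D7574C8F8828C7B7A988A965A9162556A5493899C6B6AC2AABF668270643AF3E995847B6479F0F77E89716975EEF9868F767D3035B2928F7C7B878EC6899E7C67CB7DCE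
    ++ unpack 24 0x898B6A6C70B8D4758565686B738E869471786BAAB094846A6891758698876664898FD16C8E7F7476868F87937A73D55DB29382767486F2B084827F687D3B8C7D887B7E9C92878B84717AA6609E8BA4727EA2779D848D74707DAA899590736F8A50844F8366619C5B8E7D8A7B66B06A8893917F6A5482A267867978E03CD07B816A7587A3E990896E790E74E085956C6FAD9BBC9C826E7D8A77918E95766F7482B29485756F9A58B8
    ++ unpack 24 0x818B7B7A4FE28775826E68A41CE889857D76B844CC8B85747C3878C46A897F6EEC86FE858D7C69A06AA87C927879D8E8A89183626C5647A473887B6D9E7E98899A6C73842C88758376693862AE708E716D4CCCAC758A6F7A6254B27FA4765D71979D8784726478D0B075867D74505C84688C737CE0E6C2988E675CAC4AB07F847876749B927089786F666B9C8F8C7F6A4854A26E8777706A979C83887B7E897F996383606D779BD7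
    ++ unpack 24 0x8F8676759A60B08C826A6588AC8E9D9C434762BBB59093686E3310A3A083626CC814DD678A7F7CC8E4BC6F82647D283CD497896D6C6484868A877B7162A68C7BA26B73CEA189759C7B5F6E5D998A98797D1D65FE658D6C798A64B2908472657E5A989BA37C7572769F73887E7192A2A475887164608C865C8A757D9C3E9A729373669533D48288756410B4C0708C776D5032A777947D798FC6CB91877A7776A88278836D6C98B682
    ++ unpack 24 0x9CAB625FA4AC81748A7D7CBE689E9E81705FD0429676826C7B7C81888E8F767BB258B6789C727F8C3EE07A88736C4895B164956C574B49A08C987F6CAE4E8EA88452535EAFAA679B606BD04C9C9586746F9C5CB06384585F7240D885826D6F99769574827973AC1D96938B7969A18FB9918661777C63906C8F7E7DADC8EC8F896D76AD3598949D775D1A35E979857E7F9BCE92539A6150B98AAF79856B6A7F998B6C8A5F67C2B8A4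
    ++ unpack 24 0x9F8475666ECEBC96817079C2C5957C8C6879ECB0B6878D7478B8DBD48D9377640454F87582647D3050EC97837978DA02D16D866F75955998819D6458A735DA6E897E6D3BA48C95987572844EA47F827669DC7CD87383746562549894917C7059B6B07F837C757B4E8F909179727E6688698E676A53B2C181917E6B999EB28B907B66CC40BC95816A7AA85AB4888C676CD5858F87836E72D053EE658D7E55D63A9A73817E7BFE1A9E
    ++ unpack 24 0x7B84796440F8C88F927778589E846A9366765C98B481917871A2909E8E866B68A444B88A906F6E5CA2B28681617E8F9EA272886E707A4D89678A73703B6ED19C847D718C34D46882737C6662B68697706572B488698D7C6B4C66927585726F9476F85D846C71D478E887857C78B09E986E89747E5C509E6595687E5E969761836C5ED144DA859B757E215DB7818C7B6A7260B0848F7F687577977A986267BC74B474857D7562D1BF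
    ++ unpack 24 0x668D717E757D8C9E8750780592A17D827476DA94CB9899627F7E50D485837A68B0CCA879996568896291929976756A6CB28E96645D7B99E9748E786792CEEC7387727B715FC8848D7B7D9848AE68857C733B35A78B8E7F7DD05DC66D877364696F8E958C697EBC418985936E74C438AC4283356D39C8BB669B7875B7DAEE8F8C7E7D85359E949977769E71D1958F727E8C08926E8F736D86A0987A83717F5D829D9D916E7F0CC4FC
    ++ unpack 24 0x618663622C92B65E8D7F696E48BA9089736D4C28D09B96796850768E91846B7FA09492A59D605DAB4F9A86817E7B8A74B866817E767B70A27B8B7F7799E9FD718C7B6E5CECAD899A5E7E2FD7AA7B94726AC592A496837A796E669481847A7076E49E97937C76296BA4708A6774099CA3749A687B1CA3997E89716D5E6090738975704967DF83866F7F7E548C638C6B60BE5E904F88667DBCDEA0778F7F702103A87988667E928F9B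
    ++ unpack 24 0x849F7154ADCE8393A15D54665E8881847E64565E8A7E95766F9B2C86B69F695E6073B57186687E1756B1758C676A9A68B0B88D697E0BD4B67E84786C8C8195828C67623E4DDA8D816A7E7AA2987B81787724388C7B8B697C6596877085756C3A99E46B83746C777EA37F916664C474BC8283727A5270B67F82627693999799847E5C2FEC9B7B97726BBFB6BC92887B66D456F0A2887370953EC86985797732FEA479947D6A9CE48C
    ++ unpack 24 0x7D8A6A6C71AAA764907B7E7AC28389857068CE62C5699170684A53B385847E7853B0C284896676149EA49C84677F7BFD94988A6B6456B096778B7871AA2CF0748175677617AD89967F74E33EB39B876E78352F867C8F6A74108EDB7A8A7170AA6C9C75836E71CC74C88C887E73718AAD7A8B615D6454E06A9C666DB638B961A3686FDD83D4919E7D7FCE6AAC649865733571C692907768A0C0EC8883796E54868E979A7974B4A4B0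
    ++ unpack 24 0x769D7F642F8F8676827B6F999692918F7279C13ADA5E92715DB84CBE878E7B647DBCAD6D927E7B604C984E83576E6D9AA38390686EC5958C8785686D35D18F87996972B864A66A896C75837E998885677D56A8A099837A7F4C7CC48D8A7A6A5C24D452927354DC64A295857776849CA26C887B7E769398829767657810C0988976677D47A18986766724B0FC83916978B6A2988F826F79597492B182597FDCA4BA66886573D074C4
    ++ unpack 24 0x4B86253CD2699F6581756B8C90CC738966628681937A927E714F569587866C66B2E48A6A8A6F7CB4BE906381716D951ADD8F8C7E7D85359E878C7873CE4A9B728D7C7BBCC0B07E87595EBCCACC97A17B64BA92C087887D67A1C8BF90836269423EB87A857D669895898B9C507F5E4F95938C7F7564A3FE96B95D5F4AFB8C55936C525B4F8C9C887F66A830EC8A8467642CCEC564906A71CC6CD8898772789A5A8A908A6F73839ED4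
    ++ unpack 24 0x6C8B7774996D9579A3686A264EE96C917377A7328664826E67417489898A747B38C4B86E9A707F7D50CE81866A70A254C499836564985CB390967D6671748282817A75C05CA6888D766FB089A7668A7D7FB065B652A67F6CCE4CDE6790747594A8CB8F8A756A8C4C8E9A82514B6E5D916F8C69759CFE8E6D83797AF050C46683657087858F9C827469A696A89D8C5D6DD478A09C84667F862CBF69987B64B020B876857F7399909B
    ++ unpack 24 0x9481566FA00AD28E846965D441C5708679673EC58F82876866D044FD9E81656B5658C08E9C786602BF9289847172544496878A77703028AC9F97665D74988E888C7F764E96926591725CBC0CB86E8E6D6CBCA3B260847D767088F0988E67718A48B487837163A4678D8A867D5E20D1B9938875664177E96A8D796FAD2CA77A986C6699FD8A90826572CCF0D4918B736BC4C8D481857E609C4CC492907F6F3532B9A689464E6BECF5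
    ++ unpack 24 0x78827B66AE56A46D89757D8284A67E8A706CBF8FADA9835A36513BAC7387767AB66B837A91787003D5DF689477678ADAF38881656489EC929A81677AA87C9EB9965D34C157AA6F8F70785CB6E681826F637D4ACB6D877F6C838A86659F7F7CB4FCC49FA47E7AB460E866A17B6C92BF898B826369FD5D948386676D4E88C47E99786E6C5EAA7D846779DCE8D48B936A7BC2A6C683827C7644ADA37182736A7ABCD47C8F706F795DF0
    ++ unpack 24 0x92977966C18FEE768566658FC2926B887D666EEC9B7286615D69678A7A8C767B6E99968186606AEE8FFD7B81765EA471B0748E767F4C60969E906F61B898D479847064474DAAA39E796F2F4DEC6C91686EB4BCE05E82716391678E95836A607F7B9E7E867D7FE0C28C898D7D6C82B68C908C777A5060966A84766C476BA46F8E7B7C18ECDC99897B5CF054B073907B5C6C82C28F947B7408DAEC73816F687865866E9376750826FD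
    ++ unpack 24 0x8783756D8291A37F8375676CBCD881827C6D6ED4C876907375B2E4D073886A6770DCAC6E836D763E44A47C897A7D6C8E816F827D783364B87D866F6C2CA4AA77827C7088ACDC698C7B6E87678E6B8D647458DFB28C90786D9CC48495977D71C8ADAA8492646FA397B16B99685E8E8F8775976F78F303A862827D75865AA266907F6CD878A4A0837C6C08C0CC758F6A6F74948A76866677206ECB87857C78B09E98788C737C689082
    ++ unpack 24 0x8A8B7A715821B77E8C7D6E626CF8798676714084B471976A77CEA7A46F8166753A7BD577876F71538AB27F827C66348CD09388796AB87E90708F6B76413B8C6D8B71767CAE9A888E6865F7CDAA9D8E776C59E0C2698278736B75848E877F7BD808E085837865B092EC908C6A798F97828186666F7C659582877D7F77B9BC928C6F6698A4B4718C686F907688778F635DB65EA67389687D3250C29A8E79647E9EB87F917B7D3A79B1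
    ++ unpack 24 0x64826F5E1DDD8F5F9E60677D4D8CB3B16A566F44AB639E607D4AA6AA9982707B5674B0748E7B76AD71836B817165878E9487927F74AAC5B3678C7D72584CB6958F73707F8B84928C647B6587937F8361635EA88269867B6465CEB968867F7D9A8B946E82667F4E64AE73816B781EE9B18F8C766CA3179C8D816E6ACB8FDA8E81737E6E74B9978B6A74AC56907D8C6F7A5C8AAE758969738C9EAD78816373C0668674877377839886
    ++ unpack 24 0x888A7E6B97908B948467755A8C9E9285726FBA8A9C98857D66965A827C98727FD4B98FA0856B7494A6B286877F6EB430907D897B6E64E8945C976267D438F083937864C8708C7385647FD071B7858B7073B09E96CF86272A3D6FCB728368696264A4848676733244C25E94697529BCFB71817463FDB7E45E827D64AA02F8908E6B75CE359E6A844D47B486A21C8219133E42EB608F5243A986915E817656F5C8C28F8C7E7D85359E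
    ++ unpack 24 0x91884F50B3F2FE8B9472765866A4A181696C745A8A6D82667F74388890856D72A6B0C47C826E6F5CB3BC708378731040B88A8173608654BE6F8F7D7ECC7CA06D8B5E73A4BC905E8265729193A38D83657A6CDCE46986647E6D8F9A6F827B781D3E8BAF8A54610847AA639F5C77A26EA88683726A9E6E898F837A76C2BCD17688737F9466969484696E685C836083736FA49388D28B2241A51BDA76835C5F3256D1728F7E63A173A2
    ++ unpack 24 0x8894776FA064B83D813856CA97C26D857A6C4179E9758269723FEEFD87897663A024F08E937B63F090C84F824E5F96689F7594767244B68F6D8B7770A0A8B25F897364A23CC09D817E711CECFC85926A6F6BAD98878B6C784A92B46797647EE96BEC988C7F6C5089929692697A98A0E48A917264847B8898856350DEE4867E8F767BA3E4C19990776471918C7F9466547A1CDC68856D6CB9538C6794667B35D58F7D8B6F7C8C9EA0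
    ++ unpack 24 0x738C727C5CAAB69E9C777824F0B8798B7D6598569A64837879726AAC6E816D6AF82BE46185745D3A1E95998F707F8C34C072836E6A98A4B4778178656B989773A8576BF8D1A764896C6D6A8A8C98817877BC67E48E8C7F6AA41CCC7F87756CADB7D581986A75A252A47A8F7D708A8E98348439384CC9B68F8C7E7D85359E928278768C659C7289757058F8E861B26357F811B39782666F5CB4E469886667C2B3D45D9760777A7B9D
    ++ unpack 24 0x848E7A774A9E989B87747899869664876769AA59A169857F796F7A9B8C83627894758A7C8D646E72879A93827F7576728F9B83746ACB4AAD8182625D7B6B8A4E8360621AC8BF67816D74E46C9863896E799FA0846D8F6561688384A384585A0B14BC88997E6C0274B07D8D786896569E93817A74767BB28C88656C448FF874947B7E0220B65983705C2FC5EC8A81677724E4947A9475713EAABF8985787056C5B36B986F7FF804B0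
    ++ unpack 24 0x7A8D6A6DD45CD08F977974045CD8948B727DB47CD071937767D47AE985A37C79C2AD9E71826B5E98E383878A7566682C846A8E6E799C54947B86707F88E8DC6A8876756977916DA36578EC70DC6F855F5ADA1CD485816D75762BB294837B7462B2A389866C6AD47C887D8E7577C1DACB84896E7A4A2FA7879076747AADC2AA9B715C9D6C868586756A44D0CC668B6F6A9478A6AFA67D77C8E48C7B837C718C34948A867F77607CAC
    ++ unpack 24 0x65846469AA608A798274693B7A9E78847B7E778B9183996269CBDDE9A2827D69E9718991817560C420C0798D656F8F70897782786AEC50BC8782656F74678D788750615A5F9B8D95786E65BFB67A837E7FC4248481916663A0528E6A8E6E799C54947898757E56C8C56E8D7F717D6BA493837A797775889C877D73967299A18F6D5E89E09593977E719A5EB2968579675058AA858870698C9CA083A97560EC88C081826C6A8CB298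
    ++ unpack 24 0x75885F70A09AC08884694F75959D8B8D7B6EF5E3AD74976D7A6E9EDA9183707A56A4AD6390655CA640A06D817172AA58987F997679E986BF69827266C223A19B90725E9EA0AE8E845F78DACE959E85615C6866848B837E6EACB894708D666FDAA4D76B98797ECCACD4698F6766ACA08475837174BF38B382817A764084F470916C6BF8E0D86D87707C8C958275867876AC408C7894797A8E6E8376846B719649EE63816E7ABE6AC0
    ++ unpack 24 0xC587384CC17EC39483514E61AE9C92986F717D898D8A9A6A6762B6D165846B7D9CE8E45F83626D6F8DA3848E66733586897C837466CBDFC18A8273664CE0848281776EC430A47B866473188CA08B846E73C048F0D184433F48B1D59A8367738896A8828C7F764E67C18A886E75F8DAE078947F7DC0CC8474816F7BB077A76E826478C59BC8638F6976B7E9C66C9374703823E985936965246CC89B8A687E85839A689479644C7E9A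
    ++ unpack 24 0x7E8C7D6F9847A18B8168763AA3AA838863723FF8DA658367702428B0788D7D7298968A5D8B6F789482BA74816C7A5C59C273867476858494A9A1584D0BC5928A887F706EBEC288867172BE44B26B8F6C78DCC4A48A9A797CE01CD871976D7450C8AA64977377A298AA8793667018C48C7F847876749B92978D796A7E62AA6B89796E7D8C848B8C65765466B66983756C48179C828F7A784D448C69837C675359B96D9B76799AB2AC
    ++ unpack 24 0x7C8B6A6F6418C0818279687D4A9B658D6A707892B2658C7A6C7B888A9E8C715E9BB6BC8A887F73AE6CA66F886C77A410B86E917B7D1C44B7A19077668C7993938D7B75B494AC749C79735FADC598946D7F85869B9FB67E4BEFA4FB63815657537DAF74917C738FB9B38A965D703049EE8784737594C1DF938B646A7388977782656FB62F9E75837A6BE48CA48C927D72C5B38F7F847876749B92878D7F75533FA385887C77666A9C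
    ++ unpack 24 0x8B817B6B4068A4668A7F611CF0A87B86695E6860828F8678747C28A08A8B7A6E8D7C8960997F7BA41CFC64986F7621A3949A87626E83829B749B6B79788AA28F9D61709B6E9C7E936A776C9E84998772655CC8D47F85797E33AAA3908776714F2CA3828E6B787393859583697824E490648E6B7FBCE9F87C96726F83A7CE828973799BBF988683676CA26AAC82877B6F90B8966C8B6D656BBFB082816A6E3826E05A9057731A29A4
    ++ unpack 24 0x8E8B7767E6ADB06C8C717612219968856976474DB06F84565D929F9D778C594FAAA8D496926B7D769B9376986570A1C2E0948A777F79909B748B7A71A79B89638E6875A470945E847B5D4448AE60835C6F683CA6828A7B6579948D8685676C5A6AAABA916932BBD0898D917772343C98879C687BC478BC81945C636595E66D867D73D477926F887E7954849C748A677C719CA38E827F68896E8F99837C666C3C8885836E715344A7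
    ++ unpack 24 0x8E9465798C859881846D7A7483B0A3865E63569BE98B877E6F5DAAD47B8F6E788A30DF8C937C64892F98698253618F87A874877772906C919C8171754A9EC5AA9155484AA1887E8C7F7894708498877B69B85884799A7A7790CC8C7E8E7D739E92AD9E876860D47495578175529903DFA089706D923AB869917A7D4858BA6F887674898F847794796D2CAAC872A14E58ECB08F8F9A5D685CA0919A846C674C1CD8988D726A089CE8
    ++ unpack 24 0xA5857E56AD0BE9879C7A6E6C3FDF9C916E6B547298998174708788856F8E7D7978DCE88F8A6C7AD07BAD9A847F6A7D978B79817C73956499998E7C76B460D89B927C7B26F3DF91866864769993AA9B706AE935F26889646D76B09E798B776B34E8BC8D9B7476C583B377906D666C838771947B7D7E749E7F8D6A6B70DCCC799E6961924EBE6D98675ADC92D0B0825C74E9218A548E5D61594FAA83926D68B1FED47A837C6833B8E9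
    ++ unpack 24 0x798266686C3FCB8B947E7C9E53B778826C6DC617E469836B6C84A0E482936C6F545EAE7F836473BC3AF364816E69388FB98B896E7E8496A47F946D7EA85A84668E6D6886A4B3648F657FAE7AA8718162702541FE6E9374783EE695798458633AACD28993736603B29E72837C79358AA86F8A6B6D869AB67B92706B7F6C8677947D71A168A79F88747D96B692908D79748862A87F8B6F66EE7BD593895E7E96978A73AC525D835AA9
    ++ unpack 24 0x7F847B7844DCB8738276784064BC6B927C6F2B5DDA7588796D8C62AC93896C4E61548D7E8D706F9A60A2618178714E92A47093767D6C7896A48B5E7BDF3ACB7F85687495A4AA7489756E5C7C967E946E7D9C819760AB72753BB6D18D8C6D7E59B3B689866D6990C2B29585506C48A8BD84A26370BC7ACB7381796B6D689A86816C648C58D07A91666EC4C0A481975C5E9D88986F8665766458AC568B554A6CAE9F858E7C6AD01C9C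
    ++ unpack 24 0x7F907C7786AA9A49A55342C289EC9483736F7F66959E82736865878B9084716041A3E28D955E75B676C89E9965706826DD7A906F6840C8A08191666AB6749B73835A5B9454E099977872E93ADAAF88431F693EAB88997A77844C9A6582757FBC2CE46497767E56C89E8E8A797CB4A4A8799B6F7EC8C0E484826B69412F8F8D8369787E4CB677877D7F47A1A465926B6C6078C49097727B6AA682758E637917CDE2878D656435D1A4
    ++ unpack 24 0x53884E5F5469B096817E6BBC7D8689987F7B593E9B6D8D7B7194488483867B64B4549491826665DA3F99828F73755662A19A8D796798F0EC6D827560E671B0748955482C10CE7C8B7E788EA3E28A9169795FB0988D8F7A6462C1CB9B9170713094D4879B705FC8ACD07086756D5A6A8C868E65708B669483A8547F7A3090778675768C83B6818B656C686BC895846F7E677B9C7C827D69948986718D797AB708856D886C60EC2CA7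
    ++ unpack 24 0x6C857278A868BC8A9C776DB4B8CC71907F6E6282947B896875A8D8CC9F9B7072AD56D789817E726776846D8370683EA1C88F997A753F76FD5D9F5F7E6EB8A68A86757B649290838A747CC1859472856C6024ECE88A8C697B0862AA7A817166C06AC676A15E714ADDD77794737B8AAC8C668364686D6EA096856C6EC074C8778876741709BF69856B7A5E3AAC778E7A6EB0C4A08E92797D759A8D66906B616D84918290737814BC9C
    ++ unpack 24 0xAB8A5B6B4A179E94876772989CD47F856B7C886C826D857A7D1779BF778A717C1C60C097816876B84CDC7D866C72588AD57D89696E4CD0C4A099775D7165CE9586557BD1DABC79826578CB67D06887727FB252A881955E73DDB6867A967B7908208879817170761C9969A25D7133D495558A5D549C5684A3837C739E7593608C6A696252AA6E91727B5EA499718D69686E74C59C86616C294DAD7D827568817A9A759C777DB882AE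
    ++ unpack 24 0x669B6D6C4CC898A295737EA49F8A6B857365BF50D782846C6A2FA1BF908A5E75A166878A8E736FD070DC9F916C6EEC7D867B88707A6EB38C7385776ACC68B46984786A676E9C7B847E787098CCB1B56E3DB372B77F924F59B92CF85F82686AD7CB8F85837E79499E9476897C79A6A2C89D86604E8757B16D82647D5AAA8E7785747C6C78BC9A837A7EDC9C8C6E84736A563B98948C757B72A8906B907C67C4B8B47A856978A75395
    ++ unpack 24 0x8E8C6C6592B4AEA6923944F57AD797946B79B8A8F079A27E6D5F68A07986766B9EB4826D8176718B79858B826D656F628D62817975867DD769817C5FFD21946D87737185999699817B7C9EE9EE508268637372915882537FD2B0AE8C827B7CD4CDA386956966DCF0946E83697C9C98C08F9B7B736BA4B095867570D435A465867D6A8F7591818D76755C44959591726E03ADBCA786515729F2D466926D727038D85F856C6134B888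
    ++ unpack 24 0x94897A793B50B37F827C76C5388C9A866070766B9F818268767DA79B9C887C6FD8E8A48A897472B959926F8B727D5084888191687ED07CBC838F726F44779281857E7C737D998881696F908B8478947D7992DA9B7C855C5E4EB8B09B855C7E03ADE477967379E844AC8A89705DD1299579836A67C84AA18A8E71749C7383898676699B62B66E877F77FC24C8758A6C708C8F986586756AB2C0AE858D6068CB71A146A53914DF64E3
    ++ unpack 24 0x75817E7BC29EAA71827865B6AABC9C886D658553E48D936F6A6E78C8679A6D7F3E17B97D8D6D67388CCC9A827665D74ABF64826D66D8F8CC7C8E6E73B0F8A87790717A4840A471827B64FCF8908E907F78408CA06D8A725DAEA2928F9C7F7E907492818A787AAAA48C9693766B359EFD7B93727C56B98CBD995447C620B67A8F796FB16B9C738E797F71689C64887D7C3444E4768764634E58C89C867F6B324ABF8191747E94D0C8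
    ++ unpack 24 0x7E81676B6AA88886816D79895FBF72897A6FB6B9A7988B6574D4E8908F986D644D329B70857C73A8AEC078827266B9E9B6959776751020F47F8A797830B7C1658A6B6FC2A6848C827B7CD4CDA38982717D85A3B285917C73DFBCDA74817E7BC29EAA919C717C0BAAE97C826C7F2C48A49B817E668797997A8776758FDFDA74976A6B79858B798C786B7EB0AA658B70737CC09C82907977BC38B490935E66787C8967826462AC38C2
    ++ unpack 24 0x7298657B7A48B6868A7574E608F2718D766F8CD494728973780899BC8F825461F586EF748D767CCEBC98798170754D3E9B8F876E677383897E81717BEC41CE8287767A9A469C7E9B6A6D789CEC8C8F79763EF8988E817E7124D4A069816C648F59A1A78462635C55A26C9F5C6A9EB6DD7C8F6A726260B875906367BC59E34D973A51BF44CA87837E728A939987897F7DE999CB79837B7EC4849482816D6CC5749298815E6753C5F8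
    ++ unpack 24 0x678F6C7A4CA0D86E837E7F302C888D857C77088AA88186746F5CC8E6B1886B5C2084C889847A6E9579819E82697460BE94848D6F669479857A9171655D3A8E878171676848C08B84707F44888C88847E794CD8C88681726864779E6283727147C2C87290737AA496827385606E638C93878D7E776086B899897873A6B2967B927F6CB0A0AC8F917F7062A88AA2935F73847182969E6564445AB086837E7353B09E6D8D6F7250839B
    ++ unpack 24 0x938170685F74AD81866D5FF0F4909A856D725448E4778A647B5830E87083786F58ACD084906E79609D836998726453AAB69183677FCB77A4708B6A65B48EB66D986577955CBC9391605C8FC5ECA1926370443EE388836A61709EA26886736C8F89D197907951082C896484696DCEBCC26F8667643A70BA94826766AA3E9B6B965D5C7869A088877F6E32479EA0887C6D4D50CE9E8F646C6B50CE8486797EBC26986D9472717A6695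
    ++ unpack 24 0x8B8C717B7C7E94818A77734168CE82816F5E8C1AF8A38A6B788F7398518373636703AD6B8F647DB2FDB7D8852C273B5EC6978C726F7E4EB8798A6A69C8509478906C71E638A48B8C6976C547CB738E7F7C48829C73857275B8B0D86286635EE656B38F867874736C9386917E6BDC1C909B82797CA04A8681896E72798C846E8E686170ADAC8F83786FC238A4AD9F7665F883B96B86746450C49096896D79C85CAC8B827C77957A8C
    ++ unpack 24 0x76817A756889BC6B8177669079936E8A776C6A12A18D8F747A6E53A47086776C88849E878167716A7582789169764441C8768F5C7C20D1EC6A834E736292949995745F7C8593889075729C40BC98956A7CAD5DDAB194647D2FBC897D885D6AB852A0948A7B6E5CAC96699F7B675D73849F986B69C2A6C66D9C7B75B0658CA58213152F6DC68C96677E90D4A06F89765F8E9AC86E81665E657A9D6A937866B9B3A4A7816F585A8CB1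
    ++ unpack 24 0x74937978B8C6C87F90666E787CE471827D7667D5CB90875C7A65A3A94E8C538EB33EF574877B5F3EE99292847E7B7A74A2859B716F86748D6C827D63201DBC71987F79A684AAB1907D5BE2A2C8B28F55745A52889A8D686C4E4CA4878B6F6E62A3CB83865C75A8D0988586605F38E3BC5D8F637784769497865A65A19488A7836956B2ADA98E8D6F7BA3448FAD8C5A79F24DEC7A976E7F4D5FCE8A887C707F648F5E8566765AA0B2
    ++ unpack 24 0x678363608953D474875C619E28CC95866A73AA60A6988A7D659A4AA47C8B6B6D0EBCCE91825F75F274868B8C7D6A8FEECB6895787BA29AA38687746F44B6987891657596728A7E92676D473E959E826D7DB0449C85837E797432BF689B6B6A0CE8CC4F8679517794A79099797AD5D0F85DB54C47CC20EC7F897A66A4A1D16F9867743C1CBC688B74664C7A9E7B937E6FE864AC7989787D849C8E6981736692789E87937D7C53BCE4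
    ++ unpack 24 0x7C956764C5A7BC71846A6D266E9B65876D67BF7D86658E746BB440D472946967AAD49B7892737B54A0908C8D686D4EF89EAF99565F54A79068837A7B8F8CBC798175749EC2AA768267739598B95C8375696294A1A68578549873A293877A70472CBC94905D6F2CE9ECB09A6071B8D4A66D8F647276BCF35F906A6FE3539E7D827476DA94CB708C5D773C5E9C7F8C6E79DF99D09287717EA28A9C968B6D788D70869283646C67889F
    ++ unpack 24 0x88867361504C8E7982677C3A76EE6C90776DA4B6B89591787596668AA89759666095B2878F707E7D4495718A7C666C5D91738E7B7C9A77968E877C71A264947B87757CB89CDB799A6C67CE50896884695DF2148C868C697860AEA29684686F83D1B3849875658FD0C163845C6E8E70866A9C6B6C8ADFD58584726F9B6D9C968F76655C9AA88695746E0D17D582897B6D402CDC6B89716C9848CC829A6B7560A49663836A57528E93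
    ++ unpack 24 0x86B97F6ABAB18985897E685478966F83766DD058CB6982666B776C87838C6E7B99B29E7989697F85679A748265756E62F2B48A4B68BE41A9728C6F678269887782746A7DB6B371847B646CD4C0909B615C2053AA8A96616D977EA47F887C695C29E97C927879D8E8A88D8F6B7683829B6E8F6A7264849B719376798CA0BC7B876964C8AAA79A8174675D58925E865D5FB8DED050874E55B54D8A7D897B6E645A948A967E69D8C0EC
    ++ unpack 24 0x7B87766572AAB4919A3E477E63B67785686ED4B8B08E886D691E79AA8B976C768654B0C78841645E83B176907A7C736A9A6E8179604DE9E6668F46525A6D9E8681736A6E5CDD68827D7C2F92866283545111CEEC829B736F8677B068837175D189B66D947A747E8A91888D6D6074528E8F9172695362A3818F7E6E2C60C07E887C7547B68379937F7A6C6A84659C6F768297A384907F6CB038B877937D7CD5A3DA71887C709CA0BC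
    ++ unpack 24 0x6C82696F6D6E8F90877F78D0FD8A7081767BE810A8898C797B7094A486837C6FD4749E86987B678388958293737735D498778D75658C839E738E6D687AA0A297857A74B040F4738E7775A284A67288706F77868474906F7A6409AA559D6E4FA172998F84777DA4A68E699666677262A06F87745F38E8C09C905F4F6892AC6593767752B09087A7585D2EEC949C8D7A655C30CC74897B7295F7E27498717B9564976897726D62A4B0
    ++ unpack 24 0x989B6D52B244E07F8B7065687EB6578F794C434F909094726DDAC8E07F926D79827A9091864F530544C86A90797B8F53A897827B6A529AB28A8F787799B2A887996F78A886986B8B6373ECE3AD74816C693AE9F09D82755D958C93888D6B67749A9B6F8675749571D19A956F5CF21DCB958163625F978E9083676F4E8A8C5D93776A3A46925C9469637198CB6E89767BB898E0AF876854ABA29E96857565B0BC8490957B6592E3A1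
    ++ unpack 24 0x9182435FAD67BE698179627490D48D8F5E5DB932B0958A676CFDEEDA998678765CF09CAFA6597DF5C2B3708C7D6E852699878478756A8E90978663748260BA6E87767D1430A899887C6A74449B77987A7C54D8C08B99796E945DA87381646F868AB68D896F78A24CA68D8969666E9DA4518256544FA4AD70827F5FB45CA695867D7E50A6AE768C7A7BA177AD6C816979689290848D6D7E7432F27FA55871821C848C8171771CFDD5
    ++ unpack 24 0x6C8A6B6310D4E065837E746E7F86798F7A7DB2A3CB9C857374689A8A7290717D7F7E9382816665916D8D91837C749A88B06F9572797588938C8871771E6B8E818C766C8965EC93836F721474E68193736948D08852876162140E867F8F736C4DB6A7B982494E4592AF8F9B6D7B701CC8B28145427B5E9D70977F6DAD3ECB79826377848E9E8F8C676987668494937578ADA4B96DA365600818D0558650709E6FA690977C6410B0AC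
    ++ unpack 24 0x9695656149E9B29198797076898F888A737C3E6EBC8E8F6D69486E8C6482777D0E26B6758A7173B0608C8C967B68103CD499867D6AE8889C63966861EC869B8D9968699428AC8581757CA418C08A8D787D6B998787816A70D768AD788B687AA06C9E758A6F6BB82CB0898D7B7DAD2194738C727C5CAAB69F98677EBC72C872826163BC92CB7D887C6AC859CE798C6C6690AE88AD98797FBC428C7D946943BB6E966F8376795EB8A8
    ++ unpack 24 0xA1BA4E695365A87C85707E729E9CA18F707EAA62B4918C7073B95C896E8B74668F799662A06B7EDC90F051A05556506E9D7F8978756E90969088767287949CA5BB5948ECF48A918C5F61997A879984787B72989697817873A67E8478857F6F6C74A677817B6F6EB0B38C866F6C20F8AA7B995F64AC14FC738C76656F9982478443676F89BB918B706B71868D688B766D6E71897A936A675474B284836460DF8ADA9AA5757E7435D1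
    ++ unpack 24 0xA3845E73988789A6A3657FB053E3758D6C76C895D18E87687D8CD4CB6983736550A1CB9087694EA2D2CC758D7E7F7438A8918578757CA6A25B9C6667771A8C77927F7E2CE6B08C8E797B6B569B7B81746662D1AD71827B6E44A1B68C827F647A7DD49C8E7B682074C281846A7AA078829B8F767B75889393997C724810C47889645E696E9960827477758F846882776A3E88A088927161A36AA29883707F528C8899827C69A0BCD4
    ++ unpack 24 0x8D8F7F70A6789CA2967B74A090B66C877B68539E868A96647B5428F87385767F7A829E6E8D72719485D0908964574E928B948476758681896C815C66A28CC6708F4F51576DA3768E73695268A6AFA05B68227C8286896E7B0EC2A47787786192A08F9E827F7C61839A8581707C3B598C728D6D7B70E0F07D967A6DDF9EEEA188556ACCA6AC669173676064A28D8A6C702CB4F08E946B79AABCA1868E6E716259A15B884F6F9F86AD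
    ++ unpack 24 0x90847267A652B893876C707A2C9573857F795276886E9D7F7AE454B075837A649256B28E8C77664690AE8684696364B8C4918B62577DA78E82847F78BC0EA479975C60C6F3DA958B7B6E68AC82A3865E647287827B81737890C4D884826C6E9F6586A2866F7370E88C97867B788C56E6948478765E739A83A3424C1AEC957F8C77707D56A1A483726926179B8D996B74C844B9928777671DEC9B5F9567606C178FAAA85F577828AC
    ++ unpack 24 0x5D8F6073A1E6DD8B89737092AADA7A8E7F7D588FD08288707A5D099C7B8E757186DA9E6A927476415FC26B8D797714A49B698A737F5A94B07A876F65C4489C7191777A906A92708E6E73C24AB094816D7BA65E969487667D4FF7AA47883F7B48BDBF6A86697F836F9C779173708E8493559F76575B79867B88716453568969896264FBE0A7998E6B6828E8C47D8C6E695C7AB68292796A448FB27B977E655C20E47D9F78733AB4A0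
    ++ unpack 24 0x74986578BFB6927184727FA65E9A86947B726895BF7292706DB2F8B75384657E38CAD08E887D74C2B08277B06143B9649166827368679C92678E75786A5482A2855D6E6D9D869A826D7BA1329B7C9F767F94429270857E67A2A0B292966764877F98738C66648641B66B89766E8852A0718978706C729C66857A76CBA19B6181676F68A78696827D5C4888DC918B706C84A4B46090716298C0DC8885767A7252948FAB6456DDDABF
    ++ unpack 24 0x6E81726F7483A4998E756198A1CE6D867B6B4892A883957F6CD5F8DA9A8170615A96BC9091796D9D6A859D88777410B8F49F81725C8842C2C9A33B364298B6728966767AA4B37C99776CADD7D48A817B61997C886F8372676A868C88957B7586529C7C9D5268A271B1A4896473607C8176827F6F9EA7C523841F3A2572E78A92757498C0A884827F767088A28D917F7130A09C8C886766816D989186756B53B99EA59A577D1A0B8F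
    ++ unpack 24 0x7787757F6864C8818A737B5F59C28D8372677A5EB273886C716B7C937E867D63B0E8F0938976739E6E8E8A99756844AD92998C6659E635F5978B7A719A90B08A846C7050A1A4B08D5D5EB1358E7C9B666EF0BFAA7C8E746F9C8288918A786E6D8C8BC6995B41AF9D927389797ECB8ADA6D8165641468A493846B69767B9F7F907866838B8AA6AF5B7A8D4AA27591747C92A7B3699C737D4E908A5B8253638E55B26B83747510F7A3
    ++ unpack 24 0x9B87667086C0C282816A7B625AB6958E6F6D4792A46B8175713CACE08F8A7C6F60D0B47295787354A4827D94646AE9DAA479827873939B9C929A73696517C8708962631A74C567856D6C5D44B2648B686D2095C877826C76417DB6838C636E3A908887837570E4A48C728D78676C64A66C966F7EF7E2C67F8F78701040D46A8576756C7E9C789A756EF876997088797B837AB07B92777AC8ADD17088666B7783A47D8A7B74CE7A98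
    ++ unpack 24 0x9882757C2B5DA8888E5F5DEE3FA88C866C6385928BA08565691868E481827970957C9A728A64715CD8EC85986C74D1CBB95D8E7162C24E909B87625E737E9264827F784EB8AE679C6D5EDA12F38589727FA0869CA49969597FADAE9281687444E8B05381734E2FB6EF8B90736F0E08C877815F62884ABC759B7F6BBC779E9B976360AAB0DD768B7771E02CC2998275706F6E9BA39F6E69D4B8E479837B7E3C7CB85F9B67702BFDC6
    ++ unpack 24 0x76857479983884608D5C7B1D44D79084737968C0A86D837E7F919C8B738E7D65786292A48763617A40BC7B9A5E73B0889EACA3685AB26291659076677D9588868C7172ACB4947389726DA4AD8F8E94757B8CE0C2978C6871D8B8BC928B70677D6D9199946D74B47EAA788A6F6EC8F8B88D8E746EBCCB99738A72696A6586678F6C728592877F866C66796E938A896E7F94749A88817E6344A0BE868E797F5C8CC090927F7930A8CB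
    ++ unpack 24 0x678C647386919798926C713CB0DC76837271A8D08C6B8F7E73CBCE9235A93653663DC084897B787F9792AE89464476DCC088937C738F92917F947D65A68CB27082617C949A99978256671D35AD7B847E787A50C56481697C74B6967B81786E4254A092976A66B6549490886A738B99859F86785D205AB674876A64D81DACAF9E6F7469B2AB68815F588660D8889A7956A4E4B27382626C8642A07C896469475F8682836E7274A4B8
    ++ unpack 24 0x6A8E7471B26CE4859469744CA0C29E95695EC056B23F83122D4B1CC78B8A6D659A77A378836D6C849C8247A134553DC8A56386797F8D9BA47F8B7E7B9834A66E8A726B9A54A8839175733AADB78B827C6E9488C07B847E7890C4AC66837E5F46C68C8E887B74A0E4C8669871765A749688816B746854B4988E7A6E3E95D4698E6576CCA09071887C709CA0BC7988757E924A8F928F6470B285DA9B856467B9AA9288816564EC4489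
    ++ unpack 24 0x7488657A1C4E8A92827F76AAB6A7608364678674907A856D699AB2B8908B6A64E84CCC839267796BC5B6859B716498A09E8D8E767DCE71B96C81746BB29C8A9C8C616032E9B67C8279675F17865C817A748E3A87788262797471907C8870694D89D4748E656F980EA47A8874777981924FA974667E79A77E86736C88A8849789645674DDBF67856477944EAE75977064B29A847181746696128B888766676E6A856C827577718884
    ++ unpack 24 0x738A7C69E430DC8684646D6F99826E8C717F7688979683727F706CA0828F6C6B1C58C47C817971E6929E78996B6C9EC8B082817069449B839787687E78568AA48B775D688D9C81917A71C8BCB67584686758358AA2837A6158C4A08D8A647EF83FBC5F995E7808AC8497A14554B479837682756D48F7A35C8E6662968B857D9370796B7A8886836B6478948193887377925CA273897F703BBCB6719266691C53FD7590767F6EDA89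
    ++ unpack 22 0x8B897F76A4C89E5C877B61583A8E7B8B7168A447839C86756FB8B4EC71836D74C6D0C181897175B953BF699C7E66A303947E8C7D6E626CF88E89666E79858B9E896164ADE6D47E8A7D7C7066AA828D7965B098E8708B5D603C7286828F75656ED1867E8B6E6FB0568C9B816D666E4EB471947E661A6EFE828E6D794C52B67D847F654A8288878C6A68678D886A917D67CCD0848482746412A3C6
    -- The common layout again, but with residues given in full instead of one byte each.
    ++ (full symmetric (26215 ∷ 58116 ∷ 102187 ∷ 130905 ∷ 66865 ∷ 90624 ∷ 8019 ∷ []) ∷ [])
    ++ unpack 24 0x64947F77CEAD9E8A965C77FDB28F7687545F6DA5A0708475773494D4A398716EA028C485827C794A66AA84826F652CBCD89C83736EAC60AD8E817A65A474F07B81757C8C6C967E856F6E8CE3897B8D7E696441F07C9C6C7718A4B46586697E7C6CB07D86797C8C5CA28B837C68C26EEC83827875A46B89858A707F264ABF94857F616AA08D7A84656FE414CC778A7D79B46CC6848D79604066C293877C7D76C49A5E88645F4DE095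
    ++ unpack 24 0x77816F72AC56928489736F7D86AD6E87666F5FB6D16E9477759CA0CC88996B609C24B87B91786E86799C88906575A4BCD1688C7D7ADC5C846C906F7998389B98937873D479AA7F8C6F7197688E378C553A56429492886672A31CB76A8468775C2CA18F8C7F70EC7CC48393736C5640B2868E7D77A3C1946E82767F7C5A886C8A67744DD186728C7168A40886658D6062C4408C75836D769CA4C4789373795D30856B89736A03A8B2
    ++ unpack 24 0x6D847F76C4A0906081766D1014FC8586757CE04CDC9B836671546A8C8C837667A6B0A05F8D6A6D9A54B47181697762919B8C837E671C5DB769936477866F8472837964B874B679856B7FCBE9D094897F7D5CAAE078835E63C04E8A7F8277689EC2C06D906C719E7C82848679745C5083988E7B6A74D8B4A08265626F7B8D74836A79B450D489886F7CBCE88C6A837966B6A1AA9685657C3474C093837476D0B8D87F856772487482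
    ++ unpack 24 0x7782726BF23ECE73836F64907593818E6E77C0C8BC9A81656D2F7DD49C876A71A0AEAC648368728A86A876826E6D99D0D57F9B746A84A4B894887B6E40ACB08B88707D7168B0B081676CA7AE8E7D9B6E797A38D16B944F5F1AEC9E908C6D71A868BC57B479458852B5718B786AD8B4AC6D85746C8B848275887679BCC2A49F8D534F204E92878C51434BA1BEAFB4436FA9B5A46A867978ECCCB8A283606C779CAA65816E6A8C47C2
    ++ unpack 24 0x8E93566957AB8C83847E784D9B8F8581766E6596835F886567A69AC0A29461743C56AE8C83657E5A2CDE73846A6C2428C4509368636A81AA9889727D7AB492B199705F9DA4989C997E7A5CB6AA7281627C9DA2879281776D4A5AB490815F69D7E3C2948B64715C728C7798727CD4F0907A917376688FA772846D703F2BE482967666713E8C51835B533CAAE290846C778374B06F827277CE83B3448B50554078C68A887F7C9E66A0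
    ++ unpack 24 0x82935F63667C8D8593666C76989B8B82697F777B958885756CD062B2B291494357508E75897A73AE7C82DB843619A624CD70937A7F479283D4823B1389119E878475643CE8F466837A69897E8C938C69685056C87C927F6C62DA85BDAE475417D1B367A3575CAD76A18986716CE8748885886C69836F9578907B7E38DCA48798516902599E73816367B8BA8C9D8C7F652F6BD47EB27364561DB97188737A5A70B68E8970717CA096
    ++ unpack 24 0x928E73773AC1AD91835162EFCBC889847578D4DD9B8A896A685938BF3D9B5A3FAF5796798F687D4E03D07A847B759A6EA67583657F5CB8E06D8B7A6F8C9C837B925D781CA0D0778A7D5E38C69278827B71101CC076877E651418DC999B7F767A9E907E86747566AE8E8B8E7B711828C07A9B6A72939A91838F787E2B44A87C926974C4209866847F6D7150C57F8F6E67B294C27099787A4C729672856D70357A8F9886776DEC50A8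
    ++ unpack 24 0x74927C6971CB9489906561B3BF98768D6D6CA27496868A7C7B3888B47E8375737694915C996279E929B083846763349CE8BB8A6E3B5B6AB18DAF3A69BC6DA26A846E658D94A17F8C77707D56A18293717A8B96EE92A366782F5FEC789977692B30FD6D847A6F9475857282746896699D8587626F3C7CAA9A81677A71918A7B837C73B25D9E86887C7D68928195826C7360DC8870857E64524CAC83826F625FC8AD7B907175F86EF2
    ++ unpack 24 0x608F7265844AC069916C7E4EA3A88D856577B446B6828B716D9274A69A8877657A8FBF929B697624ECA87E93727CB6649A878F78764A95D179897B765C1CF0888D6A69899C81679A7D7C10D48C8387737BBF25E97C837A799E50F2998D706B38969A88846A7A5F79904F8C5E66496CA562826169B61AD47C81716CBC95AA7E8E6B6FC608BC73946B670871F385877F76D078908F81697B929BFE6A987571B8ACCC689B7A70A38193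
    ++ unpack 24 0x688575650804B484827176756A9074907F79BF3ECB74966F7B6265A46D8D746E263FBC8185656BE677926E8C637671A4E0758F66598265AE8884756A28ACA871867C7268839472846C69786A908D8C7B7EFCBCB081A267648842A0778A6C708C8F9891896E669BA4B994866D7E9E2B85738370756848E08E85667E8A54968D8475655A889C3DBF5558C75A96828B6A666D929B7F867464BFA4B395856472A428A88C856F739A6CA4
    ++ unpack 24 0x8D88746ACB6B9EB6A36D448843BE798D7A7FA3E4B27A84736E7B6A8879987E646030D49E937D6104F0D0A08A696611C8D78AA46067657E889EA35E63C4448A62846B649A7E818D8565648CC0DC728F6F6DF8F0B063856C757999B07084736AA4B4DC81A2687AC008E095887C7DA7568F92815F60823E9C828166766574BF739662791D74C882817A76A189D472867679A3B89C7B81776F3BA7836B906967AE4E9C719B7B6AD4CEB0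
    ++ unpack 24 0x64965E73B092BE818275725D64E96B836C7B9AA28A9289797A5C56D472846C69DF3ADA99926F6838C4E07F86726A98E6F291AC5A5D64699571937665ECDCE89695767BB65AB889857579CDF7BF8C997E6235FD8A618D786BFC209C8597737D5CA8E46184637E6A98907886756AAD92A496997C75AA26D498976E7BDAC1B282877871664CA69589677314D4AC8F8C7E7D85359E898A79714EA8887A927871948190788565667E6D81
    ++ unpack 24 0x9287767BCB56AD8C9669766C889A7B847E7874629A6882656DE4BCD48D837A7F1878A875986F73B23F8A819B7E6DB814B47C857D4E62D6C67F82737886B0A043B65A53886FAE798C7F78A482A664906A682C4FCD8783756E94C8A8918E6971A744895CA07C5F9EB8A2678E686A50B6948C967B799878D88F846C70CE83B9889B6E6ABCB4D05E85615CCE8CE96F84756CECB8BC67856B6CC117DF888E7977AAE6866A8E6575847998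
    ++ unpack 24 0x8F8C7E7D85359EA18F5D6E146CF47B8F7D736C92AC778A717A58A48E728D6A757C76AC7093646E8E4AB864826A6B866C9A46B3576AAE648579827C6E5AAA9645844A49589CA7839779721A26AA7B86757459BCB3968B74727071879381776570C0D87486757C70A8826A957468D0A8C66B81717B9492AE6995605540D68C9997727E7460C0819072746E3E897F8C7E7020B4C47B8A6C7F8CBFCE728B7670417AD1838C6F649A7785
    ++ unpack 24 0x70827779D44884828367694A74CB7B847E7899729276926F64829484938A69709250B47183606D675F98759A65697A738883846E71402094918A71696C9EAE9B82667F53599E65857075609EC255864E7F48BAC09A9578555199A895867D7E34D0D89981756298BCAE728A6D5D5864BC91A1646DDD68C59981746D70E0C4669C7D7B7159B6968367745F9BAA738F726D949CA6928F6F6D44A8B87787786E2B58FD9C917E75EC34BC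
    ++ unpack 24 0x989379668E768B719677736E86F884907565602CC076986F6B905AAC78936477C860D86BA378835490F0A8A2557696AC87718675783F17A88E9C6673A47C88878D6968627BEE6C876F765A908C8587736FBC74E683A46963E9EE8F828D777B200EA483986F79B282869A8368678E6C867882756F622F92779B6B70984AB89C97686BCC6C907D947A781A08C27CA27569A6BC96988F6563605CA183826F7640D8EC688E6F635F8485
    ++ unpack 24 0x7A85696E9D7C8B9186796C8884BE858E6770A0C4B489857C6B7435BF7A8E7B7F171E956687727E838B9583827C7644ADA38A8D7277867EAC7F8E71755CB2AA788D7476D1BFAA73996D7F7B829C7488697E1C4E8A918F75791AEC9E7F826773C526958784677E359BAD659C536F28E2BE8F827F76B262AE7C97726CF262E66E937574489CA893857565E450F08A846F6D9E94CB9188707A6C83846A8C64671C03F38785705FC108DF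
    ++ unpack 24 0x95816670C824C08A8D6F668292B68BA36876A726C5708A73785CCEB06C8D6A664A088681857E6C444AD7998A7C758C868890847A6E95798156826B503CD4A28F8B727A4864BF868773708E66A07D87677A72529C728F647B6850C2748B696614249878815F62A2ACA668827D6F7159A16C977E6D4E5A848492797F7A778A8A8B7D6F3874B677A64357A167BA9B826870635F9A79826B7F7CD488738C7F7E607CAA7F97707EA48A93
    ++ unpack 24 0x8B8F76786C8D82738561643A5284A49A645D1DBFE975896E7038DC9865987778A8AD8F96827D788AB2BC6C916A7B5971C25C886B715EAAC4738A716EAC989C8490757F9E98A0868E7170846F8B8A887C70F3C6D568837A7B8F8CBC6D835E606CC0A683887A7CAE94A667896F7168D8C082855E7546C8945C8970679C87A19BA6546B3508A7788267699C38A867927163C264BA8B846E6B68A8F86D8D667E9174836E8B695D4E8CBC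
    ++ unpack 24 0x8B9B7F6E7ACEB3BD88493BDC61B6928F6C77C126E49B8D686EA04CEC67A65F525332FE8584655C4C3CA2AC945E4F7C72A1569B6154FBB3C882886D66987F94709E6B7BC2B3EC6A8469655398E092876A5F2947BC7B956467898E908E986F662BC6F88B986F767183C24E8E43476870AD7A98656703DAA3689C6F70A07E9A72916479B0D1B67587686438A4F5748678726467927594717998788A85924E5F51919C4DB753435DA0B2
    ++ unpack 24 0x7D827177682CC5888360753A6E8C858666603A82905FB25143508BC4948B737688798E738669768F5FA78C81697A9C58C86E84616F3A7B8A73856F7CA840C675857A7425B8A37B867567BC3EDD8A86677792789B688D5C6DC09CF075996E7CE8B0C472827C6DEC8CAA6D8D7A76637C8596917B65937C8DA38E6E7398709A948278729EB9B68C867D79847B987592697138DCE0828178716070A292987C60645D8993947274BC50AC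
    ++ unpack 24 0x5287564E88ABA69A816A69929DA47D8D74798EE2F7938D7B729E308F7F8F726F6D84966F8A7C6E44A783709974771041DB88957F72C0A8A4679B7D6BA8C89C9D836C6FFC90CC698D756ACBF8D08B826377840CAC85837671D4A7B98D8A696A1C20D07A8E6D74C6A38F7F846A70989795848D717E966E9C88896A73667E847B8C7779709CE4648F6C7AF888C45CA37E7B3AF7DB8195767A2CA8B483987F74705A887584796EACE8A4
    ++ unpack 24 0x81846D7A7483B066886F747585877391707EDA98AD699356782FF2D78F826F64CED1B379946B776844837C826C6F6AA69ABB8E535A4299BD7F897B6459CEB674815F7BA6DEE46F92767E9E38CB7687595AA8779C7D8F6D673EA7CB9088756CCED4E68D83607A2C90B09F866F705C98AE6C8B7965BCCE988F8C6773A0489C6E906D7E479BA7A49065666A3CB88A815C6AB3E0A19B87585402ADE07D8C776F668F9993837871829AA8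
    ++ unpack 24 0x919D746C7A61A37199746A58CBA375815A5B5F85A2639F6E7596589489816D7A585EA4858A696A546CAE6A906D7C658F8E7882667F4483D1958266694810F87384665D2F4A956E85736ABFC5A76391706188E0E87C996C643410C8968F5E7964F0A4868E74696BB09B718A685C4686B46C8A7567568C885FA47F5D4D68EC95886C73F0A3B8888E6765DFD5BC6282696364F0F48896656EB83C84678879769C94AA6CA26B5AF562F2
    ++ unpack 24 0x7F837C7AE30289778E6C7B70A8BC9C887B6DB7E4CB7F85666F886C827D8C767E4A96927290717B6C3098798E7365C25C9E92897E7B5EAAB48B847E708E68A88990787F8F5FA770936F7A6835AA91887D755C9BFE638C5B79A2C6C466857F79EC02983C9E5463BD73CAC998432AD556BB6481536E98E2CA848A75672CB6B084815D7493759A53B76D36A3C3867B81716A0964878D9A757A1C68B07F85767A7C71947E95767F907D92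
    ++ unpack 24 0xC3B85455864BA167906E659840A099847861BF6BE39A84755F4C58D08A8F6F7D62DAAA708B73687AB494698D646AC859A4848E767990B48C6C826B744C5AA8848D746C8F1CB791906E7EA8268F71877569AAD4A339841922C156EB498673575E6BA881A45B607CA2D87985706B6828DC71DB366FC3DCB29892574F209EB29382746B6569947CAC7255A35F8A8E8575767A74B96B897C6FE638CE8884756A28ACA88485736BDDC5EC
    ++ unpack 24 0x878E716C50AAA7768C717B68C4D08D8F6A6B6EC5A76F89787EFE68E073827B6EA048869583606DFCF4BC709375742FBFEC9A88655DA4E9836E8B7A67A456AD8182777564F0E4878F6465B67E8479826C7CF5D19B75835C601874D4818C766C89E3EC82935E7AC553F8998460797E909B8A817E7B5947EC8B957A667B6C927D936C69A04CB6688D7C654460C063896F67F474E8768C6C77539BB38D867D742098D46C8C7073B440B0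
    ++ unpack 24 0x708D786C3018B48F8170667E848DA1815C72F349DA90887267B7D0C68A8F7F776A90AE63854B48CAF2A4828C767D9088E07E837A7184589C798E746825C6F7AF8C5743AE42A76D857D754010C49088656B18BCC07A816D7B98C2A47084777588969E70827B6824209490826B75D0219E798A7A7BB464AC9F88473F393EC899866F7488CCE87184707D8C7A8A8E926671A85C946D8D746E263FBC6B81676C9E8DA2718D7265838B86
    ++ unpack 24 0x9289666F769C877A836F68DD38D768837A7B8F8CBCBE8B5C3B9A51C95F88655CCE9C8E7EA15A5746C4DC6A9173726E7B8A76976470B862A2949F4E5C2C47B676817B725FB98365837176B1A3C67F856C727664828A8472644750EC718B6F7EAC7C92848D5C6DA726B079816F6A8474AE85947876C112A88A8473776B9A85878464766696A49182757260E8F8858E7C659C7EAE77816F7A88208C9B8B716D88C894908671675CB4C0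
    ++ unpack 24 0x7D867B7495789496997C7064C0F0988D647D8285967F82677550D8907D866D738C329E738269688C64E86882664FB29CA494867B77627EA64F89514E6B5893768667717297827E8C7D6E626CF884925C63D0FCE06E8C72787165828D84687D242C8C54837079CE0BA1858B7C730E329898967C658644C56A8D6E647D89B99989705F08FBB3AFA75A563EDCBE93977A72B99B9E75936A6C827A857E86706B6875969085696247A1D4
    ++ unpack 24 0x6186775D729CAC8E896E6D8F7B8768947369A75CC57A8371676E859A908269724AAAA68A937F7E44C084968C78647BC6E9788D776AA14ABF98917A797872A07D82686E6A4E9A668C564F3E29FB82897B665C678A7481667B898F9C75827D742092AA6989727F716B9E7A977578E971B2799171759492A694996A6D628EA4888467699CAB9B8987686783968897896674B4C8B096857269CBD1AD7081796D346484908C7779EEADFD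
    ++ unpack 24 0x858272672C8CA772845C6F33C29693876E633BB9A77F8979699B6C85708677747CA4A6948A6F647397987D977A609267A9978F74728AAABA58967F591417AD6C8D7E77E4D58A7093767F7A4AE06E89767BB898E09CA15D6D7435C8759A73609538AA94816874C082A07D8575666890B077817E62609AB884B54F6FE626A788937A7317629B92887B69C8AD8C72875E6E54B09E94967061937A999187766DA66C9883846A656B44AA
    ++ unpack 24 0xA4B269759ACAB064877B70D0C4BC7A917C6CA85A9E708277664C88BC6D8E7C70828B856C816465CB86B3CC875C5371C4AF8683796A8D75957E817B7A8E9E8A6B8670683FFD99798E7D65D408A470865D57712392788B7E798F6B9C7E9B6D6E8A4EAC99A4636D9E54C48D8C7E690C24E052854E7C740BF872977C78944C9A78937E7A927C9E69877E66AA969C98857073EC7CC48E8F7F7798B3869B915F71C06AC4818273672C44BF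
    ++ unpack 24 0x6D897A7098849E56AE7B67C535FE878A7F6E4C10EC948F78664DCECB72927C7F50C0F08A8565744D9EDA97827C774E92AE5E996572445CDA6C936B692CD8A8928364698D7C986C9D675ED7CBBC878E7F66886EA476856E69B8ECA4A0A35C6F860BAD9C937B52F5F298A48D7B7E23C2D1898C6D6F5CC0B47D857C6B56B4887D897A6AC89EE094927F6DF91D966F877476781090719B787FC08CCC82887D7C9EA798578E6A507866A4
    ++ unpack 24 0x7690716C7C48BC75866B7C4CB2A88D987B7DA04C86698271726C4CAC948A6E757A74A87A84766F704CEC7D8C6D73C608A39884766D24E4E86D95786E76AEB66D82707C7459B0768B7D733F71B76689677C53B3988F8865738C56A093846F7B6C648E6D847270A0D0C88A8B6F7A5635E66E817569B4E0C89481786F8544997983676CB842AA84827F75324CDB828568616E919B72827774BE38A652B16E5DF8D1A79384726753C6FD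
    ++ unpack 24 0x758360789F5C867E956F6C8AB4A888866D69D425B89A936B7E9844B984866B7E67878E8882696E644AB27C82757F4A41D1798A7B74A38EB1948175743FB2FD7D8A6A66B672B46A8A66779E5CBC688A736E44F4F86293635F34F4C0779B7F786F7D9869997773D53FC66D8A7A719884A477857D6C4499B2948368788995B97E94657D8B9081938B6E77C8CEDA968467692470E48C8A737178B4AC6981796621F8A38F8A6C7284AC9E
    ++ unpack 24 0x729A736AAEACB47E84616B6ED4AA6A8672735860B67F8276672094DC6F81777E1D6E9B61826D5630BEA091A1706B2153E47D8D74779164846E88657FA74AAA9B857C779282A8819174615E98BE8E847B79AA95B18186707D14C4E07782667648E8B066827D743556C8648B6A71C250B6879150514EC08293906F789A96A88D977B7D7744D17693697CA4D1DD63937A6641B6A1749466764ACE9B7C867D766B2FA497A74E6EF265B3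
    ++ unpack 24 0x6C925F72A0A6BC7B8B7A6A532BEE9095756D968497829A7067A0B4B28F8C7E7D85359E7C856E6A3E4A838D917F7130A09C86856E79357DC299837C620CBCE88C9D7360B270C0988C6C71CEB99E978260797C569073817E67C82FD47F8E6B60F8AA9E5D83756C523CB2629156678635E391857A7568668F81947D717B8AAD7B847877C4CC8C928271703F6CB297965553A7BCE07F8D7075D17AB0908B6B6546629CA89553515044DC
    ++ unpack 24 0x9396777F6285DA969B76789586C56789746B3C8AB8709D6E617B8DA26C896E73769B8F9384715E53B0E6718A6F684DB6C5A08F665AD405C2769C655ED42092858A7A6AC1FD946796647E8C2C866F956178E4C1FD9C8D74703003BC988A6D64701CD88489647FFEF5AD89967B6FDC28947483737E5478F093947B754850F0788767504EAADA69825D642914A164907B79089EDF749376728BEE966A83657E5E8692A289766D677482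
    ++ unpack 24 0x6A8374737EC0907B95776F4FC6AA83845D6FA090997EA2617DAA41DD9A825C75836C965981625079AE9D779E6D5D1C039493B065478151A77592767A6B89A46E896A6D5C48F06D916E77D567AD9C877E6558AA9A789179708C6E967D8B7068B68C8A869A6475968D95868A6A7F5E7088668A726BB0C0CC8A867C7299E9C6838E747844DCD07C91707ABC9583908A7A75D074988E835C73A0659573AE4F7D95C69D66A26374E6A7BF
    ++ unpack 24 0x7D8B656A6E7794978667688C77D17D8A7C7E6B7F8993997A7B9BCEA149896C42AE74BBA1887A5CD470A0769F7F62CEACA6898E7476D468E097827B66685D9C8D8870756D81837584777A5C828C7582697CA198E676937F679E1AB0778E7F70F9128B938A677C5C9BCE7F8E7C785974925F82486D65469F72827C718D8386699A6870546A828B92717D14AAA470877864A15CC2898C706F78C4A07B8F6C6F96A2885F83647FC43EB8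
    ++ unpack 24 0x738370756848E0888F6F7B8C32928D847670777A817D8578758F70846F89787EA885FD66817E74907BA28984697BBCF2C2948771665A70828D90756738C5D18890727AE3DAF56F9D72715D75998588707D58828C7A977977B072927D957F6EEC38AA8392727F8CA69E8F837C6928ECAC72877C7D6C98888B847869B6A69E6D8C727C5CAAB685837E797432BF7D947B72E8F0A08F8E7E6E7044C057864E651DAACB9984646A907798
    ++ unpack 24 0x76947368B3C295B8994F7C55ADB46C926D5E8E88819182706E8F9A9E6C9970797858A2DB88692BCB4AD37C836E676D729C66827767E0B4B0948F6A7E7F6E956E87686510CCEC86987D648E6B856498757695798263904E7BBD9CA18985725F7E9D8C6D846F797A748E76896E7BA07C9696906F6D6CAAA27081656C12F38555816A50CE58B87B847E787A50C58E8C7D64B27EC489905D7AC0A6A0779B737F2CCBC5459A6757E65FDA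
    ++ unpack 24 0x849365796E719969875F74BF86DA969B6C5D6B1AD167847E65CE5CAA998778603430B48F827772682FA4928777716040A48A817E7B5F41896E8C676C2468A075816E79746C95908E7F7654A8E4738E6F7DBF2CB36F857463BA5CBC6A917868C814AA679170654498A881876E702F32B66A8D716BDA21F88982625C765D8190896F727884EC8387605CBC17B67F837C7ADF94D08584636487D4DB938F6C7968CEC2BA87445B5CA7B2
    ++ unpack 24 0x7881617B7C5C867A927778A7AA8C6B815678DCB6D266895C6FC8249432C95627CA46BF55875862ECC5A78E8F7A7B8D94917F85787610D0F899837570889CE896816272A452A0719F6A654CC09C828171723C7088558612452B36949697604E3EDDE365837662A16889778F756E948AB7939B7C68DAECAA64826D5D50E8E49B977772537DC26584757644C2C5658262717C918E6586647C7B26A37D84776A5674A27FB26B7D986DA6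
    ++ unpack 24 0x7E8F6E77256BCD7382615238F4C4878B747DB854988A8D6D7F72B0926C9B797B4E3AFD90815D68D854B46B81725E3ABEA86785737FCB65AD678E7B781C71A88986647FB2729E598E4B5F3DB0A57FA0615C366AD86B81796E85649394896974DFB2AD65857977D18FAA97816C76C84C9C5D8364702971C88C826A7D1C20B478B5433F8B45D25E935C452C1AF59E815352F5E0C58B8A7E7894208C7A8B5B526040B674867F793B44B9
    ++ unpack 24 0x8B817B681230FD8B8C706E44CEB660836D7674D8E0878A7268FD08BC5F826B62F090C8B39B617245A0AE77887A74B0B3BC75867D728A52887A956C7FE4DCA47389757DD135B97587727F5FAAA775937B735FB6929C947C6995999A728C64657870977587626A8258C68A826E774E85E4888E515F7F7A997C8C6D5E0B9BDA8C96757CB67EB46C8D7F6485C6AD84827F76C699D576997C6FACA8866C836B7B70CCD4B0AE7F7EC44084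
    ++ unpack 24 0x68857E6A8FB0958C837C729096988D8F747A6E53A47F8C7378D5998F82857F693C609479837B788C38F27C8E7773B362AD7C877B6A1040BC4A8B4E5C69B7AD8B836A7992C58C9B9C7667E956F79C8D747FBC628269957870EC5CBF9A81717EDF3A85748E7D6E756A947787726F2C20CC5C866B73FE56E688857775986D9B8796635D8C76C07E84786D7A9F816486777B59719E8C825C6A6D758D6982617350D8B4659367794C7894
    ++ unpack 24 0x718A6C6BACAEB6918D6163C270A086886F7EA8109098866F7270AA9C6D847F7A7478B09094796BAACBAD6C8563689284AA77815E78E93EBC9288707AA376EE6E877166C87AAD768C647091818789817C743878E4839178727C968CA28B616AB494C87A8A757E49A3BC7F8E68736AA4907188767BBFC5A789877D6E956D8D98856D694E589668837A637496AA9F9A71791A26A485877E6A6B44E983916B6E5F53CE89867C72916495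
    ++ unpack 24 0x79926D7BB08C8692996C729671875F8364616202B66F8869724E1CF392976677A414BF8D8677796C7F8481826572E9E2AA6C8B5E7CA303F85B8F6675556C9F6D8C67662414B05C815651B908C26792797708C8C07386647D5A4C9284856C699A778D78907471F038F88D8A7C7771C2B98D8E6478AA50F88788657A9CECA06191707138A0C24C913B4687B2BB888361687C9995878A6C745430C08E81756C687AD4768F7E751A5CB6
    ++ unpack 24 0x9789726BA741D18D8C6F786E95838A8C7A69609CB07B81716A5E508C7483687E92A79B7381746C327DCB8E815F6E3053A39B93736A7DBFAA7B815F68038AA3638260654052BC908D6E724AB986858C7F724177C8778C68668490947686776D7487987B8D65645034A09181676E0308D58C986A6F1A50F86F8D7C6B979BA2858C6B66946D8A579443568342AC6795696C736A928B835D732C10C48E87746D5C84B65E8D63682071C5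
    ++ unpack 24 0xAE82575C065490738C726C689BB08E897B70991CD5708A7E6DB4388C78956A641CCCE877846267A8E4C0958A706623929B8D82756878388C6B85686CE038DA598775584E7D9189866D66B2E48A9B9063768E749575877B6E8C98C06E8E6A7B87648C6A91757E9412E478827B6E848AA493947B754850F0738E7E708C47B6678D667E654A98879C667ED18FAD79846F65E494C19C927B695CC8D86B826E698A9CA8A1817673B8C29A
    ++ unpack 24 0x7581707CF36294978D67743F0DD06E9C6D7CA67EAC768D7C7FAA829066956F7B7F939087857375C45CA87991766C4D92C57A836F6C685E88788679649798956E8E7964A4E890698C6D7A9834EC59866F545F9BB465877F5E5FDDAD9D926A5FE98FA74E866B51659AA17F8F7C795698C86DA06661E474DC82997C6D959C9874827966868FB3768B786E98B9868988707F308CC08F8E707AB8EC9C73847D7F1088F870857C7F659791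
    ++ unpack 21 0x7DBD4C42BB40A09B86737DF75DE29A91615D4058A293977475126C99699068669396837F8D716DFEE2DB779B6476FDD0EE5E967C5F9B8E9F9A88735E723C948187727B687AB9758A6D6C868F95918576646038A487916E7A24B4E06C817C75C68EA065917F7CAA9A86788A77655F98A78D847A6AB2C18A6D875C7F8EB69C918B736DB878BC9D9C737E04A0C46B8C6D69358986
    ++ (full symmetric (117832 ∷ 210194 ∷ 210309 ∷ 90624 ∷ 189148 ∷ 83213 ∷ 110656 ∷ []) ∷ [])
    ++ unpack 24 0xCCE96A7D3FDFE8998261527C78D6678E5E50AEA98A62976578D183DA6984727D356EE07C8C796688959967837A787685B279A46D7E1484D08D84676A5CAA8C879E63695CBEA66582766E12D0A3948B747F6966896C8B6A7898DCB893986E77F353C66797717E54B2849C876577AA589483826E66A8A6A25C8B7E713A5DD04A82455395BCBD788B6E658C4C9AA8996D56D1D7F27791656B382FAA8E817E79B294A27F8C7B5126DC9C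
    ++ unpack 24 0x82817360E6A4F262836970895E9D87856D7E8CB8BC71976A6779688B5D88506B6E2FD7628275765488A8979A64679B6A8A98A370669B5CAB988366639260A46D947075AA5CCE7581717258AAB07C86736D6C50FC5E855579AF67987A81644F6C4E9F728D6D7B70E0F0878C7E7890C88479996D7B62EEAD618C5F53A491B17B957C7EB68EA0868172711A7798A2847773C66EB49C8A7A7BC45CBC5C8A5D75503CC278836C706889D4
    ++ unpack 24 0x8A85736ED4A4C07F84707E8E9B9A6181775EE971D1778A686ECBB6B97D9D7671C886AC94977F7E8567899B8F6367C070AE7E937D5F9E0DCB688A73647C70AA7184737A493AAD73887B70E874CC7D897578ECB4A88C815E5DD492DA938C797A8830BC8F94747760409CA5A776681DEFAAA399747DF871C187846A7BBC1ACE7187696294F0A08D8C7A67A741AD7B896A75E4C8B87085796D72AAC88B8E71644C70C06E8C7F778E9394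
    ++ unpack 24 0xAA846E60B053985B8C60674F548A918764733AC4A67D996B6D858C899885676C289C90968B7B6BEE71D5738E647F927690A4815962D70EDD72837A6ED468E87B916E71218AC685815E73EC62F25B81757E6FAFB2768F75706094A694987F668E658D68906C6B17B2BC64866F7270B4C48A915C63EECBA381896C7D64ACCCB18A535BAFA9A271817667626F89978A7273AA86BC858A727DF01787848370787650B29B866A757E7F93
    ++ unpack 24 0x87836C7589D49599977C6D533ABC65907C78C5CBC2878C5D5926E6F579A06372C0F0C8778274728460AA6D837B716982867B92686F082894698B677B5D4FCD49815E4DAD73B26CAF7F5072209292906C77AAF7876C9C6A6B8462B46E847A6571E9FD928D6F725AB4949997755C846CEC898B6C6E2BDF997D847E6544F0949F8565639EC2D788847B711D77929C8467690DFDAD8A837E676B47D166816B3A52359E7C827770C01CCC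
    ++ unpack 24 0x58A677544A29BC6E9B747D5A8AB2A48263684C9EB878865D63389BC26397447AC5C9ACAC826B5DDCAED48B84647A5D67B75D83765EE36BE9748F7C79DFEE8A6786796A18749C6882696F819A9B7F8870775848BC7A896C6B4C9EA25C996162857E93988D6D6750B9868B897F716F8E92799A6F7EBE788A789C797784AEA2978F7C650886E6948771706E9BD4978570642CB9C8758C706CA64EB07A877477A3DFEE5D82635359C5FE
    ++ unpack 24 0x7B9C7276562CB67E8E737B8868EC9E837963C85E8A6F877478EC44B07E8870759674A85C866F7571949584887B6EB898B281936F76859B83779976745871FD889C7C724192867C9A6B7D648B8A709C7965C5AA98A1886D7E1884D08E886B63E050FC8D857C74FE09BF45A9726BF5B3C26D9D6465627A817B846B6410E0E46E89787A620E8C7C867B6476749A6AA06D783A90B890897C6B48949A8391756EA038AC83907E67476EC2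
    ++ unpack 24 0x76A36D74449BD79A83615E38ECC2868D797F9099A0898F7874E0F0D47A83717F77ADC86D82676548A8EC8998677D2CBCB4708C776C67D0A3608368729266A68F8C7E7D85359E9F837C7B76648E99876A7178ACB6528560735DAF958C926A777E8A8F6B85666953B2A47F8A7964953EC5AC894E7F935EB597876866B744CB819C6E72413BB09099617620D1897F846D7BFD67AD939A6869F59EECA1815A684674CC9599737B44FDCB
    ++ unpack 24 0x778B767271798569856B68143C846F827F6E569A96659C696890C28E8189797D323EE0839172706073A28C856C666886B876916E77B0AD9E84886F7AD44D9B8982726066699662896F70268CD164A760714FBD967E846B7F2088A07C817278EC74B4BDA6505B596394918C7077A87294788A7A7FCCD8D067896E6B3B4DD47A84707F2CB0D18E84647D6B9D8788836671CC84D073927F658454866E8F7C7BBCA7B6848677748A7883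
    ++ unpack 24 0x7C94767D7A888294856A646E86D1938D76608F75849988756EB9BCAA7E85796D74DA9E708568788E5E9481967E759D64A479937C786A829C8190695C5428987E937875A67CB29284687D4864B087907565AA93996C90696F5054DC7A90737B3559C28D96707F2CCCE48281796C6D7D9193837875EC58C489985D65C4A2AC7B826B639E46C07D8A797234C8BC879369679E4CB8A2816E66F44C908C98717C7885816F817772D5ADEE
    ++ unpack 24 0x73C6694160C5B2859C7A79E63EA4889A7776CB71F87B816E7E5335C27D86747C5E6B899C9462666A7E818382736DA88AF391815F67A28D9B688B6673E414B47E817B7A8E9E8A86957F6A4476F36E89727F7494D07281666C419EAA799A736FDC94E87C8F67744189D46895667F5F5CAD73835F69426A8293927776C61CB2938B7371CBE4E96C8D7E653FBCDF758A7F78BCCBD081875D6EA408FC74886F617E6BA187857C78B09E98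
    ++ unpack 24 0x68876F669214CE71896F6EB4A48C9C8F6674B3AAC85182685477F2D767837E79680EC8A89B677EA2A0C483826F6E8C56EC4E856574569C88828D747A92C8D48A855C6A977A84928177665D6CC18D857F60549CCC708F66655894A47A976F7570929A85826E6DEC8CD08C8A676586A7AD68836F7C6EAE8681917D716E89AA768C75713BB0837B886E769C8CE46B827668BC74E67F847876749B9264967275544CAE70816F6AB252BA
    ++ unpack 24 0x788B7E798A90A079896C6FC0E8BC9A837376B672AC6E9A7273D4B8B46B82585230E0E47684796B1CB0886B8C7B7A14E6D48F8C7E7D85359E76815C6A2665E671917D605D62A2BBC27F2D3DD7B28C87776E486A98788267656C87976F9470786844B0778870763840D87984666A494EC1908A6A71D43B896983677A7C768D9D84797077C5DA9C8C6F7BB698D1698E7A7EB041836E967C67B060FC64816A65D1E0B3718E6F6ECC38BC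
    ++ unpack 17 0x9B8375622386AA938174674AB9838489706D8F1C948883735E77A08A9B9A7D7EB068B98E86716B88929DAF835E73D8B2B46583697F89D18669867D7E76738F769869749486906D8B717494B4E095827179B97AB67383766B68A6C47F82637886A0B06A86796575648E8D8766709C8CAA7181675F59BCB0

  smallPrimes>1 : All (1 <_) smallPrimes
  smallPrimes>1 = toWitness {a? = All.all? (1 ℕₚ.<?_) smallPrimes} tt

  -- For the sixteen primes p ≡ 13 (mod 14) with p² < 258889, from 13 to 503.
  squareCertificates : List (List ℕ)
  squareCertificates =
      (1 ∷ 6 ∷ 6 ∷ 12 ∷ 7 ∷ 10 ∷ 3 ∷ 6 ∷ 4 ∷ 4 ∷ 1 ∷ 4 ∷ 0 ∷ 0 ∷ 10 ∷ [])
    ∷ (3 ∷ 22 ∷ 19 ∷ 9 ∷ 12 ∷ 32 ∷ 5 ∷ 2 ∷ 26 ∷ 27 ∷ 35 ∷ 20 ∷ 11 ∷ 23 ∷ 38 ∷ [])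
    ∷ (1 ∷ 61 ∷ 17 ∷ 46 ∷ 25 ∷ 23 ∷ 35 ∷ 20 ∷ 40 ∷ 53 ∷ 58 ∷ 15 ∷ 16 ∷ 6 ∷ 47 ∷ [])
    ∷ (1 ∷ 58 ∷ 80 ∷ 57 ∷ 84 ∷ 77 ∷ 52 ∷ 15 ∷ 3 ∷ 61 ∷ 19 ∷ 23 ∷ 82 ∷ 31 ∷ 58 ∷ [])
    ∷ (4 ∷ 92 ∷ 27 ∷ 25 ∷ 65 ∷ 25 ∷ 12 ∷ 7 ∷ 123 ∷ 91 ∷ 115 ∷ 115 ∷ 75 ∷ 19 ∷ 53 ∷ [])
    ∷ (1 ∷ 90 ∷ 62 ∷ 133 ∷ 123 ∷ 162 ∷ 138 ∷ 34 ∷ 10 ∷ 139 ∷ 135 ∷ 94 ∷ 116 ∷ 143 ∷ 36 ∷ [])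
    ∷ (4 ∷ 22 ∷ 149 ∷ 173 ∷ 119 ∷ 83 ∷ 144 ∷ 160 ∷ 117 ∷ 82 ∷ 84 ∷ 111 ∷ 178 ∷ 6 ∷ 92 ∷ [])
    ∷ (1 ∷ 14 ∷ 189 ∷ 191 ∷ 103 ∷ 69 ∷ 163 ∷ 6 ∷ 56 ∷ 103 ∷ 128 ∷ 53 ∷ 5 ∷ 200 ∷ 94 ∷ [])
    ∷ (7 ∷ 122 ∷ 146 ∷ 101 ∷ 133 ∷ 110 ∷ 55 ∷ 23 ∷ 14 ∷ 242 ∷ 100 ∷ 23 ∷ 4 ∷ 86 ∷ 161 ∷ [])
    ∷ (1 ∷ 155 ∷ 239 ∷ 68 ∷ 60 ∷ 119 ∷ 136 ∷ 21 ∷ 57 ∷ 246 ∷ 176 ∷ 49 ∷ 163 ∷ 96 ∷ 239 ∷ [])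
    ∷ (1 ∷ 140 ∷ 148 ∷ 159 ∷ 238 ∷ 151 ∷ 222 ∷ 240 ∷ 17 ∷ 100 ∷ 147 ∷ 17 ∷ 250 ∷ 10 ∷ 84 ∷ [])
    ∷ (3 ∷ 54 ∷ 87 ∷ 98 ∷ 29 ∷ 235 ∷ 201 ∷ 134 ∷ 126 ∷ 248 ∷ 118 ∷ 143 ∷ 8 ∷ 30 ∷ 235 ∷ [])
    ∷ (4 ∷ 24 ∷ 114 ∷ 20 ∷ 236 ∷ 179 ∷ 250 ∷ 167 ∷ 225 ∷ 4 ∷ 168 ∷ 150 ∷ 255 ∷ 238 ∷ 249 ∷ [])
    ∷ (1 ∷ 227 ∷ 87 ∷ 208 ∷ 56 ∷ 154 ∷ 130 ∷ 44 ∷ 246 ∷ 128 ∷ 101 ∷ 71 ∷ 17 ∷ 179 ∷ 20 ∷ [])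
    ∷ (3 ∷ 27 ∷ 233 ∷ 195 ∷ 78 ∷ 110 ∷ 23 ∷ 219 ∷ 253 ∷ 122 ∷ 246 ∷ 97 ∷ 127 ∷ 217 ∷ 132 ∷ [])
    ∷ (1 ∷ 88 ∷ 35 ∷ 133 ∷ 229 ∷ 233 ∷ 40 ∷ 237 ∷ 12 ∷ 206 ∷ 88 ∷ 113 ∷ 29 ∷ 94 ∷ 143 ∷ [])
    ∷ []

  -- For 23 and 37, the primes p ≡ 9 (mod 14) with p³ < 258889.
  cubeCertificates₉ : List (List ℕ)
  cubeCertificates₉ =
      (4 ∷ 18 ∷ 12 ∷ 16 ∷ 3 ∷ 8 ∷ 9 ∷ 17 ∷ 1 ∷ 21 ∷ 16 ∷ 4 ∷ 9 ∷ 17 ∷ 21 ∷ 19 ∷ 9 ∷ 21 ∷ 22 ∷ 18 ∷ 13 ∷ 20 ∷ [])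
    ∷ (2 ∷ 14 ∷ 29 ∷ 28 ∷ 20 ∷ 19 ∷ 10 ∷ 24 ∷ 25 ∷ 35 ∷ 7 ∷ 12 ∷ 15 ∷ 21 ∷ 24 ∷ 27 ∷ 30 ∷ 30 ∷ 24 ∷ 32 ∷ 32 ∷ 0 ∷ [])
    ∷ []

  -- For 11 and 53, the primes p ≡ 11 (mod 14) with p³ < 258889.
  cubeCertificates₁₁ : List (List ℕ)
  cubeCertificates₁₁ =
      (3 ∷ 4 ∷ 3 ∷ 0 ∷ 2 ∷ 1 ∷ 8 ∷ 4 ∷ 2 ∷ 4 ∷ 7 ∷ 2 ∷ 1 ∷ 8 ∷ 3 ∷ 10 ∷ 0 ∷ 9 ∷ 7 ∷ 2 ∷ 0 ∷ 10 ∷ [])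
    ∷ (4 ∷ 52 ∷ 13 ∷ 23 ∷ 33 ∷ 15 ∷ 18 ∷ 36 ∷ 46 ∷ 34 ∷ 36 ∷ 33 ∷ 11 ∷ 9 ∷ 51 ∷ 52 ∷ 31 ∷ 13 ∷ 41 ∷ 11 ∷ 31 ∷ 7 ∷ [])
    ∷ []

  symmetricPairs : List (List SlotPair)
  symmetricPairs = map (Layout.pairsOf symmetric) types

  opaque
    unfolding allᵇ

    -- The scan visits (258889 - 71)/14 = 18487 numbers, namely 71, 85, ..., 258875.
    primes-checked : scan (checkPrime symmetricPairs) smallPrimes 18487 70 primeCertificates ≡ true
    primes-checked = refl

    squares-checked : scan (quadraticTest symmetricPairs) smallPrimes 36 12 squareCertificates ≡ true
    squares-checked = refl

    cubes₉-checked : scan (cubicTest symmetricPairs) smallPrimes 4 8 cubeCertificates₉ ≡ true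
    cubes₉-checked = refl

    cubes₁₁-checked : scan (cubicTest symmetricPairs) smallPrimes 4 10 cubeCertificates₁₁ ≡ true
    cubes₁₁-checked = refl

    square₂₉-checked : ∃ λ xs → quadraticTest symmetricPairs 28 xs ≡ true
    square₂₉-checked = (4 ∷ 16 ∷ 11 ∷ 14 ∷ 22 ∷ 11 ∷ 17 ∷ 0 ∷ 11 ∷ 21 ∷ 12 ∷ 5 ∷ 0 ∷ 0 ∷ 9 ∷ []) , refl

    square₄₃-checked : ∃ λ xs → quadraticTest symmetricPairs 42 xs ≡ true
    square₄₃-checked = (1 ∷ 34 ∷ 33 ∷ 18 ∷ 37 ∷ 10 ∷ 12 ∷ 12 ∷ 7 ∷ 7 ∷ 27 ∷ 20 ∷ 14 ∷ 31 ∷ 9 ∷ []) , refl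

    cube₂₉-checked : ∃ λ xs → cubicTest symmetricPairs 28 xs ≡ true
    cube₂₉-checked = (1 ∷ 7 ∷ 2 ∷ 11 ∷ 27 ∷ 25 ∷ 28 ∷ 2 ∷ 17 ∷ 28 ∷ 9 ∷ 27 ∷ 26 ∷ 10 ∷ 17 ∷ 25 ∷ 9 ∷ 14 ∷ 4 ∷ 27 ∷ 23 ∷ 5 ∷ []) , refl

    cube₄₃-checked : ∃ λ xs → cubicTest symmetricPairs 42 xs ≡ true
    cube₄₃-checked = (2 ∷ 39 ∷ 21 ∷ 2 ∷ 21 ∷ 7 ∷ 11 ∷ 41 ∷ 38 ∷ 28 ∷ 28 ∷ 20 ∷ 4 ∷ 14 ∷ 19 ∷ 28 ∷ 38 ∷ 14 ∷ 11 ∷ 41 ∷ 33 ∷ 1 ∷ []) , refl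

    sixth₃-checked : ∃ λ xs → sexticTest symmetricPairs 2 xs ≡ true
    sixth₃-checked = (1 ∷ 0 ∷ 1 ∷ 2 ∷ 1 ∷ 2 ∷ 2 ∷ 2 ∷ 2 ∷ 1 ∷ 2 ∷ 0 ∷ 0 ∷ 2 ∷ 1 ∷ 0 ∷ 2 ∷ 0 ∷ 2 ∷ 0 ∷ 2 ∷ 1 ∷ 0 ∷ 2 ∷ 2 ∷ 2 ∷ 1 ∷ 0 ∷ 1 ∷ 2 ∷ 0 ∷ 0 ∷ 1 ∷ 0 ∷ 1 ∷ 1 ∷ 1 ∷ 0 ∷ 2 ∷ 2 ∷ 2 ∷ 1 ∷ 0 ∷ 0 ∷ 1 ∷ []) , refl

    sixth₅-checked : ∃ λ xs → sexticTest symmetricPairs 4 xs ≡ true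
    sixth₅-checked = (3 ∷ 0 ∷ 1 ∷ 4 ∷ 3 ∷ 1 ∷ 3 ∷ 1 ∷ 3 ∷ 4 ∷ 0 ∷ 4 ∷ 4 ∷ 2 ∷ 3 ∷ 4 ∷ 3 ∷ 2 ∷ 2 ∷ 1 ∷ 0 ∷ 4 ∷ 3 ∷ 0 ∷ 1 ∷ 3 ∷ 0 ∷ 1 ∷ 4 ∷ 3 ∷ 0 ∷ 1 ∷ 2 ∷ 3 ∷ 2 ∷ 2 ∷ 2 ∷ 4 ∷ 1 ∷ 1 ∷ 3 ∷ 3 ∷ 2 ∷ 4 ∷ 1 ∷ []) , refl

-- Residues modulo 14, prime powers, and the theorem

open Spaces using (module Resolution)
open Soundness
open Tests
open PrimePowerFields
open Tables
open import Data.Nat using (nonTrivial⇒≢1; _+_; _*_; _^_)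
open import Data.Nat.DivMod
open import Data.Nat.Divisibility using (_∣_; divides; *-cancelˡ-∣; ∣1⇒≡1)
open import Data.Nat.Primality using (Prime; prime?; euclidsLemma; prime⇒irreducible; prime⇒nonTrivial; prime⇒nonZero)
open import Data.Nat.ListAction using (product)
open import Data.Fin using (fromℕ<)
import Data.Sum as Sum
open import Data.List using (replicate)
open import Data.List.Properties using (++-identityʳ)
open import Data.List.Membership.Propositional.Properties using (∈-map⁺)
open import Data.List.Membership.Propositional using (_∈_)
open import Data.List.Relation.Unary.AllPairs using ([]; _∷_)
open import Data.List.Relation.Unary.Unique.Propositional using (Unique)
open import Relation.Nullary.Decidable using (True; False; toWitness; toWitnessFalse; _→-dec_)

^-% : ∀ a k → a ^ k % 14 ≡ (a % 14) ^ k % 14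
^-% a zero = refl
^-% a (suc k) = begin
  a * a ^ k % 14                                ≡⟨ %-distribˡ-* a (a ^ k) 14 ⟩
  (a % 14) * (a ^ k % 14) % 14                  ≡⟨ cong (λ t → (a % 14) * t % 14) (^-% a k) ⟩
  (a % 14) * ((a % 14) ^ k % 14) % 14           ≡⟨ cong (λ t → t * ((a % 14) ^ k % 14) % 14) (m%n%n≡m%n a 14) ⟨
  (a % 14 % 14) * ((a % 14) ^ k % 14) % 14      ≡⟨ %-distribˡ-* (a % 14) ((a % 14) ^ k) 14 ⟨
  (a % 14) * (a % 14) ^ k % 14 ∎
  where open ≡-Reasoning

1^-% : ∀ a k → a % 14 ≡ 1 → a ^ k % 14 ≡ 1
1^-% a k eq = trans (^-% a k) (trans (cong (λ t → t ^ k % 14) eq) (cong (_% 14) (ℕₚ.^-zeroˡ k)))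

-- Division with remainder: a^k ≡ a^r with r < d, and `minimal` leaves only r = 0.
order-divides : ∀ a d .{{_ : NonZero d}} → a ^ d % 14 ≡ 1 → (∀ (r : Fin d) → a ^ toℕ r % 14 ≡ 1 → toℕ r ≡ 0) →
  ∀ k → a ^ k % 14 ≡ 1 → ∃ λ t → k ≡ t * d
order-divides a d period minimal k eq = k / d , trans (m≡m%n+[m/n]*n k d) (cong (_+ k / d * d) remainder≡0)
  where
  open ≡-Reasoning
  r = k % d
  r<d : r < d
  r<d = m%n<n k d
  a^r : a ^ r % 14 ≡ 1
  a^r = begin
    a ^ r % 14                                       ≡⟨ m%n%n≡m%n (a ^ r) 14 ⟨
    a ^ r % 14 % 14                                  ≡⟨ cong (_% 14) (ℕₚ.*-identityʳ (a ^ r % 14)) ⟨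
    (a ^ r % 14) * 1 % 14                            ≡⟨ cong (λ t → (a ^ r % 14) * t % 14) (1^-% (a ^ d) (k / d) period) ⟨
    (a ^ r % 14) * ((a ^ d) ^ (k / d) % 14) % 14     ≡⟨ %-distribˡ-* (a ^ r) ((a ^ d) ^ (k / d)) 14 ⟨
    a ^ r * (a ^ d) ^ (k / d) % 14                   ≡⟨ cong (λ t → a ^ r * t % 14) (ℕₚ.^-*-assoc a d (k / d)) ⟩
    a ^ r * a ^ (d * (k / d)) % 14                   ≡⟨ cong (_% 14) (ℕₚ.^-distribˡ-+-* a r (d * (k / d))) ⟨
    a ^ (r + d * (k / d)) % 14                       ≡⟨ cong (λ t → a ^ (r + t) % 14) (ℕₚ.*-comm d (k / d)) ⟩
    a ^ (r + k / d * d) % 14                         ≡⟨ cong (λ t → a ^ t % 14) (m≡m%n+[m/n]*n k d) ⟨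
    a ^ k % 14                                       ≡⟨ eq ⟩
    1 ∎
  remainder≡0 : r ≡ 0
  remainder≡0 = trans (sym (Finₚ.toℕ-fromℕ< r<d))
    (minimal (fromℕ< r<d) (subst (λ t → a ^ t % 14 ≡ 1) (sym (Finₚ.toℕ-fromℕ< r<d)) a^r))

-- If a^k ≡ 1, then a^(k - 1) is an inverse of a modulo 14.
non-unit : ∀ a → (∀ (x : Fin 14) → a * toℕ x % 14 ≢ 1) → ∀ k → 1 ≤ k → a < 14 → a ^ k % 14 ≢ 1
non-unit a none (suc k) _ a<14 eq = none (fromℕ< (m%n<n (a ^ k) 14)) (begin
  a * toℕ (fromℕ< (m%n<n (a ^ k) 14)) % 14  ≡⟨ cong (λ t → a * t % 14) (Finₚ.toℕ-fromℕ< (m%n<n (a ^ k) 14)) ⟩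
  a * (a ^ k % 14) % 14                     ≡⟨ cong (λ t → t * (a ^ k % 14) % 14) (m<n⇒m%n≡m a<14) ⟨
  (a % 14) * (a ^ k % 14) % 14              ≡⟨ %-distribˡ-* a (a ^ k) 14 ⟨
  a * a ^ k % 14                            ≡⟨ eq ⟩
  1 ∎)
  where open ≡-Reasoning

-- The constructors list the orders possible in the group of units modulo 14, which is cyclic of
-- order 6; the order of p divides k whenever p^k ≡ 1.
data Residue (p k : ℕ) : Set where
  order₁ : p % 14 ≡ 1 → Residue p k
  order₂ : p % 14 ≡ 13 → ∀ t → k ≡ t * 2 → Residue p k
  order₃ : p % 14 ≡ 9 ⊎ p % 14 ≡ 11 → ∀ t → k ≡ t * 3 → Residue p k
  order₆ : p % 14 ≡ 3 ⊎ p % 14 ≡ 5 → ∀ t → k ≡ t * 6 → Residue p k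

residue-of : ∀ p k → 1 ≤ k → p ^ k % 14 ≡ 1 → Residue p k
residue-of p k 1≤k eq = by-residue (p % 14) refl (m%n<n p 14)
  where
  power : ∀ a → p % 14 ≡ a → a ^ k % 14 ≡ 1
  power a refl = trans (sym (^-% p k)) eq
  impossible : ∀ a → p % 14 ≡ a → {_ : True (Finₚ.all? λ (x : Fin 14) → ¬? (a * toℕ x % 14 ℕₚ.≟ 1))} → {_ : True (a ℕₚ.<? 14)} → Residue p k
  impossible a p≡ {none} {a<14} = ⊥-elim (non-unit a (toWitness none) k 1≤k (toWitness a<14) (power a p≡))
  ordered : ∀ a d .{{_ : NonZero d}} → p % 14 ≡ a → a ^ d % 14 ≡ 1 →
    {_ : True (Finₚ.all? λ (r : Fin d) → (a ^ toℕ r % 14 ℕₚ.≟ 1) →-dec (toℕ r ℕₚ.≟ 0))} → ∃ λ t → k ≡ t * d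
  ordered a d p≡ period {minimal} = order-divides a d period (toWitness minimal) k (power a p≡)
  by-residue : ∀ a → p % 14 ≡ a → a < 14 → Residue p k
  by-residue 0 p≡ _ = impossible 0 p≡
  by-residue 1 p≡ _ = order₁ p≡
  by-residue 2 p≡ _ = impossible 2 p≡
  by-residue 3 p≡ _ = let t , k≡ = ordered 3 6 p≡ refl in order₆ (inj₁ p≡) t k≡
  by-residue 4 p≡ _ = impossible 4 p≡
  by-residue 5 p≡ _ = let t , k≡ = ordered 5 6 p≡ refl in order₆ (inj₂ p≡) t k≡
  by-residue 6 p≡ _ = impossible 6 p≡
  by-residue 7 p≡ _ = impossible 7 p≡
  by-residue 8 p≡ _ = impossible 8 p≡
  by-residue 9 p≡ _ = let t , k≡ = ordered 9 3 p≡ refl in order₃ (inj₁ p≡) t k≡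
  by-residue 10 p≡ _ = impossible 10 p≡
  by-residue 11 p≡ _ = let t , k≡ = ordered 11 3 p≡ refl in order₃ (inj₂ p≡) t k≡
  by-residue 12 p≡ _ = impossible 12 p≡
  by-residue 13 p≡ _ = let t , k≡ = ordered 13 2 p≡ refl in order₂ p≡ t k≡
  by-residue (suc (suc (suc (suc (suc (suc (suc (suc (suc (suc (suc (suc (suc (suc _)))))))))))))) _ a<14 =
    ⊥-elim (ℕₚ.<⇒≱ a<14 (ℕₚ.m≤m+n 14 _))

-- From U² q < (q - N)² ≤ q² follows q > U², and U(7,6) = 487404.
QBelow⇒large : ∀ q → QBelow 7 6 q → 67008420535 < q
QBelow⇒large q (N<q , below) = ℕₚ.<-trans (toWitness {a? = 67008420535 ℕₚ.<? U 7 6 * U 7 6} tt)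
  (ℕₚ.*-cancelʳ-< q (U 7 6 * U 7 6) q (ℕₚ.<-≤-trans below (ℕₚ.*-mono-≤ (ℕₚ.m∸n≤m q (6 * 7 ^ 5)) (ℕₚ.m∸n≤m q (6 * 7 ^ 5)))))

-- The consequences of the range that steer the case distinction: orders below 258889 have
-- certificates, and the field `gap` sends all other components to the greedy choice.
record Admissible (q : ℕ) : Set where
  constructor admissible
  field
    71≤q : 71 ≤ q
    gap : 258889 ≤ q → 67008420535 < q

open Admissible

admissible-order : ∀ q → (71 ≤ q × q ≤ 9941) ⊎ QBelow 7 6 q → Admissible q
admissible-order q (inj₁ (71≤q , q≤9941)) = admissible 71≤q
  (λ 258889≤q → ⊥-elim (ℕₚ.<⇒≱ (toWitness {a? = 9941 ℕₚ.<? 258889} tt) (ℕₚ.≤-trans 258889≤q q≤9941)))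
admissible-order q (inj₂ above) = admissible
  (ℕₚ.≤-trans (toWitness {a? = 71 ℕₚ.≤? 6 * 7 ^ 5} tt) (ℕₚ.<⇒≤ (proj₁ above))) (λ _ → QBelow⇒large q above)

module PrimePowers (m : ℕ) (p-prime : Prime (suc m)) (odd : 2 < suc m) where
  open Tower m p-prime odd

  private
    w²-large : ∀ d → 258889 ≤ p ^ d → 67008420535 < p ^ (d + d)
    w²-large d big = ℕₚ.<-≤-trans (toWitness {a? = 67008420535 ℕₚ.<? 258889 * 258889} tt)
      (ℕₚ.≤-trans (ℕₚ.*-mono-≤ {258889} {p ^ d} {258889} {p ^ d} big big) (ℕₚ.≤-reflexive (sym (ℕₚ.^-distribˡ-+-* p d d))))

    w³-large : ∀ d → 258889 ≤ p ^ d → 67008420535 < p ^ (d + (d + d))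
    w³-large d big = ℕₚ.<-≤-trans (w²-large d big) (ℕₚ.^-monoʳ-≤ p (ℕₚ.m≤n+m (d + d) d))

    product-%14 : ∀ a b → a % 14 ≡ 1 → b % 14 ≡ 1 → a * b % 14 ≡ 1
    product-%14 a b a≡ b≡ = trans (%-distribˡ-* a b 14) (cong₂ (λ s t → s * t % 14) a≡ b≡)

    +-%14 : ∀ a b → p ^ a % 14 ≡ 1 → p ^ b % 14 ≡ 1 → p ^ (a + b) % 14 ≡ 1
    +-%14 a b a≡ b≡ = trans (cong (_% 14) (ℕₚ.^-distribˡ-+-* p a b)) (product-%14 (p ^ a) (p ^ b) a≡ b≡)

  15≤ : ∀ {q} → 67008420535 < q → 15 ≤ q
  15≤ large = ℕₚ.≤-trans (toWitness {a? = 15 ℕₚ.≤? 67008420535} tt) (ℕₚ.<⇒≤ large)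

  -- For t = 1 the component is p^d itself and `gap` makes it large. For t ≥ 2 the order p^d may lie
  -- in the gap, but its square and cube exceed the bound, and t is a sum of twos and threes.
  good-big : ∀ d → Presented d → p ^ d % 14 ≡ 1 → 258889 ≤ p ^ d → ∀ t → 1 ≤ t → Admissible (p ^ (t * d)) → Good (replicate (t * d) p)
  good-big d P order≡1 big (suc zero) _ range = subst (λ e → Good (replicate e p)) (sym (ℕₚ.+-identityʳ d))
    (good-large P order≡1 (15≤ large) large)
    where
    large : 67008420535 < p ^ d
    large = gap (subst (λ e → Admissible (p ^ e)) (ℕₚ.+-identityʳ d) range) big
  good-big d P order≡1 big (suc (suc t)) _ range = good-from-2-3 {d}
    (good-large (double P) order²≡1 (15≤ (w²-large d big)) (w²-large d big))
    (good-large (triple P) (+-%14 d (d + d) order≡1 order²≡1) (15≤ (w³-large d big)) (w³-large d big)) t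
    where
    order²≡1 : p ^ (d + d) % 14 ≡ 1
    order²≡1 = +-%14 d d order≡1 order≡1

  good-multiple : ∀ d → (p ^ d < 258889 → Good (replicate d p)) → Presented d → p ^ d % 14 ≡ 1 →
    ∀ t → 1 ≤ t → Admissible (p ^ (t * d)) → Good (replicate (t * d) p)
  good-multiple d small P order≡1 t 1≤t range with p ^ d ℕₚ.<? 258889
  good-multiple d small P order≡1 (suc t) 1≤t range | yes w< = good-multiples {d} (small w<) t
  good-multiple d small P order≡1 t 1≤t range | no w≮ = good-big d P order≡1 (ℕₚ.≮⇒≥ w≮) t 1≤t range

index-of : ∀ m c → suc m % 14 ≡ suc c → m ≡ suc m / 14 * 14 + c
index-of m c eq = ℕₚ.suc-injective (trans (m≡m%n+[m/n]*n (suc m) 14) (trans (cong (_+ suc m / 14 * 14) eq) (cong suc (ℕₚ.+-comm c _))))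

index-bound : ∀ {m} i c K b → m ≡ i * 14 + c → b ≤ K * 14 + suc c → suc m < b → i < K
index-bound i c K b refl bound lt = ℕₚ.≰⇒> λ K≤i → ℕₚ.<⇒≱ lt (ℕₚ.≤-trans bound
  (ℕₚ.≤-trans (ℕₚ.≤-reflexive (ℕₚ.+-suc (K * 14) c)) (ℕ.s≤s (ℕₚ.+-monoˡ-≤ c (ℕₚ.*-monoˡ-≤ 14 K≤i)))))

module _ (m : ℕ) (p-prime : Prime (suc m)) where
  private
    p = suc m

    %≤ : ∀ {a} → p % 14 ≡ a → a ≤ p
    %≤ refl = m%n≤m p 14

    -- Used with 509², 64³ and 8⁶, where 509, 64 and 8 are the least bases whose powers reach
    -- 258889.
    below : ∀ d b → p ^ suc d < 258889 → {_ : True (258889 ℕₚ.≤? b ^ suc d)} → p < b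
    below d b lt {w} = ℕₚ.≰⇒> λ b≤p → ℕₚ.<⇒≱ lt (ℕₚ.≤-trans (toWitness w) (ℕₚ.^-monoˡ-≤ (suc d) b≤p))

  good-prime-power : ∀ k → 1 ≤ k → p ^ k % 14 ≡ 1 → Admissible (p ^ k) → Good (replicate k p)
  good-prime-power k 1≤k q≡1 range = by-residue (residue-of p k 1≤k q≡1)
    where
    positive : ∀ t {d} → k ≡ t * d → 1 ≤ t
    positive zero refl = 1≤k
    positive (suc t) _ = ℕ.s≤s ℕ.z≤n

    transport : ∀ t d → k ≡ t * d → Good (replicate (t * d) p) → Good (replicate k p)
    transport t d eq = subst (λ e → Good (replicate e p)) (sym eq)

    rangeAt : ∀ t d → k ≡ t * d → Admissible (p ^ (t * d))
    rangeAt t d eq = subst (λ e → Admissible (p ^ e)) eq range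

    power-%14 : ∀ {a} d → p % 14 ≡ a → a ^ d % 14 ≡ 1 → p ^ d % 14 ≡ 1
    power-%14 d p≡ eq = trans (^-% p d) (trans (cong (λ t → t ^ d % 14) p≡) eq)

    15≤p^ : ∀ d a {_ : True (15 ℕₚ.≤? a ^ suc d)} → a ≤ p → 15 ≤ p ^ suc d
    15≤p^ d a {w} a≤p = ℕₚ.≤-trans (toWitness w) (ℕₚ.^-monoˡ-≤ (suc d) a≤p)

    via : ∀ {C : Set} (test : ℕ → C → Bool) cs K m₀ → scan test smallPrimes K m₀ cs ≡ true →
      ∀ i → m ≡ i * 14 + m₀ → i < K → ∃ λ c → test m c ≡ true
    via test cs K m₀ checked i m≡ i<K = subst (λ t → ∃ λ c → test t c ≡ true) (sym m≡)
      (scan-sound test smallPrimes smallPrimes>1 K m₀ cs checked i i<K (subst (λ t → Prime (suc t)) m≡ p-prime))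

    by-residue : Residue p k → Good (replicate k p)

    by-residue (order₁ p≡) = by-index (p / 14) (index-of m 0 p≡)
      where
      order≡1 : ∀ d → p ^ d % 14 ≡ 1
      order≡1 d = 1^-% p d p≡

      k≡k*1 : k ≡ k * 1
      k≡k*1 = sym (ℕₚ.*-identityʳ k)

      not-prime : ∀ n → {_ : False (prime? (suc n))} → m ≡ n → Good (replicate k p)
      not-prime n {composite} m≡ = ⊥-elim (toWitnessFalse composite (subst (λ t → Prime (suc t)) m≡ p-prime))

      from-squares : ∀ n → {_ : True (14 ℕₚ.≤? n)} → {_ : True (suc n ℕₚ.<? 71)} → m ≡ n →
        (∃ λ xs → quadraticTest symmetricPairs n xs ≡ true) → (∃ λ xs → cubicTest symmetricPairs n xs ≡ true) → Good (replicate k p)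
      from-squares n {large} {small} refl (xs , xs-checked) (ys , ys-checked) =
        subst (λ e → Good (replicate e p)) (sym k≡k*1) (by-exponent k refl)
        where
        14≤n = toWitness large
        open Tower m p-prime (ℕ.s≤s (ℕₚ.≤-trans (ℕₚ.m≤m+n 2 12) 14≤n)) hiding (p)
        by-exponent : ∀ e → k ≡ e → Good (replicate (e * 1) p)
        by-exponent zero refl = ⊥-elim (ℕₚ.<⇒≱ 1≤k ℕ.z≤n)
        -- Here q = p is 29 or 43, less than 71.
        by-exponent (suc zero) refl = ⊥-elim (ℕₚ.<⇒≱ (toWitness small)
          (ℕₚ.≤-trans (71≤q range) (ℕₚ.≤-reflexive (ℕₚ.*-identityʳ p))))
        by-exponent (suc (suc e)) refl = good-from-2-3 {1}
          (good-square (order≡1 2) (15≤p^ 1 15 (ℕ.s≤s 14≤n)) xs xs-checked)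
          (good-cube (order≡1 3) (15≤p^ 2 15 (ℕ.s≤s 14≤n)) ys ys-checked) e

      -- The candidates for p in order are 1, 15, 29, 43, 57 and then 71 + 14 i, where the
      -- certificates begin.
      by-index : ∀ j → m ≡ j * 14 + 0 → Good (replicate k p)
      by-index 0 m≡ = not-prime 0 m≡
      by-index 1 m≡ = not-prime 14 m≡
      by-index 2 m≡ = from-squares 28 m≡ square₂₉-checked cube₂₉-checked
      by-index 3 m≡ = from-squares 42 m≡ square₄₃-checked cube₄₃-checked
      by-index 4 m≡ = not-prime 56 m≡
      by-index (suc (suc (suc (suc (suc i))))) m≡ =
        transport k 1 k≡k*1 (good-multiple 1 small base (order≡1 1) k 1≤k (rangeAt k 1 k≡k*1))
        where
        m≡′ : m ≡ i * 14 + 70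
        m≡′ = trans m≡ (trans (cong (70 +_) (ℕₚ.+-identityʳ (i * 14))) (ℕₚ.+-comm 70 (i * 14)))
        70≤m : 70 ≤ m
        70≤m = ℕₚ.≤-trans (ℕₚ.m≤n+m 70 (i * 14)) (ℕₚ.≤-reflexive (sym m≡′))
        odd : 2 < p
        odd = ℕₚ.≤-trans (ℕₚ.m≤m+n 3 68) (ℕ.s≤s 70≤m)
        open Tower m p-prime odd hiding (p)
        open PrimePowers m p-prime odd using (good-multiple)
        small : p ^ 1 < 258889 → Good (replicate 1 p)
        small lt =
          let c , eq = via (checkPrime symmetricPairs) primeCertificates 18487 70 primes-checked i m≡′
                (index-bound i 70 18487 258889 m≡′ (toWitness {a? = 258889 ℕₚ.≤? 18487 * 14 + 71} tt)
                  (ℕₚ.≤-<-trans (ℕₚ.≤-reflexive (sym (ℕₚ.*-identityʳ p))) lt))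
          in good-prime (order≡1 1) (15≤p^ 0 71 (ℕ.s≤s 70≤m)) c eq

    by-residue (order₂ p≡ t k≡) = transport t 2 k≡ (good-multiple 2 small (double base) order²≡1 t (positive t k≡) (rangeAt t 2 k≡))
      where
      odd = ℕₚ.≤-trans (ℕₚ.m≤m+n 3 10) (%≤ p≡)
      open Tower m p-prime odd hiding (p)
      open PrimePowers m p-prime odd using (good-multiple)
      order²≡1 : p ^ 2 % 14 ≡ 1
      order²≡1 = power-%14 2 p≡ refl
      small : p ^ 2 < 258889 → Good (replicate 2 p)
      small lt = let m≡ = index-of m 12 p≡
                     xs , eq = via (quadraticTest symmetricPairs) squareCertificates 36 12 squares-checked (p / 14) m≡
                       (index-bound (p / 14) 12 36 509 m≡ (toWitness {a? = 509 ℕₚ.≤? 36 * 14 + 13} tt) (below 1 509 lt))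
        in good-square order²≡1 (15≤p^ 1 13 (%≤ p≡)) xs eq

    by-residue (order₃ p≡ t k≡) = transport t 3 k≡ (good-multiple 3 (small p≡) (triple base) order³≡1 t (positive t k≡) (rangeAt t 3 k≡))
      where
      9≤p : 9 ≤ p
      9≤p = Sum.[ %≤ , (λ e → ℕₚ.≤-trans (ℕₚ.m≤m+n 9 2) (%≤ e)) ] p≡
      odd = ℕₚ.≤-trans (ℕₚ.m≤m+n 3 6) 9≤p
      open Tower m p-prime odd hiding (p)
      open PrimePowers m p-prime odd using (good-multiple)
      order³≡1 : p ^ 3 % 14 ≡ 1
      order³≡1 = Sum.[ (λ e → power-%14 3 e refl) , (λ e → power-%14 3 e refl) ] p≡
      small : p % 14 ≡ 9 ⊎ p % 14 ≡ 11 → p ^ 3 < 258889 → Good (replicate 3 p)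
      small (inj₁ p≡9) lt = let m≡ = index-of m 8 p≡9
                                xs , eq = via (cubicTest symmetricPairs) cubeCertificates₉ 4 8 cubes₉-checked (p / 14) m≡
                                  (index-bound (p / 14) 8 4 64 m≡ (toWitness {a? = 64 ℕₚ.≤? 4 * 14 + 9} tt) (below 2 64 lt))
        in good-cube order³≡1 (15≤p^ 2 9 9≤p) xs eq
      small (inj₂ p≡11) lt = let m≡ = index-of m 10 p≡11
                                 xs , eq = via (cubicTest symmetricPairs) cubeCertificates₁₁ 4 10 cubes₁₁-checked (p / 14) m≡
                                   (index-bound (p / 14) 10 4 64 m≡ (toWitness {a? = 64 ℕₚ.≤? 4 * 14 + 11} tt) (below 2 64 lt))
        in good-cube order³≡1 (15≤p^ 2 9 9≤p) xs eq

    by-residue (order₆ p≡ t k≡) = transport t 6 k≡ (good-multiple 6 (small p≡) (triple (double base)) order⁶≡1 t (positive t k≡) (rangeAt t 6 k≡))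
      where
      3≤p : 3 ≤ p
      3≤p = Sum.[ %≤ , (λ e → ℕₚ.≤-trans (ℕₚ.m≤m+n 3 2) (%≤ e)) ] p≡
      open Tower m p-prime 3≤p hiding (p)
      open PrimePowers m p-prime 3≤p using (good-multiple)
      order⁶≡1 : p ^ 6 % 14 ≡ 1
      order⁶≡1 = Sum.[ (λ e → power-%14 6 e refl) , (λ e → power-%14 6 e refl) ] p≡
      first : ∀ c → p % 14 ≡ suc c → p < 8 → m ≡ c
      first c p≡c p<8 = ℕₚ.suc-injective (trans (sym (m<n⇒m%n≡m (ℕₚ.<-trans p<8 (ℕₚ.m≤m+n 9 5)))) p≡c)
      sixth : ∀ c → m ≡ c → (∃ λ xs → sexticTest symmetricPairs c xs ≡ true) → Good (replicate 6 p)
      sixth c m≡c (xs , eq) = good-sixth order⁶≡1 (15≤p^ 5 3 3≤p) xs (subst (λ t → sexticTest symmetricPairs t xs ≡ true) (sym m≡c) eq)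
      small : p % 14 ≡ 3 ⊎ p % 14 ≡ 5 → p ^ 6 < 258889 → Good (replicate 6 p)
      small (inj₁ p≡3) lt = sixth 2 (first 2 p≡3 (below 5 8 lt)) sixth₃-checked
      small (inj₂ p≡5) lt = sixth 4 (first 4 p≡5 (below 5 8 lt)) sixth₅-checked

prime-divides-power : ∀ {r p} → Prime r → Prime p → ∀ k → r ∣ p ^ k → r ≡ p
prime-divides-power {r} r-prime p-prime zero r∣1 = ⊥-elim (nonTrivial⇒≢1 {{prime⇒nonTrivial r-prime}} (∣1⇒≡1 r∣1))
prime-divides-power {r} {p} r-prime p-prime (suc k) r∣ with euclidsLemma p (p ^ k) r-prime r∣
... | inj₂ r∣p^k = prime-divides-power r-prime p-prime k r∣p^k
... | inj₁ r∣p with prime⇒irreducible p-prime r∣p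
...   | inj₁ r≡1 = ⊥-elim (nonTrivial⇒≢1 {{prime⇒nonTrivial r-prime}} r≡1)
...   | inj₂ r≡p = r≡p

private
  order : ℕ × ℕ → ℕ
  order (p , k) = p ^ k

  PrimePower : ℕ × ℕ → Set
  PrimePower (p , k) = Prime p × 1 ≤ k

not-divides-product : ∀ {r} → Prime r → ∀ fs → All PrimePower fs → All (r ≢_) (map proj₁ fs) → ¬ r ∣ product (map order fs)
not-divides-product r-prime [] _ _ r∣1 = nonTrivial⇒≢1 {{prime⇒nonTrivial r-prime}} (∣1⇒≡1 r∣1)
not-divides-product r-prime ((p , k) ∷ fs) ((p-prime , _) ∷ primes) (r≢p ∷ r≢) r∣ with euclidsLemma (p ^ k) (product (map order fs)) r-prime r∣
... | inj₁ r∣p^k = r≢p (prime-divides-power r-prime p-prime k r∣p^k)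
... | inj₂ r∣rest = not-divides-product r-prime fs primes r≢ r∣rest

-- The factor c collects the prime powers already removed from the list.
components : ∀ fs → All PrimePower fs → Unique (map proj₁ fs) → ∀ c → All (λ f → ¬ proj₁ f ∣ c) fs →
  All (λ f → IsComponent (order f) (c * product (map order fs))) fs
components [] _ _ _ _ = []
components ((p , k) ∷ fs) ((p-prime , 1≤k) ∷ primes) (p≢ ∷ unique) c (p∤c ∷ ∤c) =
  (p , k , p-prime , 1≤k , refl , divides (c * rest) (trans (exchange c (p ^ k) rest) (ℕₚ.*-comm (p ^ k) _)) , not-higher)
  ∷ All.map (subst (IsComponent _) (ℕₚ.*-assoc c (p ^ k) rest))
      (components fs primes unique (c * p ^ k) (All.tabulate λ {f} f∈fs f∣ → coprime f f∈fs f∣))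
  where
  rest = product (map order fs)
  exchange : ∀ a b d → a * (b * d) ≡ b * (a * d)
  exchange a b d = trans (sym (ℕₚ.*-assoc a b d)) (trans (cong (_* d) (ℕₚ.*-comm a b)) (ℕₚ.*-assoc b a d))
  not-higher : ¬ p * p ^ k ∣ c * (p ^ k * rest)
  not-higher divisible = Sum.[ p∤c , not-divides-product p-prime fs primes p≢ ] (euclidsLemma c rest p-prime
    (*-cancelˡ-∣ (p ^ k) {{ℕₚ.m^n≢0 p k {{prime⇒nonZero p-prime}}}}
      (subst₂ _∣_ (ℕₚ.*-comm p (p ^ k)) (exchange c (p ^ k) rest) divisible)))
  coprime : ∀ f → f ∈ fs → ¬ proj₁ f ∣ c * p ^ k
  coprime (r , l) f∈fs r∣ = Sum.[ All.lookup ∤c f∈fs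
                                , (λ r∣p^k → All.lookup p≢ (∈-map⁺ proj₁ f∈fs) (sym (prime-divides-power r-prime p-prime k r∣p^k))) ]
    (euclidsLemma c (p ^ k) r-prime r∣)
    where
    r-prime = proj₁ (All.lookup primes f∈fs)

-- The recursion ends with one factor rather than none: over the trivial group no family exists, as
-- its base blocks need values other than ε.
good-product : ∀ f fs → All (λ (p , k) → Good (replicate k p)) (f ∷ fs) → Good (FvModuli (f ∷ fs))
good-product (p , k) [] (G ∷ []) = subst Good (sym (++-identityʳ (replicate k p))) G
good-product (p , k) (f ∷ fs) (G ∷ Gs) = good-++ G (good-product f fs Gs)

theorem8p3 : (v : ℕ) → 1 < v →
    (∀ q → IsComponent q v → q % 14 ≡ 1 × ((71 ≤ q × q ≤ 9941) ⊎ QBelow 7 6 q)) →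
    (fs : List (ℕ × ℕ)) → IsPrimePowerFactorization v fs →
    Σ (ResolvedLinearSpace (Elt (2 ∷ 2 ∷ FvModuli fs)) K3456) Harmonious
theorem8p3 v 1<v conditions [] (_ , _ , 1≡v) = ⊥-elim (ℕₚ.<⇒≢ 1<v 1≡v)
theorem8p3 v 1<v conditions fs@(f ∷ fs′) (primes , unique , product≡v) = space , harmonious
  where
  good-component : ∀ p k → Prime p → 1 ≤ k → IsComponent (p ^ k) v → Good (replicate k p)
  good-component zero k p-prime = ⊥-elim (0-not-prime p-prime)
    where
    0-not-prime : ¬ Prime 0
    0-not-prime p-prime = ℕ.≢-nonZero⁻¹ 0 {{prime⇒nonZero p-prime}} refl
  good-component (suc m) k p-prime 1≤k component = good-prime-power m p-prime k 1≤k (proj₁ (conditions (suc m ^ k) component))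
    (admissible-order (suc m ^ k) (proj₂ (conditions (suc m ^ k) component)))

  are-components : All (λ f → IsComponent (order f) v) fs
  are-components = All.map (subst (IsComponent _) (trans (ℕₚ.*-identityˡ _) product≡v))
    (components fs primes unique 1 (All.map (λ (p-prime , _) p∣1 → nonTrivial⇒≢1 {{prime⇒nonTrivial p-prime}} (∣1⇒≡1 p∣1)) primes))

  good : Good (FvModuli fs)
  good = good-product f fs′ (All.zipWith (λ {(p , k)} ((p-prime , 1≤k) , component) → good-component p k p-prime 1≤k component) (primes , are-components))

  open Resolution (FvModuli fs) (Good.nonzero good) (Good.family good)
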